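{- Let $\mathrm{HE}(N2/N1)_{\mathrm{red}}$ be the quotient of $\mathrm{HE}(N2/N1)$ by its nilradical. There is a ring isomorphism $\mathrm{HE}(N2/N1)_{\mathrm{red}}\to\mathrm{HE}(K)$ taking (the class of) $T_p$ to $T_p$ for each prime $p>3$.
   Context: $\mathbb{Z}/2[[x]]$ is the formal power series ring over the field with two elements. Let $r=\sum_{n>0}(x^{n^2}+x^{2n^2}+x^{3n^2}+x^{6n^2})$, and let $\mathbb{Z}/2[r]\subset\mathbb{Z}/2[[x]]$ be the subring generated by $r$. Put $F=r(r+1)^3$, $G=r^3(r+1)$. Operators on $\mathbb{Z}/2[[x]]$: $U_2(\sum a_nx^n)=\sum a_{2n}x^n$, $U_3(\sum a_nx^n)=\sum a_{3n}x^n$, and for primes $p>3$, $T_p(\sum a_nx^n)=\sum a_{pn}x^n+\sum a_nx^{pn}$. Let $K=\{f\in\mathbb{Z}/2[r]: U_2f=0,\ U_3f=f\}$. Let $N2$ be the free $\mathbb{Z}/2[G^2]$-submodule of $\mathbb{Z}/2[r]$ with basis $\{G,F,F^2G\}$ and $N1$ the free $\mathbb{Z}/2[G^2]$-submodule with basis $\{G\}$. The operators $T_p$ ($p>3$ prime) map $K$, $N2$ and $N1$ into themselves, so they act on $K$ and on $N2/N1$. For $V=K$ or $V=N2/N1$, $\mathrm{HE}(V)$ denotes the closure, in $\mathrm{End}_{\mathbb{Z}/2}(V)$ with the topology of pointwise convergence ($V$ discrete), of the $\mathbb{Z}/2$-subalgebra generated by the identity and the $T_p$, $p>3$ prime. 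-}

module Defs where

open import Data.Bool using (Bool; true; false; _xor_; _∧_)
open import Data.Nat using (ℕ; zero; suc; _*_; _∸_; _<_; _≡ᵇ_)
open import Data.Nat.Primality using (Prime)
open import Data.List using (List; []; _∷_)
open import Data.List.Relation.Unary.All using (All)
open import Data.Product using (Σ; ∃; _×_; _,_; proj₁)
open import Relation.Binary.PropositionalEquality using (_≡_)

-- Z/2[[x]] : formal power series over F₂ = Bool (xor, ∧),
-- a series is its coefficient function.

Series : Set
Series = ℕ → Bool

infix 4 _≈_
_≈_ : Series → Series → Set
f ≈ g = ∀ n → f n ≡ g n

xorSum : ℕ → (ℕ → Bool) → Bool
xorSum zero    h = false
xorSum (suc n) h = h n xor xorSum n h

0ₛ : Series
0ₛ n = false

1ₛ : Series
1ₛ zero    = true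
1ₛ (suc n) = false

const : Bool → Series
const b zero    = b
const b (suc n) = false

infixl 6 _+ₛ_
infixl 7 _*ₛ_
_+ₛ_ : Series → Series → Series
(f +ₛ g) n = f n xor g n

_*ₛ_ : Series → Series → Series
(f *ₛ g) n = xorSum (suc n) (λ i → f i ∧ g (n ∸ i))

Poly : Set
Poly = List Bool

evalAt : Poly → Series → Series
evalAt []       s = 0ₛ
evalAt (c ∷ cs) s = const c +ₛ s *ₛ evalAt cs s

-- r = Σ_{m>0} (x^{m²} + x^{2m²} + x^{3m²} + x^{6m²})
-- coefficient of x^n = parity of the number of terms equal to x^n
-- (only m ≤ n can contribute, m = suc j with j < n).

r : Series
r n = xorSum n (λ j → let k = suc j in
        ((k * k ≡ᵇ n) xor (2 * (k * k) ≡ᵇ n))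
          xor ((3 * (k * k) ≡ᵇ n) xor (6 * (k * k) ≡ᵇ n)))

F : Series
F = r *ₛ ((r +ₛ 1ₛ) *ₛ ((r +ₛ 1ₛ) *ₛ (r +ₛ 1ₛ)))

G : Series
G = (r *ₛ (r *ₛ r)) *ₛ (r +ₛ 1ₛ)

G² : Series
G² = G *ₛ G

U₂ : Series → Series
U₂ f n = f (2 * n)

U₃ : Series → Series
U₃ f n = f (3 * n)

-- T_p f = Σ a_{pn} x^n + Σ a_n x^{pn};
-- the second coefficient of x^n is a_k for the (unique, p > 0) k with p k = n.
T : ℕ → Series → Series
T p f n = f (p * n) xor xorSum (suc n) (λ k → (p * k ≡ᵇ n) ∧ f k)

P5 : Set
P5 = Σ ℕ (λ p → Prime p × 3 < p)

-- elements of the Z/2-subalgebra generated by id and the T_p: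
-- finite sums of finite products (monomials) of T_p's (empty product = id)
Alg : Set
Alg = List (List P5)

actMono : List P5 → Series → Series
actMono []            f = f
actMono ((p , _) ∷ ps) f = T p (actMono ps f)

act : Alg → Series → Series
act []       f = 0ₛ
act (m ∷ ms) f = actMono m f +ₛ act ms f

InZ2r : Series → Set
InZ2r f = ∃ λ (P : Poly) → f ≈ evalAt P r

InK : Series → Set
InK f = InZ2r f × (U₂ f ≈ 0ₛ) × (U₃ f ≈ f)

InN2 : Series → Set
InN2 f = ∃ λ (a : Poly) → ∃ λ (b : Poly) → ∃ λ (c : Poly) →
  f ≈ evalAt a G² *ₛ G +ₛ evalAt b G² *ₛ F +ₛ evalAt c G² *ₛ ((F *ₛ F) *ₛ G)

InN1 : Series → Set
InN1 f = ∃ λ (a : Poly) → f ≈ evalAt a G² *ₛ G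

-- A "space": vectors with an underlying series, and a relation on series
-- giving equality of vectors (series equality for K, congruence mod N1
-- for N2/N1, i.e. difference (= sum, char 2) lies in N1).

record Space : Set₁ where
  field
    Vec : Set
    ser : Vec → Series
    SR  : Series → Series → Set

  _~_ : Vec → Vec → Set
  v ~ w = SR (ser v) (ser w)

SpK : Space
SpK = record { Vec = Σ Series InK ; ser = proj₁ ; SR = _≈_ }

SpN : Space
SpN = record { Vec = Σ Series InN2 ; ser = proj₁
             ; SR = λ f g → InN1 (f +ₛ g) }

-- HE(V): endomorphisms of V (maps respecting the equality of V) lying in the
-- closure, for the topology of pointwise convergence (V discrete), of the
-- subalgebra generated by id and the T_p: on every finite set of vectors
-- the map agrees with some element of that subalgebra.
record HE (S : Space) : Set where
  open Space S
  field
    fn     : Vec → Vec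
    resp   : ∀ v w → v ~ w → fn v ~ fn w
    approx : (vs : List Vec) → ∃ λ (a : Alg) →
               All (λ v → SR (ser (fn v)) (act a (ser v))) vs

module _ {S : Space} where
  open Space S
  open HE

  _≐_ : HE S → HE S → Set
  φ ≐ ψ = ∀ v → fn φ v ~ fn ψ v

  IsSum : HE S → HE S → HE S → Set
  IsSum χ φ ψ = ∀ v → SR (ser (fn χ v)) (ser (fn φ v) +ₛ ser (fn ψ v))

  IsProd : HE S → HE S → HE S → Set
  IsProd χ φ ψ = ∀ v → fn χ v ~ fn φ (fn ψ v)

  IsOne : HE S → Set
  IsOne χ = ∀ v → fn χ v ~ v

  IsT : ℕ → HE S → Set
  IsT p χ = ∀ v → SR (ser (fn χ v)) (T p (ser v))

  iter : ℕ → (Vec → Vec) → Vec → Vec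
  iter zero    h v = v
  iter (suc n) h v = h (iter n h v)

  Nilpotent : HE S → Set
  Nilpotent χ = ∃ λ (n : ℕ) → ∀ v → SR (ser (iter n (fn χ) v)) 0ₛ

  -- equality in HE(V)_red = HE(V)/nilradical : φ - ψ (= φ + ψ) is nilpotent
  _≈red_ : HE S → HE S → Set
  φ ≈red ψ = ∃ λ (χ : HE S) → IsSum χ φ ψ × Nilpotent χ

record RedIso (Φ : HE SpN → HE SpK) : Set where
  field
    wellDef   : ∀ φ ψ → φ ≈red ψ → Φ φ ≐ Φ ψ
    injective : ∀ φ ψ → Φ φ ≐ Φ ψ → φ ≈red ψ
    surjective : ∀ ψ → ∃ λ φ → Φ φ ≐ ψ
    additive  : ∀ χ φ ψ → IsSum χ φ ψ → IsSum (Φ χ) (Φ φ) (Φ ψ)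
    multiplicative : ∀ χ φ ψ → IsProd χ φ ψ → IsProd (Φ χ) (Φ φ) (Φ ψ)
    unital    : ∀ χ → IsOne χ → IsOne (Φ χ)
    sendsT    : ∀ p → Prime p → 3 < p → ∀ χ → IsT p χ → IsT p (Φ χ)

-- Put w = G², z = F + V₃G, so that z³ = G.  Modular equations of degree 5 and 7 for r make T₅ and T₇
-- act by explicit linear recurrences.  Taking the part of a series supported on exponents prime to 3
-- identifies N2/N1 with z F₂[w] ⊕ z⁵ F₂[w], the two summands being separated by exponents mod 3, and K
-- projects isomorphically onto z F₂[w].  There T₇ is onto, T₅ is onto on ker T₇, both are locally
-- nilpotent and ker T₅ ∩ ker T₇ is spanned by F + G; hence K is the injective hull of F₂ over
-- F₂[[T₇ , T₅]], every operator commuting with T₅ and T₇ is a unique power series in them, and none is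
-- nilpotent except 0.  The same power series acts on N2/N1, which gives surjectivity.
-- If χ in HE(N2/N1) kills K, it is locally a sum of monomials in the T_p, and in characteristic 2 its
-- square is the sum of their squares, which preserve exponents mod 3.  So χ² kills z F₂[w], and, as T₅
-- maps z⁵ F₂[w] injectively into z F₂[w], also z⁵ F₂[w].

module Submission where

open import Defs
open import Data.Bool using (Bool; true; false; _xor_; _∧_; _∨_; not; if_then_else_)
open import Data.Bool.Properties using (xor-assoc; xor-comm; xor-same; xor-identityʳ; ∧-distribˡ-xor; ∧-distribʳ-xor; ∧-assoc; ∧-comm; ∧-zeroʳ; ∧-identityʳ; ∧-idem; T-≡)
open import Data.Nat hiding (_%_; _/_)
open import Data.Nat.Properties
open import Data.Nat.DivMod using (_%_; _/_; %-distribˡ-+; %-distribˡ-*; m*n%n≡0; m%n<n; m≡m%n+[m/n]*n; [m+kn]%n≡m%n; m<n⇒m%n≡m; m%n%n≡m%n)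
open import Data.Nat.Solver using (module +-*-Solver)
open import Data.Nat.Divisibility using (_∣_; divides; _∣?_; ∣1⇒≡1)
open import Data.Nat.Primality using (Prime; euclidsLemma; prime⇒nonZero; prime⇒irreducible; prime?; prime⇒nonTrivial)
open import Data.Nat.Base using (NonTrivial)
open import Data.List using (List; []; _∷_; _++_; map; length)
open import Data.List.Membership.Propositional using (_∈_)
open import Data.List.Relation.Unary.Any using (here; there)
open import Data.Product hiding (map)
open import Data.Sum using (_⊎_; inj₁; inj₂)
open import Data.Empty using (⊥; ⊥-elim)
open import Function using (_∘_)
open import Function.Bundles using (module Equivalence)
open import Relation.Nullary using (¬_; yes; no; Dec)
open import Relation.Nullary.Decidable using (from-yes)
open import Relation.Binary.PropositionalEquality
open import Relation.Binary.Definitions using (tri<; tri≈; tri>)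
open import Data.List.Relation.Unary.All using (All; []; _∷_)
import Data.List.Relation.Unary.All as All
open import Data.List.Relation.Unary.All.Properties using (map⁻)

-- The modular equations are obtained from power series alone. Counting representations N = a² + 3b²
-- gives Θ(x) Θ(x³) = (Θ(x) + Θ(x³))⁴, hence F(x³) = G, and this functional equation determines r. A
-- candidate for r(x^p) is built as the fixed point of a contraction, so that it satisfies the
-- desired equation by construction; it is recognised as r(x^p) because it also satisfies the
-- functional equation. U₃ exchanges F and G, and on square roots this is the exchange of r and r +
-- 1. Being fixed by U₃ thus becomes a linear condition in F₂[r² + r], solved by comparing degrees.
-- The surjectivity statements rest on a triangular structure that ordinary degrees do not show.
-- Split the binary digits of the exponent k of w into those in even places, A, and those in odd
-- places, B. Up to terms that are smaller for A + B and then for B, T₇ lowers A by one, and on ker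
-- T₇ the operator T₅² lowers B by two. Such digit weights can be followed because both recurrences
-- have consequences whose index shifts are powers of two or zero.

xor-swap : ∀ a b c d → (a xor b) xor (c xor d) ≡ (a xor c) xor (b xor d)
xor-swap a b c d = trans (xor-assoc a b _) (trans (cong (a xor_) (trans (sym (xor-assoc b c d))
  (trans (cong (_xor d) (xor-comm b c)) (xor-assoc c b d)))) (sym (xor-assoc a c _)))

xor-cancel : ∀ {a b} → a xor b ≡ false → a ≡ b
xor-cancel {false} {false} _ = refl
xor-cancel {true} {true} _ = refl

false≢true : false ≢ true
false≢true ()

bool-ext : ∀ {a b} → (a ≡ true → b ≡ true) → (b ≡ true → a ≡ true) → a ≡ b
bool-ext {false} {false} f g = refl
bool-ext {false} {true} f g = g refl
bool-ext {true} {false} f g = sym (f refl)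
bool-ext {true} {true} f g = refl

¬true : ∀ {a} → ¬ (a ≡ true) → a ≡ false
¬true {false} h = refl
¬true {true} h = ⊥-elim (h refl)

∧-true : ∀ {a b} → a ∧ b ≡ true → a ≡ true × b ≡ true
∧-true {true} {true} _ = refl , refl

≡ᵇ-sound : ∀ m n → (m ≡ᵇ n) ≡ true → m ≡ n
≡ᵇ-sound zero zero _ = refl
≡ᵇ-sound (suc m) (suc n) e = cong suc (≡ᵇ-sound m n e)

≡ᵇ-refl : ∀ m → (m ≡ᵇ m) ≡ true
≡ᵇ-refl zero = refl
≡ᵇ-refl (suc m) = ≡ᵇ-refl m

≡ᵇ-no : ∀ {m n} → m ≢ n → (m ≡ᵇ n) ≡ false
≡ᵇ-no {m} {n} h = ¬true (λ e → h (≡ᵇ-sound m n e))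

-- Finite sums over F₂

sum-cong : ∀ n {f g : ℕ → Bool} → (∀ i → i < n → f i ≡ g i) → xorSum n f ≡ xorSum n g
sum-cong zero h = refl
sum-cong (suc n) h = cong₂ _xor_ (h n (n<1+n n)) (sum-cong n (λ i l → h i (m<n⇒m<1+n l)))

sum-0 : ∀ n {f : ℕ → Bool} → (∀ i → i < n → f i ≡ false) → xorSum n f ≡ false
sum-0 zero h = refl
sum-0 (suc n) h = cong₂ _xor_ (h n (n<1+n n)) (sum-0 n (λ i l → h i (m<n⇒m<1+n l)))

sum-xor : ∀ n (f g : ℕ → Bool) → xorSum n (λ i → f i xor g i) ≡ xorSum n f xor xorSum n g
sum-xor zero f g = refl
sum-xor (suc n) f g = trans (cong ((f n xor g n) xor_) (sum-xor n f g)) (xor-swap (f n) (g n) _ _)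

sum-∧ˡ : ∀ n b (f : ℕ → Bool) → xorSum n (λ i → b ∧ f i) ≡ b ∧ xorSum n f
sum-∧ˡ zero b f = sym (∧-zeroʳ b)
sum-∧ˡ (suc n) b f = trans (cong ((b ∧ f n) xor_) (sum-∧ˡ n b f)) (sym (∧-distribˡ-xor b (f n) _))

sum-∧ʳ : ∀ n b (f : ℕ → Bool) → xorSum n (λ i → f i ∧ b) ≡ xorSum n f ∧ b
sum-∧ʳ n b f = trans (sum-cong n (λ i _ → ∧-comm (f i) b)) (trans (sum-∧ˡ n b f) (∧-comm b _))

sum-first : ∀ n (f : ℕ → Bool) → xorSum (suc n) f ≡ f 0 xor xorSum n (f ∘ suc)
sum-first zero f = refl
sum-first (suc n) f = trans (cong (f (suc n) xor_) (sum-first n f))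
  (trans (sym (xor-assoc (f (suc n)) (f 0) _))
  (trans (cong (_xor xorSum n (f ∘ suc)) (xor-comm (f (suc n)) (f 0))) (xor-assoc (f 0) (f (suc n)) _)))

sum-swap : ∀ m n (h : ℕ → ℕ → Bool) → xorSum m (λ i → xorSum n (h i)) ≡ xorSum n (λ j → xorSum m (λ i → h i j))
sum-swap zero n h = sym (sum-0 n (λ _ _ → refl))
sum-swap (suc m) n h = trans (cong (xorSum n (h m) xor_) (sum-swap m n h)) (sym (sum-xor n (h m) _))

sum-single : ∀ n k (f : ℕ → Bool) → k < n → (∀ i → i < n → i ≢ k → f i ≡ false) → xorSum n f ≡ f k
sum-single (suc n) k f k<n h with k ≟ n
... | yes refl = trans (cong (f k xor_) (sum-0 k (λ i l → h i (m<n⇒m<1+n l) (<⇒≢ l)))) (xor-identityʳ (f k))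
... | no k≢n = trans (cong (_xor xorSum n f) (h n (n<1+n n) (λ e → k≢n (sym e))))
                 (sum-single n k f (≤∧≢⇒< (≤-pred k<n) k≢n) (λ i l → h i (m<n⇒m<1+n l)))

sum-extend : ∀ m d (f : ℕ → Bool) → (∀ i → m ≤ i → f i ≡ false) → xorSum (d + m) f ≡ xorSum m f
sum-extend m zero f h = refl
sum-extend m (suc d) f h = trans (cong (_xor xorSum (d + m) f) (h (d + m) (m≤n+m m d))) (sum-extend m d f h)

-- off-diagonal terms of a symmetric double sum cancel in pairs
sum-sym : ∀ n (M : ℕ → ℕ → Bool) → (∀ i j → i < n → j < n → M i j ≡ M j i) →
          xorSum n (λ i → xorSum n (M i)) ≡ xorSum n (λ i → M i i)
sum-sym zero M s = refl
sum-sym (suc n) M s = begin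
  (M n n xor xorSum n (M n)) xor xorSum n (λ i → M i n xor xorSum n (M i))
    ≡⟨ cong ((M n n xor xorSum n (M n)) xor_) (sum-xor n (λ i → M i n) _) ⟩
  (M n n xor xorSum n (M n)) xor (xorSum n (λ i → M i n) xor xorSum n (λ i → xorSum n (M i)))
    ≡⟨ cong₂ (λ a b → (M n n xor xorSum n (M n)) xor (a xor b))
         (sum-cong n (λ i l → s i n (m<n⇒m<1+n l) (n<1+n n)))
         (sum-sym n M (λ i j a b → s i j (m<n⇒m<1+n a) (m<n⇒m<1+n b))) ⟩
  (M n n xor xorSum n (M n)) xor (xorSum n (M n) xor xorSum n (λ i → M i i))
    ≡⟨ lem (M n n) (xorSum n (M n)) _ ⟩
  M n n xor xorSum n (λ i → M i i) ∎
  where open ≡-Reasoning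
        lem : ∀ a b c → (a xor b) xor (b xor c) ≡ a xor c
        lem a b c = trans (xor-assoc a b _) (cong (a xor_) (trans (sym (xor-assoc b b c)) (cong (_xor c) (xor-same b))))

-- The ring of power series over F₂

infix 4 _≋_
-- A bare pointwise equality is a function type from which `f` and `g` cannot be inferred; the
-- record exposes both sides to unification.
record _≋_ (f g : Series) : Set where
  constructor mk
  field at : ∀ n → f n ≡ g n
open _≋_ public

≋-refl : ∀ {f} → f ≋ f
≋-refl .at n = refl
≋-sym : ∀ {f g} → f ≋ g → g ≋ f
≋-sym p .at n = sym (at p n)
≋-trans : ∀ {f g h} → f ≋ g → g ≋ h → f ≋ h
≋-trans p q .at n = trans (at p n) (at q n)

infixr 2 _⟫_
_⟫_ : ∀ {f g h} → f ≋ g → g ≋ h → f ≋ h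
_⟫_ = ≋-trans

infixl 6 _⊹_
infixl 7 _·_
-- Sealed, so that long identities are compared syntactically; only blocks that unfold these names
-- see the convolution.
opaque
  _⊹_ : Series → Series → Series
  _⊹_ = _+ₛ_
  _·_ : Series → Series → Series
  _·_ = _*ₛ_
  𝟘 : Series
  𝟘 = 0ₛ
  𝟙 : Series
  𝟙 = 1ₛ

tl : Series → Series
tl f n = f (suc n)

opaque
  unfolding _⊹_
  +-def : ∀ f g → f +ₛ g ≋ f ⊹ g
  +-def f g .at n = refl
  *-def : ∀ f g → f *ₛ g ≋ f · g
  *-def f g .at n = refl
  +-at : ∀ f g n → (f ⊹ g) n ≡ f n xor g n
  +-at f g n = refl
  *-at : ∀ f g n → (f · g) n ≡ xorSum (suc n) (λ i → f i ∧ g (n ∸ i))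
  *-at f g n = refl
  𝟘-at : ∀ n → 𝟘 n ≡ false
  𝟘-at n = refl
  𝟙-zero : 𝟙 0 ≡ true
  𝟙-zero = refl
  𝟙-suc : ∀ n → 𝟙 (suc n) ≡ false
  𝟙-suc n = refl

opaque
  unfolding _⊹_
  mul-zero : ∀ f g → (f · g) 0 ≡ f 0 ∧ g 0
  mul-zero f g = xor-identityʳ _
  mul-suc : ∀ f g n → (f · g) (suc n) ≡ (f 0 ∧ g (suc n)) xor (tl f · g) n
  mul-suc f g n = sum-first (suc n) (λ i → f i ∧ g (suc n ∸ i))
  mul-sucʳ : ∀ f g n → (f · g) (suc n) ≡ (f (suc n) ∧ g 0) xor (f · tl g) n
  mul-sucʳ f g n = cong₂ _xor_ (cong (λ k → f (suc n) ∧ g k) (n∸n≡0 n))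
    (sum-cong (suc n) (λ i l → cong (λ k → f i ∧ g k) (+-∸-assoc 1 (≤-pred l))))

  +-cong : ∀ {f f' g g'} → f ≋ f' → g ≋ g' → f ⊹ g ≋ f' ⊹ g'
  +-cong p q .at n = cong₂ _xor_ (at p n) (at q n)
  *-cong : ∀ {f f' g g'} → f ≋ f' → g ≋ g' → f · g ≋ f' · g'
  *-cong p q .at n = sum-cong (suc n) (λ i _ → cong₂ _∧_ (at p i) (at q (n ∸ i)))
  +-assoc' : ∀ f g h → (f ⊹ g) ⊹ h ≋ f ⊹ (g ⊹ h)
  +-assoc' f g h .at n = xor-assoc (f n) (g n) (h n)
  +-comm' : ∀ f g → f ⊹ g ≋ g ⊹ f
  +-comm' f g .at n = xor-comm (f n) (g n)
  +-idˡ : ∀ f → 𝟘 ⊹ f ≋ f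
  +-idˡ f .at n = refl
  +-idʳ : ∀ f → f ⊹ 𝟘 ≋ f
  +-idʳ f .at n = xor-identityʳ (f n)
  +-self : ∀ f → f ⊹ f ≋ 𝟘
  +-self f .at n = xor-same (f n)
  *-distʳ : ∀ f g h → (f ⊹ g) · h ≋ f · h ⊹ g · h
  *-distʳ f g h .at n = trans (sum-cong (suc n) (λ i _ → ∧-distribʳ-xor (h (n ∸ i)) (f i) (g i))) (sum-xor (suc n) (λ i → f i ∧ h (n ∸ i)) (λ i → g i ∧ h (n ∸ i)))
  *-distˡ : ∀ f g h → f · (g ⊹ h) ≋ f · g ⊹ f · h
  *-distˡ f g h .at n = trans (sum-cong (suc n) (λ i _ → ∧-distribˡ-xor (f i) (g (n ∸ i)) (h (n ∸ i)))) (sum-xor (suc n) (λ i → f i ∧ g (n ∸ i)) (λ i → f i ∧ h (n ∸ i)))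
  *-zeroˡ' : ∀ f → 𝟘 · f ≋ 𝟘
  *-zeroˡ' f .at n = sum-0 (suc n) (λ _ _ → refl)
  *-comm' : ∀ f g → f · g ≋ g · f
  *-comm' f g .at n = go n f g
    where go : ∀ n f g → (f · g) n ≡ (g · f) n
          go zero f g = cong (_xor false) (∧-comm (f 0) (g 0))
          go (suc n) f g = trans (mul-suc f g n) (trans (cong₂ _xor_ (∧-comm (f 0) (g (suc n))) (go n (tl f) g)) (sym (mul-sucʳ g f n)))
  *-zeroʳ' : ∀ f → f · 𝟘 ≋ 𝟘
  *-zeroʳ' f = ≋-trans (*-comm' f 𝟘) (*-zeroˡ' f)
  *-idˡ : ∀ f → 𝟙 · f ≋ f
  *-idˡ f .at n = trans (sum-single (suc n) 0 (λ i → 𝟙 i ∧ f (n ∸ i)) (s≤s z≤n) h) refl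
    where h : ∀ i → i < suc n → i ≢ 0 → 𝟙 i ∧ f (n ∸ i) ≡ false
          h zero _ ne = ⊥-elim (ne refl)
          h (suc i) _ _ = refl
  *-assoc' : ∀ f g h → (f · g) · h ≋ f · (g · h)
  *-assoc' f g h .at n = go n f g h
    where
    go : ∀ n f g h → ((f · g) · h) n ≡ (f · (g · h)) n
    go zero f g h = trans (mul-zero (f · g) h) (trans (cong (_∧ h 0) (mul-zero f g)) (trans (∧-assoc (f 0) (g 0) (h 0))
                    (sym (trans (mul-zero f (g · h)) (cong (f 0 ∧_) (mul-zero g h))))))
    go (suc n) f g h = begin
      ((f · g) · h) (suc n) ≡⟨ mul-suc (f · g) h n ⟩
      ((f · g) 0 ∧ h (suc n)) xor (tl (f · g) · h) n
        ≡⟨ cong₂ _xor_ (cong (_∧ h (suc n)) (mul-zero f g))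
             (at (*-cong {tl (f · g)} {sc ⊹ (tl f · g)} (mk (mul-suc f g)) (≋-refl {h})) n) ⟩
      ((f 0 ∧ g 0) ∧ h (suc n)) xor ((sc ⊹ tl f · g) · h) n
        ≡⟨ cong (((f 0 ∧ g 0) ∧ h (suc n)) xor_) (at (*-distʳ sc (tl f · g) h) n) ⟩
      ((f 0 ∧ g 0) ∧ h (suc n)) xor ((sc · h) n xor ((tl f · g) · h) n)
        ≡⟨ cong₂ (λ a b → ((f 0 ∧ g 0) ∧ h (suc n)) xor (a xor b)) scl (go n (tl f) g h) ⟩
      ((f 0 ∧ g 0) ∧ h (suc n)) xor ((f 0 ∧ (tl g · h) n) xor (tl f · (g · h)) n)
        ≡⟨ sym (xor-assoc ((f 0 ∧ g 0) ∧ h (suc n)) _ _) ⟩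
      (((f 0 ∧ g 0) ∧ h (suc n)) xor (f 0 ∧ (tl g · h) n)) xor (tl f · (g · h)) n
        ≡⟨ cong (_xor (tl f · (g · h)) n) (trans (cong (_xor (f 0 ∧ (tl g · h) n)) (∧-assoc (f 0) (g 0) (h (suc n)))) (trans (sym (∧-distribˡ-xor (f 0) (g 0 ∧ h (suc n)) ((tl g · h) n))) (cong (f 0 ∧_) (sym (mul-suc g h n))))) ⟩
      (f 0 ∧ (g · h) (suc n)) xor (tl f · (g · h)) n ≡⟨ sym (mul-suc f (g · h) n) ⟩
      (f · (g · h)) (suc n) ∎
      where open ≡-Reasoning
            sc : Series
            sc k = f 0 ∧ tl g k
            scl : (sc · h) n ≡ f 0 ∧ (tl g · h) n
            scl = trans (sum-cong (suc n) (λ i _ → ∧-assoc (f 0) (g (suc i)) (h (n ∸ i)))) (sum-∧ˡ (suc n) (f 0) _)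

*-idʳ : ∀ f → f · 𝟙 ≋ f
*-idʳ f = *-comm' f 𝟙 ⟫ *-idˡ f

+-cong0 : ∀ {f g} → f ⊹ g ≋ 𝟘 → f ≋ g
+-cong0 {f} {g} p .at n = xor-cancel (trans (sym (+-at f g n)) (trans (at p n) (𝟘-at n)))

+-cong0' : ∀ {f g} → f ≋ g → f ⊹ g ≋ 𝟘
+-cong0' {f} {g} p = +-cong p ≋-refl ⟫ +-self g

infixr 8 _^ₛ_
_^ₛ_ : Series → ℕ → Series
f ^ₛ zero = 𝟙
f ^ₛ (suc n) = f · (f ^ₛ n)

^-cong : ∀ {f g} n → f ≋ g → f ^ₛ n ≋ g ^ₛ n
^-cong zero p = ≋-refl
^-cong (suc n) p = *-cong p (^-cong n p)

^-+ : ∀ f m n → f ^ₛ (m + n) ≋ f ^ₛ m · f ^ₛ n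
^-+ f zero n = ≋-sym (*-idˡ _)
^-+ f (suc m) n = *-cong ≋-refl (^-+ f m n) ⟫ ≋-sym (*-assoc' f _ _)

-- Reflexive solver for identities in commutative algebras of characteristic 2:
-- normal forms are nested coefficient lists.
MP : ℕ → Set
MP zero = Bool
MP (suc d) = List (MP d)

Env : Set
Env = ℕ → Series

ev : ∀ d → MP d → Env → Series
ev zero true ρ = 𝟙
ev zero false ρ = 𝟘
ev (suc d) [] ρ = 𝟘
ev (suc d) (c ∷ cs) ρ = ev d c (ρ ∘ suc) ⊹ ρ 0 · ev (suc d) cs ρ

0p : ∀ d → MP d
0p zero = false
0p (suc d) = []
1p : ∀ d → MP d
1p zero = true
1p (suc d) = 1p d ∷ []
varp : ∀ d → ℕ → MP d
varp zero i = false
varp (suc d) zero = 0p d ∷ 1p d ∷ []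
varp (suc d) (suc i) = varp d i ∷ []
addp : ∀ d → MP d → MP d → MP d
addp zero a b = a xor b
addp (suc d) [] q = q
addp (suc d) (a ∷ p) [] = a ∷ p
addp (suc d) (a ∷ p) (b ∷ q) = addp d a b ∷ addp (suc d) p q
isz : ∀ d → MP d → Bool
isz zero b = not b
isz (suc d) [] = true
isz (suc d) (c ∷ cs) = isz d c ∧ isz (suc d) cs
mulp : ∀ d → MP d → MP d → MP d
scp : ∀ d → MP d → MP (suc d) → MP (suc d)
mulp zero a b = a ∧ b
mulp (suc d) [] q = []
mulp (suc d) (a ∷ p) q = addp (suc d) (scp d a q) (0p d ∷ mulp (suc d) p q)
scp d a [] = []
-- A vanishing scalar gives the empty list rather than a list of zeros, which keeps normal forms
-- sparse.
scp d a (b ∷ q) with isz d a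
... | true = []
... | false = mulp d a b ∷ scp d a q

data Ex : Set where
  var : ℕ → Ex
  _⊕_ _⊗_ : Ex → Ex → Ex
  ze on : Ex
infixl 6 _⊕_
infixl 7 _⊗_
infixr 8 _↑_
_↑_ : Ex → ℕ → Ex
e ↑ zero = on
e ↑ suc n = e ⊗ (e ↑ n)

⟦_⟧ : Ex → Env → Series
⟦ var i ⟧ ρ = ρ i
⟦ a ⊕ b ⟧ ρ = ⟦ a ⟧ ρ ⊹ ⟦ b ⟧ ρ
⟦ a ⊗ b ⟧ ρ = ⟦ a ⟧ ρ · ⟦ b ⟧ ρ
⟦ ze ⟧ ρ = 𝟘
⟦ on ⟧ ρ = 𝟙

norm : ∀ d → Ex → MP d
norm d (var i) = varp d i
norm d (a ⊕ b) = addp d (norm d a) (norm d b)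
norm d (a ⊗ b) = mulp d (norm d a) (norm d b)
norm d ze = 0p d
norm d on = 1p d

env : List Series → Env
env [] i = 𝟘
env (f ∷ fs) zero = f
env (f ∷ fs) (suc i) = env fs i

len : List Series → ℕ
len [] = 0
len (_ ∷ fs) = suc (len fs)

ev-0 : ∀ d ρ → ev d (0p d) ρ ≋ 𝟘
ev-0 zero ρ = ≋-refl
ev-0 (suc d) ρ = ≋-refl
ev-1 : ∀ d ρ → ev d (1p d) ρ ≋ 𝟙
ev-1 zero ρ = ≋-refl
ev-1 (suc d) ρ = +-cong (ev-1 d _) (*-zeroʳ' _) ⟫ +-idʳ _
ev-var : ∀ fs i → ev (len fs) (varp (len fs) i) (env fs) ≋ env fs i
ev-var [] i = ≋-refl
ev-var (f ∷ fs) zero = +-cong (ev-0 (len fs) _) (*-cong ≋-refl (+-cong (ev-1 (len fs) _) (*-zeroʳ' _) ⟫ +-idʳ _) ⟫ *-idʳ f) ⟫ +-idˡ f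
ev-var (f ∷ fs) (suc i) = +-cong (ev-var fs i) (*-zeroʳ' _) ⟫ +-idʳ _

+-swap' : ∀ a b c d → (a ⊹ b) ⊹ (c ⊹ d) ≋ (a ⊹ c) ⊹ (b ⊹ d)
+-swap' a b c d = +-assoc' a b _ ⟫ +-cong ≋-refl (≋-sym (+-assoc' b c d) ⟫ +-cong (+-comm' b c) ≋-refl ⟫ +-assoc' c b d) ⟫ ≋-sym (+-assoc' a c _)

ev-add : ∀ d p q ρ → ev d (addp d p q) ρ ≋ ev d p ρ ⊹ ev d q ρ
ev-add zero false false ρ = ≋-sym (+-idˡ _)
ev-add zero false true ρ = ≋-sym (+-idˡ _)
ev-add zero true false ρ = ≋-sym (+-idʳ _)
ev-add zero true true ρ = ≋-sym (+-self _)
ev-add (suc d) [] q ρ = ≋-sym (+-idˡ _)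
ev-add (suc d) (a ∷ p) [] ρ = ≋-sym (+-idʳ _)
ev-add (suc d) (a ∷ p) (b ∷ q) ρ = +-cong (ev-add d a b _) (*-cong ≋-refl (ev-add (suc d) p q ρ) ⟫ *-distˡ _ _ _) ⟫ +-swap' _ _ _ _

ev-isz : ∀ d p ρ → isz d p ≡ true → ev d p ρ ≋ 𝟘
ev-isz zero false ρ h = ≋-refl
ev-isz (suc d) [] ρ h = ≋-refl
ev-isz (suc d) (c ∷ cs) ρ h = +-cong (ev-isz d c _ (proj₁ (∧-true h))) (*-cong ≋-refl (ev-isz (suc d) cs ρ (proj₂ (∧-true {isz d c} h))) ⟫ *-zeroʳ' _) ⟫ +-idˡ _

*-swap' : ∀ a b c → a · (b · c) ≋ b · (a · c)
*-swap' a b c = ≋-sym (*-assoc' a b c) ⟫ *-cong (*-comm' a b) ≋-refl ⟫ *-assoc' b a c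

ev-mul : ∀ d p q ρ → ev d (mulp d p q) ρ ≋ ev d p ρ · ev d q ρ
ev-scp : ∀ d a q ρ → ev (suc d) (scp d a q) ρ ≋ ev d a (ρ ∘ suc) · ev (suc d) q ρ
ev-mul zero false q ρ = ≋-sym (*-zeroˡ' _)
ev-mul zero true q ρ = ≋-sym (*-idˡ _)
ev-mul (suc d) [] q ρ = ≋-sym (*-zeroˡ' _)
ev-mul (suc d) (a ∷ p) q ρ = ev-add (suc d) (scp d a q) (0p d ∷ mulp (suc d) p q) ρ
  ⟫ +-cong (ev-scp d a q ρ) (+-cong (ev-0 d _) (*-cong ≋-refl (ev-mul (suc d) p q ρ) ⟫ ≋-sym (*-assoc' _ _ _)) ⟫ +-idˡ _)
  ⟫ ≋-sym (*-distʳ _ _ _)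
ev-scp d a [] ρ = ≋-sym (*-zeroʳ' _)
ev-scp d a (b ∷ q) ρ with isz d a in eq
... | true = ≋-sym (*-cong (ev-isz d a _ eq) ≋-refl ⟫ *-zeroˡ' _)
... | false = +-cong (ev-mul d a b _) (*-cong ≋-refl (ev-scp d a q ρ) ⟫ *-swap' _ _ _) ⟫ ≋-sym (*-distˡ _ _ _)

ev-norm : ∀ fs e → ev (len fs) (norm (len fs) e) (env fs) ≋ ⟦ e ⟧ (env fs)
ev-norm fs (var i) = ev-var fs i
ev-norm fs (a ⊕ b) = ev-add (len fs) (norm (len fs) a) (norm (len fs) b) _ ⟫ +-cong (ev-norm fs a) (ev-norm fs b)
ev-norm fs (a ⊗ b) = ev-mul (len fs) (norm (len fs) a) (norm (len fs) b) _ ⟫ *-cong (ev-norm fs a) (ev-norm fs b)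
ev-norm fs ze = ev-0 (len fs) _
ev-norm fs on = ev-1 (len fs) _

-- In characteristic 2 equality means that the sum vanishes. A zero test is used because normal
-- forms are unique only up to trailing zeros.
ring : ∀ fs a b → isz (len fs) (addp (len fs) (norm (len fs) a) (norm (len fs) b)) ≡ true → ⟦ a ⟧ (env fs) ≋ ⟦ b ⟧ (env fs)
ring fs a b h = +-cong0 (≋-sym (+-cong (ev-norm fs a) (ev-norm fs b)) ⟫ ≋-sym (ev-add (len fs) (norm (len fs) a) (norm (len fs) b) _) ⟫ ev-isz (len fs) (addp (len fs) (norm (len fs) a) (norm (len fs) b)) _ h)

pattern X0 = var 0
pattern X1 = var 1
pattern X2 = var 2
pattern X3 = var 3
pattern X4 = var 4
pattern X5 = var 5
pattern X6 = var 6
pattern X7 = var 7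

-- Squaring and the operators U and V

even-or-odd : ∀ n → (∃ λ m → n ≡ 2 * m) ⊎ (∃ λ m → n ≡ suc (2 * m))
even-or-odd zero = inj₁ (0 , refl)
even-or-odd (suc n) with even-or-odd n
... | inj₁ (m , e) = inj₂ (m , cong suc e)
... | inj₂ (m , e) = inj₁ (suc m , trans (cong suc e) (cong suc (sym (+-suc m (m + 0)))))

sq-even : ∀ m f → (f · f) (2 * m) ≡ f m
sq-odd : ∀ m f → (f · f) (suc (2 * m)) ≡ false
-- Peeling both ends off the convolution produces the cross term of `f 0` and `f (n + 2)` twice, and
-- it cancels.
sq-step : ∀ n f → (f · f) (suc (suc n)) ≡ (tl f · tl f) n
sq-step n f = trans (mul-suc f f (suc n)) (trans (cong ((f 0 ∧ f (suc (suc n))) xor_) (mul-sucʳ (tl f) f n))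
  (trans (sym (xor-assoc (f 0 ∧ f (suc (suc n))) _ _))
  (cong (_xor (tl f · tl f) n) (trans (cong ((f 0 ∧ f (suc (suc n))) xor_) (∧-comm _ (f 0))) (xor-same (f 0 ∧ f (suc (suc n))))))))
sq-even zero f = trans (mul-zero f f) (∧-idem (f 0))
sq-even (suc m) f = trans (cong (λ k → (f · f) (suc k)) (+-suc m (m + 0))) (trans (sq-step (2 * m) f) (sq-even m (tl f)))
sq-odd zero f = trans (mul-suc f f 0) (trans (cong ((f 0 ∧ f 1) xor_) (trans (mul-zero (tl f) f) (∧-comm (f 1) (f 0)))) (xor-same (f 0 ∧ f 1)))
sq-odd (suc m) f = trans (cong (λ k → (f · f) (suc (suc k))) (+-suc m (m + 0))) (trans (sq-step (suc (2 * m)) f) (sq-odd m (tl f)))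

-- The substitution of x^d for x, written as the very sum that occurs in `T`, so that T_p is U_p +
-- V_p by definition.
V : ℕ → Series → Series
V d f n = xorSum (suc n) (λ k → (d * k ≡ᵇ n) ∧ f k)

U : ℕ → Series → Series
U d f n = f (d * n)

module _ (d : ℕ) .{{nz : NonZero d}} where
  V-mul : ∀ f m → V d f (d * m) ≡ f m
  V-mul f m = trans (sum-single (suc (d * m)) m _ (s≤s (m≤n*m m d)) h) (cong (_∧ f m) (≡ᵇ-refl (d * m)))
    where h : ∀ i → i < suc (d * m) → i ≢ m → (d * i ≡ᵇ d * m) ∧ f i ≡ false
          h i _ ne = cong (_∧ f i) (≡ᵇ-no (λ e → ne (*-cancelˡ-≡ i m d e)))

  V-non : ∀ f n → (∀ m → n ≢ d * m) → V d f n ≡ false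
  V-non f n h = sum-0 (suc n) (λ i _ → cong (_∧ f i) (≡ᵇ-no (λ e → h i (sym e))))

  V-true : ∀ f n → V d f n ≡ true → ∃ λ m → n ≡ d * m × f m ≡ true
  V-true f n e with d ∣? n
  ... | yes (divides m q) = m , trans q (*-comm m d) , trans (sym (V-mul f m)) (trans (cong (V d f) (sym (trans q (*-comm m d)))) e)
  ... | no nd = ⊥-elim (false≢true (trans (sym (V-non f n (λ m q → nd (divides m (trans q (*-comm d m)))))) e))

  V-ext : ∀ {f g} → (∀ m → f (d * m) ≡ g (d * m)) → (∀ n → (∀ m → n ≢ d * m) → f n ≡ g n) → f ≋ g
  V-ext {f} {g} p q .at n with d ∣? n
  ... | yes (divides m e) = subst (λ k → f k ≡ g k) (sym (trans e (*-comm m d))) (p m)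
  ... | no nd = q n (λ m e → nd (divides m (trans e (*-comm d m))))

  UV : ∀ f → U d (V d f) ≋ f
  UV f .at n = V-mul f n

  V-cong : ∀ {f g} → f ≋ g → V d f ≋ V d g
  V-cong p .at n = sum-cong (suc n) (λ i _ → cong ((d * i ≡ᵇ n) ∧_) (at p i))

  V-+ : ∀ f g → V d (f ⊹ g) ≋ V d f ⊹ V d g
  V-+ f g = V-ext (λ m → trans (V-mul _ m) (trans (+-at f g m) (sym (trans (+-at _ _ (d * m)) (cong₂ _xor_ (V-mul f m) (V-mul g m))))))
    (λ n h → trans (V-non _ n h) (sym (trans (+-at _ _ n) (cong₂ _xor_ (V-non f n h) (V-non g n h)))))

  V-inj : ∀ {f g} → V d f ≋ V d g → f ≋ g
  V-inj {f} {g} p = ≋-sym (UV f) ⟫ mk (λ n → at p (d * n)) ⟫ UV g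

  V-𝟘 : V d 𝟘 ≋ 𝟘
  V-𝟘 .at n = trans (sum-0 (suc n) (λ i _ → trans (cong ((d * i ≡ᵇ n) ∧_) (𝟘-at i)) (∧-zeroʳ _))) (sym (𝟘-at n))

  sum-mult : ∀ m (h : ℕ → Bool) → (∀ i → (∀ k → i ≢ d * k) → h i ≡ false) →
             xorSum (suc (d * m)) h ≡ xorSum (suc m) (λ k → h (d * k))
  sum-mult m h h0 = begin
    xorSum (suc (d * m)) h ≡⟨ sum-cong (suc (d * m)) (λ i l → spread i (≤-pred l)) ⟩
    xorSum (suc (d * m)) (λ i → xorSum (suc m) (λ k → (d * k ≡ᵇ i) ∧ h (d * k)))
      ≡⟨ sum-swap (suc (d * m)) (suc m) (λ i k → (d * k ≡ᵇ i) ∧ h (d * k)) ⟩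
    xorSum (suc m) (λ k → xorSum (suc (d * m)) (λ i → (d * k ≡ᵇ i) ∧ h (d * k)))
      ≡⟨ sum-cong (suc m) (λ k l → trans (sum-single (suc (d * m)) (d * k) _ (s≤s (*-monoʳ-≤ d (≤-pred l)))
           (λ i _ ne → cong (_∧ h (d * k)) (≡ᵇ-no (λ e → ne (sym e))))) (cong (_∧ h (d * k)) (≡ᵇ-refl (d * k)))) ⟩
    xorSum (suc m) (λ k → h (d * k)) ∎
    where
    open ≡-Reasoning
    spread : ∀ i → i ≤ d * m → h i ≡ xorSum (suc m) (λ k → (d * k ≡ᵇ i) ∧ h (d * k))
    spread i le with d ∣? i
    ... | yes (divides q e) = sym (trans (sum-single (suc m) q _ (s≤s (*-cancelˡ-≤ d (subst (_≤ d * m) (trans e (*-comm q d)) le)))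
              (λ k _ ne → cong (_∧ h (d * k)) (≡ᵇ-no (λ e' → ne (*-cancelˡ-≡ k q d (trans e' (trans e (*-comm q d))))))))
              (trans (cong₂ _∧_ (subst (λ z → (d * q ≡ᵇ z) ≡ true) (sym (trans e (*-comm q d))) (≡ᵇ-refl (d * q))) (cong h (sym (trans e (*-comm q d))))) refl))
    ... | no nd = trans (h0 i (λ k e → nd (divides k (trans e (*-comm d k)))))
              (sym (sum-0 (suc m) (λ k _ → cong (_∧ h (d * k)) (≡ᵇ-no (λ e → nd (divides k (trans (sym e) (*-comm d k))))))))

  -- The projection formula: in degree d n only indices divisible by d contribute. This linearity
  -- over series in x^d is what turns a modular equation into a recurrence.
  U-V· : ∀ f g → U d (V d f · g) ≋ f · U d g
  U-V· f g .at n = trans (*-at _ g (d * n)) (trans (sum-mult n _ (λ i h → cong (_∧ g (d * n ∸ i)) (V-non f i h)))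
     (trans (sum-cong (suc n) (λ k _ → cong₂ _∧_ (V-mul f k) (cong g (sym (*-distribˡ-∸ d n k))))) (sym (*-at f _ n))))

  V-* : ∀ f g → V d (f · g) ≋ V d f · V d g
  V-* f g = V-ext (λ m → trans (V-mul _ m) (sym (trans (at (U-V· f (V d g)) m) (at (*-cong ≋-refl (UV g)) m))))
    (λ n h → trans (V-non _ n h) (sym (trans (*-at _ _ n) (sum-0 (suc n) (λ i l → z n h i (≤-pred l))))))
    where
    z : ∀ n → (∀ m → n ≢ d * m) → ∀ i → i ≤ n → V d f i ∧ V d g (n ∸ i) ≡ false
    z n h i le = ¬true (λ e → let (a , ea , _) = V-true f i (proj₁ (∧-true e))
                                  (b , eb , _) = V-true g (n ∸ i) (proj₂ (∧-true {V d f i} e))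
                              in h (a + b) (trans (sym (m+[n∸m]≡n le)) (trans (cong₂ _+_ ea eb) (sym (*-distribˡ-+ d a b)))))

  V-𝟙 : V d 𝟙 ≋ 𝟙
  V-𝟙 = V-ext p q
    where p : ∀ m → V d 𝟙 (d * m) ≡ 𝟙 (d * m)
          p zero = trans (V-mul 𝟙 0) (cong 𝟙 (sym (*-zeroʳ d)))
          p (suc m) = trans (V-mul 𝟙 (suc m)) (trans (𝟙-suc m) (sym (h (d * suc m) (m*n≢0 d (suc m)))))
            where h : ∀ n → NonZero n → 𝟙 n ≡ false
                  h (suc n) _ = 𝟙-suc n
          q : ∀ n → (∀ m → n ≢ d * m) → V d 𝟙 n ≡ 𝟙 n
          q zero h = ⊥-elim (h 0 (sym (*-zeroʳ d)))
          q (suc n) h = trans (V-non 𝟙 _ h) (sym (𝟙-suc n))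

  V-^ : ∀ f n → V d (f ^ₛ n) ≋ V d f ^ₛ n
  V-^ f zero = V-𝟙
  V-^ f (suc n) = V-* f _ ⟫ *-cong ≋-refl (V-^ f n)

  U-cong : ∀ {f g} → f ≋ g → U d f ≋ U d g
  U-cong p .at n = at p (d * n)

  U-+ : ∀ f g → U d (f ⊹ g) ≋ U d f ⊹ U d g
  U-+ f g .at n = trans (+-at f g _) (sym (+-at _ _ n))

  U-𝟘 : U d 𝟘 ≋ 𝟘
  U-𝟘 .at n = trans (𝟘-at (d * n)) (sym (𝟘-at n))

sq-V : ∀ f → f · f ≋ V 2 f
sq-V f .at n with even-or-odd n
... | inj₁ (m , refl) = trans (sq-even m f) (sym (V-mul 2 f m))
... | inj₂ (m , refl) = trans (sq-odd m f) (sym (V-non 2 f _ (λ k e → 1+2m≢2k m k e)))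
  where 1+2m≢2k : ∀ m k → suc (2 * m) ≢ 2 * k
        1+2m≢2k m zero ()
        1+2m≢2k zero (suc k) e with trans (suc-injective e) (+-suc k (k + 0))
        ... | ()
        1+2m≢2k (suc m) (suc k) e = 1+2m≢2k m k (suc-injective (trans (suc-injective (trans (cong suc (cong suc (sym (+-suc m (m + 0))))) e)) (+-suc k (k + 0))))

sq-inj : ∀ {f g} → f · f ≋ g · g → f ≋ g
sq-inj {f} {g} p = V-inj 2 (≋-sym (sq-V f) ⟫ p ⟫ sq-V g)

V-V : ∀ a b .{{_ : NonZero a}} .{{_ : NonZero b}} f → V a (V b f) ≋ V (a * b) f
V-V a b f = V-ext (a * b) {{m*n≢0 a b}}
   (λ m → trans (trans (cong (V a (V b f)) (*-assoc a b m)) (trans (V-mul a _ (b * m)) (V-mul b f m))) (sym (V-mul (a * b) {{m*n≢0 a b}} f m)))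
   (λ n h → trans (¬true (λ e → let (k , ek , e2) = V-true a _ n e ; (j , ej , _) = V-true b f k e2
                     in h j (trans ek (trans (cong (a *_) ej) (sym (*-assoc a b j)))))) (sym (V-non (a * b) {{m*n≢0 a b}} f n h)))

V-comm : ∀ a b .{{_ : NonZero a}} .{{_ : NonZero b}} f → V a (V b f) ≋ V b (V a f)
V-comm a b f = V-V a b f ⟫ subst (λ c → V (a * b) f ≋ V c f) (*-comm a b) ≋-refl ⟫ ≋-sym (V-V b a f)

U-U : ∀ a b f → U a (U b f) ≋ U b (U a f)
U-U a b f .at n = cong f (trans (sym (*-assoc b a n)) (trans (cong (_* n) (*-comm b a)) (*-assoc a b n)))

-- By Euclid's lemma q divides a n only if it divides n, so both sides see the same exponents.
UV-comm : ∀ {q} a → (pq : Prime q) → ¬ (q ∣ a) → ∀ f → U a (V q f) ≋ V q (U a f)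
UV-comm {q} a pq nd f = V-ext q {{prime⇒nonZero pq}}
   (λ m → trans (cong (V q f) (trans (sym (*-assoc a q m)) (trans (cong (_* m) (*-comm a q)) (*-assoc q a m))))
            (trans (V-mul q {{prime⇒nonZero pq}} f (a * m)) (sym (V-mul q {{prime⇒nonZero pq}} (U a f) m))))
   (λ n h → trans (V-non q {{prime⇒nonZero pq}} f (a * n) (λ m e → k n h (euclidsLemma a n pq (divides m (trans e (*-comm q m))))))
              (sym (V-non q {{prime⇒nonZero pq}} _ n h)))
   where k : ∀ n → (∀ m → n ≢ q * m) → q ∣ a ⊎ q ∣ n → ⊥
         k n h (inj₁ x) = nd x
         k n h (inj₂ (divides m e)) = h m (trans e (*-comm m q))

prime-∤ : ∀ {p q} → Prime p → Prime q → p ≢ q → ¬ (q ∣ p)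
prime-∤ {p} {q} pp pq ne d with prime⇒irreducible pp d
... | inj₁ q≡1 = h (prime⇒nonTrivial pq) q≡1
  where h : ∀ {q} → NonTrivial q → q ≢ 1
        h {suc (suc q)} _ ()
... | inj₂ q≡p = ne (sym q≡p)

prime2 : Prime 2
prime2 = from-yes (prime? 2)
prime3 : Prime 3
prime3 = from-yes (prime? 3)
prime5 : Prime 5
prime5 = from-yes (prime? 5)
prime7 : Prime 7
prime7 = from-yes (prime? 7)

-- Hecke operators on series

opaque
  Tₛ : ℕ → Series → Series
  Tₛ p f = U p f ⊹ V p f

  T-def : ∀ p f → T p f ≋ Tₛ p f
  T-def p f .at n = sym (+-at _ _ n)

  T-UV : ∀ p f → Tₛ p f ≋ U p f ⊹ V p f
  T-UV p f = ≋-refl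

module Hecke (p : ℕ) .{{nz : NonZero p}} where
  T-cong : ∀ {f g} → f ≋ g → Tₛ p f ≋ Tₛ p g
  T-cong {f} {g} e = T-UV p f ⟫ +-cong (U-cong p e) (V-cong p e) ⟫ ≋-sym (T-UV p g)
  T-+ : ∀ f g → Tₛ p (f ⊹ g) ≋ Tₛ p f ⊹ Tₛ p g
  T-+ f g = T-UV p _ ⟫ +-cong (U-+ p f g) (V-+ p f g) ⟫ +-swap' _ _ _ _ ⟫ ≋-sym (+-cong (T-UV p f) (T-UV p g))
  T-𝟘 : Tₛ p 𝟘 ≋ 𝟘
  T-𝟘 = T-UV p _ ⟫ +-cong (U-𝟘 p) (V-𝟘 p) ⟫ +-idˡ 𝟘

open Hecke public

T-comm : ∀ {p q} → Prime p → Prime q → ∀ f → Tₛ p (Tₛ q f) ≋ Tₛ q (Tₛ p f)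
T-comm {p} {q} pp pq f with p ≟ q
... | yes refl = ≋-refl
... | no ne = T-UV p _ ⟫ +-cong (U-cong p (T-UV q f) ⟫ U-+ p _ _) (V-cong p (T-UV q f) ⟫ V-+ p _ _)
    ⟫ +-cong (+-cong (U-U p q f) (UV-comm p pq (prime-∤ pp pq ne) f)) (+-cong (≋-sym (UV-comm q pp (prime-∤ pq pp (λ e → ne (sym e))) f)) (V-comm p q f))
    ⟫ +-swap' _ _ _ _
    ⟫ ≋-sym (T-UV q _ ⟫ +-cong (U-cong q (T-UV p f) ⟫ U-+ q _ _) (V-cong q (T-UV p f) ⟫ V-+ q _ _))
  where instance
    _ : NonZero p
    _ = prime⇒nonZero pp
    _ : NonZero q
    _ = prime⇒nonZero pq

module _ {p q : ℕ} (pp : Prime p) (pq : Prime q) (ne : p ≢ q) where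
  private instance
    nzp : NonZero p
    nzp = prime⇒nonZero pp
    nzq : NonZero q
    nzq = prime⇒nonZero pq
  T-U : ∀ f → U q (Tₛ p f) ≋ Tₛ p (U q f)
  T-U f = U-cong q (T-UV p f) ⟫ U-+ q _ _ ⟫ +-cong (U-U q p f) (UV-comm q pp (prime-∤ pq pp (λ e → ne (sym e))) f) ⟫ ≋-sym (T-UV p _)
  T-V : ∀ f → V q (Tₛ p f) ≋ Tₛ p (V q f)
  T-V f = V-cong q (T-UV p f) ⟫ V-+ q _ _ ⟫ +-cong (≋-sym (UV-comm p pq (prime-∤ pp pq ne) f)) (V-comm q p f) ⟫ ≋-sym (T-UV p _)

-- Squaring is the substitution `V 2`, which commutes with T_p for every prime p other than 2.
T-sq : ∀ p .{{_ : NonZero p}} f → Prime p → p ≢ 2 → Tₛ p (f · f) ≋ Tₛ p f · Tₛ p f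
T-sq p f pp ne = T-cong p (sq-V f) ⟫ ≋-sym (T-V pp prime2 ne f) ⟫ ≋-sym (sq-V _)

-- Once the coefficients of `f` below n vanish, the coefficient of the product in degree n + k is
-- `f n`.
·-domain : ∀ k {f g} → (∀ i → i < k → g i ≡ false) → g k ≡ true → f · g ≋ 𝟘 → f ≋ 𝟘
·-domain k {f} {g} lo hi p .at n = trans (go (suc n) n ≤-refl) (sym (𝟘-at n))
  where
  go : ∀ B n → n < B → f n ≡ false
  go (suc B) n l = begin
    f n ≡⟨ sym (∧-identityʳ (f n)) ⟩
    f n ∧ true ≡⟨ cong (f n ∧_) (trans (sym hi) (cong g (sym (m+n∸m≡n n k)))) ⟩
    f n ∧ g (n + k ∸ n) ≡⟨ sym (sum-single (suc (n + k)) n _ (s≤s (m≤m+n n k)) z) ⟩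
    xorSum (suc (n + k)) (λ i → f i ∧ g (n + k ∸ i)) ≡⟨ sym (*-at f g (n + k)) ⟩
    (f · g) (n + k) ≡⟨ trans (at p (n + k)) (𝟘-at (n + k)) ⟩
    false ∎
    where
    open ≡-Reasoning
    z : ∀ i → i < suc (n + k) → i ≢ n → f i ∧ g (n + k ∸ i) ≡ false
    z i li ne with <-cmp i n
    ... | tri< a _ _ = cong (_∧ g (n + k ∸ i)) (go B i (<-≤-trans a (≤-pred l)))
    ... | tri≈ _ e _ = ⊥-elim (ne e)
    ... | tri> _ _ c = trans (cong (f i ∧_) (lo (n + k ∸ i) (+-cancelˡ-< i _ _ (subst (_< i + k) (sym (m+[n∸m]≡n (≤-pred li))) (+-monoˡ-< k c))))) (∧-zeroʳ (f i))

-- Theta series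

Q : Series
Q n = xorSum n (λ j → suc j * suc j ≡ᵇ n)

sq-cancel : ∀ x y → x * x ≡ y * y → x ≡ y
sq-cancel x y e with <-cmp x y
... | tri< l _ _ = ⊥-elim (<⇒≢ (*-mono-< l l) e)
... | tri≈ _ q _ = q
... | tri> _ _ l = ⊥-elim (<⇒≢ (*-mono-< l l) (sym e))

Q-sq : ∀ a → Q (suc a * suc a) ≡ true
Q-sq a = trans (sum-single (suc a * suc a) a _ (m≤m*n (suc a) (suc a)) h) (≡ᵇ-refl (suc a * suc a))
  where h : ∀ i → i < suc a * suc a → i ≢ a → (suc i * suc i ≡ᵇ suc a * suc a) ≡ false
        h i _ ne = ≡ᵇ-no (λ e → ne (suc-injective (sq-cancel (suc i) (suc a) e)))

Q-true : ∀ n → Q n ≡ true → ∃ λ a → n ≡ suc a * suc a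
Q-true n e = go n e
  where
  go : ∀ k → xorSum k (λ j → suc j * suc j ≡ᵇ n) ≡ true → ∃ λ a → n ≡ suc a * suc a
  go (suc k) e with suc k * suc k ≡ᵇ n in q
  ... | true = k , sym (≡ᵇ-sound (suc k * suc k) n q)
  ... | false = go k e

module _ (d : ℕ) .{{nz : NonZero d}} where
  r-dil : ∀ n → xorSum n (λ j → d * (suc j * suc j) ≡ᵇ n) ≡ V d Q n
  r-dil n with d ∣? n
  ... | no nd = trans (sum-0 n (λ j _ → ≡ᵇ-no (λ e → nd (divides (suc j * suc j) (trans (sym e) (*-comm d _))))))
                 (sym (V-non d Q n (λ m e → nd (divides m (trans e (*-comm d m))))))
  ... | yes (divides m e) = subst (λ k → xorSum k (λ j → d * (suc j * suc j) ≡ᵇ k) ≡ V d Q k) (sym (trans e (*-comm m d))) h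
    where
    h : xorSum (d * m) (λ j → d * (suc j * suc j) ≡ᵇ d * m) ≡ V d Q (d * m)
    h = trans (sum-cong (d * m) (λ j _ → bool-ext (λ t → trans (cong (_≡ᵇ m) (*-cancelˡ-≡ (suc j * suc j) m d (≡ᵇ-sound _ _ t))) (≡ᵇ-refl m))
                 (λ t → trans (cong (λ z → d * z ≡ᵇ d * m) (≡ᵇ-sound _ m t)) (≡ᵇ-refl (d * m)))))
         (trans (cong (λ k → xorSum k (λ j → suc j * suc j ≡ᵇ m)) (sym (m∸n+n≡m (m≤n*m m d))))
         (trans (sum-extend m (d * m ∸ m) _ (λ j le → ≡ᵇ-no (λ e' → <⇒≢ (≤-<-trans le (<-≤-trans (n<1+n j) (m≤m*n (suc j) (suc j)))) (sym e'))))
         (sym (V-mul d Q m))))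

r-Q : r ≋ (Q ⊹ V 2 Q) ⊹ (V 3 Q ⊹ V 6 Q)
r-Q .at n = begin
  xorSum n (λ j → (a j xor b j) xor (c j xor d j)) ≡⟨ sum-xor n (λ j → a j xor b j) (λ j → c j xor d j) ⟩
  xorSum n (λ j → a j xor b j) xor xorSum n (λ j → c j xor d j) ≡⟨ cong₂ _xor_ (sum-xor n a b) (sum-xor n c d) ⟩
  (xorSum n a xor xorSum n b) xor (xorSum n c xor xorSum n d)
    ≡⟨ cong₂ _xor_ (cong (Q n xor_) (r-dil 2 n)) (cong₂ _xor_ (r-dil 3 n) (r-dil 6 n)) ⟩
  (Q n xor V 2 Q n) xor (V 3 Q n xor V 6 Q n) ≡⟨ cong₂ _xor_ (sym (+-at _ _ n)) (sym (+-at _ _ n)) ⟩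
  (Q ⊹ V 2 Q) n xor (V 3 Q ⊹ V 6 Q) n ≡⟨ sym (+-at _ _ n) ⟩
  ((Q ⊹ V 2 Q) ⊹ (V 3 Q ⊹ V 6 Q)) n ∎
  where
  open ≡-Reasoning
  a b c d : ℕ → Bool
  a j = suc j * suc j ≡ᵇ n
  b j = 2 * (suc j * suc j) ≡ᵇ n
  c j = 3 * (suc j * suc j) ≡ᵇ n
  d j = 6 * (suc j * suc j) ≡ᵇ n

-- The sum of x^(a²) over odd a > 0: the second summand has the exponents (2m)² and cancels the even
-- squares.
Θ : Series
Θ = Q ⊹ V 4 Q

-- Since squaring is `V 2`, the sum telescopes: `V 2 Q` and `V 6 Q` cancel, while `V 4 Q` and
-- `V 12 Q` appear.
r²+r : r · r ⊹ r ≋ Θ ⊹ V 3 Θ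
r²+r = +-cong (sq-V r ⟫ V-cong 2 r-Q ⟫ V-+ 2 _ _ ⟫ +-cong (V-+ 2 _ _) (V-+ 2 _ _)) r-Q
  ⟫ +-cong (+-cong (+-cong ≋-refl (V-V 2 2 Q)) (+-cong (V-V 2 3 Q) (V-V 2 6 Q))) ≋-refl
  ⟫ ring (Q ∷ V 2 Q ∷ V 3 Q ∷ V 6 Q ∷ V 4 Q ∷ V 12 Q ∷ [])
      (((X1 ⊕ X4) ⊕ (X3 ⊕ X5)) ⊕ ((X0 ⊕ X1) ⊕ (X2 ⊕ X3))) ((X0 ⊕ X4) ⊕ (X2 ⊕ X5)) refl
  ⟫ +-cong ≋-refl (≋-sym (V-+ 3 _ _ ⟫ +-cong ≋-refl (V-V 3 4 Q)))

odd : ℕ → Bool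
odd zero = false
odd (suc n) = not (odd n)

odd-+ : ∀ m n → odd (m + n) ≡ odd m xor odd n
odd-+ zero n = refl
odd-+ (suc m) n = trans (cong not (odd-+ m n)) (lem (odd m) (odd n))
  where lem : ∀ a b → not (a xor b) ≡ not a xor b
        lem false b = refl
        lem true false = refl
        lem true true = refl

odd-2 : ∀ m → odd (2 * m) ≡ false
odd-2 m = trans (odd-+ m (m + 0)) (trans (cong (odd m xor_) (cong odd (+-identityʳ m))) (xor-same (odd m)))

odd-∣-∣ : ∀ m n → odd ∣ m - n ∣ ≡ odd m xor odd n
odd-∣-∣ zero n = refl
odd-∣-∣ (suc m) zero = sym (xor-identityʳ _)
odd-∣-∣ (suc m) (suc n) = trans (odd-∣-∣ m n) (lem (odd m) (odd n))
  where lem : ∀ a b → a xor b ≡ not a xor not b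
        lem false false = refl
        lem false true = refl
        lem true false = refl
        lem true true = refl

odd-half : ∀ a → odd a ≡ true → ∃ λ i → a ≡ suc (2 * i)
odd-half a o with even-or-odd a
... | inj₁ (m , refl) = ⊥-elim (false≢true (trans (sym (odd-2 m)) o))
... | inj₂ q = q

odd-sq : ∀ a → odd a ≡ true → odd (a * a) ≡ true
odd-sq a o with odd-half a o
... | (i , refl) = cong not (trans (cong odd lem) (odd-2 (2 * i * i + 2 * i)))
  where open +-*-Solver
        lem : 2 * i + (2 * i) * suc (2 * i) ≡ 2 * (2 * i * i + 2 * i)
        lem = solve 1 (λ i → con 2 :* i :+ (con 2 :* i) :* (con 1 :+ con 2 :* i) := con 2 :* (con 2 :* i :* i :+ con 2 :* i)) refl i

odd≢4 : ∀ n m → odd n ≡ true → n ≢ 4 * m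
odd≢4 n m o e = false≢true (trans (sym (trans (cong odd (trans e (*-assoc 2 2 m))) (odd-2 (2 * m)))) o)

Θ-odd : ∀ a → odd a ≡ true → Θ (a * a) ≡ true
Θ-odd (suc a) o = trans (+-at Q _ _) (cong₂ _xor_ (Q-sq a) (V-non 4 Q (suc a * suc a) (λ m → odd≢4 _ m (odd-sq (suc a) o))))

Θ-true : ∀ n → Θ n ≡ true → ∃ λ a → odd a ≡ true × n ≡ a * a
Θ-true n t = go (Q n) (V 4 Q n) refl refl (trans (sym (+-at Q (V 4 Q) n)) t)
  where
  go : ∀ x y → Q n ≡ x → V 4 Q n ≡ y → x xor y ≡ true → ∃ λ a → odd a ≡ true × n ≡ a * a
  go false true q q4 _ = let (m , e , qm) = V-true 4 Q n q4 ; (a , ea) = Q-true m qm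
      in ⊥-elim (false≢true (trans (sym q) (trans (cong Q (trans e (trans (cong (4 *_) ea) (four a)))) (Q-sq (suc (2 * a))))))
    where four : ∀ a → 4 * (suc a * suc a) ≡ suc (suc (2 * a)) * suc (suc (2 * a))
          four a = solve 1 (λ a → con 4 :* ((con 1 :+ a) :* (con 1 :+ a)) := (con 2 :+ con 2 :* a) :* (con 2 :+ con 2 :* a)) refl a
            where open +-*-Solver
  go true false q q4 _ = let (a , ea) = Q-true n q in suc a , o a ea , ea
    where
    o : ∀ a → n ≡ suc a * suc a → odd (suc a) ≡ true
    o a ea with even-or-odd (suc a)
    ... | inj₂ (m , e) = trans (cong odd e) (cong not (odd-2 m))
    ... | inj₁ (suc m , e) = ⊥-elim (false≢true (trans (sym q4) (trans (cong (V 4 Q) (trans ea (trans (cong₂ _*_ e e)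
          (solve 1 (λ m → (con 2 :* (con 1 :+ m)) :* (con 2 :* (con 1 :+ m)) := con 4 :* ((con 1 :+ m) :* (con 1 :+ m))) refl m))))
          (trans (V-mul 4 Q (suc m * suc m)) (Q-sq m)))))
      where open +-*-Solver

sum-delta : ∀ B k (h : ℕ → Bool) → (h k ≡ true → k < B) → xorSum B (λ a → (k ≡ᵇ a) ∧ h a) ≡ h k
sum-delta B k h lt with k <? B
... | yes l = trans (sum-single B k _ l (λ a _ ne → cong (_∧ h a) (≡ᵇ-no (λ e → ne (sym e))))) (cong (_∧ h k) (≡ᵇ-refl k))
... | no nl = trans (sum-0 B (λ a l → cong (_∧ h a) (≡ᵇ-no (λ e → nl (subst (_< B) (sym e) l))))) (sym (¬true (λ t → nl (lt t))))

module _ (d : ℕ) .{{nz : NonZero d}} where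
  VΘ-true : ∀ n → V d Θ n ≡ true → ∃ λ a → odd a ≡ true × n ≡ d * (a * a)
  VΘ-true n t = let (m , e , tm) = V-true d Θ n t ; (a , o , ea) = Θ-true m tm in a , o , trans e (cong (d *_) ea)

  VΘ-sum : ∀ B n → n < B → V d Θ n ≡ xorSum B (λ a → odd a ∧ (d * (a * a) ≡ᵇ n))
  VΘ-sum B n l with V d Θ n in q
  ... | true = let (a , o , e) = VΘ-true n q in
       sym (trans (sum-single B a _ (≤-<-trans (≤-trans (m≤m*m a) (m≤n*m (a * a) d)) (subst (_< B) e l))
          (λ i _ ne → trans (cong (odd i ∧_) (≡ᵇ-no (λ e' → ne (sq-cancel i a (*-cancelˡ-≡ (i * i) (a * a) d (trans e' e)))))) (∧-zeroʳ _)))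
          (cong₂ _∧_ o (subst (λ z → (d * (a * a) ≡ᵇ z) ≡ true) (sym e) (≡ᵇ-refl (d * (a * a))))))
    where m≤m*m : ∀ m → m ≤ m * m
          m≤m*m zero = z≤n
          m≤m*m (suc m) = m≤m*n (suc m) (suc m)
  ... | false = sym (sum-0 B (λ a _ → ¬true (λ t → let (o , e) = ∧-true {odd a} t in
       false≢true (trans (sym q) (trans (cong (V d Θ) (sym (≡ᵇ-sound _ n e))) (trans (V-mul d Θ (a * a)) (Θ-odd a o)))))))

conv-delta : ∀ N x y → xorSum (suc N) (λ i → (x ≡ᵇ i) ∧ (y ≡ᵇ N ∸ i)) ≡ (x + y ≡ᵇ N)
conv-delta N x y with x ≤? N
... | yes le = trans (sum-delta (suc N) x (λ i → y ≡ᵇ N ∸ i) (λ _ → s≤s le))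
     (bool-ext (λ t → trans (cong (λ z → x + z ≡ᵇ N) (≡ᵇ-sound y _ t)) (trans (cong (_≡ᵇ N) (m+[n∸m]≡n le)) (≡ᵇ-refl N)))
               (λ t → trans (cong (λ z → y ≡ᵇ z ∸ x) (sym (≡ᵇ-sound (x + y) N t))) (trans (cong (y ≡ᵇ_) (m+n∸m≡n x y)) (≡ᵇ-refl y))))
... | no nle = trans (sum-0 (suc N) (λ i l → cong (_∧ (y ≡ᵇ N ∸ i)) (≡ᵇ-no (λ e → nle (subst (_≤ N) (sym e) (≤-pred l))))))
     (sym (≡ᵇ-no (λ e → nle (subst (x ≤_) e (m≤m+n x y)))))

∣-∣-sq : ∀ x y → ∣ x - y ∣ * ∣ x - y ∣ + 2 * (x * y) ≡ x * x + y * y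
∣-∣-sq zero y = +-identityʳ (y * y)
∣-∣-sq (suc x) zero = cong (suc x * suc x +_) (cong (2 *_) (*-zeroʳ x))
∣-∣-sq (suc x) (suc y) = trans (cong (∣ x - y ∣ * ∣ x - y ∣ +_) (l1 x y)) (trans (sym (+-assoc (∣ x - y ∣ * ∣ x - y ∣) _ _)) (trans (cong (_+ (2 * x + 2 * y + 2)) (∣-∣-sq x y)) (l2 x y)))
  where
  open +-*-Solver
  l1 : ∀ x y → 2 * (suc x * suc y) ≡ 2 * (x * y) + (2 * x + 2 * y + 2)
  l1 = solve 2 (λ x y → con 2 :* ((con 1 :+ x) :* (con 1 :+ y)) := con 2 :* (x :* y) :+ (con 2 :* x :+ con 2 :* y :+ con 2)) refl
  l2 : ∀ x y → (x * x + y * y) + (2 * x + 2 * y + 2) ≡ suc x * suc x + suc y * suc y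
  l2 = solve 2 (λ x y → (x :* x :+ y :* y) :+ (con 2 :* x :+ con 2 :* y :+ con 2) := (con 1 :+ x) :* (con 1 :+ x) :+ (con 1 :+ y) :* (con 1 :+ y)) refl

-- Representations N = a² + 3b² with a, b odd.  Multiplying a + b√-3 by a primitive cube root of
-- unity and taking absolute values gives the two candidates below, exactly one of which is odd.
module Pairs (N : ℕ) where
  B : ℕ
  B = suc N

  P : ℕ → ℕ → Bool
  P a b = odd a ∧ (odd b ∧ (a * a + 3 * (b * b) ≡ᵇ N))

  R₁ R₂ R M : ℕ → ℕ → ℕ → ℕ → Bool
  R₁ a b a' b' = (2 * a' ≡ᵇ a + 3 * b) ∧ (2 * b' ≡ᵇ ∣ a - b ∣)
  R₂ a b a' b' = (2 * a' ≡ᵇ ∣ a - 3 * b ∣) ∧ (2 * b' ≡ᵇ a + b)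
  R a b a' b' = (odd a' ∧ odd b') ∧ (R₁ a b a' b' ∨ R₂ a b a' b')
  M a b a' b' = P a b ∧ R a b a' b'

  ∨-true : ∀ {a b} → a ∨ b ≡ true → a ≡ true ⊎ b ≡ true
  ∨-true {true} _ = inj₁ refl
  ∨-true {false} e = inj₂ e

  ∨-r : ∀ a {b} → b ≡ true → a ∨ b ≡ true
  ∨-r true _ = refl
  ∨-r false e = e

  ≡ᵇ-intro : ∀ {m n} → m ≡ n → (m ≡ᵇ n) ≡ true
  ≡ᵇ-intro {m} refl = ≡ᵇ-refl m

  P-true : ∀ {a b} → P a b ≡ true → odd a ≡ true × odd b ≡ true × a * a + 3 * (b * b) ≡ N
  P-true {a} {b} t = let (x , y) = ∧-true {odd a} t ; (y' , z) = ∧-true {odd b} y in x , y' , ≡ᵇ-sound _ N z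

  P-intro : ∀ {a b} → odd a ≡ true → odd b ≡ true → a * a + 3 * (b * b) ≡ N → P a b ≡ true
  P-intro {a} {b} x y z = cong₂ _∧_ x (cong₂ _∧_ y (≡ᵇ-intro z))

  Rel₁ Rel₂ : ℕ → ℕ → ℕ → ℕ → Set
  Rel₁ a b a' b' = 2 * a' ≡ a + 3 * b × 2 * b' ≡ ∣ a - b ∣
  Rel₂ a b a' b' = 2 * a' ≡ ∣ a - 3 * b ∣ × 2 * b' ≡ a + b

  R₁-sound : ∀ {a b a' b'} → R₁ a b a' b' ≡ true → Rel₁ a b a' b'
  R₁-sound {a} {b} {a'} t = let (x , y) = ∧-true {2 * a' ≡ᵇ a + 3 * b} t in ≡ᵇ-sound _ _ x , ≡ᵇ-sound _ _ y
  R₂-sound : ∀ {a b a' b'} → R₂ a b a' b' ≡ true → Rel₂ a b a' b'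
  R₂-sound {a} {b} {a'} t = let (x , y) = ∧-true {2 * a' ≡ᵇ ∣ a - 3 * b ∣} t in ≡ᵇ-sound _ _ x , ≡ᵇ-sound _ _ y

  R-true : ∀ {a b a' b'} → R a b a' b' ≡ true → (odd a' ≡ true × odd b' ≡ true) × (Rel₁ a b a' b' ⊎ Rel₂ a b a' b')
  R-true {a} {b} {a'} {b'} t with ∧-true {odd a' ∧ odd b'} t
  ... | o , s with ∨-true {R₁ a b a' b'} s
  ...   | inj₁ x = ∧-true o , inj₁ (R₁-sound {a} {b} {a'} {b'} x)
  ...   | inj₂ x = ∧-true o , inj₂ (R₂-sound {a} {b} {a'} {b'} x)

  R-intro : ∀ {a b a' b'} → odd a' ≡ true → odd b' ≡ true → Rel₁ a b a' b' ⊎ Rel₂ a b a' b' → R a b a' b' ≡ true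
  R-intro {a} {b} {a'} {b'} x y (inj₁ (p , q)) = cong₂ _∧_ (cong₂ _∧_ x y) (cong (_∨ R₂ a b a' b') (cong₂ _∧_ (≡ᵇ-intro p) (≡ᵇ-intro q)))
  R-intro {a} {b} {a'} {b'} x y (inj₂ (p , q)) = cong₂ _∧_ (cong₂ _∧_ x y) (∨-r (R₁ a b a' b') (cong₂ _∧_ (≡ᵇ-intro p) (≡ᵇ-intro q)))

  open +-*-Solver

  -- Units preserve the norm of a + b√-3. Both sides are multiplied by 4 and shifted by a cross
  -- term, so that `∣-∣-sq` applies without any case distinction on signs.
  norm-inv : ∀ {a b a' b'} → Rel₁ a b a' b' ⊎ Rel₂ a b a' b' → a' * a' + 3 * (b' * b') ≡ a * a + 3 * (b * b)
  norm-inv {a} {b} {a'} {b'} (inj₁ (p , q)) = *-cancelˡ-≡ _ _ 4 (+-cancelʳ-≡ (6 * (a * b)) _ _ (begin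
    4 * (a' * a' + 3 * (b' * b')) + 6 * (a * b)
      ≡⟨ solve 3 (λ a b c → con 4 :* (a :* a :+ con 3 :* (b :* b)) :+ con 6 :* c := (con 2 :* a) :* (con 2 :* a) :+ con 3 :* ((con 2 :* b) :* (con 2 :* b) :+ con 2 :* c)) refl a' b' (a * b) ⟩
    (2 * a') * (2 * a') + 3 * ((2 * b') * (2 * b') + 2 * (a * b)) ≡⟨ cong₂ (λ x y → x * x + 3 * (y * y + 2 * (a * b))) p q ⟩
    (a + 3 * b) * (a + 3 * b) + 3 * (∣ a - b ∣ * ∣ a - b ∣ + 2 * (a * b)) ≡⟨ cong (λ z → (a + 3 * b) * (a + 3 * b) + 3 * z) (∣-∣-sq a b) ⟩
    (a + 3 * b) * (a + 3 * b) + 3 * (a * a + b * b)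
      ≡⟨ solve 2 (λ a b → (a :+ con 3 :* b) :* (a :+ con 3 :* b) :+ con 3 :* (a :* a :+ b :* b) := con 4 :* (a :* a :+ con 3 :* (b :* b)) :+ con 6 :* (a :* b)) refl a b ⟩
    4 * (a * a + 3 * (b * b)) + 6 * (a * b) ∎))
    where open ≡-Reasoning
  norm-inv {a} {b} {a'} {b'} (inj₂ (p , q)) = *-cancelˡ-≡ _ _ 4 (+-cancelʳ-≡ (2 * (a * (3 * b))) _ _ (begin
    4 * (a' * a' + 3 * (b' * b')) + 2 * (a * (3 * b))
      ≡⟨ solve 3 (λ a b c → con 4 :* (a :* a :+ con 3 :* (b :* b)) :+ con 2 :* c := ((con 2 :* a) :* (con 2 :* a) :+ con 2 :* c) :+ con 3 :* ((con 2 :* b) :* (con 2 :* b))) refl a' b' (a * (3 * b)) ⟩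
    ((2 * a') * (2 * a') + 2 * (a * (3 * b))) + 3 * ((2 * b') * (2 * b')) ≡⟨ cong₂ (λ x y → (x * x + 2 * (a * (3 * b))) + 3 * (y * y)) p q ⟩
    (∣ a - 3 * b ∣ * ∣ a - 3 * b ∣ + 2 * (a * (3 * b))) + 3 * ((a + b) * (a + b)) ≡⟨ cong (λ z → z + 3 * ((a + b) * (a + b))) (∣-∣-sq a (3 * b)) ⟩
    (a * a + (3 * b) * (3 * b)) + 3 * ((a + b) * (a + b))
      ≡⟨ solve 2 (λ a b → (a :* a :+ (con 3 :* b) :* (con 3 :* b)) :+ con 3 :* ((a :+ b) :* (a :+ b)) := con 4 :* (a :* a :+ con 3 :* (b :* b)) :+ con 2 :* (a :* (con 3 :* b))) refl a b ⟩
    4 * (a * a + 3 * (b * b)) + 2 * (a * (3 * b)) ∎))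
    where open ≡-Reasoning

  dist+ : ∀ {x y d} → y + d ≡ x → ∣ x - y ∣ ≡ d
  dist+ {x} {y} {d} refl = trans (∣-∣-comm (y + d) y) (∣m-m+n∣≡n y d)

  dist- : ∀ {x y d} → x + d ≡ y → ∣ x - y ∣ ≡ d
  dist- {x} {y} {d} refl = ∣m-m+n∣≡n x d

  dist-cases : ∀ x y → (y + ∣ x - y ∣ ≡ x) ⊎ (x + ∣ x - y ∣ ≡ y)
  dist-cases x y with ≤-total x y
  ... | inj₁ le = inj₂ (trans (cong (x +_) (m≤n⇒∣m-n∣≡n∸m le)) (m+[n∸m]≡n le))
  ... | inj₂ le = inj₁ (trans (cong (y +_) (m≤n⇒∣n-m∣≡n∸m le)) (m+[n∸m]≡n le))

  -- Multiplication by a cube root of unity is undone by its conjugate. Which of the two shapes the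
  -- inverse takes depends on the sign hidden in the absolute difference.
  Rel-sym : ∀ {a b a' b'} → Rel₁ a b a' b' ⊎ Rel₂ a b a' b' → Rel₁ a' b' a b ⊎ Rel₂ a' b' a b
  Rel-sym {a} {b} {a'} {b'} (inj₁ (p , q)) with dist-cases a b
  ... | inj₁ e = inj₁ (*-cancelˡ-≡ _ _ 2 (begin
          2 * (2 * a) ≡⟨ solve 1 (λ a → con 2 :* (con 2 :* a) := a :+ con 3 :* a) refl a ⟩
          a + 3 * a ≡⟨ cong (λ z → a + 3 * z) (sym e) ⟩
          a + 3 * (b + ∣ a - b ∣) ≡⟨ solve 3 (λ a b d → a :+ con 3 :* (b :+ d) := (a :+ con 3 :* b) :+ con 3 :* d) refl a b ∣ a - b ∣ ⟩
          (a + 3 * b) + 3 * ∣ a - b ∣ ≡⟨ cong₂ (λ x y → x + 3 * y) (sym p) (sym q) ⟩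
          2 * a' + 3 * (2 * b') ≡⟨ solve 2 (λ a b → con 2 :* a :+ con 3 :* (con 2 :* b) := con 2 :* (a :+ con 3 :* b)) refl a' b' ⟩
          2 * (a' + 3 * b') ∎)
       , sym (dist+ {a'} {b'} {2 * b} (*-cancelˡ-≡ _ _ 2 (begin
          2 * (b' + 2 * b) ≡⟨ solve 2 (λ x b → con 2 :* (x :+ con 2 :* b) := con 2 :* x :+ con 4 :* b) refl b' b ⟩
          2 * b' + 4 * b ≡⟨ cong (_+ 4 * b) q ⟩
          ∣ a - b ∣ + 4 * b ≡⟨ solve 2 (λ d b → d :+ con 4 :* b := (b :+ d) :+ con 3 :* b) refl ∣ a - b ∣ b ⟩
          (b + ∣ a - b ∣) + 3 * b ≡⟨ cong (_+ 3 * b) e ⟩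
          a + 3 * b ≡⟨ sym p ⟩
          2 * a' ∎))))
     where open ≡-Reasoning
  ... | inj₂ e = inj₂ (sym (dist+ {a'} {3 * b'} {2 * a} (*-cancelˡ-≡ _ _ 2 (begin
          2 * (3 * b' + 2 * a) ≡⟨ solve 2 (λ x a → con 2 :* (con 3 :* x :+ con 2 :* a) := con 3 :* (con 2 :* x) :+ con 4 :* a) refl b' a ⟩
          3 * (2 * b') + 4 * a ≡⟨ cong (λ z → 3 * z + 4 * a) q ⟩
          3 * ∣ a - b ∣ + 4 * a ≡⟨ solve 2 (λ d a → con 3 :* d :+ con 4 :* a := a :+ con 3 :* (a :+ d)) refl ∣ a - b ∣ a ⟩
          a + 3 * (a + ∣ a - b ∣) ≡⟨ cong (λ z → a + 3 * z) e ⟩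
          a + 3 * b ≡⟨ sym p ⟩
          2 * a' ∎)))
       , *-cancelˡ-≡ _ _ 2 (begin
          2 * (2 * b) ≡⟨ solve 1 (λ b → con 2 :* (con 2 :* b) := con 3 :* b :+ b) refl b ⟩
          3 * b + b ≡⟨ cong (3 * b +_) (sym e) ⟩
          3 * b + (a + ∣ a - b ∣) ≡⟨ solve 3 (λ a b d → con 3 :* b :+ (a :+ d) := (a :+ con 3 :* b) :+ d) refl a b ∣ a - b ∣ ⟩
          (a + 3 * b) + ∣ a - b ∣ ≡⟨ cong₂ _+_ (sym p) (sym q) ⟩
          2 * a' + 2 * b' ≡⟨ sym (*-distribˡ-+ 2 a' b') ⟩
          2 * (a' + b') ∎))
     where open ≡-Reasoning
  Rel-sym {a} {b} {a'} {b'} (inj₂ (p , q)) with dist-cases a (3 * b)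
  ... | inj₁ e = inj₁ (*-cancelˡ-≡ _ _ 2 (begin
          2 * (2 * a) ≡⟨ solve 1 (λ a → con 2 :* (con 2 :* a) := con 3 :* a :+ a) refl a ⟩
          3 * a + a ≡⟨ cong (3 * a +_) (sym e) ⟩
          3 * a + (3 * b + ∣ a - 3 * b ∣) ≡⟨ solve 3 (λ a b d → con 3 :* a :+ (con 3 :* b :+ d) := d :+ con 3 :* (a :+ b)) refl a b ∣ a - 3 * b ∣ ⟩
          ∣ a - 3 * b ∣ + 3 * (a + b) ≡⟨ cong₂ (λ x y → x + 3 * y) (sym p) (sym q) ⟩
          2 * a' + 3 * (2 * b') ≡⟨ solve 2 (λ a b → con 2 :* a :+ con 3 :* (con 2 :* b) := con 2 :* (a :+ con 3 :* b)) refl a' b' ⟩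
          2 * (a' + 3 * b') ∎)
       , sym (dist- {a'} {b'} {2 * b} (*-cancelˡ-≡ _ _ 2 (begin
          2 * (a' + 2 * b) ≡⟨ solve 2 (λ x b → con 2 :* (x :+ con 2 :* b) := con 2 :* x :+ con 4 :* b) refl a' b ⟩
          2 * a' + 4 * b ≡⟨ cong (_+ 4 * b) p ⟩
          ∣ a - 3 * b ∣ + 4 * b ≡⟨ solve 2 (λ d b → d :+ con 4 :* b := (con 3 :* b :+ d) :+ b) refl ∣ a - 3 * b ∣ b ⟩
          (3 * b + ∣ a - 3 * b ∣) + b ≡⟨ cong (_+ b) e ⟩
          a + b ≡⟨ sym q ⟩
          2 * b' ∎))))
     where open ≡-Reasoning
  ... | inj₂ e = inj₂ (sym (dist- {a'} {3 * b'} {2 * a} (*-cancelˡ-≡ _ _ 2 (begin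
          2 * (a' + 2 * a) ≡⟨ solve 2 (λ x a → con 2 :* (x :+ con 2 :* a) := con 2 :* x :+ con 4 :* a) refl a' a ⟩
          2 * a' + 4 * a ≡⟨ cong (_+ 4 * a) p ⟩
          ∣ a - 3 * b ∣ + 4 * a ≡⟨ solve 2 (λ d a → d :+ con 4 :* a := (a :+ d) :+ con 3 :* a) refl ∣ a - 3 * b ∣ a ⟩
          (a + ∣ a - 3 * b ∣) + 3 * a ≡⟨ cong (_+ 3 * a) e ⟩
          3 * b + 3 * a ≡⟨ solve 2 (λ a b → con 3 :* b :+ con 3 :* a := con 3 :* (a :+ b)) refl a b ⟩
          3 * (a + b) ≡⟨ cong (3 *_) (sym q) ⟩
          3 * (2 * b') ≡⟨ solve 1 (λ b → con 3 :* (con 2 :* b) := con 2 :* (con 3 :* b)) refl b' ⟩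
          2 * (3 * b') ∎)))
       , *-cancelˡ-≡ _ _ 2 (begin
          2 * (2 * b) ≡⟨ solve 1 (λ b → con 2 :* (con 2 :* b) := con 3 :* b :+ b) refl b ⟩
          3 * b + b ≡⟨ cong (_+ b) (sym e) ⟩
          (a + ∣ a - 3 * b ∣) + b ≡⟨ solve 3 (λ a b d → (a :+ d) :+ b := d :+ (a :+ b)) refl a b ∣ a - 3 * b ∣ ⟩
          ∣ a - 3 * b ∣ + (a + b) ≡⟨ cong₂ _+_ (sym p) (sym q) ⟩
          2 * a' + 2 * b' ≡⟨ sym (*-distribˡ-+ 2 a' b') ⟩
          2 * (a' + b') ∎))
     where open ≡-Reasoning

  M-imp : ∀ a b a' b' → M a b a' b' ≡ true → M a' b' a b ≡ true
  M-imp a b a' b' t = let (pt , rt) = ∧-true {P a b} t ; (x , y , e) = P-true {a} {b} pt ; ((x' , y') , rel) = R-true {a} {b} {a'} {b'} rt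
    in cong₂ _∧_ (P-intro {a'} {b'} x' y' (trans (norm-inv {a} {b} {a'} {b'} rel) e)) (R-intro {a'} {b'} {a} {b} x y (Rel-sym {a} {b} {a'} {b'} rel))

  M-sym : ∀ a b a' b' → M a b a' b' ≡ M a' b' a b
  M-sym a b a' b' = bool-ext (M-imp a b a' b') (M-imp a' b' a b)

  P-bound : ∀ {a b} → P a b ≡ true → a < B × b < B
  P-bound {a} {b} t = let (_ , _ , e) = P-true {a} {b} t in
     s≤s (subst (a ≤_) e (≤-trans (m≤m*m a) (m≤m+n (a * a) _))) ,
     s≤s (subst (b ≤_) e (≤-trans (m≤m*m b) (≤-trans (m≤n*m (b * b) 3) (m≤n+m _ (a * a)))))
    where m≤m*m : ∀ m → m ≤ m * m
          m≤m*m zero = z≤n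
          m≤m*m (suc m) = m≤m*n (suc m) (suc m)

  S₂ : (ℕ → ℕ → Bool) → Bool
  S₂ h = xorSum B (λ a → xorSum B (h a))

  S₂-cong : ∀ {h k : ℕ → ℕ → Bool} → (∀ a b → h a b ≡ k a b) → S₂ h ≡ S₂ k
  S₂-cong e = sum-cong B (λ a _ → sum-cong B (λ b _ → e a b))

  -- For a = 2i + 1 and b = 2j + 1 the two candidates for b' are |i - j| and i + j + 1, of opposite
  -- parity, and each a' has the parity of its b'. Exactly one candidate therefore consists of odd
  -- numbers.
  row : ∀ a b → S₂ (M a b) ≡ P a b
  row a b with P a b in eq
  ... | false = sum-0 B (λ _ _ → sum-0 B (λ _ _ → refl))
  ... | true = unique a₀ b₀ rel₀ odd₀ uniq
    where
    oa : odd a ≡ true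
    oa = proj₁ (P-true {a} {b} eq)
    ob : odd b ≡ true
    ob = proj₁ (proj₂ (P-true {a} {b} eq))
    i j k : ℕ
    i = proj₁ (odd-half a oa)
    j = proj₁ (odd-half b ob)
    k = ∣ i - j ∣
    ea : a ≡ suc (2 * i)
    ea = proj₂ (odd-half a oa)
    eb : b ≡ suc (2 * j)
    eb = proj₂ (odd-half b ob)
    e1 : 2 * (i + 3 * j + 2) ≡ a + 3 * b
    e1 = trans (solve 2 (λ i j → con 2 :* (i :+ con 3 :* j :+ con 2) := (con 1 :+ con 2 :* i) :+ con 3 :* (con 1 :+ con 2 :* j)) refl i j)
           (cong₂ (λ x y → x + 3 * y) (sym ea) (sym eb))
    e2 : 2 * k ≡ ∣ a - b ∣
    e2 = trans (*-distribˡ-∣-∣ 2 i j) (cong₂ ∣_-_∣ (sym ea) (sym eb))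
    e3 : 2 * ∣ i - (3 * j + 1) ∣ ≡ ∣ a - 3 * b ∣
    e3 = trans (*-distribˡ-∣-∣ 2 i (3 * j + 1)) (cong₂ ∣_-_∣ (sym ea)
          (trans (solve 1 (λ j → con 1 :+ con 2 :* (con 3 :* j :+ con 1) := con 3 :* (con 1 :+ con 2 :* j)) refl j) (cong (3 *_) (sym eb))))
    e4 : 2 * (i + j + 1) ≡ a + b
    e4 = trans (solve 2 (λ i j → con 2 :* (i :+ j :+ con 1) := (con 1 :+ con 2 :* i) :+ (con 1 :+ con 2 :* j)) refl i j) (cong₂ _+_ (sym ea) (sym eb))
    o3 : odd (3 * j) ≡ odd j
    o3 = trans (odd-+ j (2 * j)) (trans (cong (odd j xor_) (odd-2 j)) (xor-identityʳ (odd j)))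
    p1 : odd (i + 3 * j + 2) ≡ odd k
    p1 = trans (odd-+ (i + 3 * j) 2) (trans (xor-identityʳ _) (trans (odd-+ i (3 * j)) (trans (cong (odd i xor_) o3) (sym (odd-∣-∣ i j)))))
    p4 : odd (i + j + 1) ≡ not (odd k)
    p4 = trans (cong odd (+-comm (i + j) 1)) (cong not (trans (odd-+ i j) (sym (odd-∣-∣ i j))))
    p3 : odd ∣ i - (3 * j + 1) ∣ ≡ not (odd k)
    p3 = trans (odd-∣-∣ i (3 * j + 1)) (trans (cong (odd i xor_) (trans (cong odd (+-comm (3 * j) 1)) (cong not o3)))
           (trans (lem (odd i) (odd j)) (cong not (sym (odd-∣-∣ i j)))))
      where lem : ∀ x y → x xor not y ≡ not (x xor y)
            lem false y = refl
            lem true y = refl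
    a₀ b₀ : ℕ
    a₀ = if odd k then i + 3 * j + 2 else ∣ i - (3 * j + 1) ∣
    b₀ = if odd k then k else i + j + 1
    rel₀ : Rel₁ a b a₀ b₀ ⊎ Rel₂ a b a₀ b₀
    rel₀ with odd k
    ... | true = inj₁ (e1 , e2)
    ... | false = inj₂ (e3 , e4)
    odd₀ : odd a₀ ≡ true × odd b₀ ≡ true
    odd₀ with odd k in q
    ... | true = trans p1 q , q
    ... | false = trans p3 (cong not q) , trans p4 (cong not q)
    uniq : ∀ a' b' → R a b a' b' ≡ true → a' ≡ a₀ × b' ≡ b₀
    uniq a' b' t with R-true {a} {b} {a'} {b'} t
    ... | (o , o') , inj₁ (p , q) = h (*-cancelˡ-≡ _ _ 2 (trans p (sym e1))) (*-cancelˡ-≡ _ _ 2 (trans q (sym e2)))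
      where h : a' ≡ i + 3 * j + 2 → b' ≡ k → a' ≡ a₀ × b' ≡ b₀
            h x y with odd k | trans (cong odd (sym y)) o'
            ... | true | _ = x , y
    ... | (o , o') , inj₂ (p , q) = h (*-cancelˡ-≡ _ _ 2 (trans p (sym e3))) (*-cancelˡ-≡ _ _ 2 (trans q (sym e4)))
      where h : a' ≡ ∣ i - (3 * j + 1) ∣ → b' ≡ i + j + 1 → a' ≡ a₀ × b' ≡ b₀
            h x y with odd k | trans (sym p4) (trans (cong odd (sym y)) o')
            ... | false | _ = x , y
    unique : ∀ a₀ b₀ → Rel₁ a b a₀ b₀ ⊎ Rel₂ a b a₀ b₀ → odd a₀ ≡ true × odd b₀ ≡ true →
             (∀ a' b' → R a b a' b' ≡ true → a' ≡ a₀ × b' ≡ b₀) → S₂ (R a b) ≡ true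
    unique a₀ b₀ rel (x , y) u = trans (sum-single B a₀ _ (proj₁ bd) (λ a' _ ne → sum-0 B (λ b' _ → ¬true (λ t → ne (proj₁ (u a' b' t))))))
       (trans (sum-single B b₀ _ (proj₂ bd) (λ b' _ ne → ¬true (λ t → ne (proj₂ (u a₀ b' t))))) (R-intro {a} {b} {a₀} {b₀} x y rel))
      where bd : a₀ < B × b₀ < B
            bd = P-bound {a₀} {b₀} (P-intro {a₀} {b₀} x y (trans (norm-inv {a} {b} {a₀} {b₀} rel) (proj₂ (proj₂ (P-true {a} {b} eq)))))

  -- `M` matches every representation with exactly one representation, symmetrically, so modulo 2
  -- only self-matched ones count. The fourfold sum is reduced to its diagonal one coordinate at a
  -- time.
  involution : S₂ P ≡ S₂ (λ a b → M a b a b)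
  involution = begin
    S₂ P ≡⟨ S₂-cong (λ a b → sym (row a b)) ⟩
    xorSum B (λ a → xorSum B (λ b → xorSum B (λ a' → xorSum B (λ b' → M a b a' b'))))
      ≡⟨ sum-cong B (λ a _ → sum-swap B B (λ b a' → xorSum B (M a b a'))) ⟩
    xorSum B (λ a → xorSum B (λ a' → xorSum B (λ b → xorSum B (λ b' → M a b a' b'))))
      ≡⟨ sum-sym B (λ a a' → xorSum B (λ b → xorSum B (λ b' → M a b a' b')))
           (λ a a' _ _ → trans (sum-swap B B (λ b b' → M a b a' b')) (sum-cong B (λ b' _ → sum-cong B (λ b _ → M-sym a b a' b')))) ⟩
    xorSum B (λ a → xorSum B (λ b → xorSum B (λ b' → M a b a b')))
      ≡⟨ sum-cong B (λ a _ → sum-sym B (λ b b' → M a b a b') (λ b b' _ _ → M-sym a b a b')) ⟩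
    S₂ (λ a b → M a b a b) ∎
    where open ≡-Reasoning

  -- Fixed points of the matching: 2a = a + 3b forces a = 3b, and 2b = a + b forces a = b. The cases
  -- exclude each other because b is odd, hence nonzero.
  diag : ∀ a b → M a b a b ≡ ((3 * b ≡ᵇ a) ∧ (odd b ∧ (12 * (b * b) ≡ᵇ N))) xor ((a ≡ᵇ b) ∧ (odd a ∧ (4 * (a * a) ≡ᵇ N)))
  diag a b = bool-ext to from
    where
    twelve : ∀ b → (3 * b) * (3 * b) + 3 * (b * b) ≡ 12 * (b * b)
    twelve = solve 1 (λ b → (con 3 :* b) :* (con 3 :* b) :+ con 3 :* (b :* b) := con 12 :* (b :* b)) refl
    four : ∀ b → b * b + 3 * (b * b) ≡ 4 * (b * b)
    four = solve 1 (λ b → b :* b :+ con 3 :* (b :* b) := con 4 :* (b :* b)) refl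
    3b≢b : ∀ b → odd b ≡ true → (3 * b ≡ᵇ b) ≡ false
    3b≢b (suc b) _ = ≡ᵇ-no (λ e → m≢1+m+n (suc b) (trans (sym e) (solve 1 (λ b → con 3 :* (con 1 :+ b) := con 1 :+ ((con 1 :+ b) :+ (con 1 :+ con 2 :* b))) refl b)))
    odd3 : ∀ b → odd b ≡ true → odd (3 * b) ≡ true
    odd3 b o = trans (odd-+ b (2 * b)) (cong₂ _xor_ o (odd-2 b))
    to : M a b a b ≡ true → ((3 * b ≡ᵇ a) ∧ (odd b ∧ (12 * (b * b) ≡ᵇ N))) xor ((a ≡ᵇ b) ∧ (odd a ∧ (4 * (a * a) ≡ᵇ N))) ≡ true
    to t with ∧-true {P a b} t
    ... | pt , rt with P-true {a} {b} pt | R-true {a} {b} {a} {b} rt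
    ...   | x , y , e | _ , inj₁ (p , q) = h (+-cancelˡ-≡ a _ _ (trans (cong (a +_) (sym (+-identityʳ a))) p))
      where h : a ≡ 3 * b → ((3 * b ≡ᵇ a) ∧ (odd b ∧ (12 * (b * b) ≡ᵇ N))) xor ((a ≡ᵇ b) ∧ (odd a ∧ (4 * (a * a) ≡ᵇ N))) ≡ true
            h refl = cong₂ _xor_ (cong₂ _∧_ (≡ᵇ-refl (3 * b)) (cong₂ _∧_ y (≡ᵇ-intro (trans (sym (twelve b)) e)))) (cong (_∧ (odd (3 * b) ∧ (4 * ((3 * b) * (3 * b)) ≡ᵇ N))) (3b≢b b y))
    ...   | x , y , e | _ , inj₂ (p , q) = h (+-cancelʳ-≡ b _ _ (trans (sym q) (cong (b +_) (+-identityʳ b))))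
      where h : a ≡ b → ((3 * b ≡ᵇ a) ∧ (odd b ∧ (12 * (b * b) ≡ᵇ N))) xor ((a ≡ᵇ b) ∧ (odd a ∧ (4 * (a * a) ≡ᵇ N))) ≡ true
            h refl = cong₂ _xor_ (cong (_∧ (odd b ∧ (12 * (b * b) ≡ᵇ N))) (3b≢b b y)) (cong₂ _∧_ (≡ᵇ-refl b) (cong₂ _∧_ y (≡ᵇ-intro (trans (sym (four b)) e))))
    c1 : (3 * b ≡ᵇ a) ∧ (odd b ∧ (12 * (b * b) ≡ᵇ N)) ≡ true → M a b a b ≡ true
    c1 t with ∧-true {3 * b ≡ᵇ a} t
    ... | x , s with ∧-true {odd b} s
    ...   | o , e with ≡ᵇ-sound (3 * b) a x
    ...     | refl = cong₂ _∧_ (P-intro {3 * b} {b} (odd3 b o) o (trans (twelve b) (≡ᵇ-sound (12 * (b * b)) N e)))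
                (R-intro {3 * b} {b} {3 * b} {b} (odd3 b o) o (inj₁ (cong (3 * b +_) (+-identityʳ (3 * b)) , sym (dist+ {3 * b} {b} {2 * b} refl))))
    c2 : (a ≡ᵇ b) ∧ (odd a ∧ (4 * (a * a) ≡ᵇ N)) ≡ true → M a b a b ≡ true
    c2 t with ∧-true {a ≡ᵇ b} t
    ... | x , s with ∧-true {odd a} s
    ...   | o , e with ≡ᵇ-sound a b x
    ...     | refl = cong₂ _∧_ (P-intro {a} {a} o o (trans (four a) (≡ᵇ-sound (4 * (a * a)) N e)))
                (R-intro {a} {a} {a} {a} o o (inj₂ (sym (dist- {a} {3 * a} {2 * a} refl) , cong (a +_) (+-identityʳ a))))
    from : ((3 * b ≡ᵇ a) ∧ (odd b ∧ (12 * (b * b) ≡ᵇ N))) xor ((a ≡ᵇ b) ∧ (odd a ∧ (4 * (a * a) ≡ᵇ N))) ≡ true → M a b a b ≡ true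
    from t with (3 * b ≡ᵇ a) ∧ (odd b ∧ (12 * (b * b) ≡ᵇ N)) in q
    ... | true = c1 q
    ... | false = c2 t

  fixed : S₂ (λ a b → M a b a b) ≡ V 12 Θ N xor V 4 Θ N
  fixed = begin
    S₂ (λ a b → M a b a b) ≡⟨ S₂-cong diag ⟩
    S₂ (λ a b → D₁ a b xor D₂ a b) ≡⟨ trans (sum-cong B (λ a _ → sum-xor B (D₁ a) (D₂ a))) (sum-xor B (λ a → xorSum B (D₁ a)) (λ a → xorSum B (D₂ a))) ⟩
    S₂ D₁ xor S₂ D₂ ≡⟨ cong₂ _xor_ (sum-swap B B D₁) refl ⟩
    xorSum B (λ b → xorSum B (λ a → D₁ a b)) xor S₂ D₂
      ≡⟨ cong₂ _xor_ (sum-cong B (λ b _ → sum-delta B (3 * b) _ (λ t → s≤s (lb 12 3 9 b (refl) (proj₂ (∧-true {odd b} t))))))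
                     (sum-cong B (λ a _ → sum-delta B a _ (λ t → s≤s (≤-trans (m≤m+n a (0 * a)) (lb 4 1 3 a refl (proj₂ (∧-true {odd a} t))))))) ⟩
    xorSum B (λ b → odd b ∧ (12 * (b * b) ≡ᵇ N)) xor xorSum B (λ a → odd a ∧ (4 * (a * a) ≡ᵇ N))
      ≡⟨ sym (cong₂ _xor_ (VΘ-sum 12 B N (n<1+n N)) (VΘ-sum 4 B N (n<1+n N))) ⟩
    V 12 Θ N xor V 4 Θ N ∎
    where
    open ≡-Reasoning
    D₁ D₂ : ℕ → ℕ → Bool
    D₁ a b = (3 * b ≡ᵇ a) ∧ (odd b ∧ (12 * (b * b) ≡ᵇ N))
    D₂ a b = (a ≡ᵇ b) ∧ (odd a ∧ (4 * (a * a) ≡ᵇ N))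
    lb : ∀ d c e x → d ≡ c + e → (d * (x * x) ≡ᵇ N) ≡ true → c * x ≤ N
    lb d c e x refl t = subst (c * x ≤_) (≡ᵇ-sound _ N t) (≤-trans (*-monoʳ-≤ c (m≤m*m x)) (*-monoˡ-≤ (x * x) (m≤m+n c e)))
      where m≤m*m : ∀ m → m ≤ m * m
            m≤m*m zero = z≤n
            m≤m*m (suc m) = m≤m*n (suc m) (suc m)

  product : (Θ · V 3 Θ) N ≡ S₂ P
  product = begin
    (Θ · V 3 Θ) N ≡⟨ *-at Θ (V 3 Θ) N ⟩
    xorSum B (λ i → Θ i ∧ V 3 Θ (N ∸ i)) ≡⟨ sum-cong B (λ i l → cong₂ _∧_ (trans (Θ-1 i) (VΘ-sum 1 B i l)) (VΘ-sum 3 B (N ∸ i) (s≤s (m∸n≤m N i)))) ⟩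
    xorSum B (λ i → xorSum B (f i) ∧ xorSum B (g i)) ≡⟨ sum-cong B (λ i _ → trans (sym (sum-∧ʳ B (xorSum B (g i)) (f i))) (sum-cong B (λ a _ → sym (sum-∧ˡ B (f i a) (g i))))) ⟩
    xorSum B (λ i → xorSum B (λ a → xorSum B (λ b → f i a ∧ g i b)))
      ≡⟨ sum-swap B B (λ i a → xorSum B (λ b → f i a ∧ g i b)) ⟩
    xorSum B (λ a → xorSum B (λ i → xorSum B (λ b → f i a ∧ g i b)))
      ≡⟨ sum-cong B (λ a _ → sum-swap B B (λ i b → f i a ∧ g i b)) ⟩
    S₂ (λ a b → xorSum B (λ i → f i a ∧ g i b)) ≡⟨ S₂-cong inner ⟩
    S₂ P ∎
    where
    open ≡-Reasoning
    f g : ℕ → ℕ → Bool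
    f i a = odd a ∧ (1 * (a * a) ≡ᵇ i)
    g i b = odd b ∧ (3 * (b * b) ≡ᵇ N ∸ i)
    Θ-1 : ∀ i → Θ i ≡ V 1 Θ i
    Θ-1 i = sym (trans (cong (V 1 Θ) (sym (+-identityʳ i))) (V-mul 1 Θ i))
    inner : ∀ a b → xorSum B (λ i → f i a ∧ g i b) ≡ P a b
    inner a b = trans (sum-cong B (λ i _ → lem (odd a) (1 * (a * a) ≡ᵇ i) (odd b) (3 * (b * b) ≡ᵇ N ∸ i)))
      (trans (sum-∧ˡ B (odd a ∧ odd b) (λ i → (1 * (a * a) ≡ᵇ i) ∧ (3 * (b * b) ≡ᵇ N ∸ i)))
      (trans (cong ((odd a ∧ odd b) ∧_) (trans (conv-delta N (1 * (a * a)) (3 * (b * b))) (cong (λ z → z + 3 * (b * b) ≡ᵇ N) (+-identityʳ (a * a))))) (∧-assoc (odd a) (odd b) _)))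
      where lem : ∀ x y z w → (x ∧ y) ∧ (z ∧ w) ≡ (x ∧ z) ∧ (y ∧ w)
            lem false y z w = refl
            lem true false false w = refl
            lem true false true w = refl
            lem true true false w = refl
            lem true true true w = refl

-- The fixed points contribute Θ(x⁴) + Θ(x¹²), which is a fourth power by Frobenius.
Θ-modular : Θ · V 3 Θ ≋ (Θ ⊹ V 3 Θ) ^ₛ 4
Θ-modular = mk (λ N → trans (product N) (trans (involution N) (trans (fixed N) (sym (+-at _ _ N)))))
  ⟫ +-cong (≋-sym (V-V 4 3 Θ)) ≋-refl
  ⟫ +-comm' _ _ ⟫ ≋-sym (V-+ 4 _ _) ⟫ ≋-sym (V-V 2 2 _) ⟫ V-cong 2 (≋-sym (sq-V _)) ⟫ ≋-sym (sq-V _)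
  ⟫ ring ((Θ ⊹ V 3 Θ) ∷ []) ((X0 ⊗ X0) ⊗ (X0 ⊗ X0)) (X0 ↑ 4) refl
  where open Pairs

-- Contractions and orders of vanishing

Agree : ℕ → Series → Series → Set
Agree n f g = ∀ i → i < n → f i ≡ g i

Agree-+ : ∀ {n f f' g g'} → Agree n f f' → Agree n g g' → Agree n (f ⊹ g) (f' ⊹ g')
Agree-+ p q i l = trans (+-at _ _ i) (trans (cong₂ _xor_ (p i l) (q i l)) (sym (+-at _ _ i)))

Agree-* : ∀ {n f f' g g'} → Agree n f f' → Agree n g g' → Agree n (f · g) (f' · g')
Agree-* p q i l = trans (*-at _ _ i) (trans (sum-cong (suc i) (λ j lj → cong₂ _∧_ (p j (≤-<-trans (≤-pred lj) l)) (q (i ∸ j) (≤-<-trans (m∸n≤m i j) l)))) (sym (*-at _ _ i)))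

Agree-shift : ∀ {n h f g} → h 0 ≡ false → Agree n f g → Agree (suc n) (h · f) (h · g)
Agree-shift {n} {h} {f} {g} h0 p i l = trans (*-at _ _ i) (trans (sum-cong (suc i) (step i l)) (sym (*-at _ _ i)))
  where step : ∀ i → i < suc n → ∀ j → j < suc i → h j ∧ f (i ∸ j) ≡ h j ∧ g (i ∸ j)
        step i l zero _ = trans (cong (_∧ f i) h0) (sym (cong (_∧ g i) h0))
        step zero l (suc j) (s≤s ())
        step (suc i) l (suc j) _ = cong (h (suc j) ∧_) (p (i ∸ j) (≤-<-trans (m∸n≤m i j) (≤-pred l)))

Agree-ex : ∀ e {n ρ ρ'} → (∀ i → Agree n (ρ i) (ρ' i)) → Agree n (⟦ e ⟧ ρ) (⟦ e ⟧ ρ')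
Agree-ex (var i) h = h i
Agree-ex (a ⊕ b) h = Agree-+ (Agree-ex a h) (Agree-ex b h)
Agree-ex (a ⊗ b) h = Agree-* (Agree-ex a h) (Agree-ex b h)
Agree-ex ze h i l = refl
Agree-ex on h i l = refl

-- Banach iteration: each application of the map settles one more coefficient, so coefficient n is
-- final after n + 1 iterations.
module Fix (Ψ : Series → Series) (contr : ∀ {n f g} → Agree n f g → Agree (suc n) (Ψ f) (Ψ g)) where
  it : ℕ → Series
  it zero = 𝟘
  it (suc n) = Ψ (it n)

  it-agree : ∀ n m → n ≤ m → Agree n (it n) (it m)
  it-agree (suc n) (suc m) (s≤s le) = contr (it-agree n m le)

  fix : Series
  fix n = it (suc n) n

  fix-eq : fix ≋ Ψ fix
  fix-eq .at n = contr {n} {it n} {fix} (λ i l → sym (it-agree (suc i) n l i (n<1+n i))) n (n<1+n n)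

Low : ℕ → Series → Set
Low n f = ∀ i → i < n → f i ≡ false

Lead : ℕ → Series → Set
Lead n f = Low n f × f n ≡ true

Low-≤ : ∀ {m n f} → m ≤ n → Low n f → Low m f
Low-≤ le p i l = p i (<-≤-trans l le)

Low-≋ : ∀ {n f g} → f ≋ g → Low n f → Low n g
Low-≋ e p i l = trans (sym (at e i)) (p i l)

Low-+ : ∀ {n f g} → Low n f → Low n g → Low n (f ⊹ g)
Low-+ p q i l = trans (+-at _ _ i) (cong₂ _xor_ (p i l) (q i l))

Low-* : ∀ {m n f g} → Low m f → Low n g → Low (m + n) (f · g)
Low-* {m} {n} {f} {g} p q i l = trans (*-at f g i) (sum-0 (suc i) h)
  where h : ∀ j → j < suc i → f j ∧ g (i ∸ j) ≡ false
        h j lj with j <? m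
        ... | yes a = cong (_∧ g (i ∸ j)) (p j a)
        ... | no a = trans (cong (f j ∧_) (q (i ∸ j) (+-cancelˡ-< j _ _ (subst (_< j + n) (sym (m+[n∸m]≡n (≤-pred lj))) (<-≤-trans l (+-monoˡ-≤ n (≮⇒≥ a))))))) (∧-zeroʳ (f j))

Low-*ˡ : ∀ {m f} g → Low m f → Low m (f · g)
Low-*ˡ {m} {f} g p = subst (λ k → Low k (f · g)) (+-identityʳ m) (Low-* {m} {0} p (λ _ ()))

*-low-at : ∀ m n {f g} → Low m f → Low n g → (f · g) (m + n) ≡ f m ∧ g n
*-low-at m n {f} {g} p q = trans (*-at f g (m + n)) (trans (sum-single (suc (m + n)) m _ (s≤s (m≤m+n m n)) h) (cong (λ z → f m ∧ g z) (m+n∸m≡n m n)))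
  where h : ∀ j → j < suc (m + n) → j ≢ m → f j ∧ g (m + n ∸ j) ≡ false
        h j lj ne with <-cmp j m
        ... | tri< a _ _ = cong (_∧ g (m + n ∸ j)) (p j a)
        ... | tri≈ _ e _ = ⊥-elim (ne e)
        ... | tri> _ _ c = trans (cong (f j ∧_) (q (m + n ∸ j) (+-cancelˡ-< j _ _ (subst (_< j + n) (sym (m+[n∸m]≡n (≤-pred lj))) (+-monoˡ-< n c))))) (∧-zeroʳ (f j))

Lead-* : ∀ {m n f g} → Lead m f → Lead n g → Lead (m + n) (f · g)
Lead-* {m} {n} (p , a) (q , b) = Low-* p q , trans (*-low-at m n p q) (cong₂ _∧_ a b)

Lead-+ : ∀ {m f g} → Lead m f → Low (suc m) g → Lead m (f ⊹ g)
Lead-+ {m} (p , a) q = Low-+ p (Low-≤ (n≤1+n m) q) , trans (+-at _ _ m) (cong₂ _xor_ a (q m (n<1+n m)))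

Lead-≋ : ∀ {m f g} → f ≋ g → Lead m f → Lead m g
Lead-≋ {m} e (p , a) = Low-≋ e p , trans (sym (at e m)) a

Lead-𝟙 : Lead 0 𝟙
Lead-𝟙 = (λ _ ()) , 𝟙-zero

Lead-^ : ∀ {m f} n → Lead m f → Lead (n * m) (f ^ₛ n)
Lead-^ zero p = Lead-𝟙
Lead-^ (suc n) p = Lead-* p (Lead-^ n p)

Low-V : ∀ d .{{_ : NonZero d}} {n f} → Low n f → Low (d * n) (V d f)
Low-V d {n} {f} p i l = ¬true (λ t → let (m , e , fm) = V-true d f i t in
   false≢true (trans (sym (p m (*-cancelˡ-< d m n (subst (_< d * n) e l)))) fm))

Lead-V : ∀ d .{{_ : NonZero d}} {n f} → Lead n f → Lead (d * n) (V d f)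
Lead-V d {n} {f} (p , a) = Low-V d p , trans (V-mul d f n) a

-- The leading coefficient is 1 + 1 + 1 = 1. This form is the cofactor of f + g in f³ + g³, and it
-- will be cancelled as such.
Lead-Q³ : ∀ {n f g} → Lead n f → Lead n g → Lead (n + n) (f · f ⊹ f · g ⊹ g · g)
Lead-Q³ {n} p q = let (l1 , a1) = Lead-* p p ; (l2 , a2) = Lead-* p q ; (l3 , a3) = Lead-* q q in
   Low-+ (Low-+ l1 l2) l3 , trans (+-at _ _ (n + n)) (cong₂ _xor_ (trans (+-at _ _ (n + n)) (cong₂ _xor_ a1 a2)) a3)

·-domain' : ∀ {k f g} → Lead k g → f · g ≋ 𝟘 → f ≋ 𝟘
·-domain' {k} (lo , hi) = ·-domain k lo hi

-- Solver for identities modulo a monic relation X0 ^ D = ⟦ relE ⟧.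
module Mod (D : ℕ) (relE : Ex) where
  module _ (d : ℕ) where
    rel : MP (suc d)
    rel = norm (suc d) relE
    cut : ℕ → MP (suc d) → MP (suc d) × MP (suc d)
    cut n [] = [] , []
    cut zero (c ∷ cs) = [] , c ∷ cs
    cut (suc n) (c ∷ cs) = let (l , o) = cut n cs in c ∷ l , o
    redu : MP (suc d) → MP (suc d)
    redu p = let (l , o) = cut D p in addp (suc d) l (mulp (suc d) o rel)
    qmul : MP (suc d) → MP (suc d) → MP (suc d)
    qmul [] q = []
    qmul (a ∷ p) q = addp (suc d) (scp d a q) (redu (0p d ∷ qmul p q))
    qnorm : Ex → MP (suc d)
    qnorm (var i) = varp (suc d) i
    qnorm (a ⊕ b) = addp (suc d) (qnorm a) (qnorm b)
    qnorm (a ⊗ b) = qmul (qnorm a) (qnorm b)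
    qnorm ze = 0p (suc d)
    qnorm on = 1p (suc d)

  module _ (f : Series) (fs : List Series) (hyp : f ^ₛ D ≋ ⟦ relE ⟧ (env (f ∷ fs))) where
    private
      d : ℕ
      d = len fs
      ρ : Env
      ρ = env (f ∷ fs)
    ev-cut : ∀ n p → ev (suc d) p ρ ≋ ev (suc d) (proj₁ (cut d n p)) ρ ⊹ f ^ₛ n · ev (suc d) (proj₂ (cut d n p)) ρ
    ev-cut n [] = ≋-sym (+-cong ≋-refl (*-zeroʳ' _) ⟫ +-idʳ _)
    ev-cut zero (c ∷ cs) = ≋-sym (+-idˡ _ ⟫ *-idˡ _)
    ev-cut (suc n) (c ∷ cs) = +-cong ≋-refl (*-cong ≋-refl (ev-cut n cs) ⟫ *-distˡ _ _ _) ⟫ ≋-sym (+-assoc' _ _ _) ⟫ +-cong ≋-refl (≋-sym (*-assoc' _ _ _))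
    ev-redu : ∀ p → ev (suc d) (redu d p) ρ ≋ ev (suc d) p ρ
    ev-redu p = ev-add (suc d) (proj₁ (cut d D p)) _ ρ
      ⟫ +-cong ≋-refl (ev-mul (suc d) (proj₂ (cut d D p)) (rel d) ρ ⟫ *-cong ≋-refl (ev-norm (f ∷ fs) relE ⟫ ≋-sym hyp) ⟫ *-comm' _ _)
      ⟫ ≋-sym (ev-cut D p)
    ev-qmul : ∀ p q → ev (suc d) (qmul d p q) ρ ≋ ev (suc d) p ρ · ev (suc d) q ρ
    ev-qmul [] q = ≋-sym (*-zeroˡ' _)
    ev-qmul (a ∷ p) q = ev-add (suc d) (scp d a q) (redu d (0p d ∷ qmul d p q)) ρ
      ⟫ +-cong (ev-scp d a q ρ) (ev-redu (0p d ∷ qmul d p q) ⟫ +-cong (ev-0 d _) (*-cong ≋-refl (ev-qmul p q) ⟫ ≋-sym (*-assoc' _ _ _)) ⟫ +-idˡ _)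
      ⟫ ≋-sym (*-distʳ _ _ _)
    ev-qnorm : ∀ e → ev (suc d) (qnorm d e) ρ ≋ ⟦ e ⟧ ρ
    ev-qnorm (var i) = ev-var (f ∷ fs) i
    ev-qnorm (a ⊕ b) = ev-add (suc d) (qnorm d a) (qnorm d b) ρ ⟫ +-cong (ev-qnorm a) (ev-qnorm b)
    ev-qnorm (a ⊗ b) = ev-qmul (qnorm d a) (qnorm d b) ⟫ *-cong (ev-qnorm a) (ev-qnorm b)
    ev-qnorm ze = ev-0 (suc d) ρ
    ev-qnorm on = ev-1 (suc d) ρ
    ringmod : ∀ a b → isz (suc d) (addp (suc d) (qnorm d a) (qnorm d b)) ≡ true → ⟦ a ⟧ ρ ≋ ⟦ b ⟧ ρ
    ringmod a b h = +-cong0 (≋-sym (+-cong (ev-qnorm a) (ev-qnorm b)) ⟫ ≋-sym (ev-add (suc d) (qnorm d a) (qnorm d b) ρ) ⟫ ev-isz (suc d) (addp (suc d) (qnorm d a) (qnorm d b)) ρ h)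

-- F and G as theta series

opaque
  unfolding _⊹_
  F-def : F ≋ r · ((r ⊹ 𝟙) · ((r ⊹ 𝟙) · (r ⊹ 𝟙)))
  F-def .at n = refl
  G-def : G ≋ (r · (r · r)) · (r ⊹ 𝟙)
  G-def .at n = refl
  G²-def : G² ≋ G · G
  G²-def .at n = refl

pF pG : Series → Series
pF x = ⟦ X0 ⊗ (X0 ⊕ on) ↑ 3 ⟧ (env (x ∷ []))
pG x = ⟦ X0 ↑ 3 ⊗ (X0 ⊕ on) ⟧ (env (x ∷ []))

ExF ExG : Ex → Ex
ExF x = x ⊗ (x ⊕ on) ↑ 3
ExG x = x ↑ 3 ⊗ (x ⊕ on)

F-r : F ≋ pF r
F-r = F-def ⟫ ring (r ∷ []) (X0 ⊗ ((X0 ⊕ on) ⊗ ((X0 ⊕ on) ⊗ (X0 ⊕ on)))) (ExF X0) refl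
G-r : G ≋ pG r
G-r = G-def ⟫ ring (r ∷ []) ((X0 ⊗ (X0 ⊗ X0)) ⊗ (X0 ⊕ on)) (ExG X0) refl

Lead-r : Lead 1 r
Lead-r = (λ { zero _ → refl ; (suc _) (s≤s ()) }) , refl

Lead-F : Lead 1 F
Lead-F = (λ { zero _ → refl ; (suc _) (s≤s ()) }) , refl

Lead-G : Lead 3 G
Lead-G = (λ { zero _ → refl ; (suc zero) _ → refl ; (suc (suc zero)) _ → refl ; (suc (suc (suc _))) (s≤s (s≤s (s≤s ()))) }) , refl

Lead-Θ : Lead 1 Θ
Lead-Θ = (λ { zero _ → trans (+-at Q (V 4 Q) 0) refl ; (suc _) (s≤s ()) }) , trans (+-at Q (V 4 Q) 1) refl

-- Θ and Θ(x³) have sum u = r² + r and product u⁴, and F is a root of Y² + uY + u⁴, which splits as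
-- (Y + Θ)(Y + Θ(x³)). At Y = F the second factor has order 1, so the first one vanishes.
F≋Θ : F ≋ Θ
F≋Θ = +-cong0 (·-domain' {1} {F ⊹ Θ} {F ⊹ V 3 Θ} (Lead-+ Lead-F (Low-≤ (s≤s (s≤s z≤n)) (proj₁ (Lead-V 3 Lead-Θ))))
  (ring (F ∷ Θ ∷ V 3 Θ ∷ []) ((X0 ⊕ X1) ⊗ (X0 ⊕ X2)) ((X0 ⊗ X0 ⊕ X0 ⊗ (X1 ⊕ X2)) ⊕ X1 ⊗ X2) refl
   ⟫ +-cong (+-cong (*-cong F-r F-r) (*-cong F-r (≋-sym r²+r))) (Θ-modular ⟫ ^-cong 4 (≋-sym r²+r))
   ⟫ ring (r ∷ []) ((ExF X0 ⊗ ExF X0 ⊕ ExF X0 ⊗ (X0 ⊗ X0 ⊕ X0)) ⊕ (X0 ⊗ X0 ⊕ X0) ↑ 4) ze refl))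

uₛ : Series
uₛ = r · r ⊹ r

F+G : F ⊹ G ≋ uₛ
F+G = +-cong F-r G-r ⟫ ring (r ∷ []) (ExF X0 ⊕ ExG X0) (X0 ⊗ X0 ⊕ X0) refl

FG : F · G ≋ (F ⊹ G) ^ₛ 4
FG = *-cong F-r G-r ⟫ ring (r ∷ []) (ExF X0 ⊗ ExG X0) ((ExF X0 ⊕ ExG X0) ↑ 4) refl ⟫ ^-cong 4 (≋-sym (+-cong F-r G-r))

-- F + G and Θ + Θ(x³) both equal r² + r, and F is Θ.
V3F : V 3 F ≋ G
V3F = V-cong 3 F≋Θ ⟫ +-cong0 ( +-cong (ring (Θ ∷ V 3 Θ ∷ []) X1 (X0 ⊕ (X0 ⊕ X1)) refl ⟫ +-cong (≋-sym F≋Θ) (≋-sym r²+r)) ≋-refl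
   ⟫ +-cong (+-cong ≋-refl (≋-sym F+G)) ≋-refl ⟫ ring (F ∷ G ∷ []) ((X0 ⊕ (X0 ⊕ X1)) ⊕ X1) ze refl)

module _ (d : ℕ) .{{nz : NonZero d}} where
  V-ex : ∀ e fs → V d (⟦ e ⟧ (env fs)) ≋ ⟦ e ⟧ (env (map (V d) fs))
  V-ex (var i) fs = go fs i
    where go : ∀ fs i → V d (env fs i) ≋ env (map (V d) fs) i
          go [] i = V-𝟘 d
          go (f ∷ fs) zero = ≋-refl
          go (f ∷ fs) (suc i) = go fs i
  V-ex (a ⊕ b) fs = V-+ d _ _ ⟫ +-cong (V-ex a fs) (V-ex b fs)
  V-ex (a ⊗ b) fs = V-* d _ _ ⟫ *-cong (V-ex a fs) (V-ex b fs)
  V-ex ze fs = V-𝟘 d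
  V-ex on fs = V-𝟙 d

ex-cong : ∀ e {ρ ρ'} → (∀ i → ρ i ≋ ρ' i) → ⟦ e ⟧ ρ ≋ ⟦ e ⟧ ρ'
ex-cong (var i) h = h i
ex-cong (a ⊕ b) h = +-cong (ex-cong a h) (ex-cong b h)
ex-cong (a ⊗ b) h = *-cong (ex-cong a h) (ex-cong b h)
ex-cong ze h = ≋-refl
ex-cong on h = ≋-refl

env2 : ∀ {a a' b b'} → a ≋ a' → b ≋ b' → ∀ i → env (a ∷ b ∷ []) i ≋ env (a' ∷ b' ∷ []) i
env2 p q zero = p
env2 p q (suc zero) = q
env2 p q (suc (suc i)) = ≋-refl

-- V₃ F = G, written as an equation in r, determines r among the series x^p + ⋯.
r-unique : ∀ p {s t} → Lead p s → Lead p t → V 3 (pF s) ≋ pG s → V 3 (pF t) ≋ pG t → s ≋ t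
r-unique p {s} {t} (ls , as) (lt , at') es et = +-cong0 (mk (λ n → trans (go (suc n) n ≤-refl) (sym (𝟘-at n))))
  where
  D E X : Series
  D = s ⊹ t
  E = s · s ⊹ s · t ⊹ t · t
  X = D ⊹ D · D ⊹ D · E ⊹ D ^ₛ 4
  eq : D ^ₛ 4 ⊹ D · E ≋ V 3 X
  eq = ring (s ∷ t ∷ []) ((X0 ⊕ X1) ↑ 4 ⊕ (X0 ⊕ X1) ⊗ (X0 ⊗ X0 ⊕ X0 ⊗ X1 ⊕ X1 ⊗ X1)) (ExG X0 ⊕ ExG X1) refl
    ⟫ +-cong (≋-sym es) (≋-sym et) ⟫ ≋-sym (V-+ 3 _ _)
    ⟫ V-cong 3 (ring (s ∷ t ∷ []) (ExF X0 ⊕ ExF X1) ((X0 ⊕ X1) ⊕ (X0 ⊕ X1) ⊗ (X0 ⊕ X1) ⊕ (X0 ⊕ X1) ⊗ (X0 ⊗ X0 ⊕ X0 ⊗ X1 ⊕ X1 ⊗ X1) ⊕ (X0 ⊕ X1) ↑ 4) refl)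
  LE : Lead (p + p) E
  LE = Lead-Q³ (ls , as) (lt , at')
  go : ∀ B n → n < B → D n ≡ false
  go (suc B) n l with <-cmp n p
  ... | tri< a _ _ = trans (+-at s t n) (cong₂ _xor_ (ls n a) (lt n a))
  ... | tri≈ _ refl _ = trans (+-at s t n) (cong₂ _xor_ as at')
  -- Let D vanish below n > p. In degree n + 2p the left side of `eq` is `D n`, as E has order 2p
  -- and D⁴ vanishes below 4n; the right side vanishes below 3n. Both 3n and 4n exceed n + 2p.
  ... | tri> _ _ c = begin
      D n ≡⟨ sym (∧-identityʳ _) ⟩
      D n ∧ true ≡⟨ cong (D n ∧_) (sym (proj₂ LE)) ⟩
      D n ∧ E (p + p) ≡⟨ sym (*-low-at n (p + p) lowD (proj₁ LE)) ⟩
      (D · E) (n + (p + p)) ≡⟨ sym (trans (+-at _ _ _) (cong (_xor (D · E) (n + (p + p))) (low4 (n + (p + p)) b4))) ⟩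
      (D ^ₛ 4 ⊹ D · E) (n + (p + p)) ≡⟨ at eq (n + (p + p)) ⟩
      V 3 X (n + (p + p)) ≡⟨ Low-V 3 {n} {X} (Low-+ (Low-+ (Low-+ lowD (Low-*ˡ D lowD)) (Low-*ˡ E lowD)) (Low-*ˡ _ lowD)) (n + (p + p)) b3 ⟩
      false ∎
    where
    open ≡-Reasoning
    lowD : Low n D
    lowD i li = go B i (<-≤-trans li (≤-pred l))
    low4 : Low (n + (n + (n + n))) (D ^ₛ 4)
    low4 = Low-≋ (ring (D ∷ []) (X0 ⊗ (X0 ⊗ (X0 ⊗ X0))) (X0 ↑ 4) refl) (Low-* lowD (Low-* lowD (Low-* lowD lowD)))
    b2 : p + p < n + n
    b2 = +-mono-< c c
    b3 : n + (p + p) < 3 * n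
    b3 = subst (n + (p + p) <_) (cong (n +_) (cong (n +_) (sym (+-identityʳ n)))) (+-monoʳ-< n b2)
    b4 : n + (p + p) < n + (n + (n + n))
    b4 = +-monoʳ-< n (<-≤-trans b2 (+-monoʳ-≤ n (m≤m+n n n)))

-- With s = r^p σ the relation `relE` becomes σ = 1 + r W(σ, r), a contraction, whose fixed point
-- gives a root s. By `idF` and `idG` both V₃ (`pF s`) and `pG s` are roots of Φ(Y, G) of order at
-- least 4, and `uniq` identifies them. So s satisfies the equation that characterises r(x^p), by
-- `r-unique`.
module ModEq (p : ℕ) .{{nz : NonZero p}} (W relE Φ : Ex)
  (lift : ∀ σ → (r ^ₛ p · σ) ^ₛ suc p ⊹ ⟦ relE ⟧ (env (r ^ₛ p · σ ∷ r ∷ [])) ≋ r ^ₛ suc p · (σ ⊹ (𝟙 ⊹ r · ⟦ W ⟧ (env (σ ∷ r ∷ [])))))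
  (idF : ∀ s → s ^ₛ suc p ≋ ⟦ relE ⟧ (env (s ∷ r ∷ [])) → ⟦ Φ ⟧ (env (pF s ∷ pF r ∷ [])) ≋ 𝟘)
  (idG : ∀ s → s ^ₛ suc p ≋ ⟦ relE ⟧ (env (s ∷ r ∷ [])) → ⟦ Φ ⟧ (env (pG s ∷ pG r ∷ [])) ≋ 𝟘)
  (uniq : ∀ A B → Low 4 A → Low 4 B → ⟦ Φ ⟧ (env (A ∷ G ∷ [])) ≋ 𝟘 → ⟦ Φ ⟧ (env (B ∷ G ∷ [])) ≋ 𝟘 → A ≋ B)
  (p≥4 : 4 ≤ p) where

  Ψ : Series → Series
  Ψ f = 𝟙 ⊹ r · ⟦ W ⟧ (env (f ∷ r ∷ []))

  contr : ∀ {n f g} → Agree n f g → Agree (suc n) (Ψ f) (Ψ g)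
  contr {n} {f} {g} h = Agree-+ {suc n} {𝟙} (λ _ _ → refl) (Agree-shift {n} {r} refl (Agree-ex W e))
    where e : ∀ i → Agree n (env (f ∷ r ∷ []) i) (env (g ∷ r ∷ []) i)
          e zero = h
          e (suc i) = λ _ _ → refl

  open Fix Ψ contr

  s : Series
  s = r ^ₛ p · fix

  s-rel : s ^ₛ suc p ≋ ⟦ relE ⟧ (env (s ∷ r ∷ []))
  s-rel = +-cong0 (lift fix ⟫ *-cong ≋-refl (+-cong0' fix-eq) ⟫ *-zeroʳ' _)

  Lead-s : Lead p s
  Lead-s = subst (λ k → Lead k s) (trans (+-identityʳ (p * 1)) (*-identityʳ p))
    (Lead-* (Lead-^ p Lead-r) (Lead-≋ (≋-sym fix-eq) (Lead-+ Lead-𝟙 (Low-*ˡ _ (λ { zero _ → refl ; (suc _) (s≤s ()) })))))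

  V3Fs : V 3 (pF s) ≋ pG s
  V3Fs = uniq _ _ (Low-≤ (≤-trans p≥4 (m≤n*m p 3)) (Low-V 3 {p} (Low-*ˡ _ (proj₁ Lead-s)))) (Low-≤ p≥4 (Low-*ˡ _ (Low-*ˡ _ (proj₁ Lead-s))))
     (ex-cong Φ (env2 ≋-refl (≋-sym (V-cong 3 (≋-sym F-r) ⟫ V3F))) ⟫ ≋-sym (V-ex 3 Φ (pF s ∷ pF r ∷ [])) ⟫ V-cong 3 (idF s s-rel) ⟫ V-𝟘 3)
     (ex-cong Φ (env2 ≋-refl G-r) ⟫ idG s s-rel)

  V-pF : V p F ≋ pF (V p r)
  V-pF = V-cong p F-r ⟫ V-ex p (ExF X0) (r ∷ [])
  V-pG : V p G ≋ pG (V p r)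
  V-pG = V-cong p G-r ⟫ V-ex p (ExG X0) (r ∷ [])

  s≋V : s ≋ V p r
  s≋V = r-unique p Lead-s (subst (λ k → Lead k (V p r)) (*-identityʳ p) (Lead-V p Lead-r)) V3Fs
     (V-cong 3 (≋-sym V-pF) ⟫ V-comm 3 p F ⟫ V-cong p V3F ⟫ V-pG)

  r-mod : V p r ^ₛ suc p ≋ ⟦ relE ⟧ (env (V p r ∷ r ∷ []))
  r-mod = ^-cong (suc p) (≋-sym s≋V) ⟫ s-rel ⟫ ex-cong relE (env2 s≋V ≋-refl)

  F-mod : ⟦ Φ ⟧ (env (V p F ∷ F ∷ [])) ≋ 𝟘
  F-mod = ex-cong Φ (env2 V-pF F-r) ⟫ idF (V p r) r-mod

  G-mod : ⟦ Φ ⟧ (env (V p G ∷ G ∷ [])) ≋ 𝟘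
  G-mod = ex-cong Φ (env2 (V-cong p (≋-sym V3F) ⟫ V-comm p 3 F) (≋-sym V3F)) ⟫ ≋-sym (V-ex 3 Φ (V p F ∷ F ∷ [])) ⟫ V-cong 3 F-mod ⟫ V-𝟘 3

-- Modular equations of degrees 5 and 7

-- Here `X0` stands for the series in x^p and `X1` for the one in x. `rel5` and `rel7` give the
-- powers s⁶ and s⁸; `W5` and `W7` collect what is left beside 1 + σ after substituting s = r^p σ
-- and dividing by r^(p + 1). `Φ5` and `Φ7` hold for F and for G alike.
rel5 rel7 W5 W7 Φ5 Φ7 : Ex
rel5 = X1 ↑ 6 ⊕ (X1 ⊗ X0 ⊕ X1 ⊗ X0 ↑ 2 ⊕ X1 ↑ 2 ⊗ X0 ⊕ X1 ↑ 2 ⊗ X0 ↑ 2 ⊕ X1 ↑ 2 ⊗ X0 ↑ 4 ⊕ X1 ↑ 4 ⊗ X0 ↑ 2)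
rel7 = X1 ↑ 8 ⊕ ((X1 ⊕ X1 ↑ 2) ⊗ (X0 ⊕ X0 ↑ 2 ⊕ X0 ↑ 3 ⊕ X0 ↑ 4) ⊕ (X1 ↑ 3 ⊕ X1 ↑ 4) ⊗ (X0 ⊕ X0 ↑ 2))
W5 = X0 ⊕ X1 ↑ 4 ⊗ X0 ↑ 2 ⊕ X1 ↑ 5 ⊗ X0 ↑ 2 ⊕ X1 ↑ 7 ⊗ X0 ↑ 2 ⊕ X1 ↑ 15 ⊗ X0 ↑ 4 ⊕ X1 ↑ 23 ⊗ X0 ↑ 6
W7 = X0 ⊕ X1 ⊗ X0 ⊕ X1 ↑ 2 ⊗ X0 ⊕ X1 ↑ 6 ⊗ X0 ↑ 2 ⊕ X1 ↑ 7 ⊗ X0 ↑ 2 ⊕ X1 ↑ 8 ⊗ X0 ↑ 2 ⊕ X1 ↑ 9 ⊗ X0 ↑ 2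
  ⊕ X1 ↑ 13 ⊗ X0 ↑ 3 ⊕ X1 ↑ 14 ⊗ X0 ↑ 3 ⊕ X1 ↑ 20 ⊗ X0 ↑ 4 ⊕ X1 ↑ 21 ⊗ X0 ↑ 4 ⊕ X1 ↑ 47 ⊗ X0 ↑ 8
Φ5 = (X0 ⊕ X1) ↑ 6 ⊕ X0 ⊗ X1
Φ7 = (X0 ⊕ X1) ↑ 8 ⊕ (X0 ⊗ X1 ⊕ (X0 ⊗ X1) ↑ 2)

subst-ex : Ex → Ex → Ex → Ex
subst-ex (var zero) a b = a
subst-ex (var (suc zero)) a b = b
subst-ex (var (suc (suc i))) a b = ze
subst-ex (x ⊕ y) a b = subst-ex x a b ⊕ subst-ex y a b
subst-ex (x ⊗ y) a b = subst-ex x a b ⊗ subst-ex y a b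
subst-ex ze a b = ze
subst-ex on a b = on

-- The difference of the equations is (A + B) times a cofactor that begins like G, in degree 3,
-- because A and B have order at least 4.
uniq5 : ∀ A B → Low 4 A → Low 4 B → ⟦ Φ5 ⟧ (env (A ∷ G ∷ [])) ≋ 𝟘 → ⟦ Φ5 ⟧ (env (B ∷ G ∷ [])) ≋ 𝟘 → A ≋ B
uniq5 A B la lb ea eb = +-cong0 (·-domain' {3} (Lead-+ Lead-G (Low-*ˡ _ (Low-+ la lb)))
  (ring (A ∷ B ∷ G ∷ []) ((X0 ⊕ X1) ⊗ (X2 ⊕ (X0 ⊕ X1) ⊗ ((X0 ⊕ X2) ↑ 4 ⊕ (X0 ⊕ X2) ↑ 2 ⊗ (X1 ⊕ X2) ↑ 2 ⊕ (X1 ⊕ X2) ↑ 4)))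
     (((X0 ⊕ X2) ↑ 6 ⊕ X0 ⊗ X2) ⊕ ((X1 ⊕ X2) ↑ 6 ⊕ X1 ⊗ X2)) refl ⟫ +-cong ea eb ⟫ +-idˡ 𝟘))

uniq7 : ∀ A B → Low 4 A → Low 4 B → ⟦ Φ7 ⟧ (env (A ∷ G ∷ [])) ≋ 𝟘 → ⟦ Φ7 ⟧ (env (B ∷ G ∷ [])) ≋ 𝟘 → A ≋ B
uniq7 A B la lb ea eb = +-cong0 (·-domain' {3} (Lead-+ Lead-G (Low-*ˡ _ (Low-+ la lb)))
  (ring (A ∷ B ∷ G ∷ []) ((X0 ⊕ X1) ⊗ (X2 ⊕ (X0 ⊕ X1) ⊗ (X2 ⊗ X2 ⊕ (X0 ⊕ X1) ↑ 6)))
     (((X0 ⊕ X2) ↑ 8 ⊕ (X0 ⊗ X2 ⊕ (X0 ⊗ X2) ↑ 2)) ⊕ ((X1 ⊕ X2) ↑ 8 ⊕ (X1 ⊗ X2 ⊕ (X1 ⊗ X2) ↑ 2))) refl ⟫ +-cong ea eb ⟫ +-idˡ 𝟘))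

module E5 = ModEq 5 W5 rel5 Φ5
  (λ σ → ring (σ ∷ r ∷ []) ((X1 ↑ 5 ⊗ X0) ↑ 6 ⊕ subst-ex rel5 (X1 ↑ 5 ⊗ X0) X1) (X1 ↑ 6 ⊗ (X0 ⊕ (on ⊕ X1 ⊗ W5))) refl)
  (λ s h → Mod.ringmod 6 rel5 s (r ∷ []) h (subst-ex Φ5 (ExF X0) (ExF X1)) ze refl)
  (λ s h → Mod.ringmod 6 rel5 s (r ∷ []) h (subst-ex Φ5 (ExG X0) (ExG X1)) ze refl)
  uniq5 (s≤s (s≤s (s≤s (s≤s z≤n))))

module E7 = ModEq 7 W7 rel7 Φ7
  (λ σ → ring (σ ∷ r ∷ []) ((X1 ↑ 7 ⊗ X0) ↑ 8 ⊕ subst-ex rel7 (X1 ↑ 7 ⊗ X0) X1) (X1 ↑ 8 ⊗ (X0 ⊕ (on ⊕ X1 ⊗ W7))) refl)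
  (λ s h → Mod.ringmod 8 rel7 s (r ∷ []) h (subst-ex Φ7 (ExF X0) (ExF X1)) ze refl)
  (λ s h → Mod.ringmod 8 rel7 s (r ∷ []) h (subst-ex Φ7 (ExG X0) (ExG X1)) ze refl)
  uniq7 (s≤s (s≤s (s≤s (s≤s z≤n))))

-- The cube root z of G and its modular equations

β z : Series
β = V 3 G
z = F ⊹ β

Lead-β : Lead 9 β
Lead-β = Lead-V 3 Lead-G
Lead-z : Lead 1 z
Lead-z = Lead-+ Lead-F (Low-≤ (s≤s (s≤s z≤n)) (proj₁ Lead-β))

-- Multiplied by z, the claim is the sum of FG = (F + G)⁴ and its image under `V 3`, which sends F
-- to G and G to β.
z³ : z ^ₛ 3 ≋ G
z³ = +-cong0 (·-domain' {1} Lead-z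
  (ring (F ∷ G ∷ β ∷ []) (((X0 ⊕ X2) ↑ 3 ⊕ X1) ⊗ (X0 ⊕ X2)) ((X0 ⊗ X1 ⊕ (X0 ⊕ X1) ↑ 4) ⊕ (X1 ⊗ X2 ⊕ (X1 ⊕ X2) ↑ 4)) refl
   ⟫ +-cong (+-cong0' FG) (+-cong0' (*-cong (≋-sym V3F) ≋-refl ⟫ ≋-sym (V-* 3 F G) ⟫ V-cong 3 FG ⟫ V-ex 3 ((X0 ⊕ X1) ↑ 4) (F ∷ G ∷ []) ⟫ ^-cong 4 (+-cong V3F ≋-refl)))
   ⟫ +-idˡ 𝟘))

module _ (p : ℕ) .{{nz : NonZero p}} where
  Vz³ : V p z ^ₛ 3 ≋ V p G
  Vz³ = ≋-sym (V-ex p (X0 ↑ 3) (z ∷ [])) ⟫ V-cong p z³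
  Lead-Vz : Lead p (V p z)
  Lead-Vz = subst (λ k → Lead k (V p z)) (*-identityʳ p) (Lead-V p Lead-z)

≤from : ∀ m n → (m ≤ᵇ n) ≡ true → m ≤ n
≤from m n e = ≤ᵇ⇒≤ m n (Equivalence.from T-≡ e)

-- With G = z³ the equation `Φ5` of G reads X³ + Y³ = 0 for X = z⁶ + z(x⁵)⁶ and Y = z z(x⁵). Both
-- have order 6, so the cofactor of X + Y does not vanish and can be cancelled.
z5 : V 5 z ^ₛ 6 ⊹ (z · V 5 z ⊹ z ^ₛ 6) ≋ 𝟘
z5 = ·-domain' {12} {_} {Xx · Xx ⊹ Xx · Yy ⊹ Yy · Yy} (Lead-Q³ lX lY)
  (ring (z ∷ B ∷ []) ((X1 ↑ 6 ⊕ (X0 ⊗ X1 ⊕ X0 ↑ 6)) ⊗ ((X0 ↑ 6 ⊕ X1 ↑ 6) ⊗ (X0 ↑ 6 ⊕ X1 ↑ 6) ⊕ (X0 ↑ 6 ⊕ X1 ↑ 6) ⊗ (X0 ⊗ X1) ⊕ (X0 ⊗ X1) ⊗ (X0 ⊗ X1)))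
      ((X1 ↑ 3 ⊕ X0 ↑ 3) ↑ 6 ⊕ X1 ↑ 3 ⊗ X0 ↑ 3) refl
   ⟫ ex-cong Φ5 (env2 (Vz³ 5) z³) ⟫ E5.G-mod)
  where
  B Xx Yy : Series
  B = V 5 z
  Xx = z ^ₛ 6 ⊹ B ^ₛ 6
  Yy = z · B
  lX : Lead 6 Xx
  lX = Lead-+ (Lead-^ 6 Lead-z) (Low-≤ (≤from 7 30 refl) (proj₁ (Lead-^ 6 (Lead-Vz 5))))
  lY : Lead 6 Yy
  lY = Lead-* Lead-z (Lead-Vz 5)

-- As in degree 5, with Y + Y⁴ in place of Y. The cofactor acquires the extra term Y⁸, of order 64,
-- far beyond its leading term in degree 16.
z7 : V 7 z ^ₛ 8 ⊹ (z · V 7 z ⊹ z ^ₛ 4 · V 7 z ^ₛ 4 ⊹ z ^ₛ 8) ≋ 𝟘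
z7 = ·-domain' {16} {_} {(Xx · Xx ⊹ Xx · Y₀ ⊹ Y₀ · Y₀) ⊹ Yy ^ₛ 8} (Lead-+ (Lead-Q³ lX lY) (Low-≤ (≤from 17 64 refl) (proj₁ (Lead-^ 8 lY'))))
  (ring (z ∷ B ∷ []) ((X1 ↑ 8 ⊕ (X0 ⊗ X1 ⊕ X0 ↑ 4 ⊗ X1 ↑ 4 ⊕ X0 ↑ 8)) ⊗
        (((X0 ↑ 8 ⊕ X1 ↑ 8) ⊗ (X0 ↑ 8 ⊕ X1 ↑ 8) ⊕ (X0 ↑ 8 ⊕ X1 ↑ 8) ⊗ (X0 ⊗ X1 ⊕ (X0 ⊗ X1) ↑ 4) ⊕ (X0 ⊗ X1 ⊕ (X0 ⊗ X1) ↑ 4) ⊗ (X0 ⊗ X1 ⊕ (X0 ⊗ X1) ↑ 4)) ⊕ (X0 ⊗ X1) ↑ 8))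
      ((X1 ↑ 3 ⊕ X0 ↑ 3) ↑ 8 ⊕ (X1 ↑ 3 ⊗ X0 ↑ 3 ⊕ (X1 ↑ 3 ⊗ X0 ↑ 3) ↑ 2)) refl
   ⟫ ex-cong Φ7 (env2 (Vz³ 7) z³) ⟫ E7.G-mod)
  where
  B Xx Yy Y₀ : Series
  B = V 7 z
  Xx = z ^ₛ 8 ⊹ B ^ₛ 8
  Yy = z · B
  Y₀ = Yy ⊹ Yy ^ₛ 4
  lX : Lead 8 Xx
  lX = Lead-+ (Lead-^ 8 Lead-z) (Low-≤ (≤from 9 56 refl) (proj₁ (Lead-^ 8 (Lead-Vz 7))))
  lY' : Lead 8 Yy
  lY' = Lead-* Lead-z (Lead-Vz 7)
  lY : Lead 8 Y₀
  lY = Lead-+ lY' (Low-≤ (≤from 9 32 refl) (proj₁ (Lead-^ 4 lY')))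

-- Linear recurrences for T₅ and T₇

sumL : List (ℕ × ℕ) → (ℕ → ℕ → Series) → Series
sumL [] f = 𝟘
sumL ((i , j) ∷ R) f = f i j ⊹ sumL R f

sumL-cong : ∀ R {f g} → (∀ i j → f i j ≋ g i j) → sumL R f ≋ sumL R g
sumL-cong [] h = ≋-refl
sumL-cong ((i , j) ∷ R) h = +-cong (h i j) (sumL-cong R h)

sumL-+ : ∀ R f g → sumL R (λ i j → f i j ⊹ g i j) ≋ sumL R f ⊹ sumL R g
sumL-+ [] f g = ≋-sym (+-idˡ 𝟘)
sumL-+ ((i , j) ∷ R) f g = +-cong ≋-refl (sumL-+ R f g) ⟫ +-swap' _ _ _ _

sumL-* : ∀ R f h → sumL R (λ i j → f i j · h) ≋ sumL R f · h
sumL-* [] f h = ≋-sym (*-zeroˡ' h)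
sumL-* ((i , j) ∷ R) f h = +-cong ≋-refl (sumL-* R f h) ⟫ ≋-sym (*-distʳ _ _ _)

sumL-U : ∀ d .{{_ : NonZero d}} R f → sumL R (λ i j → U d (f i j)) ≋ U d (sumL R f)
sumL-U d [] f = ≋-sym (U-𝟘 d)
sumL-U d ((i , j) ∷ R) f = +-cong ≋-refl (sumL-U d R f) ⟫ ≋-sym (U-+ d _ _)

-- A relation between A and A(x^p), valid with its two arguments exchanged, makes n ↦ T_p(A^n h) a linear recurrence.
T-rec : ∀ p .{{_ : NonZero p}} A R →
  sumL R (λ i j → A ^ₛ i · V p A ^ₛ j) ≋ 𝟘 → sumL R (λ i j → A ^ₛ j · V p A ^ₛ i) ≋ 𝟘 →
  ∀ h → sumL R (λ i j → A ^ₛ j · Tₛ p (A ^ₛ i · h)) ≋ 𝟘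
T-rec p A R e1 e2 h =
  sumL-cong R (λ i j → *-cong ≋-refl (T-UV p _) ⟫ *-distˡ _ _ _) ⟫ sumL-+ R _ _
  ⟫ +-cong
    (sumL-cong R (λ i j → ≋-sym (U-V· p (A ^ₛ j) (A ^ₛ i · h)) ⟫ U-cong p (*-cong (V-^ p A j) ≋-refl ⟫ ring (V p A ^ₛ j ∷ A ^ₛ i ∷ h ∷ []) (X0 ⊗ (X1 ⊗ X2)) (X1 ⊗ X0 ⊗ X2) refl))
     ⟫ sumL-U p R _ ⟫ U-cong p (sumL-* R _ h ⟫ *-cong e1 ≋-refl ⟫ *-zeroˡ' h) ⟫ U-𝟘 p)
    (sumL-cong R (λ i j → *-cong ≋-refl (V-* p _ _ ⟫ *-cong (V-^ p A i) ≋-refl) ⟫ ≋-sym (*-assoc' _ _ _))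
     ⟫ sumL-* R _ (V p h) ⟫ *-cong e2 ≋-refl ⟫ *-zeroˡ' _)
  ⟫ +-idˡ 𝟘

-- Exponent pairs of the modular equations. Each list is symmetric, as `T-rec` requires, and its
-- head (p + 1, 0) makes the recurrence monic.
Rz5 Rz7 Rw5 Rw7 Rr5 Rr7 : List (ℕ × ℕ)
Rz5 = (6 , 0) ∷ (1 , 1) ∷ (0 , 6) ∷ []
Rz7 = (8 , 0) ∷ (1 , 1) ∷ (4 , 4) ∷ (0 , 8) ∷ []
Rw5 = (6 , 0) ∷ (4 , 2) ∷ (2 , 4) ∷ (1 , 1) ∷ (0 , 6) ∷ []
Rw7 = (8 , 0) ∷ (2 , 2) ∷ (1 , 1) ∷ (0 , 8) ∷ []
Rr5 = (6 , 0) ∷ (0 , 6) ∷ (1 , 1) ∷ (1 , 2) ∷ (2 , 1) ∷ (2 , 2) ∷ (2 , 4) ∷ (4 , 2) ∷ []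
Rr7 = (8 , 0) ∷ (0 , 8) ∷ (1 , 1) ∷ (1 , 2) ∷ (1 , 3) ∷ (1 , 4) ∷ (2 , 1) ∷ (2 , 2) ∷ (2 , 3) ∷ (2 , 4) ∷ (3 , 1) ∷ (3 , 2) ∷ (4 , 1) ∷ (4 , 2) ∷ []

ExL : List (ℕ × ℕ) → Ex → Ex → Ex
ExL [] a b = ze
ExL ((i , j) ∷ R) a b = a ↑ i ⊗ b ↑ j ⊕ ExL R a b

ex-^ : ∀ a n ρ → ⟦ a ↑ n ⟧ ρ ≋ ⟦ a ⟧ ρ ^ₛ n
ex-^ a zero ρ = ≋-refl
ex-^ a (suc n) ρ = *-cong ≋-refl (ex-^ a n ρ)

ExL-≋ : ∀ R a b ρ → ⟦ ExL R a b ⟧ ρ ≋ sumL R (λ i j → ⟦ a ⟧ ρ ^ₛ i · ⟦ b ⟧ ρ ^ₛ j)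
ExL-≋ [] a b ρ = ≋-refl
ExL-≋ ((i , j) ∷ R) a b ρ = +-cong (*-cong (ex-^ a i ρ) (ex-^ b j ρ)) (ExL-≋ R a b ρ)

ExL-≋' : ∀ R a b ρ → ⟦ ExL R a b ⟧ ρ ≋ sumL R (λ i j → ⟦ b ⟧ ρ ^ₛ j · ⟦ a ⟧ ρ ^ₛ i)
ExL-≋' R a b ρ = ExL-≋ R a b ρ ⟫ sumL-cong R (λ i j → *-comm' _ _)

w : Series
w = G · G

Φ-w : ∀ p .{{_ : NonZero p}} → V p w ≋ V p G · V p G
Φ-w p = V-* p G G

module Rec (p : ℕ) .{{nz : NonZero p}} (A : Series) (R : List (ℕ × ℕ)) (P : Ex)
  (hyp : ⟦ P ⟧ (env (V p A ∷ A ∷ [])) ≋ 𝟘)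
  (s1 : ⟦ ExL R X1 X0 ⟧ (env (V p A ∷ A ∷ [])) ≋ ⟦ P ⟧ (env (V p A ∷ A ∷ [])))
  (s2 : ⟦ ExL R X0 X1 ⟧ (env (V p A ∷ A ∷ [])) ≋ ⟦ P ⟧ (env (V p A ∷ A ∷ []))) where
  rec : ∀ h → sumL R (λ i j → A ^ₛ j · Tₛ p (A ^ₛ i · h)) ≋ 𝟘
  rec = T-rec p A R (≋-sym (ExL-≋ R X1 X0 (env (V p A ∷ A ∷ []))) ⟫ s1 ⟫ hyp) (≋-sym (ExL-≋' R X0 X1 (env (V p A ∷ A ∷ []))) ⟫ s2 ⟫ hyp)

Pz5 Pz7 : Ex
Pz5 = X0 ↑ 6 ⊕ (X1 ⊗ X0 ⊕ X1 ↑ 6)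
Pz7 = X0 ↑ 8 ⊕ (X1 ⊗ X0 ⊕ X1 ↑ 4 ⊗ X0 ↑ 4 ⊕ X1 ↑ 8)

-- The coefficients lie in F₂, so the square of the equation for G is the same equation for G².
w-mod5 : ⟦ Φ5 ⟧ (env (V 5 w ∷ w ∷ [])) ≋ 𝟘
w-mod5 = ex-cong Φ5 (env2 (Φ-w 5) ≋-refl)
  ⟫ ring (V 5 G ∷ G ∷ []) (subst-ex Φ5 (X0 ⊗ X0) (X1 ⊗ X1)) (Φ5 ⊗ Φ5) refl ⟫ *-cong E5.G-mod ≋-refl ⟫ *-zeroˡ' _

w-mod7 : ⟦ Φ7 ⟧ (env (V 7 w ∷ w ∷ [])) ≋ 𝟘
w-mod7 = ex-cong Φ7 (env2 (Φ-w 7) ≋-refl)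
  ⟫ ring (V 7 G ∷ G ∷ []) (subst-ex Φ7 (X0 ⊗ X0) (X1 ⊗ X1)) (Φ7 ⊗ Φ7) refl ⟫ *-cong E7.G-mod ≋-refl ⟫ *-zeroˡ' _

module Z5 = Rec 5 z Rz5 Pz5 z5 (ring (V 5 z ∷ z ∷ []) (ExL Rz5 X1 X0) Pz5 refl) (ring (V 5 z ∷ z ∷ []) (ExL Rz5 X0 X1) Pz5 refl)
module Z7 = Rec 7 z Rz7 Pz7 z7 (ring (V 7 z ∷ z ∷ []) (ExL Rz7 X1 X0) Pz7 refl) (ring (V 7 z ∷ z ∷ []) (ExL Rz7 X0 X1) Pz7 refl)
module Wr5 = Rec 5 w Rw5 Φ5 w-mod5 (ring (V 5 w ∷ w ∷ []) (ExL Rw5 X1 X0) Φ5 refl) (ring (V 5 w ∷ w ∷ []) (ExL Rw5 X0 X1) Φ5 refl)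
module Wr7 = Rec 7 w Rw7 Φ7 w-mod7 (ring (V 7 w ∷ w ∷ []) (ExL Rw7 X1 X0) Φ7 refl) (ring (V 7 w ∷ w ∷ []) (ExL Rw7 X0 X1) Φ7 refl)
module R5 = Rec 5 r Rr5 (X0 ↑ 6 ⊕ rel5) (+-cong0' E5.r-mod) (ring (V 5 r ∷ r ∷ []) (ExL Rr5 X1 X0) (X0 ↑ 6 ⊕ rel5) refl) (ring (V 5 r ∷ r ∷ []) (ExL Rr5 X0 X1) (X0 ↑ 6 ⊕ rel5) refl)
module R7 = Rec 7 r Rr7 (X0 ↑ 8 ⊕ rel7) (+-cong0' E7.r-mod) (ring (V 7 r ∷ r ∷ []) (ExL Rr7 X1 X0) (X0 ↑ 8 ⊕ rel7) refl) (ring (V 7 r ∷ r ∷ []) (ExL Rr7 X0 X1) (X0 ↑ 8 ⊕ rel7) refl)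

-- Series killed by T_p, and initial values of the recurrences

module _ {p : ℕ} (pp : Prime p) where
  private instance
    nzp : NonZero p
    nzp = prime⇒nonZero pp
  -- p m is a square exactly when m is p times a square. Hence U_p and V_p agree on Q, and T_p kills
  -- Q and all that is built from it by sums, squares and V₃.
  U-Q : ∀ m → Q (p * m) ≡ V p Q m
  U-Q m = bool-ext to from
    where
    open +-*-Solver
    both : ∀ a → p ∣ a * a → p ∣ a
    both a d with euclidsLemma a a pp d
    ... | inj₁ x = x
    ... | inj₂ x = x
    to : Q (p * m) ≡ true → V p Q m ≡ true
    to t with Q-true (p * m) t
    ... | a , e with both (suc a) (divides m (trans (sym e) (*-comm p m)))
    ...   | divides zero ()
    ...   | divides (suc b) eb = trans (cong (V p Q) (*-cancelˡ-≡ m (p * (suc b * suc b)) p (trans e (trans (cong₂ _*_ eb eb)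
              (solve 2 (λ b p → (b :* p) :* (b :* p) := p :* (p :* (b :* b))) refl (suc b) p))))) (trans (V-mul p Q (suc b * suc b)) (Q-sq b))
    from : V p Q m ≡ true → Q (p * m) ≡ true
    from t with V-true p Q m t
    ... | k , refl , qk with Q-true k qk
    ...   | a , refl = trans (cong Q (trans (solve 2 (λ p a → p :* (p :* (a :* a)) := (p :* a) :* (p :* a)) refl p (suc a)) (pos p))) (Q-sq (pred (p * suc a)))
      where pos : ∀ q .{{_ : NonZero q}} → (q * suc a) * (q * suc a) ≡ suc (pred (q * suc a)) * suc (pred (q * suc a))
            pos (suc q) = refl

module Vanish (p : ℕ) (pp : Prime p) (3<p : 3 < p) where
  private instance
    nzp : NonZero p
    nzp = prime⇒nonZero pp
  p≢2 : p ≢ 2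
  p≢2 e = <⇒≢ (<-trans (n<1+n 2) 3<p) (sym e)
  p≢3 : p ≢ 3
  p≢3 e = <⇒≢ 3<p (sym e)

  T-sq0 : ∀ {f} → Tₛ p f ≋ 𝟘 → Tₛ p (f · f) ≋ 𝟘
  T-sq0 {f} e = T-sq p f pp p≢2 ⟫ *-cong e e ⟫ *-zeroˡ' 𝟘
  T-+0 : ∀ {f g} → Tₛ p f ≋ 𝟘 → Tₛ p g ≋ 𝟘 → Tₛ p (f ⊹ g) ≋ 𝟘
  T-+0 {f} {g} e e' = T-+ p f g ⟫ +-cong e e' ⟫ +-idˡ 𝟘
  T-V3 : ∀ {f} → Tₛ p f ≋ 𝟘 → Tₛ p (V 3 f) ≋ 𝟘
  T-V3 {f} e = ≋-sym (T-V pp prime3 p≢3 f) ⟫ V-cong 3 e ⟫ V-𝟘 3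
  TQ : Tₛ p Q ≋ 𝟘
  TQ = T-UV p Q ⟫ +-cong0' (mk (U-Q pp))
  TV2Q : Tₛ p (V 2 Q) ≋ 𝟘
  TV2Q = T-cong p (≋-sym (sq-V Q)) ⟫ T-sq0 TQ
  Tr : Tₛ p r ≋ 𝟘
  Tr = T-cong p r-Q ⟫ T-+0 (T-+0 TQ TV2Q) (T-+0 (T-V3 TQ) (T-cong p (≋-sym (V-V 3 2 Q)) ⟫ T-V3 TV2Q))
  TF : Tₛ p F ≋ 𝟘
  TF = T-cong p F≋Θ ⟫ T-+0 TQ (T-cong p (≋-sym (V-V 2 2 Q) ⟫ ≋-sym (sq-V _)) ⟫ T-sq0 TV2Q)
  TG : Tₛ p G ≋ 𝟘
  TG = T-cong p (≋-sym V3F) ⟫ T-V3 TF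
  Tz : Tₛ p z ≋ 𝟘
  Tz = T-+0 TF (T-V3 TG)
  T𝟙 : Tₛ p 𝟙 ≋ 𝟘
  T𝟙 = T-UV p 𝟙 ⟫ +-cong0' (mk h ⟫ ≋-sym (V-𝟙 p))
    where h : ∀ n → 𝟙 (p * n) ≡ 𝟙 n
          h zero = cong 𝟙 (*-zeroʳ p)
          h (suc n) = trans (k (p * suc n) (m*n≢0 p (suc n))) (sym (𝟙-suc n))
            where k : ∀ n → NonZero n → 𝟙 n ≡ false
                  k (suc n) _ = 𝟙-suc n

  T^2 : ∀ {f} n → Tₛ p (f ^ₛ n) ≋ 𝟘 → Tₛ p (f ^ₛ (n + n)) ≋ 𝟘
  T^2 {f} n e = T-cong p (^-+ f n n) ⟫ T-sq0 e
  T^1 : ∀ {f} → Tₛ p f ≋ 𝟘 → Tₛ p (f ^ₛ 1) ≋ 𝟘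
  T^1 {f} e = T-cong p (*-idʳ f) ⟫ e
  -- r³ differs from F by r + r² + r⁴, and T_p commutes with squaring.
  Tr3 : Tₛ p (r ^ₛ 3) ≋ 𝟘
  Tr3 = T-cong p (ring (r ∷ []) (X0 ↑ 3) (ExF X0 ⊕ (X0 ↑ 4 ⊕ (X0 ↑ 2 ⊕ X0))) refl)
    ⟫ T-+0 (T-cong p (≋-sym F-r) ⟫ TF) (T-+0 (T^2 2 (T^2 1 (T^1 Tr))) (T-+0 (T^2 1 (T^1 Tr)) Tr))
  Tz3 : Tₛ p (z ^ₛ 3) ≋ 𝟘
  Tz3 = T-cong p z³ ⟫ TG

module V5 = Vanish 5 prime5 (≤from 4 5 refl)
module V7 = Vanish 7 prime7 (≤from 4 7 refl)

T5^ : ∀ f i n → Tₛ 5 (f ^ₛ i · f ^ₛ n) ≋ Tₛ 5 (f ^ₛ (i + n))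
T5^ f i n = T-cong 5 (≋-sym (^-+ f i n))
T7^ : ∀ f i n → Tₛ 7 (f ^ₛ i · f ^ₛ n) ≋ Tₛ 7 (f ^ₛ (i + n))
T7^ f i n = T-cong 7 (≋-sym (^-+ f i n))

Low-T-lead : ∀ p .{{_ : NonZero p}} {f} → 1 < p → Lead p f → Lead 1 (Tₛ p f)
Low-T-lead p {f} 1<p (lo , hi) = (λ { zero _ → trans (at (T-UV p f) 0) (trans (+-at _ _ 0) (cong₂ _xor_ (trans (cong f (*-zeroʳ p)) f0) (trans (cong (V p f) (sym (*-zeroʳ p))) (trans (V-mul p f 0) f0)))) ; (suc _) (s≤s ()) })
  , trans (at (T-UV p f) 1) (trans (+-at _ _ 1) (cong₂ _xor_ (trans (cong f (*-identityʳ p)) hi) (V-non p f 1 (λ m e → <⇒≢ 1<p (sym (∣1⇒≡1 (divides m (trans e (*-comm p m)))))))))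
  where f0 : f 0 ≡ false
        f0 = lo 0 (<-trans (s≤s z≤n) 1<p)

-- Initial values arise as roots of a quadratic: T_p(f²) = T_p(f)², while the recurrence gives
-- T_p(f²) = c T_p(f). A nonzero T_p(f) must then be c.
root : ∀ {t c} → Lead 1 t → t · t ≋ c · t → t ≋ c
root {t} {c} l e = +-cong0 (·-domain' {1} l (*-distʳ t c t ⟫ +-cong0' e))

T5r5 : Tₛ 5 (r ^ₛ 5) ≋ r ⊹ r · r
T5r5 = root (Low-T-lead 5 (≤from 2 5 refl) (Lead-^ 5 Lead-r))
  (≋-sym (T-sq 5 (r ^ₛ 5) prime5 V5.p≢2) ⟫ T5^ r 5 5 ⟫ +-cong0
   (ring (Tₛ 5 (r ^ₛ 10) ∷ Tₛ 5 (r ^ₛ 5) ∷ r ∷ []) (X0 ⊕ (X2 ⊕ X2 ⊗ X2) ⊗ X1)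
      (on ⊗ X0 ⊕ (X2 ↑ 6 ⊗ ze ⊕ (X2 ↑ 1 ⊗ X1 ⊕ (X2 ↑ 2 ⊗ X1 ⊕ (X2 ↑ 1 ⊗ ze ⊕ (X2 ↑ 2 ⊗ ze ⊕ (X2 ↑ 4 ⊗ ze ⊕ (X2 ↑ 2 ⊗ ze ⊕ ze)))))))) refl
   ⟫ ≋-sym (+-cong (*-cong ≋-refl (T5^ r 6 4)) (+-cong (*-cong ≋-refl (T5^ r 0 4 ⟫ r4)) (+-cong (*-cong ≋-refl (T5^ r 1 4)) (+-cong (*-cong ≋-refl (T5^ r 1 4))
        (+-cong (*-cong ≋-refl (T5^ r 2 4 ⟫ r6)) (+-cong (*-cong ≋-refl (T5^ r 2 4 ⟫ r6)) (+-cong (*-cong ≋-refl (T5^ r 2 4 ⟫ r6)) (+-cong (*-cong ≋-refl (T5^ r 4 4 ⟫ r8)) ≋-refl))))))))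
   ⟫ R5.rec (r ^ₛ 4)))
  where
  open V5
  r4 = T^2 2 (T^2 1 (T^1 Tr))
  r6 = T^2 3 Tr3
  r8 = T^2 4 r4

T5z5 : Tₛ 5 (z ^ₛ 5) ≋ z
T5z5 = root (Low-T-lead 5 (≤from 2 5 refl) (Lead-^ 5 Lead-z))
  (≋-sym (T-sq 5 (z ^ₛ 5) prime5 V5.p≢2) ⟫ T5^ z 5 5 ⟫ +-cong0
   (ring (Tₛ 5 (z ^ₛ 10) ∷ Tₛ 5 (z ^ₛ 5) ∷ z ∷ []) (X0 ⊕ X2 ⊗ X1) (on ⊗ X0 ⊕ (X2 ↑ 1 ⊗ X1 ⊕ (X2 ↑ 6 ⊗ ze ⊕ ze))) refl
   ⟫ ≋-sym (+-cong (*-cong ≋-refl (T5^ z 6 4)) (+-cong (*-cong ≋-refl (T5^ z 1 4)) (+-cong (*-cong ≋-refl (T5^ z 0 4 ⟫ T^2 2 (T^2 1 (T^1 Tz)))) ≋-refl)))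
   ⟫ Z5.rec (z ^ₛ 4)))
  where open V5

-- The recurrence writes T₇(z¹⁰) through T₇ of z³, z⁶ and z², all zero, so the square of T₇(z⁵)
-- vanishes.
T7z5 : Tₛ 7 (z ^ₛ 5) ≋ 𝟘
T7z5 = sq-inj (≋-sym (T-sq 7 (z ^ₛ 5) prime7 V7.p≢2) ⟫ T7^ z 5 5 ⟫ 
   (ring (Tₛ 7 (z ^ₛ 10) ∷ z ∷ []) X0 (on ⊗ X0 ⊕ (X1 ↑ 1 ⊗ ze ⊕ (X1 ↑ 4 ⊗ ze ⊕ (X1 ↑ 8 ⊗ ze ⊕ ze)))) refl
   ⟫ ≋-sym (+-cong (*-cong ≋-refl (T7^ z 8 2)) (+-cong (*-cong ≋-refl (T7^ z 1 2 ⟫ Tz3)) (+-cong (*-cong ≋-refl (T7^ z 4 2 ⟫ T^2 3 Tz3)) (+-cong (*-cong ≋-refl (T7^ z 0 2 ⟫ T^2 1 (T^1 Tz))) ≋-refl))))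
   ⟫ Z7.rec (z ^ₛ 2)) ⟫ ≋-sym (*-zeroˡ' 𝟘))
  where open V7

T7z7 : Tₛ 7 (z ^ₛ 7) ≋ z
T7z7 = root (Low-T-lead 7 (≤from 2 7 refl) (Lead-^ 7 Lead-z))
  (≋-sym (T-sq 7 (z ^ₛ 7) prime7 V7.p≢2) ⟫ T7^ z 7 7 ⟫ +-cong0
   (ring (Tₛ 7 (z ^ₛ 14) ∷ Tₛ 7 (z ^ₛ 7) ∷ z ∷ []) (X0 ⊕ X2 ⊗ X1) (on ⊗ X0 ⊕ (X2 ↑ 1 ⊗ X1 ⊕ (X2 ↑ 4 ⊗ ze ⊕ (X2 ↑ 8 ⊗ ze ⊕ ze)))) refl
   ⟫ ≋-sym (+-cong (*-cong ≋-refl (T7^ z 8 6)) (+-cong (*-cong ≋-refl (T7^ z 1 6)) (+-cong (*-cong ≋-refl (T7^ z 4 6 ⟫ T^2 5 T7z5)) (+-cong (*-cong ≋-refl (T7^ z 0 6 ⟫ T^2 3 Tz3)) ≋-refl))))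
   ⟫ Z7.rec (z ^ₛ 6)))
  where open V7

opaque
  unfolding _⊹_
  -- The coefficient of x in T₇(r⁵). Since r⁵ begins in degree 5, below 7, its order does not give
  -- this value, which is found by evaluation.
  r5-7 : (r ^ₛ 5) 7 ≡ true
  r5-7 = refl

T7r5 : Tₛ 7 (r ^ₛ 5) ≋ r ⊹ r · r
T7r5 = root ((λ { zero _ → trans (at (T-UV 7 _) 0) (trans (+-at _ _ 0) (cong₂ _xor_ f0 (trans (V-mul 7 (r ^ₛ 5) 0) f0))) ; (suc _) (s≤s ()) })
    , trans (at (T-UV 7 _) 1) (trans (+-at _ _ 1) (cong₂ _xor_ r5-7 (V-non 7 (r ^ₛ 5) 1 (λ { zero () ; (suc m) e → <⇒≢ (≤from 2 7 refl) (sym (∣1⇒≡1 (divides (suc m) (trans e (*-comm 7 (suc m)))))) })))))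
  (≋-sym (T-sq 7 (r ^ₛ 5) prime7 V7.p≢2) ⟫ T7^ r 5 5 ⟫ +-cong0
   (ring (Tₛ 7 (r ^ₛ 10) ∷ Tₛ 7 (r ^ₛ 5) ∷ r ∷ []) (X0 ⊕ (X2 ⊕ X2 ⊗ X2) ⊗ X1)
      (on ⊗ X0 ⊕ (X2 ↑ 8 ⊗ ze ⊕ (X2 ↑ 1 ⊗ ze ⊕ (X2 ↑ 2 ⊗ ze ⊕ (X2 ↑ 3 ⊗ ze ⊕ (X2 ↑ 4 ⊗ ze ⊕ (X2 ↑ 1 ⊗ ze ⊕ (X2 ↑ 2 ⊗ ze ⊕ (X2 ↑ 3 ⊗ ze ⊕ (X2 ↑ 4 ⊗ ze
        ⊕ (X2 ↑ 1 ⊗ X1 ⊕ (X2 ↑ 2 ⊗ X1 ⊕ (X2 ↑ 1 ⊗ ze ⊕ (X2 ↑ 2 ⊗ ze ⊕ ze)))))))))))))) refl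
   ⟫ ≋-sym (+-cong (*-cong ≋-refl (T7^ r 8 2)) (+-cong (*-cong ≋-refl (T7^ r 0 2 ⟫ r2))
       (+-cong (*-cong ≋-refl (T7^ r 1 2 ⟫ Tr3)) (+-cong (*-cong ≋-refl (T7^ r 1 2 ⟫ Tr3)) (+-cong (*-cong ≋-refl (T7^ r 1 2 ⟫ Tr3)) (+-cong (*-cong ≋-refl (T7^ r 1 2 ⟫ Tr3))
       (+-cong (*-cong ≋-refl (T7^ r 2 2 ⟫ r4)) (+-cong (*-cong ≋-refl (T7^ r 2 2 ⟫ r4)) (+-cong (*-cong ≋-refl (T7^ r 2 2 ⟫ r4)) (+-cong (*-cong ≋-refl (T7^ r 2 2 ⟫ r4))
       (+-cong (*-cong ≋-refl (T7^ r 3 2)) (+-cong (*-cong ≋-refl (T7^ r 3 2))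
       (+-cong (*-cong ≋-refl (T7^ r 4 2 ⟫ r6)) (+-cong (*-cong ≋-refl (T7^ r 4 2 ⟫ r6)) ≋-refl))))))))))))))
   ⟫ R7.rec (r ^ₛ 2)))
  where
  open V7
  f0 : (r ^ₛ 5) 0 ≡ false
  f0 = proj₁ (Lead-^ 5 Lead-r) 0 (s≤s z≤n)
  r2 = T^2 1 (T^1 Tr)
  r4 = T^2 2 r2
  r6 = T^2 3 Tr3

T7r9 : Tₛ 7 (r ^ₛ 9) ≋ (r ⊹ r · r) · (r ⊹ r · r)
T7r9 = +-cong0
   (ring (Tₛ 7 (r ^ₛ 9) ∷ r ∷ []) (X0 ⊕ (X1 ⊕ X1 ⊗ X1) ⊗ (X1 ⊕ X1 ⊗ X1))
      (on ⊗ X0 ⊕ (X1 ↑ 8 ⊗ ze ⊕ (X1 ↑ 1 ⊗ ze ⊕ (X1 ↑ 2 ⊗ ze ⊕ (X1 ↑ 3 ⊗ ze ⊕ (X1 ↑ 4 ⊗ ze ⊕ (X1 ↑ 1 ⊗ ze ⊕ (X1 ↑ 2 ⊗ ze ⊕ (X1 ↑ 3 ⊗ ze ⊕ (X1 ↑ 4 ⊗ ze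
        ⊕ (X1 ↑ 1 ⊗ ze ⊕ (X1 ↑ 2 ⊗ ze ⊕ (X1 ↑ 1 ⊗ (X1 ⊕ X1 ⊗ X1) ⊕ (X1 ↑ 2 ⊗ (X1 ⊕ X1 ⊗ X1) ⊕ ze)))))))))))))) refl
   ⟫ ≋-sym (+-cong (*-cong ≋-refl (T7^ r 8 1)) (+-cong (*-cong ≋-refl (T7^ r 0 1 ⟫ r1))
       (+-cong (*-cong ≋-refl (T7^ r 1 1 ⟫ r2)) (+-cong (*-cong ≋-refl (T7^ r 1 1 ⟫ r2)) (+-cong (*-cong ≋-refl (T7^ r 1 1 ⟫ r2)) (+-cong (*-cong ≋-refl (T7^ r 1 1 ⟫ r2))
       (+-cong (*-cong ≋-refl (T7^ r 2 1 ⟫ Tr3)) (+-cong (*-cong ≋-refl (T7^ r 2 1 ⟫ Tr3)) (+-cong (*-cong ≋-refl (T7^ r 2 1 ⟫ Tr3)) (+-cong (*-cong ≋-refl (T7^ r 2 1 ⟫ Tr3))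
       (+-cong (*-cong ≋-refl (T7^ r 3 1 ⟫ T^2 2 r2)) (+-cong (*-cong ≋-refl (T7^ r 3 1 ⟫ T^2 2 r2))
       (+-cong (*-cong ≋-refl (T7^ r 4 1 ⟫ T7r5)) (+-cong (*-cong ≋-refl (T7^ r 4 1 ⟫ T7r5)) ≋-refl))))))))))))))
   ⟫ R7.rec (r ^ₛ 1))
  where
  open V7
  r1 = T^1 Tr
  r2 = T^2 1 r1

T7r7 : Tₛ 7 (r ^ₛ 7) ≋ (r ⊹ r · r) ⊹ (r ^ₛ 3 ⊹ r ^ₛ 4)
T7r7 = root (Low-T-lead 7 (≤from 2 7 refl) (Lead-^ 7 Lead-r))
  (≋-sym (T-sq 7 (r ^ₛ 7) prime7 V7.p≢2) ⟫ T7^ r 7 7 ⟫ +-cong0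
   (ring (Tₛ 7 (r ^ₛ 14) ∷ Tₛ 7 (r ^ₛ 7) ∷ r ∷ []) (X0 ⊕ ((X2 ⊕ X2 ⊗ X2) ⊕ (X2 ↑ 3 ⊕ X2 ↑ 4)) ⊗ X1)
      (on ⊗ X0 ⊕ (X2 ↑ 8 ⊗ ze ⊕ (X2 ↑ 1 ⊗ X1 ⊕ (X2 ↑ 2 ⊗ X1 ⊕ (X2 ↑ 3 ⊗ X1 ⊕ (X2 ↑ 4 ⊗ X1 ⊕ (X2 ↑ 1 ⊗ ze ⊕ (X2 ↑ 2 ⊗ ze ⊕ (X2 ↑ 3 ⊗ ze ⊕ (X2 ↑ 4 ⊗ ze
        ⊕ (X2 ↑ 1 ⊗ t5² ⊕ (X2 ↑ 2 ⊗ t5² ⊕ (X2 ↑ 1 ⊗ t5² ⊕ (X2 ↑ 2 ⊗ t5² ⊕ ze)))))))))))))) refl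
   ⟫ ≋-sym (+-cong (*-cong ≋-refl (T7^ r 8 6)) (+-cong (*-cong ≋-refl (T7^ r 0 6 ⟫ r6))
       (+-cong (*-cong ≋-refl (T7^ r 1 6)) (+-cong (*-cong ≋-refl (T7^ r 1 6)) (+-cong (*-cong ≋-refl (T7^ r 1 6)) (+-cong (*-cong ≋-refl (T7^ r 1 6))
       (+-cong (*-cong ≋-refl (T7^ r 2 6 ⟫ r8)) (+-cong (*-cong ≋-refl (T7^ r 2 6 ⟫ r8)) (+-cong (*-cong ≋-refl (T7^ r 2 6 ⟫ r8)) (+-cong (*-cong ≋-refl (T7^ r 2 6 ⟫ r8))
       (+-cong (*-cong ≋-refl (T7^ r 3 6 ⟫ T7r9)) (+-cong (*-cong ≋-refl (T7^ r 3 6 ⟫ T7r9))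
       (+-cong (*-cong ≋-refl (T7^ r 4 6 ⟫ r10)) (+-cong (*-cong ≋-refl (T7^ r 4 6 ⟫ r10)) ≋-refl))))))))))))))
   ⟫ R7.rec (r ^ₛ 6)))
  where
  open V7
  t5² : Ex
  t5² = (X2 ⊕ X2 ⊗ X2) ⊗ (X2 ⊕ X2 ⊗ X2)
  r6 = T^2 3 Tr3
  r8 = T^2 4 (T^2 2 (T^2 1 (T^1 Tr)))
  r10 = T-cong 7 (^-+ r 5 5) ⟫ T-sq 7 (r ^ₛ 5) prime7 V7.p≢2 ⟫ *-cong T7r5 T7r5

-- Polynomials in a series, and their degrees

Poly1 : Set
Poly1 = MP 1

⟪_⟫ : Poly1 → Series → Series
⟪ p ⟫ f = ev 1 p (env (f ∷ []))

b𝟙 : Bool → Series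
b𝟙 c = ev 0 c (env [])

ev-0-env : ∀ c ρ ρ' → ev 0 c ρ ≋ ev 0 c ρ'
ev-0-env true ρ ρ' = ≋-refl
ev-0-env false ρ ρ' = ≋-refl

ev-1-env : ∀ p ρ ρ' → ρ 0 ≋ ρ' 0 → ev 1 p ρ ≋ ev 1 p ρ'
ev-1-env [] ρ ρ' e = ≋-refl
ev-1-env (c ∷ p) ρ ρ' e = +-cong (ev-0-env c _ _) (*-cong e (ev-1-env p ρ ρ' e))

⟪⟫-∷ : ∀ c p f → ⟪ c ∷ p ⟫ f ≋ b𝟙 c ⊹ f · ⟪ p ⟫ f
⟪⟫-∷ c p f = +-cong (ev-0-env c _ _) ≋-refl

⟪⟫-cong : ∀ p {f g} → f ≋ g → ⟪ p ⟫ f ≋ ⟪ p ⟫ g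
⟪⟫-cong p e = ev-1-env p _ _ e

infixl 6 _⊞_
_⊞_ : Poly1 → Poly1 → Poly1
_⊞_ = addp 1

⟪⟫-+ : ∀ p q f → ⟪ p ⊞ q ⟫ f ≋ ⟪ p ⟫ f ⊹ ⟪ q ⟫ f
⟪⟫-+ p q f = ev-add 1 p q _

⟪⟫-* : ∀ p q f → ⟪ mulp 1 p q ⟫ f ≋ ⟪ p ⟫ f · ⟪ q ⟫ f
⟪⟫-* p q f = ev-mul 1 p q _

⟪⟫-sq : ∀ p f → ⟪ p ⟫ f · ⟪ p ⟫ f ≋ ⟪ p ⟫ (f · f)
⟪⟫-sq [] f = *-zeroˡ' 𝟘
⟪⟫-sq (c ∷ p) f = ring (ev 0 c _ ∷ f ∷ ⟪ p ⟫ f ∷ []) ((X0 ⊕ X1 ⊗ X2) ⊗ (X0 ⊕ X1 ⊗ X2)) (X0 ⊗ X0 ⊕ (X1 ⊗ X1) ⊗ (X2 ⊗ X2)) refl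
   ⟫ +-cong (h c) (*-cong ≋-refl (⟪⟫-sq p f))
   where h : ∀ c {ρ ρ'} → ev 0 c ρ · ev 0 c ρ ≋ ev 0 c ρ'
         h true = *-idˡ 𝟙
         h false = *-zeroˡ' 𝟘

V-b𝟙 : ∀ d .{{_ : NonZero d}} c {ρ ρ'} → V d (ev 0 c ρ) ≋ ev 0 c ρ'
V-b𝟙 d true = V-𝟙 d
V-b𝟙 d false = V-𝟘 d

V-⟪⟫ : ∀ d .{{_ : NonZero d}} p f → V d (⟪ p ⟫ f) ≋ ⟪ p ⟫ (V d f)
V-⟪⟫ d [] f = V-𝟘 d
V-⟪⟫ d (c ∷ p) f = V-+ d _ _ ⟫ +-cong (V-b𝟙 d c) (V-* d _ _ ⟫ *-cong ≋-refl (V-⟪⟫ d p f))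

opaque
  unfolding _⊹_
  const-def : ∀ c → const c ≋ b𝟙 c
  const-def true .at zero = refl
  const-def true .at (suc n) = refl
  const-def false .at zero = refl
  const-def false .at (suc n) = refl
  *-defc : ∀ {f f' g g'} → f ≋ f' → g ≋ g' → f *ₛ g ≋ f' · g'
  *-defc = *-cong
  +-defc : ∀ {f f' g g'} → f ≋ f' → g ≋ g' → f +ₛ g ≋ f' ⊹ g'
  +-defc = +-cong

eval-def : ∀ P {f g} → f ≋ g → evalAt P f ≋ ⟪ P ⟫ g
eval-def [] e = z0
  where opaque
          unfolding 𝟘
          z0 : 0ₛ ≋ 𝟘
          z0 = ≋-refl
eval-def (c ∷ P) e = +-defc (const-def c ⟫ ev-0-env c _ _) (*-defc e (eval-def P e))

-- The constant term must vanish because `t` has order 1; cancelling a factor `t` shortens the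
-- polynomial.
transc : ∀ {t} → Lead 1 t → ∀ p → ⟪ p ⟫ t ≋ 𝟘 → isz 1 p ≡ true
transc l [] e = refl
transc {t} l (c ∷ p) e = k c e
  where
  k : ∀ c → ⟪ c ∷ p ⟫ t ≋ 𝟘 → isz 1 (c ∷ p) ≡ true
  k true e = ⊥-elim (false≢true (trans (sym (trans (at e 0) (𝟘-at 0))) (trans (+-at _ _ 0) (cong₂ _xor_ 𝟙-zero (trans (mul-zero t _) (cong (_∧ ⟪ p ⟫ t 0) (proj₁ l 0 (s≤s z≤n))))))))
  k false e = transc l p (·-domain' l (*-comm' _ t ⟫ ≋-sym (+-idˡ _) ⟫ e))

isz-⟪⟫ : ∀ p f → isz 1 p ≡ true → ⟪ p ⟫ f ≋ 𝟘
isz-⟪⟫ p f e = ev-isz 1 p _ e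

comb : (ℕ → Series) → Poly1 → Series
comb A [] = 𝟘
comb A (c ∷ p) = b𝟙 c · A 0 ⊹ comb (A ∘ suc) p

comb-^ : ∀ X p → comb (X ^ₛ_) p ≋ ⟪ p ⟫ X
comb-^ X p = go p 𝟙 (X ^ₛ_) (λ i → ≋-sym (*-idˡ _)) ⟫ *-idˡ _
  where
  go : ∀ p h A → (∀ i → A i ≋ h · X ^ₛ i) → comb A p ≋ h · ⟪ p ⟫ X
  go [] h A e = ≋-sym (*-zeroʳ' h)
  go (c ∷ p) h A e = +-cong (*-cong ≋-refl (e 0 ⟫ *-idʳ h)) (go p (h · X) (A ∘ suc) (λ i → e (suc i) ⟫ ≋-sym (*-assoc' _ _ _)))
     ⟫ ring (b𝟙 c ∷ h ∷ X ∷ ⟪ p ⟫ X ∷ []) (X0 ⊗ X1 ⊕ (X1 ⊗ X2) ⊗ X3) (X1 ⊗ (X0 ⊕ X2 ⊗ X3)) refl ⟫ *-cong ≋-refl (≋-sym (⟪⟫-∷ c p X))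

-- Degree bounds are predicates on series, so they can be transported along equalities of series;
-- transcendence of `t` makes the degree unique.
module Degree (t : Series) (lt : Lead 1 t) where

  LT : ℕ → Series → Set
  LT n f = ∃ λ (P : Poly1) → length P ≤ n × f ≋ ⟪ P ⟫ t

  Deg : ℕ → Series → Set
  Deg n f = ∃ λ g → LT n g × f ≋ t ^ₛ n ⊹ g

  LT-≋ : ∀ {n f g} → f ≋ g → LT n f → LT n g
  LT-≋ e (P , l , p) = P , l , (≋-sym e ⟫ p)
  Deg-≋ : ∀ {n f g} → f ≋ g → Deg n f → Deg n g
  Deg-≋ e (h , l , p) = h , l , (≋-sym e ⟫ p)
  LT-≤ : ∀ {m n f} → m ≤ n → LT m f → LT n f
  LT-≤ le (P , l , p) = P , ≤-trans l le , p
  LT-𝟘 : ∀ {n} → LT n 𝟘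
  LT-𝟘 = [] , z≤n , ≋-refl
  LT-b : ∀ c → LT 1 (b𝟙 c)
  LT-b c = c ∷ [] , s≤s z≤n , ≋-sym (⟪⟫-∷ c [] t ⟫ +-cong ≋-refl (*-zeroʳ' t) ⟫ +-idʳ _)
  LT-+ : ∀ {n f g} → LT n f → LT n g → LT n (f ⊹ g)
  LT-+ (P , l , p) (Q , l' , q) = P ⊞ Q , len≤ P Q l l' , (+-cong p q ⟫ ≋-sym (⟪⟫-+ P Q t))
    where len≤ : ∀ {n} (P Q : Poly1) → length P ≤ n → length Q ≤ n → length (P ⊞ Q) ≤ n
          len≤ [] Q a b = b
          len≤ (x ∷ P) [] a b = a
          len≤ (x ∷ P) (y ∷ Q) (s≤s a) (s≤s b) = s≤s (len≤ P Q a b)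
  LT-t : ∀ {n f} → LT n f → LT (suc n) (t · f)
  LT-t (P , l , p) = false ∷ P , s≤s l , (*-cong ≋-refl p ⟫ ≋-sym (⟪⟫-∷ false P t ⟫ +-idˡ _))
  LT-t^ : ∀ k {n f} → LT n f → LT (k + n) (t ^ₛ k · f)
  LT-t^ zero p = LT-≋ (≋-sym (*-idˡ _)) p
  LT-t^ (suc k) p = LT-≋ (≋-sym (*-assoc' _ _ _)) (LT-t (LT-t^ k p))
  LT-* : ∀ {m n f g} → LT m f → LT n g → LT (m + n) (f · g)
  LT-* {m} {n} {f} {g} (P , l , p) q = LT-≋ (*-cong (≋-sym p) ≋-refl) (go P m l)
    where
    go : ∀ P m → length P ≤ m → LT (m + n) (⟪ P ⟫ t · g)
    go [] m l = LT-≋ (≋-sym (*-zeroˡ' g)) LT-𝟘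
    go (c ∷ P) (suc m) (s≤s l) = LT-≋ (≋-sym (*-cong (⟪⟫-∷ c P t) ≋-refl ⟫ *-distʳ _ _ _ ⟫ +-cong ≋-refl (*-assoc' _ _ _)))
      (LT-+ (LT-≤ (m≤n+m n (suc m)) (sc c)) (LT-t (go P m l)))
      where sc : ∀ c → LT n (b𝟙 c · g)
            sc true = LT-≋ (≋-sym (*-idˡ g)) q
            sc false = LT-≋ (≋-sym (*-zeroˡ' g)) LT-𝟘
  Deg-LT : ∀ {n f} → Deg n f → LT (suc n) f
  Deg-LT {n} (g , l , p) = LT-≋ (≋-sym p) (LT-+ (LT-≋ (*-idʳ _) (subst (λ k → LT k (t ^ₛ n · 𝟙)) (+-comm n 1) (LT-t^ n (LT-≋ ≋-refl (LT-b true))))) (LT-≤ (n≤1+n n) l))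
  Deg-+ : ∀ {n f g} → Deg n f → LT n g → Deg n (f ⊹ g)
  Deg-+ (h , l , p) q = h ⊹ _ , LT-+ l q , (+-cong p ≋-refl ⟫ +-assoc' _ _ _)
  Deg-+< : ∀ {m n f g} → Deg n f → Deg m g → m < n → Deg n (f ⊹ g)
  Deg-+< p q l = Deg-+ p (LT-≤ l (Deg-LT q))
  Deg-* : ∀ {m n f g} → Deg m f → Deg n g → Deg (m + n) (f · g)
  Deg-* {m} {n} {f} {g} (f' , l , p) (g' , l' , q) = t ^ₛ m · g' ⊹ (t ^ₛ n · f' ⊹ f' · g') ,
    LT-+ (LT-t^ m l') (LT-+ (subst (λ k → LT k (t ^ₛ n · f')) (+-comm n m) (LT-t^ n l)) (LT-* l l')) ,
    (*-cong p q ⟫ ring (t ^ₛ m ∷ t ^ₛ n ∷ f' ∷ g' ∷ []) ((X0 ⊕ X2) ⊗ (X1 ⊕ X3)) (X0 ⊗ X1 ⊕ (X0 ⊗ X3 ⊕ (X1 ⊗ X2 ⊕ X2 ⊗ X3))) refl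
      ⟫ +-cong (≋-sym (^-+ t m n)) ≋-refl)
  Deg-𝟙 : Deg 0 𝟙
  Deg-𝟙 = 𝟘 , LT-𝟘 , ≋-sym (+-idʳ 𝟙)
  Deg-^ : ∀ {m f} n → Deg m f → Deg (n * m) (f ^ₛ n)
  Deg-^ zero p = Deg-𝟙
  Deg-^ (suc n) p = Deg-* p (Deg-^ n p)
  Deg-t : Deg 1 t
  Deg-t = 𝟘 , LT-𝟘 , ≋-sym (+-idʳ _ ⟫ *-idʳ t)

  Deg≠0 : ∀ {n f} → Deg n f → ¬ (f ≋ 𝟘)
  Deg≠0 {n} {f} (g , (P , l , p) , q) e = go P n l (transc lt (pad P n) (pad-ev P n l ⟫ +-cong ≋-refl (≋-sym p) ⟫ ≋-sym q ⟫ e))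
    where
    pad : Poly1 → ℕ → Poly1
    pad P zero = true ∷ []
    pad [] (suc n) = false ∷ pad [] n
    pad (c ∷ P) (suc n) = c ∷ pad P n
    pad-ev : ∀ P n → length P ≤ n → ⟪ pad P n ⟫ t ≋ t ^ₛ n ⊹ ⟪ P ⟫ t
    pad-ev [] zero l = +-cong ≋-refl (*-zeroʳ' t)
    pad-ev [] (suc n) l = +-idˡ _ ⟫ *-cong ≋-refl (pad-ev [] n z≤n ⟫ +-idʳ _) ⟫ ≋-sym (+-idʳ _)
    pad-ev (c ∷ P) (suc n) (s≤s l) = +-cong ≋-refl (*-cong ≋-refl (pad-ev P n l) ⟫ *-distˡ _ _ _) ⟫ ≋-sym (+-assoc' _ _ _) ⟫ +-cong (+-comm' _ _) ≋-refl ⟫ +-assoc' _ _ _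
    go : ∀ P n → length P ≤ n → isz 1 (pad P n) ≡ true → ⊥
    go [] zero l ()
    go [] (suc n) l h = go [] n z≤n h
    go (c ∷ P) (suc n) (s≤s l) h = go P n l (proj₂ (∧-true {not c} h))

  Deg-unique : ∀ {m n f} → Deg m f → Deg n f → m ≡ n
  Deg-unique {m} {n} {f} p q with <-cmp m n
  ... | tri< a _ _ = ⊥-elim (Deg≠0 (Deg-+< q p a) (+-self f))
  ... | tri≈ _ e _ = e
  ... | tri> _ _ c = ⊥-elim (Deg≠0 (Deg-+< p q c) (+-self f))

  -- Strictly increasing degrees cannot cancel: the last nonzero coefficient dictates the degree of
  -- the combination.
  comb-Deg : ∀ (A : ℕ → Series) a k → 1 ≤ k → (∀ i → Deg (a + k * i) (A i)) → ∀ p → isz 1 p ≡ true ⊎ ∃ λ e → Deg (a + k * e) (comb A p)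
  comb-Deg A a k k≥1 D [] = inj₁ refl
  comb-Deg A a k k≥1 D (c ∷ p) with comb-Deg (A ∘ suc) (a + k) k k≥1 (λ i → subst (λ z → Deg z (A (suc i))) (lem i) (D (suc i))) p
    where lem : ∀ i → a + k * suc i ≡ a + k + k * i
          lem i = trans (cong (a +_) (*-suc k i)) (sym (+-assoc a k (k * i)))
  ... | inj₂ (e , d) = inj₂ (suc e , subst (λ z → Deg z (comb A (c ∷ p))) (trans (+-assoc a k _) (cong (a +_) (sym (*-suc k e)))) (Deg-≋ (+-comm' _ _) (Deg-+ d (sc c))))
    where sc : ∀ c → LT (a + k + k * e) (b𝟙 c · A 0)
          sc true = LT-≋ (≋-sym (*-idˡ _)) (LT-≤ (≤-trans (s≤s (≤-reflexive (trans (cong (a +_) (*-zeroʳ k)) (+-identityʳ a)))) (≤-trans (subst (_≤ a + k) (+-comm a 1) (+-monoʳ-≤ a k≥1)) (m≤m+n (a + k) (k * e)))) (Deg-LT (D 0)))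
          sc false = LT-≋ (≋-sym (*-zeroˡ' _)) LT-𝟘
  comb-Deg A a k k≥1 D (true ∷ p) | inj₁ h = inj₂ (0 , Deg-≋ (≋-sym (+-cong (*-idˡ _) (comb0 p (A ∘ suc) h) ⟫ +-idʳ _)) (D 0))
    where comb0 : ∀ p A → isz 1 p ≡ true → comb A p ≋ 𝟘
          comb0 [] A h = ≋-refl
          comb0 (false ∷ p) A h = +-cong (*-zeroˡ' _) (comb0 p (A ∘ suc) h) ⟫ +-idˡ 𝟘
  comb-Deg A a k k≥1 D (false ∷ p) | inj₁ h = inj₁ h

  ⟪⟫-Deg : ∀ {k X} → 1 ≤ k → Deg k X → ∀ p → isz 1 p ≡ true ⊎ ∃ λ e → Deg (k * e) (⟪ p ⟫ X)
  ⟪⟫-Deg {k} {X} k≥1 D p with comb-Deg (X ^ₛ_) 0 k k≥1 (λ i → subst (λ z → Deg z (X ^ₛ i)) (*-comm i k) (Deg-^ i D)) p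
  ... | inj₁ h = inj₁ h
  ... | inj₂ (e , d) = inj₂ (e , Deg-≋ (comb-^ X p) d)

  top-split : ∀ m {g} → LT (suc m) g → ∃ λ c → ∃ λ g' → LT m g' × g ≋ b𝟙 c · t ^ₛ m ⊹ g'
  top-split m {g} (P , l , p) = let (c , g' , lt' , e) = go P m l in c , g' , lt' , (p ⟫ e)
    where
    go : ∀ P m → length P ≤ suc m → ∃ λ c → ∃ λ g' → LT m g' × ⟪ P ⟫ t ≋ b𝟙 c · t ^ₛ m ⊹ g'
    go [] m l = false , 𝟘 , LT-𝟘 , ≋-sym (+-idʳ _ ⟫ *-zeroˡ' _)
    go (c ∷ []) zero l = c , 𝟘 , LT-𝟘 , (⟪⟫-∷ c [] t ⟫ +-cong (≋-sym (*-idʳ _)) (*-zeroʳ' t))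
    go (c ∷ x ∷ P) zero (s≤s ())
    go (c ∷ P) (suc m) (s≤s l) = let (c' , g' , lt' , e) = go P m l in
      c' , b𝟙 c ⊹ t · g' , LT-+ (LT-≤ (s≤s z≤n) (LT-b c)) (LT-t lt') ,
      (⟪⟫-∷ c P t ⟫ +-cong ≋-refl (*-cong ≋-refl e) ⟫ ring (b𝟙 c ∷ b𝟙 c' ∷ t ∷ t ^ₛ m ∷ g' ∷ []) (X0 ⊕ X2 ⊗ (X1 ⊗ X3 ⊕ X4)) (X1 ⊗ (X2 ⊗ X3) ⊕ (X0 ⊕ X2 ⊗ X4)) refl)

  reduce : ∀ m {X g} → Deg m X → LT (suc m) g → ∃ λ c → LT m (g ⊹ b𝟙 c · X)
  reduce m {X} {g} (h , lh , eX) l = go (top-split m l)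
    where
    go : (∃ λ c → ∃ λ g' → LT m g' × g ≋ b𝟙 c · t ^ₛ m ⊹ g') → ∃ λ c → LT m (g ⊹ b𝟙 c · X)
    go (c , g' , lg , e) = c , LT-≋ (ring (b𝟙 c ∷ t ^ₛ m ∷ g' ∷ h ∷ []) (X2 ⊕ X0 ⊗ X3) ((X0 ⊗ X1 ⊕ X2) ⊕ X0 ⊗ (X1 ⊕ X3)) refl ⟫ ≋-sym (+-cong e (*-cong ≋-refl eX)))
         (LT-+ lg (sc c))
      where sc : ∀ c → LT m (b𝟙 c · h)
            sc true = LT-≋ (≋-sym (*-idˡ h)) lh
            sc false = LT-≋ (≋-sym (*-zeroˡ' h)) LT-𝟘

module PolyIn (t : Series) where
  In : Series → Set
  In f = ∃ λ P → f ≋ ⟪ P ⟫ t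
  In-≋ : ∀ {f g} → f ≋ g → In f → In g
  In-≋ e (P , p) = P , (≋-sym e ⟫ p)
  In-+ : ∀ {f g} → In f → In g → In (f ⊹ g)
  In-+ (P , p) (Q , q) = P ⊞ Q , (+-cong p q ⟫ ≋-sym (⟪⟫-+ P Q t))
  In-* : ∀ {f g} → In f → In g → In (f · g)
  In-* (P , p) (Q , q) = mulp 1 P Q , (*-cong p q ⟫ ≋-sym (⟪⟫-* P Q t))
  In-𝟘 : In 𝟘
  In-𝟘 = [] , ≋-refl
  In-𝟙 : In 𝟙
  In-𝟙 = true ∷ [] , ≋-sym (⟪⟫-∷ true [] t ⟫ +-cong ≋-refl (*-zeroʳ' t) ⟫ +-idʳ 𝟙)
  In-t : In t
  In-t = false ∷ true ∷ [] , ≋-sym (⟪⟫-∷ false (true ∷ []) t ⟫ +-idˡ _ ⟫ *-cong ≋-refl (≋-sym (proj₂ In-𝟙)) ⟫ *-idʳ t)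
  In-^ : ∀ {f} n → In f → In (f ^ₛ n)
  In-^ zero p = In-𝟙
  In-^ (suc n) p = In-* p (In-^ n p)
  In-b : ∀ c → In (b𝟙 c)
  In-b true = In-𝟙
  In-b false = In-𝟘
  In-comb : ∀ A p → (∀ i → In (A i)) → In (comb A p)
  In-comb A [] h = In-𝟘
  In-comb A (c ∷ p) h = In-+ (In-* (In-b c) (h 0)) (In-comb (A ∘ suc) p (h ∘ suc))

-- Stability of F₂[r] under T₅ and T₇

open PolyIn r renaming (In to Z2; In-≋ to Z2-≋; In-+ to Z2-+; In-* to Z2-*; In-𝟘 to Z2-𝟘; In-𝟙 to Z2-𝟙; In-t to Z2-r; In-^ to Z2-^) hiding (In-b; In-comb) public

Z2-F : Z2 F
Z2-F = Z2-≋ (≋-sym F-r) (Z2-* Z2-r (Z2-^ 3 (Z2-+ Z2-r Z2-𝟙)))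
Z2-G : Z2 G
Z2-G = Z2-≋ (≋-sym G-r) (Z2-* (Z2-^ 3 Z2-r) (Z2-+ Z2-r Z2-𝟙))
Z2-⟪⟫ : ∀ p {f} → Z2 f → Z2 (⟪ p ⟫ f)
Z2-⟪⟫ [] z' = Z2-𝟘
Z2-⟪⟫ (c ∷ p) {f} z' = Z2-≋ (≋-sym (⟪⟫-∷ c p f)) (Z2-+ (b c) (Z2-* z' (Z2-⟪⟫ p z')))
  where b : ∀ c → Z2 (b𝟙 c)
        b true = Z2-𝟙
        b false = Z2-𝟘

⟪⟫-lin : ∀ (L : Series → Series) (C : Series → Set) → (∀ {f g} → f ≋ g → L f ≋ L g) → (∀ f g → L (f ⊹ g) ≋ L f ⊹ L g) → L 𝟘 ≋ 𝟘 →
  (∀ {f g} → f ≋ g → C f → C g) → (∀ {f g} → C f → C g → C (f ⊹ g)) → C 𝟘 →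
  ∀ t → (∀ n → C (L (t ^ₛ n))) → ∀ p → C (L (⟪ p ⟫ t))
⟪⟫-lin L C Lc L+ L0 Cc C+ C0 t h p = Cc (Lc (*-idˡ _)) (go p 0)
  where
  go : ∀ p n → C (L (t ^ₛ n · ⟪ p ⟫ t))
  go [] n = Cc (≋-sym (Lc (*-zeroʳ' _) ⟫ L0)) C0
  go (c ∷ p) n = Cc (≋-sym (Lc (*-cong ≋-refl (⟪⟫-∷ c p t) ⟫ ring (b𝟙 c ∷ t ∷ t ^ₛ n ∷ ⟪ p ⟫ t ∷ []) (X2 ⊗ (X0 ⊕ X1 ⊗ X3)) (X0 ⊗ X2 ⊕ (X1 ⊗ X2) ⊗ X3) refl) ⟫ L+ _ _))
     (C+ (sc c) (go p (suc n)))
    where sc : ∀ c → C (L (b𝟙 c · t ^ₛ n))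
          sc true = Cc (≋-sym (Lc (*-idˡ _))) (h n)
          sc false = Cc (≋-sym (Lc (*-zeroˡ' _) ⟫ L0)) C0

-- The monic recurrence expresses T_p(r^n) for n > D through T_p of smaller powers with coefficients
-- in F₂[r], so the values for n up to D suffice.
module Closed (p : ℕ) .{{nz : NonZero p}} (D : ℕ) (R : List (ℕ × ℕ))
  (rec : ∀ h → sumL ((suc D , 0) ∷ R) (λ i j → r ^ₛ j · Tₛ p (r ^ₛ i · h)) ≋ 𝟘)
  (low : ∀ i j → (i , j) ∈ R → i ≤ D)
  (ini : ∀ n → n ≤ D → Z2 (Tₛ p (r ^ₛ n))) where

  T-pow : ∀ B n → n < B → Z2 (Tₛ p (r ^ₛ n))
  T-pow (suc B) n l with n ≤? D
  ... | yes le = ini n le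
  ... | no nle = Z2-≋ (≋-sym (T-cong p (subst (λ k → r ^ₛ k ≋ r ^ₛ suc D · r ^ₛ m) en (^-+ r (suc D) m)) ⟫ ≋-sym (*-idˡ _) ⟫ +-cong0 (rec (r ^ₛ m)))) (terms R low)
    where
    m : ℕ
    m = n ∸ suc D
    en : suc D + m ≡ n
    en = m+[n∸m]≡n (≰⇒> nle)
    terms : ∀ R' → (∀ i j → (i , j) ∈ R' → i ≤ D) → Z2 (sumL R' (λ i j → r ^ₛ j · Tₛ p (r ^ₛ i · r ^ₛ m)))
    terms [] _ = Z2-𝟘
    terms ((i , j) ∷ R') lo = Z2-+ (Z2-* (Z2-^ j Z2-r) (Z2-≋ (T-cong p (^-+ r i m)) (T-pow B (i + m)
        (<-≤-trans (+-monoˡ-< m (s≤s (lo i j (here refl)))) (subst (_≤ B) (sym en) (≤-pred l))))))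
      (terms R' (λ i' j' x → lo i' j' (there x)))

  T-Z2 : ∀ {f} → Z2 f → Z2 (Tₛ p f)
  T-Z2 (P , e) = Z2-≋ (T-cong p (≋-sym e)) (⟪⟫-lin (Tₛ p) Z2 (T-cong p) (T-+ p) (T-𝟘 p) Z2-≋ Z2-+ Z2-𝟘 r (λ n → T-pow (suc n) n ≤-refl) P)

tailL : List (ℕ × ℕ) → List (ℕ × ℕ)
tailL [] = []
tailL (x ∷ xs) = xs

lows : ℕ → List (ℕ × ℕ) → Bool
lows D [] = true
lows D ((i , j) ∷ R) = (i ≤ᵇ D) ∧ lows D R

lows-sound : ∀ D R → lows D R ≡ true → ∀ i j → (i , j) ∈ R → i ≤ D
lows-sound D ((i , j) ∷ R) h _ _ (here refl) = ≤from i D (proj₁ (∧-true h))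
lows-sound D ((i , j) ∷ R) h i' j' (there x) = lows-sound D R (proj₂ (∧-true {i ≤ᵇ D} h)) i' j' x

≋0-Z2 : ∀ {f} → f ≋ 𝟘 → Z2 f
≋0-Z2 e = Z2-≋ (≋-sym e) Z2-𝟘

T5-r^ : ∀ n → n ≤ 5 → Z2 (Tₛ 5 (r ^ₛ n))
T5-r^ 0 _ = ≋0-Z2 V5.T𝟙
T5-r^ 1 _ = ≋0-Z2 (V5.T^1 V5.Tr)
T5-r^ 2 _ = ≋0-Z2 (V5.T^2 1 (V5.T^1 V5.Tr))
T5-r^ 3 _ = ≋0-Z2 V5.Tr3
T5-r^ 4 _ = ≋0-Z2 (V5.T^2 2 (V5.T^2 1 (V5.T^1 V5.Tr)))
T5-r^ 5 _ = Z2-≋ (≋-sym T5r5) (Z2-+ Z2-r (Z2-* Z2-r Z2-r))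
T5-r^ (suc (suc (suc (suc (suc (suc _)))))) (s≤s (s≤s (s≤s (s≤s (s≤s ())))))

T7-r^ : ∀ n → n ≤ 7 → Z2 (Tₛ 7 (r ^ₛ n))
T7-r^ 0 _ = ≋0-Z2 V7.T𝟙
T7-r^ 1 _ = ≋0-Z2 (V7.T^1 V7.Tr)
T7-r^ 2 _ = ≋0-Z2 (V7.T^2 1 (V7.T^1 V7.Tr))
T7-r^ 3 _ = ≋0-Z2 V7.Tr3
T7-r^ 4 _ = ≋0-Z2 (V7.T^2 2 (V7.T^2 1 (V7.T^1 V7.Tr)))
T7-r^ 5 _ = Z2-≋ (≋-sym T7r5) (Z2-+ Z2-r (Z2-* Z2-r Z2-r))
T7-r^ 6 _ = ≋0-Z2 (V7.T^2 3 V7.Tr3)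
T7-r^ 7 _ = Z2-≋ (≋-sym T7r7) (Z2-+ (Z2-+ Z2-r (Z2-* Z2-r Z2-r)) (Z2-+ (Z2-^ 3 Z2-r) (Z2-^ 4 Z2-r)))
T7-r^ (suc (suc (suc (suc (suc (suc (suc (suc _)))))))) (s≤s (s≤s (s≤s (s≤s (s≤s (s≤s (s≤s ())))))))

module C5 = Closed 5 5 (tailL Rr5) R5.rec (lows-sound 5 (tailL Rr5) refl) T5-r^
module C7 = Closed 7 7 (tailL Rr7) R7.rec (lows-sound 7 (tailL Rr7) refl) T7-r^

-- The kernel of U₂ in F₂[r]

open Degree r Lead-r renaming (LT to LTr; Deg to Degr) public

U2u : U 2 uₛ ≋ 𝟘
U2u .at n = trans (¬true h) (sym (𝟘-at n))
  where
  h : ¬ (uₛ (2 * n) ≡ true)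
  h t = go (Θ (2 * n)) (V 3 Θ (2 * n)) refl refl (trans (sym (+-at Θ (V 3 Θ) (2 * n))) (trans (sym (at r²+r (2 * n))) t))
    where
    go : ∀ x y → Θ (2 * n) ≡ x → V 3 Θ (2 * n) ≡ y → x xor y ≡ true → ⊥
    go true _ e _ _ = let (a , o , q) = Θ-true (2 * n) e in false≢true (trans (sym (odd-2 n)) (trans (cong odd q) (odd-sq a o)))
    go false true _ e _ = let (a , o , q) = VΘ-true 3 (2 * n) e in
      false≢true (trans (sym (odd-2 n)) (trans (cong odd q) (trans (odd-+ (a * a) (2 * (a * a))) (cong₂ _xor_ (odd-sq a o) (odd-2 (a * a))))))
    go false false _ _ ()

U2-sq : ∀ f → U 2 (f · f) ≋ f
U2-sq f = U-cong 2 (sq-V f) ⟫ UV 2 f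

U2-usq : ∀ f → U 2 (uₛ · (f · f)) ≋ 𝟘
U2-usq f = U-cong 2 (*-comm' _ _ ⟫ *-cong (sq-V f) ≋-refl) ⟫ U-V· 2 f uₛ ⟫ *-cong ≋-refl U2u ⟫ *-zeroʳ' f

split : Poly1 → Poly1 × Poly1
split [] = [] , []
split (c ∷ p) = let (e , o) = split p in c ∷ o , e

split-ok : ∀ p f → ⟪ p ⟫ f ≋ ⟪ proj₁ (split p) ⟫ (f · f) ⊹ f · ⟪ proj₂ (split p) ⟫ (f · f)
split-ok [] f = ≋-sym (+-idˡ _ ⟫ *-zeroʳ' f)
split-ok (c ∷ p) f = ⟪⟫-∷ c p f ⟫ +-cong ≋-refl (*-cong ≋-refl (split-ok p f))
  ⟫ ring (b𝟙 c ∷ f ∷ ⟪ proj₁ (split p) ⟫ (f · f) ∷ ⟪ proj₂ (split p) ⟫ (f · f) ∷ []) (X0 ⊕ X1 ⊗ (X2 ⊕ X1 ⊗ X3)) ((X0 ⊕ (X1 ⊗ X1) ⊗ X3) ⊕ X1 ⊗ X2) refl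
  ⟫ +-cong (≋-sym (⟪⟫-∷ c (proj₂ (split p)) (f · f))) ≋-refl

-- As r = r² + u with u = r² + r, every element of F₂[r] is C² + u O². Since u has odd exponents
-- only, U₂ returns C.
odd-form : ∀ {f} → Z2 f → U 2 f ≋ 𝟘 → ∃ λ B → f ≋ uₛ · (⟪ B ⟫ r · ⟪ B ⟫ r)
odd-form {f} (P , p) e = O , (fC ⟫ +-cong (*-cong C0 C0 ⟫ *-zeroˡ' 𝟘) ≋-refl ⟫ +-idˡ _)
  where
  E O : Poly1
  E = proj₁ (split P)
  O = proj₂ (split P)
  C : Series
  C = ⟪ E ⟫ r ⊹ r · ⟪ O ⟫ r
  fC : f ≋ C · C ⊹ uₛ · (⟪ O ⟫ r · ⟪ O ⟫ r)
  fC = p ⟫ split-ok P r ⟫ +-cong (≋-sym (⟪⟫-sq E r)) (*-cong ≋-refl (≋-sym (⟪⟫-sq O r)))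
    ⟫ ring (⟪ E ⟫ r ∷ ⟪ O ⟫ r ∷ r ∷ []) (X0 ⊗ X0 ⊕ X2 ⊗ (X1 ⊗ X1)) ((X0 ⊕ X2 ⊗ X1) ⊗ (X0 ⊕ X2 ⊗ X1) ⊕ (X2 ⊗ X2 ⊕ X2) ⊗ (X1 ⊗ X1)) refl
  C0 : C ≋ 𝟘
  C0 = ≋-sym (U-cong 2 fC ⟫ U-+ 2 _ _ ⟫ +-cong (U2-sq C) (U2-usq _) ⟫ +-idʳ C) ⟫ e

basis4 : ∀ P → ∃ λ b0 → ∃ λ b1 → ∃ λ b2 → ∃ λ b3 → ⟪ P ⟫ r ≋ ⟪ b0 ⟫ G ⊹ (r · ⟪ b1 ⟫ G ⊹ (r ^ₛ 2 · ⟪ b2 ⟫ G ⊹ r ^ₛ 3 · ⟪ b3 ⟫ G))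
basis4 [] = [] , [] , [] , [] , ring (r ∷ []) ze (ze ⊕ (X0 ⊗ ze ⊕ (X0 ↑ 2 ⊗ ze ⊕ X0 ↑ 3 ⊗ ze))) refl
basis4 (c ∷ P) with basis4 P
... | b0 , b1 , b2 , b3 , e = c ∷ b3 , b0 , b1 , b2 ⊞ b3 ,
   (⟪⟫-∷ c P r ⟫ +-cong ≋-refl (*-cong ≋-refl e)
   ⟫ ring (b𝟙 c ∷ r ∷ ⟪ b0 ⟫ G ∷ ⟪ b1 ⟫ G ∷ ⟪ b2 ⟫ G ∷ ⟪ b3 ⟫ G ∷ []) (X0 ⊕ X1 ⊗ (X2 ⊕ (X1 ⊗ X3 ⊕ (X1 ↑ 2 ⊗ X4 ⊕ X1 ↑ 3 ⊗ X5))))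
      ((X0 ⊕ ExG X1 ⊗ X5) ⊕ (X1 ⊗ X2 ⊕ (X1 ↑ 2 ⊗ X3 ⊕ X1 ↑ 3 ⊗ (X4 ⊕ X5)))) refl
   ⟫ +-cong (+-cong ≋-refl (*-cong (≋-sym G-r) ≋-refl) ⟫ ≋-sym (⟪⟫-∷ c b3 G)) (+-cong ≋-refl (+-cong ≋-refl (*-cong ≋-refl (≋-sym (⟪⟫-+ b2 b3 G))))))

nform : Poly1 → Poly1 → Poly1 → Series
nform a b c = ⟪ a ⟫ w · G ⊹ ⟪ b ⟫ w · F ⊹ ⟪ c ⟫ w · ((F · F) · G)

-- The kernel of U₂ in F₂[r] needs one generator beyond those of N2, namely F³; two later arguments
-- show that d = 0 where it matters.
mform : Poly1 → Poly1 → Poly1 → Poly1 → Series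
mform a b c d = nform a b c ⊹ ⟪ d ⟫ w · F ^ₛ 3

ur² : uₛ · r ^ₛ 2 ≋ G
ur² = ring (r ∷ []) ((X0 ⊗ X0 ⊕ X0) ⊗ X0 ↑ 2) (ExG X0) refl ⟫ ≋-sym G-r

ur⁶ : uₛ · r ^ₛ 6 ≋ F ^ₛ 3 ⊹ (w · F ⊹ G)
ur⁶ = ring (r ∷ []) ((X0 ⊗ X0 ⊕ X0) ⊗ X0 ↑ 6) (ExF X0 ↑ 3 ⊕ ((ExG X0 ⊗ ExG X0) ⊗ ExF X0 ⊕ ExG X0)) refl
  ⟫ ≋-sym (+-cong (^-cong 3 F-r) (+-cong (*-cong (*-cong G-r G-r) F-r) G-r))

ur⁴ : uₛ · r ^ₛ 4 ≋ (F · F) · G ⊹ (w · G ⊹ (F ^ₛ 3 ⊹ (w · F ⊹ G)))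
ur⁴ = ring (r ∷ []) ((X0 ⊗ X0 ⊕ X0) ⊗ X0 ↑ 4) ((ExF X0 ⊗ ExF X0) ⊗ ExG X0 ⊕ ((ExG X0 ⊗ ExG X0) ⊗ ExG X0 ⊕ (ExF X0 ↑ 3 ⊕ ((ExG X0 ⊗ ExG X0) ⊗ ExF X0 ⊕ ExG X0)))) refl
  ⟫ ≋-sym (+-cong (*-cong (*-cong F-r F-r) G-r) (+-cong (*-cong (*-cong G-r G-r) G-r) (+-cong (^-cong 3 F-r) (+-cong (*-cong (*-cong G-r G-r) F-r) G-r))))

⟪⟫-shift : ∀ p f → ⟪ false ∷ p ⟫ f ≋ f · ⟪ p ⟫ f
⟪⟫-shift p f = ⟪⟫-∷ false p f ⟫ +-idˡ _

B4-sq : ∀ a b c d → (a ⊹ (r · b ⊹ (r ^ₛ 2 · c ⊹ r ^ₛ 3 · d))) · (a ⊹ (r · b ⊹ (r ^ₛ 2 · c ⊹ r ^ₛ 3 · d)))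
  ≋ a · a ⊹ (r ^ₛ 2 · (b · b) ⊹ (r ^ₛ 4 · (c · c) ⊹ r ^ₛ 6 · (d · d)))
B4-sq a b c d = ring (r ∷ a ∷ b ∷ c ∷ d ∷ []) (B4 ⊗ B4) ((X1 ⊗ X1) ⊕ (X0 ↑ 2 ⊗ (X2 ⊗ X2) ⊕ (X0 ↑ 4 ⊗ (X3 ⊗ X3) ⊕ X0 ↑ 6 ⊗ (X4 ⊗ X4)))) refl
  where B4 : Ex
        B4 = X1 ⊕ (X0 ⊗ X2 ⊕ (X0 ↑ 2 ⊗ X3 ⊕ X0 ↑ 3 ⊗ X4))

uB4 : ∀ a b c d → uₛ · (a ⊹ (r ^ₛ 2 · b ⊹ (r ^ₛ 4 · c ⊹ r ^ₛ 6 · d)))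
  ≋ ((a ⊹ b ⊹ c ⊹ w · c ⊹ d) · G ⊹ (a ⊹ w · c ⊹ w · d) · F ⊹ c · ((F · F) · G)) ⊹ (c ⊹ d) · F ^ₛ 3
uB4 a b c d = ring (uₛ ∷ r ^ₛ 2 ∷ r ^ₛ 4 ∷ r ^ₛ 6 ∷ a ∷ b ∷ c ∷ d ∷ []) (X0 ⊗ (X4 ⊕ (X1 ⊗ X5 ⊕ (X2 ⊗ X6 ⊕ X3 ⊗ X7))))
     (X0 ⊗ X4 ⊕ ((X0 ⊗ X1) ⊗ X5 ⊕ ((X0 ⊗ X2) ⊗ X6 ⊕ (X0 ⊗ X3) ⊗ X7))) refl
  ⟫ +-cong (*-cong (≋-sym F+G) ≋-refl) (+-cong (*-cong ur² ≋-refl) (+-cong (*-cong ur⁴ ≋-refl) (*-cong ur⁶ ≋-refl)))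
  ⟫ ring (F ∷ G ∷ w ∷ a ∷ b ∷ c ∷ d ∷ [])
     ((X0 ⊕ X1) ⊗ X3 ⊕ (X1 ⊗ X4 ⊕ (((X0 ⊗ X0) ⊗ X1 ⊕ (X2 ⊗ X1 ⊕ (X0 ↑ 3 ⊕ (X2 ⊗ X0 ⊕ X1)))) ⊗ X5 ⊕ (X0 ↑ 3 ⊕ (X2 ⊗ X0 ⊕ X1)) ⊗ X6)))
     (((X3 ⊕ X4 ⊕ X5 ⊕ X2 ⊗ X5 ⊕ X6) ⊗ X1 ⊕ (X3 ⊕ X2 ⊗ X5 ⊕ X2 ⊗ X6) ⊗ X0 ⊕ X5 ⊗ ((X0 ⊗ X0) ⊗ X1)) ⊕ (X5 ⊕ X6) ⊗ X0 ↑ 3) refl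

-- In f = u B(r)², expand B over F₂[G] in 1, r, r², r³ and square: G becomes w, and u, u r², u r⁴, u
-- r⁶ are combinations of G, F, F²G and F³ over F₂[w].
odd-mform : ∀ {f} → Z2 f → U 2 f ≋ 𝟘 → ∃ λ a → ∃ λ b → ∃ λ c → ∃ λ d → f ≋ mform a b c d
odd-mform {f} zf e = go (odd-form zf e)
  where
  go : (∃ λ B → f ≋ uₛ · (⟪ B ⟫ r · ⟪ B ⟫ r)) → ∃ λ a → ∃ λ b → ∃ λ c → ∃ λ d → f ≋ mform a b c d
  go (B , eB) = go' (basis4 B)
    where
    go' : (∃ λ b0 → ∃ λ b1 → ∃ λ b2 → ∃ λ b3 → ⟪ B ⟫ r ≋ ⟪ b0 ⟫ G ⊹ (r · ⟪ b1 ⟫ G ⊹ (r ^ₛ 2 · ⟪ b2 ⟫ G ⊹ r ^ₛ 3 · ⟪ b3 ⟫ G)))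
      → ∃ λ a → ∃ λ b → ∃ λ c → ∃ λ d → f ≋ mform a b c d
    go' (b0 , b1 , b2 , b3 , e4) = b0 ⊞ b1 ⊞ b2 ⊞ (false ∷ b2) ⊞ b3 , b0 ⊞ (false ∷ b2) ⊞ (false ∷ b3) , b2 , b2 ⊞ b3 ,
      (eB ⟫ *-cong ≋-refl (*-cong e4 e4 ⟫ B4-sq _ _ _ _
        ⟫ +-cong (⟪⟫-sq b0 G) (+-cong (*-cong ≋-refl (⟪⟫-sq b1 G)) (+-cong (*-cong ≋-refl (⟪⟫-sq b2 G)) (*-cong ≋-refl (⟪⟫-sq b3 G)))))
      ⟫ uB4 (⟪ b0 ⟫ w) (⟪ b1 ⟫ w) (⟪ b2 ⟫ w) (⟪ b3 ⟫ w)
      ⟫ ≋-sym (+-cong (+-cong (+-cong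
          (*-cong (⟪⟫-+ (b0 ⊞ b1 ⊞ b2 ⊞ (false ∷ b2)) b3 w ⟫ +-cong (⟪⟫-+ (b0 ⊞ b1 ⊞ b2) (false ∷ b2) w ⟫ +-cong (⟪⟫-+ (b0 ⊞ b1) b2 w ⟫ +-cong (⟪⟫-+ b0 b1 w) ≋-refl) (⟪⟫-shift b2 w)) ≋-refl) ≋-refl)
          (*-cong (⟪⟫-+ (b0 ⊞ (false ∷ b2)) (false ∷ b3) w ⟫ +-cong (⟪⟫-+ b0 (false ∷ b2) w ⟫ +-cong ≋-refl (⟪⟫-shift b2 w)) (⟪⟫-shift b3 w)) ≋-refl))
          ≋-refl) (*-cong (⟪⟫-+ b2 b3 w) ≋-refl)))

-- Exponents modulo 3

sum-true : ∀ n (h : ℕ → Bool) → xorSum n h ≡ true → ∃ λ i → i < n × h i ≡ true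
sum-true (suc n) h e with h n in q
... | true = n , n<1+n n , q
... | false = let (i , l , t) = sum-true n h e in i , m<n⇒m<1+n l , t

Cl : ℕ → Series → Set
Cl i f = ∀ n → f n ≡ true → n % 3 ≡ i

Cl-≋ : ∀ {i f g} → f ≋ g → Cl i f → Cl i g
Cl-≋ e c n t = c n (trans (at e n) t)

Cl-+ : ∀ {i f g} → Cl i f → Cl i g → Cl i (f ⊹ g)
Cl-+ {i} {f} {g} c d n t = go (f n) (g n) refl refl (trans (sym (+-at f g n)) t)
  where go : ∀ x y → f n ≡ x → g n ≡ y → x xor y ≡ true → n % 3 ≡ i
        go true _ e _ _ = c n e
        go false true _ e _ = d n e

Cl-𝟘 : ∀ {i} → Cl i 𝟘
Cl-𝟘 n t = ⊥-elim (false≢true (trans (sym (𝟘-at n)) t))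

Cl-* : ∀ {i j f g} → Cl i f → Cl j g → Cl ((i + j) % 3) (f · g)
Cl-* {i} {j} {f} {g} c d n t = let (k , l , e) = sum-true (suc n) (λ k → f k ∧ g (n ∸ k)) (trans (sym (*-at f g n)) t) ; (ef , eg) = ∧-true {f k} e in
  trans (cong (_% 3) (sym (m+[n∸m]≡n (≤-pred l)))) (trans (%-distribˡ-+ k (n ∸ k) 3) (cong₂ (λ x y → (x + y) % 3) (c k ef) (d (n ∸ k) eg)))

Cl-V3 : ∀ f → Cl 0 (V 3 f)
Cl-V3 f n t = let (m , e , _) = V-true 3 f n t in trans (cong (_% 3) (trans e (*-comm 3 m))) (m*n%n≡0 m 3)

Cl-split : ∀ {i j f g} → i ≢ j → Cl i f → Cl j g → f ⊹ g ≋ 𝟘 → f ≋ 𝟘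
Cl-split {i} {j} {f} {g} ne c d e .at n = trans (¬true (λ t → ne (trans (sym (c n t)) (d n (trans (sym (at (+-cong0 e) n)) t))))) (sym (𝟘-at n))

φ : Series
φ = F · F

V3φ : V 3 φ ≋ w
V3φ = V-* 3 F F ⟫ *-cong V3F V3F

w-V3 : ∀ p → ⟪ p ⟫ w ≋ V 3 (⟪ p ⟫ φ)
w-V3 p = ≋-sym (V-⟪⟫ 3 p φ ⟫ ⟪⟫-cong p V3φ)

Cl-w : ∀ p → Cl 0 (⟪ p ⟫ w)
Cl-w p = Cl-≋ (≋-sym (w-V3 p)) (Cl-V3 _)

U3-V2 : ∀ f → U 3 (f · f) ≋ U 3 f · U 3 f
U3-V2 f = U-cong 3 (sq-V f) ⟫ UV-comm 3 prime2 (prime-∤ prime3 prime2 (λ ())) f ⟫ ≋-sym (sq-V _)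

-- By `U-Q` for the prime 3, U₃ and V₃ agree on Θ, and V₃ F = G.
U3F : U 3 F ≋ G
U3F = U-cong 3 F≋Θ ⟫ U-+ 3 Q (V 4 Q) ⟫ +-cong (mk (U-Q prime3)) (U-cong 3 (≋-sym (V-V 2 2 Q) ⟫ ≋-sym (sq-V _)) ⟫ U3-V2 _
     ⟫ *-cong u2 u2 ⟫ sq-V _ ⟫ V-V 2 2 _ ⟫ V-comm 4 3 Q) ⟫ ≋-sym (V-+ 3 Q (V 4 Q)) ⟫ V-cong 3 (≋-sym F≋Θ) ⟫ V3F
  where u2 : U 3 (V 2 Q) ≋ V 2 (V 3 Q)
        u2 = U-cong 3 (≋-sym (sq-V Q)) ⟫ U3-V2 Q ⟫ sq-V _ ⟫ V-cong 2 (mk (U-Q prime3))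

U3G : U 3 G ≋ F
U3G = U-cong 3 (≋-sym V3F) ⟫ UV 3 F

U3z : U 3 z ≋ 𝟘
U3z = U-+ 3 F β ⟫ +-cong U3F (UV 3 G) ⟫ +-self G

-- U₃ z = 0, and at exponents prime to 3 the series z agrees with F, whose exponents are squares;
-- such a square is 1 modulo 3.
Cl-z : Cl 1 z
Cl-z n t with 3 ∣? n
... | yes (divides m e) = ⊥-elim (false≢true (trans (sym (trans (at U3z m) (𝟘-at m))) (trans (cong z (sym (trans e (*-comm m 3)))) t)))
... | no nd = go (Θ-true n (trans (sym (at F≋Θ n)) (trans (sym (trans (+-at F β n) (trans (cong (F n xor_) (V-non 3 G n (λ m e → nd (divides m (trans e (*-comm 3 m)))))) (xor-identityʳ (F n))))) t)))
  where
  go : (∃ λ a → odd a ≡ true × n ≡ a * a) → n % 3 ≡ 1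
  go (a , _ , e) = trans (cong (_% 3) e) (trans (%-distribˡ-* a a 3) (h (a % 3) refl (m%n<n a 3)))
    where h : ∀ k → a % 3 ≡ k → k < 3 → ((a % 3) * (a % 3)) % 3 ≡ 1
          h 0 q _ = ⊥-elim (nd (divides (a / 3 * a) (trans e (trans (cong (_* a) (trans (m≡m%n+[m/n]*n a 3) (cong (_+ a / 3 * 3) q))) (trans (*-assoc (a / 3) 3 a) (trans (cong (a / 3 *_) (*-comm 3 a)) (sym (*-assoc (a / 3) a 3))))))))
          h 1 q _ = cong (λ x → (x * x) % 3) q
          h 2 q _ = cong (λ x → (x * x) % 3) q
          h (suc (suc (suc k))) q (s≤s (s≤s (s≤s ())))

Cl-z² : Cl 2 (z · z)
Cl-z² = Cl-* Cl-z Cl-z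

z5G : z ^ₛ 5 ≋ (z · z) · G
z5G = ring (z ∷ []) (X0 ↑ 5) ((X0 ⊗ X0) ⊗ X0 ↑ 3) refl ⟫ *-cong ≋-refl z³

Cl-G : Cl 0 G
Cl-G = Cl-≋ V3F (Cl-V3 F)

Cl-z5 : Cl 2 (z ^ₛ 5)
Cl-z5 = Cl-≋ (≋-sym z5G) (Cl-* Cl-z² Cl-G)

sform : Poly1 → Poly1 → Series
sform b c = z · ⟪ b ⟫ w ⊹ z ^ₛ 5 · ⟪ c ⟫ w

Cl-s1 : ∀ b → Cl 1 (z · ⟪ b ⟫ w)
Cl-s1 b = Cl-* Cl-z (Cl-w b)
Cl-s2 : ∀ c → Cl 2 (z ^ₛ 5 · ⟪ c ⟫ w)
Cl-s2 c = Cl-* Cl-z5 (Cl-w c)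

Lead-w : Lead 6 w
Lead-w = Lead-* Lead-G Lead-G

transc-φ : ∀ p → ⟪ p ⟫ F ≋ 𝟘 → isz 1 p ≡ true
transc-φ = transc Lead-F

-- w = V₃(F²) has order 6, so the claim is pulled back to F, of order 1, by injectivity of V₃ and of
-- squaring.
transc-w : ∀ p → ⟪ p ⟫ w ≋ 𝟘 → isz 1 p ≡ true
transc-w p e = transc-φ p (sq-inj (⟪⟫-sq p F ⟫ V-inj 3 (≋-sym (w-V3 p) ⟫ e ⟫ ≋-sym (V-𝟘 3)) ⟫ ≋-sym (*-zeroˡ' 𝟘)))

sform-zero : ∀ b c → sform b c ≋ 𝟘 → isz 1 b ≡ true × isz 1 c ≡ true
sform-zero b c e = transc-w b (·-domain' Lead-z (*-comm' _ z ⟫ e1)) , transc-w c (·-domain' (Lead-^ 5 Lead-z) (*-comm' _ _ ⟫ ≋-sym (+-idˡ _) ⟫ +-cong (≋-sym e1) ≋-refl ⟫ e))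
  where e1 : z · ⟪ b ⟫ w ≋ 𝟘
        e1 = Cl-split (λ ()) (Cl-s1 b) (Cl-s2 c) e

-- Deletes the exponents divisible by 3. It is linear over F₂[w] because w is a series in x³.
π : Series → Series
π f = f ⊹ V 3 (U 3 f)

π-cong : ∀ {f g} → f ≋ g → π f ≋ π g
π-cong e = +-cong e (V-cong 3 (U-cong 3 e))
π-+ : ∀ f g → π (f ⊹ g) ≋ π f ⊹ π g
π-+ f g = +-cong ≋-refl (V-cong 3 (U-+ 3 f g) ⟫ V-+ 3 _ _) ⟫ +-swap' _ _ _ _
π-w : ∀ p g → π (⟪ p ⟫ w · g) ≋ ⟪ p ⟫ w · π g
π-w p g = +-cong ≋-refl (V-cong 3 (U-cong 3 (*-cong (w-V3 p) ≋-refl) ⟫ U-V· 3 _ g) ⟫ V-* 3 _ _ ⟫ *-cong (≋-sym (w-V3 p)) ≋-refl) ⟫ ≋-sym (*-distˡ _ _ _)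

U3-w : ∀ p g → U 3 (⟪ p ⟫ w · g) ≋ ⟪ p ⟫ φ · U 3 g
U3-w p g = U-cong 3 (*-cong (w-V3 p) ≋-refl) ⟫ U-V· 3 _ g

U3FFG : U 3 ((F · F) · G) ≋ F · (G · G)
U3FFG = U-cong 3 (*-comm' _ _ ⟫ *-cong (≋-sym V3F) ≋-refl) ⟫ U-V· 3 F _ ⟫ *-cong ≋-refl (U3-V2 F ⟫ *-cong U3F U3F)

π-G : π G ≋ 𝟘
π-G = +-cong ≋-refl (V-cong 3 U3G ⟫ V3F) ⟫ +-self G
π-F : π F ≋ z
π-F = +-cong ≋-refl (V-cong 3 U3F)
π-FFG : π ((F · F) · G) ≋ z ^ₛ 5
π-FFG = +-cong ≋-refl (V-cong 3 U3FFG ⟫ V-* 3 F _ ⟫ *-cong V3F (V-* 3 G G)) ⟫ ring (F ∷ G ∷ β ∷ []) ((X0 ⊗ X0) ⊗ X1 ⊕ X1 ⊗ (X2 ⊗ X2)) (((X0 ⊕ X2) ⊗ (X0 ⊕ X2)) ⊗ X1) refl ⟫ ≋-sym z5G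

π-nform : ∀ a b c → π (nform a b c) ≋ sform b c
π-nform a b c = π-+ _ _ ⟫ +-cong (π-+ _ _ ⟫ +-cong (π-w a G ⟫ *-cong ≋-refl π-G ⟫ *-zeroʳ' _) (π-w b F ⟫ *-cong ≋-refl π-F ⟫ *-comm' _ _) ⟫ +-idˡ _)
   (π-w c _ ⟫ *-cong ≋-refl π-FFG ⟫ *-comm' _ _)

-- Expand F = z + β. The mixed terms vanish since U₃ kills z and z²; z³ = G contributes F, and β³ =
-- V₃(G³) contributes G³.
U3F3 : U 3 (F ^ₛ 3) ≋ F ⊹ G ^ₛ 3
U3F3 = U-cong 3 (ring (F ∷ β ∷ []) (X0 ↑ 3) ((X0 ⊕ X1) ↑ 3 ⊕ (X1 ⊗ ((X0 ⊕ X1) ⊗ (X0 ⊕ X1)) ⊕ ((X1 ⊗ X1) ⊗ (X0 ⊕ X1) ⊕ X1 ↑ 3))) refl)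
  ⟫ U-+ 3 _ _ ⟫ +-cong (U-cong 3 z³ ⟫ U3G) (U-+ 3 _ _ ⟫ +-cong (U-V· 3 G _ ⟫ *-cong ≋-refl (U3-V2 z ⟫ *-cong U3z U3z ⟫ *-zeroˡ' 𝟘) ⟫ *-zeroʳ' G)
     (U-+ 3 _ _ ⟫ +-cong (U-cong 3 (*-cong (≋-sym (V-* 3 G G)) ≋-refl) ⟫ U-V· 3 _ z ⟫ *-cong ≋-refl U3z ⟫ *-zeroʳ' _) (U-cong 3 (≋-sym (V-^ 3 G 3)) ⟫ UV 3 _) ⟫ +-idˡ _) ⟫ +-idˡ _)

u-F : F ≋ uₛ · ((r ⊹ 𝟙) · (r ⊹ 𝟙))
u-F = F-r ⟫ ring (r ∷ []) (ExF X0) ((X0 ⊗ X0 ⊕ X0) ⊗ ((X0 ⊕ on) ⊗ (X0 ⊕ on))) refl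
u-G : G ≋ uₛ · (r · r)
u-G = G-r ⟫ ring (r ∷ []) (ExG X0) ((X0 ⊗ X0 ⊕ X0) ⊗ (X0 ⊗ X0)) refl

Lead-u : Lead 1 uₛ
Lead-u = Low-+ (Low-*ˡ r (proj₁ Lead-r)) (proj₁ Lead-r) , trans (+-at _ _ 1) (cong₂ _xor_ (proj₁ (Lead-* Lead-r Lead-r) 1 (s≤s (s≤s z≤n))) (proj₂ Lead-r))

usq-zero : ∀ {f} → uₛ · (f · f) ≋ 𝟘 → f ≋ 𝟘
usq-zero e = sq-inj (·-domain' Lead-u (*-comm' _ _ ⟫ e) ⟫ ≋-sym (*-zeroˡ' 𝟘))

Degr-u : Degr 2 uₛ
Degr-u = Deg-+< (Deg-* Deg-t Deg-t) Deg-t ≤-refl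
Degr-r1 : Degr 1 (r ⊹ 𝟙)
Degr-r1 = Deg-+< Deg-t Deg-𝟙 ≤-refl
Degr-F : Degr 4 F
Degr-F = Deg-≋ (≋-sym F-r) (Deg-* Deg-t (Deg-^ 3 Degr-r1))

4≢ : ∀ a m n → a < 4 → 1 ≤ a → a + 4 * m ≢ 4 * n
4≢ a m n l l' e = h (trans (sym (trans (cong (λ x → (a + x) % 4) (*-comm 4 m)) (trans ([m+kn]%n≡m%n a m 4) (m<n⇒m%n≡m l)))) (trans (cong (_% 4) e) (trans (cong (_% 4) (*-comm 4 n)) (m*n%n≡0 n 4))))
  where h : a ≢ 0
        h refl = <-irrefl refl l'

-- Exponents congruent to 2 modulo 3 yield F e(F²) + G d(F²) = 0. With F = u (r + 1)² and G = u r²,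
-- square roots give r (e + d)(F) + e(F) = 0. Degrees in r are 1 modulo 4 in one term and 0 in the
-- other, so both vanish.
no-F3 : ∀ a b c d b' c' → π (mform a b c d) ≋ sform b' c' → ⟪ d ⟫ w ≋ 𝟘
no-F3 a b c d b' c' e = isz-⟪⟫ d w (transc-φ d dF)
  where
  ee : Poly1
  ee = c ⊞ c'
  πd : π (⟪ d ⟫ w · F ^ₛ 3) ≋ ⟪ d ⟫ w · ((z · z) · β ⊹ z · (β · β))
  πd = π-w d _ ⟫ *-cong ≋-refl (+-cong ≋-refl (V-cong 3 U3F3 ⟫ V-+ 3 _ _ ⟫ +-cong V3F (V-^ 3 G 3))
      ⟫ +-cong ≋-refl (+-cong (≋-sym z³) ≋-refl) ⟫ ring (F ∷ β ∷ []) (X0 ↑ 3 ⊕ ((X0 ⊕ X1) ↑ 3 ⊕ X1 ↑ 3)) (((X0 ⊕ X1) ⊗ (X0 ⊕ X1)) ⊗ X1 ⊕ (X0 ⊕ X1) ⊗ (X1 ⊗ X1)) refl)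
  sum0 : (z · z) · (G · (⟪ c ⟫ w ⊹ ⟪ c' ⟫ w) ⊹ β · ⟪ d ⟫ w) ⊹ z · ((⟪ b ⟫ w ⊹ ⟪ b' ⟫ w) ⊹ (β · β) · ⟪ d ⟫ w) ≋ 𝟘
  sum0 = ring (z ∷ G ∷ β ∷ ⟪ b ⟫ w ∷ ⟪ b' ⟫ w ∷ ⟪ c ⟫ w ∷ ⟪ c' ⟫ w ∷ ⟪ d ⟫ w ∷ [])
      ((X0 ⊗ X0) ⊗ (X1 ⊗ (X5 ⊕ X6) ⊕ X2 ⊗ X7) ⊕ X0 ⊗ ((X3 ⊕ X4) ⊕ (X2 ⊗ X2) ⊗ X7))
      ((((X0 ⊗ X3) ⊕ (((X0 ⊗ X0) ⊗ X1) ⊗ X5)) ⊕ X7 ⊗ ((X0 ⊗ X0) ⊗ X2 ⊕ X0 ⊗ (X2 ⊗ X2))) ⊕ ((X0 ⊗ X4) ⊕ (((X0 ⊗ X0) ⊗ X1) ⊗ X6))) refl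
    ⟫ +-cong0' (+-cong (+-cong ≋-refl (*-cong (≋-sym z5G) ≋-refl) ⟫ ≋-sym (π-nform a b c)) (≋-sym πd) ⟫ ≋-sym (π-+ _ _) ⟫ e ⟫ +-cong ≋-refl (*-cong z5G ≋-refl))
  cl2 : Cl 2 ((z · z) · (G · (⟪ c ⟫ w ⊹ ⟪ c' ⟫ w) ⊹ β · ⟪ d ⟫ w))
  cl2 = Cl-* Cl-z² (Cl-+ (Cl-* Cl-G (Cl-+ (Cl-w c) (Cl-w c'))) (Cl-* (Cl-V3 G) (Cl-w d)))
  cl1 : Cl 1 (z · ((⟪ b ⟫ w ⊹ ⟪ b' ⟫ w) ⊹ (β · β) · ⟪ d ⟫ w))
  cl1 = Cl-* Cl-z (Cl-+ (Cl-+ (Cl-w b) (Cl-w b')) (Cl-* (Cl-* (Cl-V3 G) (Cl-V3 G)) (Cl-w d)))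
  Ge : F · ⟪ ee ⟫ φ ⊹ G · ⟪ d ⟫ φ ≋ 𝟘
  Ge = V-inj 3 (V-+ 3 _ _ ⟫ +-cong (V-* 3 _ _ ⟫ *-cong V3F (≋-sym (w-V3 ee) ⟫ ⟪⟫-+ c c' w)) (V-* 3 _ _ ⟫ *-cong ≋-refl (≋-sym (w-V3 d)))
     ⟫ ·-domain' (Lead-* Lead-z Lead-z) (*-comm' _ _ ⟫ Cl-split (λ ()) cl2 cl1 sum0) ⟫ ≋-sym (V-𝟘 3))
  lin : r · ⟪ ee ⊞ d ⟫ F ⊹ ⟪ ee ⟫ F ≋ 𝟘
  lin = *-cong ≋-refl (⟪⟫-+ ee d F) ⟫' usq-zero (ring (uₛ ∷ r ∷ ⟪ ee ⟫ F ∷ ⟪ d ⟫ F ∷ []) (X0 ⊗ ((X1 ⊗ (X2 ⊕ X3) ⊕ X2) ⊗ (X1 ⊗ (X2 ⊕ X3) ⊕ X2)))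
       ((X0 ⊗ ((X1 ⊕ on) ⊗ (X1 ⊕ on))) ⊗ (X2 ⊗ X2) ⊕ (X0 ⊗ (X1 ⊗ X1)) ⊗ (X3 ⊗ X3)) refl
     ⟫ +-cong (*-cong (≋-sym u-F) (⟪⟫-sq ee F)) (*-cong (≋-sym u-G) (⟪⟫-sq d F)) ⟫ Ge)
    where _⟫'_ : ∀ {a b} → a ≋ b → b ⊹ ⟪ ee ⟫ F ≋ 𝟘 → a ⊹ ⟪ ee ⟫ F ≋ 𝟘
          p ⟫' q = +-cong p ≋-refl ⟫ q
  ed : ⟪ ee ⊞ d ⟫ F ≋ 𝟘 → ⟪ d ⟫ F ≋ 𝟘
  ed h = ring (⟪ ee ⟫ F ∷ ⟪ d ⟫ F ∷ []) X1 (X0 ⊕ (X0 ⊕ X1)) refl ⟫ +-cong e0 (≋-sym (⟪⟫-+ ee d F) ⟫ h) ⟫ +-idˡ 𝟘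
    where e0 : ⟪ ee ⟫ F ≋ 𝟘
          e0 = ≋-sym (+-idˡ _) ⟫ +-cong (≋-sym (*-zeroʳ' r) ⟫ *-cong ≋-refl (≋-sym h)) ≋-refl ⟫ lin
  cases : (isz 1 (ee ⊞ d) ≡ true ⊎ ∃ λ k → Degr (4 * k) (⟪ ee ⊞ d ⟫ F)) → (isz 1 ee ≡ true ⊎ ∃ λ k → Degr (4 * k) (⟪ ee ⟫ F)) → ⟪ d ⟫ F ≋ 𝟘
  cases (inj₁ h) _ = ed (isz-⟪⟫ (ee ⊞ d) F h)
  cases (inj₂ (k , D)) (inj₁ h) = ⊥-elim (Deg≠0 (Deg-* Deg-t D) (≋-sym (+-idʳ _) ⟫ +-cong ≋-refl (≋-sym (isz-⟪⟫ ee F h)) ⟫ lin))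
  cases (inj₂ (k , D)) (inj₂ (k' , D')) = ⊥-elim (4≢ 1 k k' (s≤s (s≤s z≤n)) (s≤s z≤n) (Deg-unique (Deg-* Deg-t D) (Deg-≋ (≋-sym (+-cong0 lin)) D')))
  dF : ⟪ d ⟫ F ≋ 𝟘
  dF = cases (⟪⟫-Deg (s≤s z≤n) Degr-F (ee ⊞ d)) (⟪⟫-Deg (s≤s z≤n) Degr-F ee)

-- Fixed points of U₃

comb-cong : ∀ {A B : ℕ → Series} p → (∀ i → A i ≋ B i) → comb A p ≋ comb B p
comb-cong [] h = ≋-refl
comb-cong (c ∷ p) h = +-cong (*-cong ≋-refl (h 0)) (comb-cong p (λ i → h (suc i)))

comb-+ˢ : ∀ (A B : ℕ → Series) p → comb (λ i → A i ⊹ B i) p ≋ comb A p ⊹ comb B p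
comb-+ˢ A B [] = ≋-sym (+-idˡ 𝟘)
comb-+ˢ A B (c ∷ p) = +-cong (*-distˡ _ _ _) (comb-+ˢ (A ∘ suc) (B ∘ suc) p) ⟫ +-swap' _ _ _ _

comb-scale : ∀ x (A : ℕ → Series) p → comb (λ i → x · A i) p ≋ x · comb A p
comb-scale x A [] = ≋-sym (*-zeroʳ' x)
comb-scale x A (c ∷ p) = +-cong (*-swap' _ _ _) (comb-scale x (A ∘ suc) p) ⟫ ≋-sym (*-distˡ _ _ _)

comb-⊞ : ∀ (A : ℕ → Series) p q → comb A (p ⊞ q) ≋ comb A p ⊹ comb A q
comb-⊞ A [] q = ≋-sym (+-idˡ _)
comb-⊞ A (c ∷ p) [] = ≋-sym (+-idʳ _)
comb-⊞ A (c ∷ p) (d ∷ q) = +-cong (*-cong (ev-add 0 c d _) ≋-refl ⟫ *-distʳ _ _ _) (comb-⊞ (A ∘ suc) p q) ⟫ +-swap' _ _ _ _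

mono : Bool → ℕ → Poly1
mono c zero = c ∷ []
mono c (suc n) = false ∷ mono c n

comb-mono : ∀ c (A : ℕ → Series) n → comb A (mono c n) ≋ b𝟙 c · A n
comb-mono c A zero = +-idʳ _
comb-mono c A (suc n) = +-cong (*-zeroˡ' _) (comb-mono c (A ∘ suc) n) ⟫ +-idˡ _

comb-shift : ∀ (A : ℕ → Series) p → comb A (false ∷ p) ≋ comb (A ∘ suc) p
comb-shift A p = +-cong (*-zeroˡ' _) ≋-refl ⟫ +-idˡ _

lin2 : Series → Series → ℕ → Series
lin2 x y i = x · G ^ₛ i ⊹ y · F ^ₛ i

comb-lin2 : ∀ x y p → comb (lin2 x y) p ≋ x · ⟪ p ⟫ G ⊹ y · ⟪ p ⟫ F
comb-lin2 x y p = comb-+ˢ _ _ p ⟫ +-cong (comb-scale x _ p ⟫ *-cong ≋-refl (comb-^ G p)) (comb-scale y _ p ⟫ *-cong ≋-refl (comb-^ F p))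

-- Square roots (divided by u) of the U₃-symmetrised monomials of N2.
A' B' C' D' : ℕ → Series
A' = lin2 r (r ⊹ 𝟙)
B' = lin2 (r ⊹ 𝟙) r
C' = lin2 (r · F) ((r ⊹ 𝟙) · G)
D' = lin2 ((r ⊹ 𝟙) · F) (r · G)

-- F and G are the roots of Y² + uY + u⁴.
lin2-rec : ∀ x y i → lin2 x y (suc (suc i)) ≋ uₛ · lin2 x y (suc i) ⊹ uₛ ^ₛ 4 · lin2 x y i
lin2-rec x y i = ring (x ∷ y ∷ F ∷ G ∷ F ^ₛ i ∷ G ^ₛ i ∷ []) (X0 ⊗ (X3 ⊗ (X3 ⊗ X5)) ⊕ X1 ⊗ (X2 ⊗ (X2 ⊗ X4)))
    ((X2 ⊕ X3) ⊗ (X0 ⊗ (X3 ⊗ X5) ⊕ X1 ⊗ (X2 ⊗ X4)) ⊕ (X2 ⊗ X3) ⊗ (X0 ⊗ X5 ⊕ X1 ⊗ X4)) refl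
  ⟫ +-cong (*-cong F+G ≋-refl) (*-cong (FG ⟫ ^-cong 4 F+G) ≋-refl)

A'0 : A' 0 ≋ 𝟙
A'0 = ring (r ∷ []) (X0 ⊗ on ⊕ (X0 ⊕ on) ⊗ on) on refl
A'1 : A' 1 ≋ uₛ · uₛ ⊹ uₛ
A'1 = +-cong (*-cong ≋-refl (*-cong G-r ≋-refl)) (*-cong ≋-refl (*-cong F-r ≋-refl)) ⟫ ring (r ∷ []) (X0 ⊗ (ExG X0 ⊗ on) ⊕ (X0 ⊕ on) ⊗ (ExF X0 ⊗ on)) ((X0 ⊗ X0 ⊕ X0) ⊗ (X0 ⊗ X0 ⊕ X0) ⊕ (X0 ⊗ X0 ⊕ X0)) refl
B'0 : B' 0 ≋ 𝟙
B'0 = ring (r ∷ []) ((X0 ⊕ on) ⊗ on ⊕ X0 ⊗ on) on refl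
B'1 : B' 1 ≋ uₛ · uₛ
B'1 = +-cong (*-cong ≋-refl (*-cong G-r ≋-refl)) (*-cong ≋-refl (*-cong F-r ≋-refl)) ⟫ ring (r ∷ []) ((X0 ⊕ on) ⊗ (ExG X0 ⊗ on) ⊕ X0 ⊗ (ExF X0 ⊗ on)) ((X0 ⊗ X0 ⊕ X0) ⊗ (X0 ⊗ X0 ⊕ X0)) refl

C'-A : ∀ i → C' i ≋ A' (suc i) ⊹ uₛ · A' i
C'-A i = ring (r ∷ F ∷ G ∷ F ^ₛ i ∷ G ^ₛ i ∷ []) ((X0 ⊗ X1) ⊗ X4 ⊕ ((X0 ⊕ on) ⊗ X2) ⊗ X3) ((X0 ⊗ (X2 ⊗ X4) ⊕ (X0 ⊕ on) ⊗ (X1 ⊗ X3)) ⊕ (X1 ⊕ X2) ⊗ (X0 ⊗ X4 ⊕ (X0 ⊕ on) ⊗ X3)) refl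
  ⟫ +-cong ≋-refl (*-cong F+G ≋-refl)
D'-B : ∀ i → D' i ≋ B' (suc i) ⊹ uₛ · B' i
D'-B i = ring (r ∷ F ∷ G ∷ F ^ₛ i ∷ G ^ₛ i ∷ []) (((X0 ⊕ on) ⊗ X1) ⊗ X4 ⊕ (X0 ⊗ X2) ⊗ X3) (((X0 ⊕ on) ⊗ (X2 ⊗ X4) ⊕ X0 ⊗ (X1 ⊗ X3)) ⊕ (X1 ⊕ X2) ⊗ ((X0 ⊕ on) ⊗ X4 ⊕ X0 ⊗ X3)) refl
  ⟫ +-cong ≋-refl (*-cong F+G ≋-refl)

open PolyIn uₛ renaming (In to Pu; In-≋ to Pu-≋; In-+ to Pu-+; In-* to Pu-*; In-𝟘 to Pu-𝟘; In-𝟙 to Pu-𝟙; In-t to Pu-u; In-^ to Pu-^; In-comb to Pu-comb) hiding (In-b) public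
module Du = Degree uₛ Lead-u

two-step : ∀ {P : ℕ → Set} → P 0 → P 1 → (∀ i → P i → P (suc i) → P (suc (suc i))) → ∀ i → P i
two-step p0 p1 st zero = p0
two-step p0 p1 st (suc zero) = p1
two-step p0 p1 st (suc (suc i)) = st i (two-step p0 p1 st i) (two-step p0 p1 st (suc i))

lin2-Pu : ∀ x y → Pu (lin2 x y 0) → Pu (lin2 x y 1) → ∀ i → Pu (lin2 x y i)
lin2-Pu x y p0 p1 = two-step p0 p1 (λ i p q → Pu-≋ (≋-sym (lin2-rec x y i)) (Pu-+ (Pu-* Pu-u q) (Pu-* (Pu-^ 4 Pu-u) p)))

-- The sequence is invariant under the exchange of r with r + 1, which exchanges F and G; membership
-- in F₂[u] follows explicitly from the recurrence.
A'-Pu : ∀ i → Pu (A' i)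
A'-Pu = lin2-Pu _ _ (Pu-≋ (≋-sym A'0) Pu-𝟙) (Pu-≋ (≋-sym A'1) (Pu-+ (Pu-* Pu-u Pu-u) Pu-u))
B'-Pu : ∀ i → Pu (B' i)
B'-Pu = lin2-Pu _ _ (Pu-≋ (≋-sym B'0) Pu-𝟙) (Pu-≋ (≋-sym B'1) (Pu-* Pu-u Pu-u))
C'-Pu : ∀ i → Pu (C' i)
C'-Pu i = Pu-≋ (≋-sym (C'-A i)) (Pu-+ (A'-Pu (suc i)) (Pu-* Pu-u (A'-Pu i)))
D'-Pu : ∀ i → Pu (D' i)
D'-Pu i = Pu-≋ (≋-sym (D'-B i)) (Pu-+ (B'-Pu (suc i)) (Pu-* Pu-u (B'-Pu i)))

module ADeg (t : Series) (lt : Lead 1 t) (k : ℕ) (k≥1 : 1 ≤ k) (du : Degree.Deg t lt k uₛ) where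
  private module D = Degree t lt
  A'-Deg : ∀ i → D.Deg (k * 2 * i) (A' i)
  A'-Deg = two-step (subst (λ n → D.Deg n (A' 0)) (sym (*-zeroʳ (k * 2))) (D.Deg-≋ (≋-sym A'0) D.Deg-𝟙))
    (subst (λ n → D.Deg n (A' 1)) e1 (D.Deg-≋ (≋-sym A'1) (D.Deg-+< (D.Deg-* du du) du (subst (k <_) refl (m<m+n k k≥1)))))
    (λ i p q → D.Deg-≋ (≋-sym (lin2-rec r (r ⊹ 𝟙) i ⟫ +-comm' _ _)) (subst (λ n → D.Deg n (uₛ ^ₛ 4 · A' i ⊹ uₛ · A' (suc i))) (e2 i) (D.Deg-+< (D.Deg-* (D.Deg-^ 4 du) p) (D.Deg-* du q) (e3 i))))
    where
    open +-*-Solver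
    e1 : k + k ≡ k * 2 * 1
    e1 = solve 1 (λ k → k :+ k := k :* con 2 :* con 1) refl k
    e2 : ∀ i → 4 * k + k * 2 * i ≡ k * 2 * suc (suc i)
    e2 i = solve 2 (λ k i → con 4 :* k :+ k :* con 2 :* i := k :* con 2 :* (con 2 :+ i)) refl k i
    e3 : ∀ i → k + k * 2 * suc i < 4 * k + k * 2 * i
    e3 i = subst (k + k * 2 * suc i <_) (solve 2 (λ k i → (k :+ k :* con 2 :* (con 1 :+ i)) :+ k := con 4 :* k :+ k :* con 2 :* i) refl k i) (m<m+n (k + k * 2 * suc i) k≥1)

module Ar = ADeg r Lead-r 2 (s≤s z≤n) Degr-u
module Au = ADeg uₛ Lead-u 1 (s≤s z≤n) Du.Deg-t

-- A'_i and u A'_i have degrees 2i and 2i + 1 in u, so every degree occurs once and leading terms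
-- can be removed in turn.
span : ∀ n {g} → Du.LT n g → ∃ λ e → ∃ λ c → g ≋ comb A' e ⊹ uₛ · comb A' c
span zero ([] , z≤n , p) = [] , [] , (p ⟫ ≋-sym (+-idˡ _ ⟫ *-zeroʳ' uₛ))
span (suc m) {g} l = go (even-or-odd m)
  where
  go : (∃ λ j → m ≡ 2 * j) ⊎ (∃ λ j → m ≡ suc (2 * j)) → ∃ λ e → ∃ λ c → g ≋ comb A' e ⊹ uₛ · comb A' c
  go (inj₁ (j , e)) = fin (Du.reduce m (subst (λ k → Du.Deg k (A' j)) (sym e) (Au.A'-Deg j)) l)
    where
    fin : (∃ λ b → Du.LT m (g ⊹ b𝟙 b · A' j)) → ∃ λ e → ∃ λ c → g ≋ comb A' e ⊹ uₛ · comb A' c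
    fin (b , l') = let (ee , c , q) = span m l' in ee ⊞ mono b j , c ,
      (ring (g ∷ b𝟙 b · A' j ∷ []) X0 ((X0 ⊕ X1) ⊕ X1) refl ⟫ +-cong q (≋-sym (comb-mono b A' j))
        ⟫ ring (comb A' ee ∷ uₛ · comb A' c ∷ comb A' (mono b j) ∷ []) ((X0 ⊕ X1) ⊕ X2) ((X0 ⊕ X2) ⊕ X1) refl ⟫ +-cong (≋-sym (comb-⊞ A' ee (mono b j))) ≋-refl)
  go (inj₂ (j , e)) = fin (Du.reduce m (subst (λ k → Du.Deg k (uₛ · A' j)) (sym e) (Du.Deg-* Du.Deg-t (Au.A'-Deg j))) l)
    where
    fin : (∃ λ b → Du.LT m (g ⊹ b𝟙 b · (uₛ · A' j))) → ∃ λ e → ∃ λ c → g ≋ comb A' e ⊹ uₛ · comb A' c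
    fin (b , l') = let (ee , c , q) = span m l' in ee , c ⊞ mono b j ,
      (ring (g ∷ b𝟙 b · (uₛ · A' j) ∷ []) X0 ((X0 ⊕ X1) ⊕ X1) refl ⟫ +-cong q (*-swap' _ _ _ ⟫ *-cong ≋-refl (≋-sym (comb-mono b A' j)))
        ⟫ ring (comb A' ee ∷ uₛ ∷ comb A' c ∷ comb A' (mono b j) ∷ []) ((X0 ⊕ X1 ⊗ X2) ⊕ X1 ⊗ X3) (X0 ⊕ X1 ⊗ (X2 ⊕ X3)) refl ⟫ +-cong ≋-refl (*-cong ≋-refl (≋-sym (comb-⊞ A' c (mono b j)))))

comb-C' : ∀ c → comb C' c ≋ comb A' (false ∷ c) ⊹ uₛ · comb A' c
comb-C' c = comb-cong c C'-A ⟫ comb-+ˢ _ _ c ⟫ +-cong (≋-sym (comb-shift A' c)) (comb-scale uₛ A' c)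

4≢2 : ∀ m n → 4 * m ≢ 2 + 4 * n
4≢2 m n e = 4≢ 2 n m (s≤s (s≤s (s≤s z≤n))) (s≤s z≤n) (sym e)

-- By C'_i = A'_(i + 1) + u A'_i the relation equates a combination of the A' with u times another.
-- Degrees in r are 0 modulo 4 on one side and 2 on the other.
comb-AC-zero : ∀ a c → comb A' a ⊹ comb C' c ≋ 𝟘 → isz 1 a ≡ true × isz 1 c ≡ true
comb-AC-zero a c e = k (comb-Deg A' 0 4 (s≤s z≤n) Ar.A'-Deg ac) (comb-Deg A' 0 4 (s≤s z≤n) Ar.A'-Deg c)
  where
  ac : Poly1
  ac = a ⊞ (false ∷ c)
  e' : comb A' ac ≋ uₛ · comb A' c
  e' = +-cong0 (+-cong (comb-⊞ A' a (false ∷ c)) ≋-refl ⟫ +-assoc' _ _ _ ⟫ +-cong ≋-refl (≋-sym (comb-C' c)) ⟫ e)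
  isz-⊞ : ∀ p q → isz 1 q ≡ true → isz 1 (p ⊞ q) ≡ true → isz 1 p ≡ true
  isz-⊞ [] q h h' = refl
  isz-⊞ (x ∷ p) [] h h' = h'
  isz-⊞ (false ∷ p) (false ∷ q) h h' = isz-⊞ p q h h'
  comb0 : ∀ p A → isz 1 p ≡ true → comb A p ≋ 𝟘
  comb0 [] A h = ≋-refl
  comb0 (false ∷ p) A h = +-cong (*-zeroˡ' _) (comb0 p (A ∘ suc) h) ⟫ +-idˡ 𝟘
  k : (isz 1 ac ≡ true ⊎ ∃ λ m → Degr (0 + 4 * m) (comb A' ac)) → (isz 1 c ≡ true ⊎ ∃ λ m → Degr (0 + 4 * m) (comb A' c)) → isz 1 a ≡ true × isz 1 c ≡ true
  k (inj₁ h) (inj₁ h') = isz-⊞ a (false ∷ c) h' h , h'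
  k (inj₁ h) (inj₂ (m , D)) = ⊥-elim (Deg≠0 (Deg-* Degr-u D) (≋-sym e' ⟫ comb0 ac A' h))
  k (inj₂ (m , D)) (inj₁ h) = ⊥-elim (Deg≠0 D (e' ⟫ *-cong ≋-refl (comb0 c A' h) ⟫ *-zeroʳ' uₛ))
  k (inj₂ (m , D)) (inj₂ (n , D')) = ⊥-elim (4≢2 m n (Deg-unique D (Deg-≋ (≋-sym e') (Deg-* Degr-u D'))))

swapf : Poly1 → Poly1 → Poly1 → Series
swapf a b c = ⟪ a ⟫ φ · F ⊹ ⟪ b ⟫ φ · G ⊹ ⟪ c ⟫ φ · (F · (G · G))

U3-nform : ∀ a b c → U 3 (nform a b c) ≋ swapf a b c
U3-nform a b c = U-+ 3 _ _ ⟫ +-cong (U-+ 3 _ _ ⟫ +-cong (U3-w a G ⟫ *-cong ≋-refl U3G) (U3-w b F ⟫ *-cong ≋-refl U3F)) (U3-w c _ ⟫ *-cong ≋-refl U3FFG)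

root-n : ∀ a b c → nform a b c ≋ uₛ · ((r · ⟪ a ⟫ G ⊹ (r ⊹ 𝟙) · ⟪ b ⟫ G ⊹ (r · F) · ⟪ c ⟫ G) · (r · ⟪ a ⟫ G ⊹ (r ⊹ 𝟙) · ⟪ b ⟫ G ⊹ (r · F) · ⟪ c ⟫ G))
root-n a b c = +-cong (+-cong (*-cong (≋-sym (⟪⟫-sq a G)) u-G) (*-cong (≋-sym (⟪⟫-sq b G)) u-F)) (*-cong (≋-sym (⟪⟫-sq c G)) (*-cong ≋-refl u-G))
  ⟫ ring (uₛ ∷ r ∷ F ∷ ⟪ a ⟫ G ∷ ⟪ b ⟫ G ∷ ⟪ c ⟫ G ∷ [])
     ((X3 ⊗ X3) ⊗ (X0 ⊗ (X1 ⊗ X1)) ⊕ (X4 ⊗ X4) ⊗ (X0 ⊗ ((X1 ⊕ on) ⊗ (X1 ⊕ on))) ⊕ (X5 ⊗ X5) ⊗ ((X2 ⊗ X2) ⊗ (X0 ⊗ (X1 ⊗ X1))))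
     (X0 ⊗ ((X1 ⊗ X3 ⊕ (X1 ⊕ on) ⊗ X4 ⊕ (X1 ⊗ X2) ⊗ X5) ⊗ (X1 ⊗ X3 ⊕ (X1 ⊕ on) ⊗ X4 ⊕ (X1 ⊗ X2) ⊗ X5))) refl

root-s : ∀ a b c → swapf a b c ≋ uₛ · (((r ⊹ 𝟙) · ⟪ a ⟫ F ⊹ r · ⟪ b ⟫ F ⊹ ((r ⊹ 𝟙) · G) · ⟪ c ⟫ F) · ((r ⊹ 𝟙) · ⟪ a ⟫ F ⊹ r · ⟪ b ⟫ F ⊹ ((r ⊹ 𝟙) · G) · ⟪ c ⟫ F))
root-s a b c = +-cong (+-cong (*-cong (≋-sym (⟪⟫-sq a F)) u-F) (*-cong (≋-sym (⟪⟫-sq b F)) u-G)) (*-cong (≋-sym (⟪⟫-sq c F)) (*-cong u-F ≋-refl))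
  ⟫ ring (uₛ ∷ r ∷ G ∷ ⟪ a ⟫ F ∷ ⟪ b ⟫ F ∷ ⟪ c ⟫ F ∷ [])
     ((X3 ⊗ X3) ⊗ (X0 ⊗ ((X1 ⊕ on) ⊗ (X1 ⊕ on))) ⊕ (X4 ⊗ X4) ⊗ (X0 ⊗ (X1 ⊗ X1)) ⊕ (X5 ⊗ X5) ⊗ ((X0 ⊗ ((X1 ⊕ on) ⊗ (X1 ⊕ on))) ⊗ (X2 ⊗ X2)))
     (X0 ⊗ (((X1 ⊕ on) ⊗ X3 ⊕ X1 ⊗ X4 ⊕ ((X1 ⊕ on) ⊗ X2) ⊗ X5) ⊗ ((X1 ⊕ on) ⊗ X3 ⊕ X1 ⊗ X4 ⊕ ((X1 ⊕ on) ⊗ X2) ⊗ X5))) refl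

symm : Poly1 → Poly1 → Poly1 → Series
symm a b c = comb A' a ⊹ comb B' b ⊹ comb C' c

symm-sq : ∀ a b c → nform a b c ⊹ swapf a b c ≋ uₛ · (symm a b c · symm a b c)
symm-sq a b c = +-cong (root-n a b c) (root-s a b c) ⟫ ring (uₛ ∷ r ⊹ 𝟙 ∷ r ∷ F ∷ G ∷ ⟪ a ⟫ G ∷ ⟪ b ⟫ G ∷ ⟪ c ⟫ G ∷ ⟪ a ⟫ F ∷ ⟪ b ⟫ F ∷ ⟪ c ⟫ F ∷ [])
    (X0 ⊗ (n ⊗ n) ⊕ X0 ⊗ (s ⊗ s)) (X0 ⊗ (m ⊗ m)) refl
  ⟫ *-cong ≋-refl (*-cong q q)
  where
  n s m : Ex
  n = X2 ⊗ X5 ⊕ X1 ⊗ X6 ⊕ (X2 ⊗ X3) ⊗ X7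
  s = X1 ⊗ var 8 ⊕ X2 ⊗ var 9 ⊕ (X1 ⊗ X4) ⊗ var 10
  m = (X2 ⊗ X5 ⊕ X1 ⊗ var 8) ⊕ (X1 ⊗ X6 ⊕ X2 ⊗ var 9) ⊕ ((X2 ⊗ X3) ⊗ X7 ⊕ (X1 ⊗ X4) ⊗ var 10)
  q = +-cong (+-cong (≋-sym (comb-lin2 r (r ⊹ 𝟙) a)) (≋-sym (comb-lin2 (r ⊹ 𝟙) r b))) (≋-sym (comb-lin2 (r · F) ((r ⊹ 𝟙) · G) c))

-- The defect of invariance under U₃ is u times the square of `symm a b c`. It vanishes when the
-- combination of A' and C' given by a and c equals `comb B' b` in F₂[u], and `span` solves this.
K-exists : ∀ b → ∃ λ a → ∃ λ c → U 3 (nform a b c) ≋ nform a b c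
K-exists b = go (Pu-comb B' b B'-Pu)
  where
  go : Pu (comb B' b) → ∃ λ a → ∃ λ c → U 3 (nform a b c) ≋ nform a b c
  go (P , p) = go' (span (length P) (P , ≤-refl , p))
    where
    go' : (∃ λ e → ∃ λ c → comb B' b ≋ comb A' e ⊹ uₛ · comb A' c) → ∃ λ a → ∃ λ c → U 3 (nform a b c) ≋ nform a b c
    go' (e , c , q) = a , c , (U3-nform a b c ⟫ ≋-sym (+-cong0 (symm-sq a b c ⟫ *-cong ≋-refl (*-cong s0 s0 ⟫ *-zeroˡ' 𝟘) ⟫ *-zeroʳ' uₛ)))
      where
      a : Poly1
      a = e ⊞ (false ∷ c)
      s0 : symm a b c ≋ 𝟘
      s0 = +-cong (+-cong (comb-⊞ A' e (false ∷ c)) q) (comb-C' c)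
         ⟫ ring (comb A' e ∷ comb A' (false ∷ c) ∷ uₛ · comb A' c ∷ []) (((X0 ⊕ X1) ⊕ (X0 ⊕ X2)) ⊕ (X1 ⊕ X2)) ze refl

K-inj : ∀ a b c → U 3 (nform a b c) ≋ nform a b c → isz 1 b ≡ true → nform a b c ≋ 𝟘
K-inj a b c e hb = go (comb-AC-zero a c (+-cong (≋-sym (+-idʳ _) ⟫ +-cong ≋-refl (≋-sym b0)) ≋-refl ⟫ usq-zero (≋-sym (symm-sq a b c) ⟫ +-cong0' (≋-sym e ⟫ U3-nform a b c))))
  where
  b0 : comb B' b ≋ 𝟘
  b0 = comb-lin2 (r ⊹ 𝟙) r b ⟫ +-cong (*-cong ≋-refl (isz-⟪⟫ b G hb) ⟫ *-zeroʳ' _) (*-cong ≋-refl (isz-⟪⟫ b F hb) ⟫ *-zeroʳ' _) ⟫ +-idˡ 𝟘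
  zz : ∀ p g → isz 1 p ≡ true → ⟪ p ⟫ w · g ≋ 𝟘
  zz p g h = *-cong (isz-⟪⟫ p w h) ≋-refl ⟫ *-zeroˡ' g
  go : isz 1 a ≡ true × isz 1 c ≡ true → nform a b c ≋ 𝟘
  go (ha , hc) = +-cong (+-cong (zz a _ ha) (zz b _ hb) ⟫ +-idˡ 𝟘) (zz c _ hc) ⟫ +-idˡ 𝟘

-- If F³ occurred, invariance under U₃ would put (r + 1) d(F) into F₂[u]; but its degree in r is
-- odd, while nonzero elements of F₂[u] have even degree.
K-N2 : ∀ {f} → Z2 f → U 2 f ≋ 𝟘 → U 3 f ≋ f → ∃ λ a → ∃ λ b → ∃ λ c → f ≋ nform a b c
K-N2 {f} zf e2 e3 = go (odd-mform zf e2)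
  where
  go : (∃ λ a → ∃ λ b → ∃ λ c → ∃ λ d → f ≋ mform a b c d) → ∃ λ a → ∃ λ b → ∃ λ c → f ≋ nform a b c
  go (a , b , c , d , e) = a , b , c , (e ⟫ +-cong ≋-refl (*-cong (isz-⟪⟫ d w dz) ≋-refl ⟫ *-zeroˡ' _) ⟫ +-idʳ _)
    where
    rd gd : Series
    rd = (r ⊹ 𝟙) · ⟪ d ⟫ F
    gd = symm a b c ⊹ comb D' d
    eq : uₛ · ((gd ⊹ rd) · (gd ⊹ rd)) ≋ 𝟘
    eq = *-cong ≋-refl (*-cong (+-cong (+-cong ≋-refl (comb-lin2 _ _ d)) ≋-refl) (+-cong (+-cong ≋-refl (comb-lin2 _ _ d)) ≋-refl))
      ⟫ ring (uₛ ∷ r ⊹ 𝟙 ∷ r ∷ F ∷ G ∷ ⟪ d ⟫ G ∷ ⟪ d ⟫ F ∷ symm a b c ∷ [])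
        (X0 ⊗ (m ⊗ m)) (X0 ⊗ (X7 ⊗ X7) ⊕ ((X5 ⊗ X5) ⊗ ((X0 ⊗ (X1 ⊗ X1)) ⊗ (X3 ⊗ X3)) ⊕ (X6 ⊗ X6) ⊗ (X0 ⊗ (X1 ⊗ X1) ⊕ (X0 ⊗ (X2 ⊗ X2)) ⊗ (X4 ⊗ X4)))) refl
      ⟫ +-cong (≋-sym (symm-sq a b c)) (+-cong (*-cong (⟪⟫-sq d G) (*-cong (≋-sym u-F) ≋-refl ⟫ ring (F ∷ []) (X0 ⊗ (X0 ⊗ X0)) (X0 ↑ 3) refl))
          (*-cong (⟪⟫-sq d F) (+-cong (≋-sym u-F) (*-cong (≋-sym u-G) ≋-refl ⟫ ring (G ∷ []) (X0 ⊗ (X0 ⊗ X0)) (X0 ↑ 3) refl))))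
      ⟫ ring (nform a b c ∷ swapf a b c ∷ ⟪ d ⟫ w · F ^ₛ 3 ∷ ⟪ d ⟫ φ · (F ⊹ G ^ₛ 3) ∷ []) ((X0 ⊕ X1) ⊕ (X2 ⊕ X3)) ((X0 ⊕ X2) ⊕ (X1 ⊕ X3)) refl
      ⟫ +-cong0' (≋-sym e ⟫ ≋-sym e3 ⟫ U-cong 3 e ⟫ U-+ 3 _ _ ⟫ +-cong (U3-nform a b c) (U3-w d _ ⟫ *-cong ≋-refl U3F3))
      where m : Ex
            m = (X7 ⊕ ((X1 ⊗ X3) ⊗ X5 ⊕ (X2 ⊗ X4) ⊗ X6)) ⊕ X1 ⊗ X6
    rd-u : Pu rd
    rd-u = Pu-≋ (+-cong0 (usq-zero eq)) (Pu-+ (Pu-+ (Pu-+ (Pu-comb A' a A'-Pu) (Pu-comb B' b B'-Pu)) (Pu-comb C' c C'-Pu)) (Pu-comb D' d D'-Pu))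
    dz : isz 1 d ≡ true
    dz = k rd-u (⟪⟫-Deg (s≤s z≤n) Degr-F d)
      where
      k : Pu rd → (isz 1 d ≡ true ⊎ ∃ λ m → Degr (4 * m) (⟪ d ⟫ F)) → isz 1 d ≡ true
      k _ (inj₁ h) = h
      k (P , p) (inj₂ (m , D)) = ⊥-elim (k' (⟪⟫-Deg (s≤s z≤n) Degr-u P))
        where
        k' : (isz 1 P ≡ true ⊎ ∃ λ n → Degr (2 * n) (⟪ P ⟫ uₛ)) → ⊥
        k' (inj₁ h) = Deg≠0 (Deg-* Degr-r1 D) (p ⟫ isz-⟪⟫ P uₛ h)
        k' (inj₂ (n , D')) = false≢true (trans (sym (odd-2 n)) (trans (cong odd (sym (Deg-unique (Deg-* Degr-r1 D) (Deg-≋ (≋-sym p) D')))) (cong not (trans (cong odd (*-assoc 2 2 m)) (odd-2 (2 * m))))))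

U2-nform : ∀ a b c → U 2 (nform a b c) ≋ 𝟘
U2-nform a b c = U-cong 2 (root-n a b c) ⟫ U2-usq _

Z2-nform : ∀ a b c → Z2 (nform a b c)
Z2-nform a b c = Z2-+ (Z2-+ (Z2-* (Z2-⟪⟫ a zw) Z2-G) (Z2-* (Z2-⟪⟫ b zw) Z2-F)) (Z2-* (Z2-⟪⟫ c zw) (Z2-* (Z2-* Z2-F Z2-F) Z2-G))
  where zw = Z2-* Z2-G Z2-G

-- A criterion that T₅ and T₇ visibly respect; it shows that they preserve N2.
N2-exact : ∀ {f} b' c' → Z2 f → U 2 f ≋ 𝟘 → π f ≋ sform b' c' → ∃ λ a → ∃ λ b → ∃ λ c → f ≋ nform a b c
N2-exact {f} b' c' zf e ep = go (odd-mform zf e)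
  where
  go : (∃ λ a → ∃ λ b → ∃ λ c → ∃ λ d → f ≋ mform a b c d) → ∃ λ a → ∃ λ b → ∃ λ c → f ≋ nform a b c
  go (a , b , c , d , q) = a , b , c , (q ⟫ +-cong ≋-refl (*-cong (no-F3 a b c d b' c' (≋-sym (π-cong q) ⟫ ep)) ≋-refl ⟫ *-zeroˡ' _) ⟫ +-idʳ _)

-- Polynomials in X read as power series, and linear recurrences

Xv : Series
Xv n = n ≡ᵇ 1

X-zero : ∀ g → (Xv · g) 0 ≡ false
X-zero g = mul-zero Xv g
X-suc : ∀ g n → (Xv · g) (suc n) ≡ g n
X-suc g n = trans (mul-suc Xv g n) (at (*-cong {tl Xv} {𝟙} (mk (λ { zero → sym 𝟙-zero ; (suc n) → sym (𝟙-suc n) })) (≋-refl {g}) ⟫ *-idˡ g) n)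

Xq : ℕ → Series
Xq zero = Xv
Xq (suc i) = Xq i · Xq i

dbl : ∀ i t → 2 ^ i + (2 ^ i + t) ≡ 2 ^ suc i + t
dbl i t = trans (sym (+-assoc (2 ^ i) (2 ^ i) t)) (cong (λ z → 2 ^ i + z + t) (sym (+-identityʳ (2 ^ i))))

Xq-true : ∀ i g t → (Xq i · g) t ≡ true → ∃ λ t' → t ≡ 2 ^ i + t' × g t' ≡ true
Xq-true zero g zero e = ⊥-elim (false≢true (trans (sym (X-zero g)) e))
Xq-true zero g (suc t) e = t , refl , trans (sym (X-suc g t)) e
Xq-true (suc i) g t e =
  let (t₁ , e₁ , h₁) = Xq-true i (Xq i · g) t (trans (sym (at (*-assoc' (Xq i) (Xq i) g) t)) e)
      (t₂ , e₂ , h₂) = Xq-true i g t₁ h₁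
  in t₂ , trans e₁ (trans (cong (2 ^ i +_) e₂) (dbl i t₂)) , h₂

look : Poly1 → ℕ → Bool
look [] t = false
look (c ∷ p) zero = c
look (c ∷ p) (suc t) = look p t

look-ok : ∀ p t → ⟪ p ⟫ Xv t ≡ look p t
look-ok [] t = 𝟘-at t
look-ok (c ∷ p) t = trans (at (⟪⟫-∷ c p Xv) t) (trans (+-at _ _ t) (go t))
  where
  b0 : ∀ c → b𝟙 c 0 ≡ c
  b0 true = 𝟙-zero
  b0 false = 𝟘-at 0
  bs : ∀ c t → b𝟙 c (suc t) ≡ false
  bs true t = 𝟙-suc t
  bs false t = 𝟘-at (suc t)
  go : ∀ t → b𝟙 c t xor (Xv · ⟪ p ⟫ Xv) t ≡ look (c ∷ p) t
  go zero = trans (cong₂ _xor_ (b0 c) (X-zero _)) (xor-identityʳ c)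
  go (suc t) = trans (cong₂ _xor_ (bs c t) (X-suc _ t)) (look-ok p t)

allAt : (ℕ → Bool) → Poly1 → Bool
allAt P [] = true
allAt P (c ∷ p) = (not c ∨ P 0) ∧ allAt (P ∘ suc) p

allAt-ok : ∀ P p → allAt P p ≡ true → ∀ t → look p t ≡ true → P t ≡ true
allAt-ok P (true ∷ p) h zero e = proj₁ (∧-true h)
allAt-ok P (c ∷ p) h (suc t) e = allAt-ok (P ∘ suc) p (proj₂ (∧-true {not c ∨ P 0} h)) t e

allB : ℕ → (ℕ → Bool) → Bool
allB zero P = true
allB (suc n) P = P n ∧ allB n P

allB-ok : ∀ n P → allB n P ≡ true → ∀ k → k < n → P k ≡ true
allB-ok (suc n) P h k l = go (k ≟ n)
  where go : Dec (k ≡ n) → P k ≡ true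
        go (yes refl) = proj₁ (∧-true h)
        go (no ne) = allB-ok n P (proj₂ (∧-true {P n} h)) k (≤∧≢⇒< (≤-pred l) ne)

eqP : Poly1 → Poly1 → Bool
eqP p q = isz 1 (p ⊞ q)

eqP-ok : ∀ p q f → eqP p q ≡ true → ⟪ p ⟫ f ≋ ⟪ q ⟫ f
eqP-ok p q f h = +-cong0 (≋-sym (⟪⟫-+ p q f) ⟫ isz-⟪⟫ (p ⊞ q) f h)

sh : ℕ → Poly1 → Poly1
sh zero p = p
sh (suc n) p = false ∷ sh n p

sh-ok : ∀ n p f → ⟪ sh n p ⟫ f ≋ f ^ₛ n · ⟪ p ⟫ f
sh-ok zero p f = ≋-sym (*-idˡ _)
sh-ok (suc n) p f = ⟪⟫-shift (sh n p) f ⟫ *-cong ≋-refl (sh-ok n p f) ⟫ ≋-sym (*-assoc' _ _ _)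

Seq : Set
Seq = ℕ → Series

-- The recurrences of T₇ and T₅ with respect to powers of w (a plays the role of w).
Rec7 Rec5 : Series → Seq → Set
Rec7 a f = ∀ n → f (8 + n) ≋ a ^ₛ 2 · f (2 + n) ⊹ (a · f (1 + n) ⊹ a ^ₛ 8 · f n)
Rec5 a f = ∀ n → f (6 + n) ≋ a ^ₛ 2 · f (4 + n) ⊹ (a ^ₛ 4 · f (2 + n) ⊹ (a · f (1 + n) ⊹ a ^ₛ 6 · f n))

-- The recurrences run on coefficient lists from a table of initial values, so that identities
-- between finitely many terms hold by evaluation.
rec7 rec5 : (ℕ → Poly1) → ℕ → Poly1
rec7 i (suc (suc (suc (suc (suc (suc (suc (suc n)))))))) = sh 2 (rec7 i (suc (suc n))) ⊞ (sh 1 (rec7 i (suc n)) ⊞ sh 8 (rec7 i n))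
rec7 i n = i n
rec5 i (suc (suc (suc (suc (suc (suc n)))))) = sh 2 (rec5 i (suc (suc (suc (suc n))))) ⊞ (sh 4 (rec5 i (suc (suc n))) ⊞ (sh 1 (rec5 i (suc n)) ⊞ sh 6 (rec5 i n)))
rec5 i n = i n

rec7-Rec : ∀ i f → Rec7 f (λ n → ⟪ rec7 i n ⟫ f)
rec7-Rec i f n = ⟪⟫-+ (sh 2 (rec7 i (2 + n))) (sh 1 (rec7 i (1 + n)) ⊞ sh 8 (rec7 i n)) f ⟫ +-cong (sh-ok 2 (rec7 i (2 + n)) f) (⟪⟫-+ (sh 1 (rec7 i (1 + n))) (sh 8 (rec7 i n)) f ⟫ +-cong (sh-ok 1 (rec7 i (1 + n)) f ⟫ *-cong (*-idʳ f) ≋-refl) (sh-ok 8 (rec7 i n) f))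

rec5-Rec : ∀ i f → Rec5 f (λ n → ⟪ rec5 i n ⟫ f)
rec5-Rec i f n = ⟪⟫-+ (sh 2 (rec5 i (4 + n))) (sh 4 (rec5 i (2 + n)) ⊞ (sh 1 (rec5 i (1 + n)) ⊞ sh 6 (rec5 i n))) f ⟫ +-cong (sh-ok 2 (rec5 i (4 + n)) f) (⟪⟫-+ (sh 4 (rec5 i (2 + n))) (sh 1 (rec5 i (1 + n)) ⊞ sh 6 (rec5 i n)) f ⟫ +-cong (sh-ok 4 (rec5 i (2 + n)) f)
   (⟪⟫-+ (sh 1 (rec5 i (1 + n))) (sh 6 (rec5 i n)) f ⟫ +-cong (sh-ok 1 (rec5 i (1 + n)) f ⟫ *-cong (*-idʳ f) ≋-refl) (sh-ok 6 (rec5 i n) f)))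

base-step : ∀ d {P : ℕ → Set} → (∀ n → n < d → P n) → (∀ m → (∀ k → k < d + m → P k) → P (d + m)) → ∀ n → P n
base-step d {P} b st n = go (suc n) n ≤-refl
  where
  go : ∀ B n → n < B → P n
  go (suc B) n l with n <? d
  ... | yes l8 = b n l8
  ... | no nl = subst P (m+[n∸m]≡n (≮⇒≥ nl)) (st (n ∸ d) (λ k lk → go B k (<-≤-trans (subst (k <_) (m+[n∸m]≡n (≮⇒≥ nl)) lk) (≤-pred l))))

uniq-rec7 : ∀ {a f g} → Rec7 a f → Rec7 a g → (∀ n → n < 8 → f n ≋ g n) → ∀ n → f n ≋ g n
uniq-rec7 {a} {f} {g} rf rg h = base-step 8 h (λ m ih → rf m ⟫ +-cong (*-cong ≋-refl (ih (2 + m) (+-monoˡ-< m (≤from 3 8 refl))))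
   (+-cong (*-cong ≋-refl (ih (1 + m) (+-monoˡ-< m (≤from 2 8 refl)))) (*-cong ≋-refl (ih m (+-monoˡ-< m (≤from 1 8 refl))))) ⟫ ≋-sym (rg m))

uniq-rec5 : ∀ {a f g} → Rec5 a f → Rec5 a g → (∀ n → n < 6 → f n ≋ g n) → ∀ n → f n ≋ g n
uniq-rec5 {a} {f} {g} rf rg h = base-step 6 h (λ m ih → rf m ⟫ +-cong (*-cong ≋-refl (ih (4 + m) (+-monoˡ-< m (≤from 5 6 refl)))) (+-cong (*-cong ≋-refl (ih (2 + m) (+-monoˡ-< m (≤from 3 6 refl))))
   (+-cong (*-cong ≋-refl (ih (1 + m) (+-monoˡ-< m (≤from 2 6 refl)))) (*-cong ≋-refl (ih m (+-monoˡ-< m (≤from 1 6 refl)))))) ⟫ ≋-sym (rg m))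

Rec7-+ : ∀ {a f g} → Rec7 a f → Rec7 a g → Rec7 a (λ n → f n ⊹ g n)
Rec7-+ {a} {f} {g} rf rg n = +-cong (rf n) (rg n) ⟫ ring (a ∷ f (2 + n) ∷ f (1 + n) ∷ f n ∷ g (2 + n) ∷ g (1 + n) ∷ g n ∷ [])
  ((X0 ↑ 2 ⊗ X1 ⊕ (X0 ⊗ X2 ⊕ X0 ↑ 8 ⊗ X3)) ⊕ (X0 ↑ 2 ⊗ X4 ⊕ (X0 ⊗ X5 ⊕ X0 ↑ 8 ⊗ X6))) (X0 ↑ 2 ⊗ (X1 ⊕ X4) ⊕ (X0 ⊗ (X2 ⊕ X5) ⊕ X0 ↑ 8 ⊗ (X3 ⊕ X6))) refl
Rec5-+ : ∀ {a f g} → Rec5 a f → Rec5 a g → Rec5 a (λ n → f n ⊹ g n)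
Rec5-+ {a} {f} {g} rf rg n = +-cong (rf n) (rg n) ⟫ ring (a ∷ f (4 + n) ∷ f (2 + n) ∷ f (1 + n) ∷ f n ∷ g (4 + n) ∷ g (2 + n) ∷ g (1 + n) ∷ g n ∷ [])
  ((X0 ↑ 2 ⊗ X1 ⊕ (X0 ↑ 4 ⊗ X2 ⊕ (X0 ⊗ X3 ⊕ X0 ↑ 6 ⊗ X4))) ⊕ (X0 ↑ 2 ⊗ X5 ⊕ (X0 ↑ 4 ⊗ X6 ⊕ (X0 ⊗ X7 ⊕ X0 ↑ 6 ⊗ var 8)))) (X0 ↑ 2 ⊗ (X1 ⊕ X5) ⊕ (X0 ↑ 4 ⊗ (X2 ⊕ X6) ⊕ (X0 ⊗ (X3 ⊕ X7) ⊕ X0 ↑ 6 ⊗ (X4 ⊕ var 8)))) refl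

Rec7-· : ∀ {a f} c → Rec7 a f → Rec7 a (λ n → c · f n)
Rec7-· {a} {f} c rf n = *-cong ≋-refl (rf n) ⟫ ring (a ∷ f (2 + n) ∷ f (1 + n) ∷ f n ∷ c ∷ []) (X4 ⊗ (X0 ↑ 2 ⊗ X1 ⊕ (X0 ⊗ X2 ⊕ X0 ↑ 8 ⊗ X3))) (X0 ↑ 2 ⊗ (X4 ⊗ X1) ⊕ (X0 ⊗ (X4 ⊗ X2) ⊕ X0 ↑ 8 ⊗ (X4 ⊗ X3))) refl
Rec5-· : ∀ {a f} c → Rec5 a f → Rec5 a (λ n → c · f n)
Rec5-· {a} {f} c rf n = *-cong ≋-refl (rf n) ⟫ ring (a ∷ f (4 + n) ∷ f (2 + n) ∷ f (1 + n) ∷ f n ∷ c ∷ []) (X5 ⊗ (X0 ↑ 2 ⊗ X1 ⊕ (X0 ↑ 4 ⊗ X2 ⊕ (X0 ⊗ X3 ⊕ X0 ↑ 6 ⊗ X4)))) (X0 ↑ 2 ⊗ (X5 ⊗ X1) ⊕ (X0 ↑ 4 ⊗ (X5 ⊗ X2) ⊕ (X0 ⊗ (X5 ⊗ X3) ⊕ X0 ↑ 6 ⊗ (X5 ⊗ X4)))) refl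

Rec7-sq : ∀ {a f} → Rec7 a f → Rec7 (a · a) (λ n → f n · f n)
Rec7-sq {a} {f} rf n = *-cong (rf n) (rf n) ⟫ ring (a ∷ f (2 + n) ∷ f (1 + n) ∷ f n ∷ []) ((X0 ↑ 2 ⊗ X1 ⊕ (X0 ⊗ X2 ⊕ X0 ↑ 8 ⊗ X3)) ⊗ (X0 ↑ 2 ⊗ X1 ⊕ (X0 ⊗ X2 ⊕ X0 ↑ 8 ⊗ X3)))
  ((X0 ⊗ X0) ↑ 2 ⊗ (X1 ⊗ X1) ⊕ ((X0 ⊗ X0) ⊗ (X2 ⊗ X2) ⊕ (X0 ⊗ X0) ↑ 8 ⊗ (X3 ⊗ X3))) refl
Rec5-sq : ∀ {a f} → Rec5 a f → Rec5 (a · a) (λ n → f n · f n)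
Rec5-sq {a} {f} rf n = *-cong (rf n) (rf n) ⟫ ring (a ∷ f (4 + n) ∷ f (2 + n) ∷ f (1 + n) ∷ f n ∷ []) ((X0 ↑ 2 ⊗ X1 ⊕ (X0 ↑ 4 ⊗ X2 ⊕ (X0 ⊗ X3 ⊕ X0 ↑ 6 ⊗ X4))) ⊗ (X0 ↑ 2 ⊗ X1 ⊕ (X0 ↑ 4 ⊗ X2 ⊕ (X0 ⊗ X3 ⊕ X0 ↑ 6 ⊗ X4))))
  ((X0 ⊗ X0) ↑ 2 ⊗ (X1 ⊗ X1) ⊕ ((X0 ⊗ X0) ↑ 4 ⊗ (X2 ⊗ X2) ⊕ ((X0 ⊗ X0) ⊗ (X3 ⊗ X3) ⊕ (X0 ⊗ X0) ↑ 6 ⊗ (X4 ⊗ X4)))) refl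

Rec7-2 : ∀ {a f} → Rec7 a f → ∀ n → f (16 + n) ≋ (a · a) ^ₛ 2 · f (4 + n) ⊹ ((a · a) · f (2 + n) ⊹ (a · a) ^ₛ 8 · f n)
Rec7-2 {a} {f} rf n = rf (8 + n) ⟫ +-cong (*-cong ≋-refl (rf (2 + n))) (+-cong (*-cong ≋-refl (rf (1 + n))) (*-cong ≋-refl (rf n)))
  ⟫ ring (a ∷ f (4 + n) ∷ f (3 + n) ∷ f (2 + n) ∷ f (1 + n) ∷ f n ∷ [])
    (X0 ↑ 2 ⊗ (X0 ↑ 2 ⊗ X1 ⊕ (X0 ⊗ X2 ⊕ X0 ↑ 8 ⊗ X3)) ⊕ (X0 ⊗ (X0 ↑ 2 ⊗ X2 ⊕ (X0 ⊗ X3 ⊕ X0 ↑ 8 ⊗ X4)) ⊕ X0 ↑ 8 ⊗ (X0 ↑ 2 ⊗ X3 ⊕ (X0 ⊗ X4 ⊕ X0 ↑ 8 ⊗ X5))))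
    ((X0 ⊗ X0) ↑ 2 ⊗ X1 ⊕ ((X0 ⊗ X0) ⊗ X3 ⊕ (X0 ⊗ X0) ↑ 8 ⊗ X5)) refl

Rec5-2 : ∀ {a f} → Rec5 a f → ∀ n → f (12 + n) ≋ (a · a) ^ₛ 2 · f (8 + n) ⊹ ((a · a) ^ₛ 4 · f (4 + n) ⊹ ((a · a) · f (2 + n) ⊹ (a · a) ^ₛ 6 · f n))
Rec5-2 {a} {f} rf n = rf (6 + n) ⟫ +-cong (*-cong ≋-refl (rf (4 + n))) (+-cong (*-cong ≋-refl (rf (2 + n))) (+-cong (*-cong ≋-refl (rf (1 + n))) (*-cong ≋-refl (rf n))))
  ⟫ ring (a ∷ f (8 + n) ∷ f (6 + n) ∷ f (5 + n) ∷ f (4 + n) ∷ f (3 + n) ∷ f (2 + n) ∷ f (1 + n) ∷ f n ∷ [])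
    (X0 ↑ 2 ⊗ (X0 ↑ 2 ⊗ X1 ⊕ (X0 ↑ 4 ⊗ X2 ⊕ (X0 ⊗ X3 ⊕ X0 ↑ 6 ⊗ X4))) ⊕ (X0 ↑ 4 ⊗ (X0 ↑ 2 ⊗ X2 ⊕ (X0 ↑ 4 ⊗ X4 ⊕ (X0 ⊗ X5 ⊕ X0 ↑ 6 ⊗ X6)))
      ⊕ (X0 ⊗ (X0 ↑ 2 ⊗ X3 ⊕ (X0 ↑ 4 ⊗ X5 ⊕ (X0 ⊗ X6 ⊕ X0 ↑ 6 ⊗ X7))) ⊕ X0 ↑ 6 ⊗ (X0 ↑ 2 ⊗ X4 ⊕ (X0 ↑ 4 ⊗ X6 ⊕ (X0 ⊗ X7 ⊕ X0 ↑ 6 ⊗ var 8))))))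
    ((X0 ⊗ X0) ↑ 2 ⊗ X1 ⊕ ((X0 ⊗ X0) ↑ 4 ⊗ X4 ⊕ ((X0 ⊗ X0) ⊗ X6 ⊕ (X0 ⊗ X0) ↑ 6 ⊗ var 8))) refl

2*+ : ∀ c n → 2 * (c + n) ≡ 2 * c + 2 * n
2*+ c n = *-distribˡ-+ 2 c n

-- Using the recurrence twice squares its characteristic polynomial, which leaves even shifts only.
-- Even-indexed terms thus obey the recurrence for a², as do squares of solutions for a; an equality
-- between the two needs just eight initial values.
Rec7-even : ∀ {a f} → Rec7 a f → Rec7 (a · a) (λ n → f (2 * n))
Rec7-even {a} {f} rf n = g 8 ⟫ Rec7-2 rf (2 * n) ⟫ ≋-sym (+-cong (*-cong ≋-refl (g 2)) (+-cong (*-cong ≋-refl (g 1)) ≋-refl))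
  where g : ∀ c → f (2 * (c + n)) ≋ f (2 * c + 2 * n)
        g c = subst (λ k → f (2 * (c + n)) ≋ f k) (2*+ c n) ≋-refl
Rec5-even : ∀ {a f} → Rec5 a f → Rec5 (a · a) (λ n → f (2 * n))
Rec5-even {a} {f} rf n = g 6 ⟫ Rec5-2 rf (2 * n) ⟫ ≋-sym (+-cong (*-cong ≋-refl (g 4)) (+-cong (*-cong ≋-refl (g 2)) (+-cong (*-cong ≋-refl (g 1)) ≋-refl)))
  where g : ∀ c → f (2 * (c + n)) ≋ f (2 * c + 2 * n)
        g c = subst (λ k → f (2 * (c + n)) ≋ f k) (2*+ c n) ≋-refl

Rec7-suc : ∀ {a f} → Rec7 a f → Rec7 a (λ n → f (suc n))
Rec7-suc rf n = rf (suc n)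
Rec5-suc : ∀ {a f} → Rec5 a f → Rec5 a (λ n → f (suc n))
Rec5-suc rf n = rf (suc n)

idx-dbl : ∀ (f : Seq) m n → f (2 * m + n) ≋ f (m + (m + n))
idx-dbl f m n = subst (λ k → f (2 * m + n) ≋ f k) (trans (cong (λ z → m + z + n) (+-identityʳ m)) (+-assoc m m n)) ≋-refl
idx-swap : ∀ (f : Seq) x y n → f (x + (y + n)) ≋ f (y + (x + n))
idx-swap f x y n = subst (λ k → f (x + (y + n)) ≋ f k) (trans (sym (+-assoc x y n)) (trans (cong (_+ n) (+-comm x y)) (+-assoc y x n))) ≋-refl

-- The 2^i-th power of the characteristic polynomial: in characteristic 2 it keeps its four terms.
Rec7-q : ∀ {f} → Rec7 Xv f → ∀ i n → f (2 ^ (3 + i) + n) ≋ Xq (1 + i) · f (2 ^ (1 + i) + n) ⊹ (Xq i · f (2 ^ i + n) ⊹ Xq (3 + i) · f n)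
Rec7-q {f} rf zero n = rf n ⟫ ring (Xv ∷ f (2 + n) ∷ f (1 + n) ∷ f n ∷ []) (X0 ↑ 2 ⊗ X1 ⊕ (X0 ⊗ X2 ⊕ X0 ↑ 8 ⊗ X3)) ((X0 ⊗ X0) ⊗ X1 ⊕ (X0 ⊗ X2 ⊕ (((X0 ⊗ X0) ⊗ (X0 ⊗ X0)) ⊗ ((X0 ⊗ X0) ⊗ (X0 ⊗ X0))) ⊗ X3)) refl
Rec7-q {f} rf (suc i) n = idx-dbl f (2 ^ (3 + i)) n
    ⟫ Rec7-q rf i (2 ^ (3 + i) + n)
    ⟫ +-cong (*-cong ≋-refl (idx-swap f (2 ^ (1 + i)) (2 ^ (3 + i)) n ⟫ Rec7-q rf i (2 ^ (1 + i) + n))) (+-cong (*-cong ≋-refl (idx-swap f (2 ^ i) (2 ^ (3 + i)) n ⟫ Rec7-q rf i (2 ^ i + n))) (*-cong ≋-refl (Rec7-q rf i n)))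
    ⟫ +-cong ≋-refl (+-cong (*-cong ≋-refl (+-cong (*-cong ≋-refl (idx-swap f (2 ^ (1 + i)) (2 ^ i) n)) ≋-refl)) ≋-refl)
    ⟫ ring (Xq i ∷ f (2 ^ (1 + i) + (2 ^ (1 + i) + n)) ∷ f (2 ^ i + (2 ^ (1 + i) + n)) ∷ f (2 ^ (1 + i) + n) ∷ f (2 ^ i + (2 ^ i + n)) ∷ f (2 ^ i + n) ∷ f n ∷ [])
        (a2 ⊗ (a2 ⊗ X1 ⊕ (X0 ⊗ X2 ⊕ a8 ⊗ X3)) ⊕ (X0 ⊗ (a2 ⊗ X2 ⊕ (X0 ⊗ X4 ⊕ a8 ⊗ X5)) ⊕ a8 ⊗ (a2 ⊗ X3 ⊕ (X0 ⊗ X5 ⊕ a8 ⊗ X6))))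
        (a4 ⊗ X1 ⊕ (a2 ⊗ X4 ⊕ (a8 ⊗ a8) ⊗ X6)) refl
    ⟫ +-cong (*-cong ≋-refl (≋-sym (idx-dbl f (2 ^ (1 + i)) n))) (+-cong (*-cong ≋-refl (≋-sym (idx-dbl f (2 ^ i) n))) ≋-refl)
    where
    a2 a4 a8 : Ex
    a2 = X0 ⊗ X0
    a4 = a2 ⊗ a2
    a8 = a4 ⊗ a4

E5 : ℕ → Ex
E5 (suc (suc (suc (suc (suc (suc k)))))) = X0 ↑ 2 ⊗ E5 (suc (suc (suc (suc k)))) ⊕ (X0 ↑ 4 ⊗ E5 (suc (suc k)) ⊕ (X0 ⊗ E5 (suc k) ⊕ X0 ↑ 6 ⊗ E5 k))
E5 k = var (suc k)

E5-ok : ∀ {f} → Rec5 Xv f → ∀ n k → f (k + n) ≋ ⟦ E5 k ⟧ (env (Xv ∷ f n ∷ f (1 + n) ∷ f (2 + n) ∷ f (3 + n) ∷ f (4 + n) ∷ f (5 + n) ∷ []))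
E5-ok rf n (suc (suc (suc (suc (suc (suc k)))))) = rf (k + n) ⟫ +-cong (*-cong ≋-refl (E5-ok rf n (suc (suc (suc (suc k)))))) (+-cong (*-cong ≋-refl (E5-ok rf n (suc (suc k)))) (+-cong (*-cong ≋-refl (E5-ok rf n (suc k))) (*-cong ≋-refl (E5-ok rf n k))))
E5-ok rf n 0 = ≋-refl
E5-ok rf n 1 = ≋-refl
E5-ok rf n 2 = ≋-refl
E5-ok rf n 3 = ≋-refl
E5-ok rf n 4 = ≋-refl
E5-ok rf n 5 = ≋-refl

Rec5-q : ∀ {f} → Rec5 Xv f → ∀ i n → f (2 ^ (4 + i) + n) ≋ Xq (4 + i) · f n ⊹ (Xq (2 + i) · f (2 ^ (2 + i) + n) ⊹ (Xq (3 + i) · f n ⊹ Xq i · (Xq (1 + i) · f (2 ^ i + n))))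
Rec5-q {f} rf zero n = E5-ok rf n 16 ⟫ ring (Xv ∷ f n ∷ f (1 + n) ∷ f (2 + n) ∷ f (3 + n) ∷ f (4 + n) ∷ f (5 + n) ∷ []) (E5 16)
  (((a8 ⊗ a8) ⊗ X1) ⊕ (a4 ⊗ X5 ⊕ (a8 ⊗ X1 ⊕ X0 ⊗ ((X0 ⊗ X0) ⊗ X2)))) refl
  where
  a4 a8 : Ex
  a4 = (X0 ⊗ X0) ⊗ (X0 ⊗ X0)
  a8 = a4 ⊗ a4
Rec5-q {f} rf (suc i) n = idx-dbl f (2 ^ (4 + i)) n
  ⟫ Rec5-q rf i (2 ^ (4 + i) + n)
  ⟫ +-cong (*-cong ≋-refl (Rec5-q rf i n)) (+-cong (*-cong ≋-refl (idx-swap f (2 ^ (2 + i)) (2 ^ (4 + i)) n ⟫ Rec5-q rf i (2 ^ (2 + i) + n)))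
      (+-cong (*-cong ≋-refl (Rec5-q rf i n)) (*-cong ≋-refl (*-cong ≋-refl (idx-swap f (2 ^ i) (2 ^ (4 + i)) n ⟫ Rec5-q rf i (2 ^ i + n)
         ⟫ +-cong ≋-refl (+-cong (*-cong ≋-refl (idx-swap f (2 ^ (2 + i)) (2 ^ i) n)) ≋-refl))))))
  ⟫ ring (Xq i ∷ f n ∷ f (2 ^ (2 + i) + n) ∷ f (2 ^ i + n) ∷ f (2 ^ (2 + i) + (2 ^ (2 + i) + n)) ∷ f (2 ^ i + (2 ^ (2 + i) + n)) ∷ f (2 ^ i + (2 ^ i + n)) ∷ [])
     (a16 ⊗ R X1 X2 X3 ⊕ (a4 ⊗ R X2 X4 X5 ⊕ (a8 ⊗ R X1 X2 X3 ⊕ X0 ⊗ (a2 ⊗ R X3 X5 X6))))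
     ((a16 ⊗ a16) ⊗ X1 ⊕ (a8 ⊗ X4 ⊕ (a16 ⊗ X1 ⊕ a2 ⊗ (a4 ⊗ X6)))) refl
  ⟫ +-cong ≋-refl (+-cong (*-cong ≋-refl (≋-sym (idx-dbl f (2 ^ (2 + i)) n))) (+-cong ≋-refl (*-cong ≋-refl (*-cong ≋-refl (≋-sym (idx-dbl f (2 ^ i) n))))))
  where
  a2 a4 a8 a16 : Ex
  a2 = X0 ⊗ X0
  a4 = a2 ⊗ a2
  a8 = a4 ⊗ a4
  a16 = a8 ⊗ a8
  R : Ex → Ex → Ex → Ex
  R x y z = a16 ⊗ x ⊕ (a4 ⊗ y ⊕ (a8 ⊗ x ⊕ X0 ⊗ (a2 ⊗ z)))

-- Binary digits: A k collects the digits of k in even places, B k those in odd places.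
AB : ℕ → ℕ → ℕ × ℕ
AB zero k = 0 , 0
AB (suc fuel) k = let (a , b) = AB fuel ⌊ k /2⌋ in (if odd k then suc (2 * b) else 2 * b) , a

A B : ℕ → ℕ
A k = proj₁ (AB k k)
B k = proj₂ (AB k k)

AB-zero : ∀ f → AB f 0 ≡ (0 , 0)
AB-zero zero = refl
AB-zero (suc f) = cong (λ p → 2 * proj₂ p , proj₁ p) (AB-zero f)

half< : ∀ k → ⌊ suc k /2⌋ < suc k
half< k = ⌊n/2⌋<n k

AB-fuel : ∀ f g k → k ≤ f → k ≤ g → AB f k ≡ AB g k
AB-fuel zero g zero _ _ = sym (AB-zero g)
AB-fuel (suc f) zero zero _ _ = AB-zero (suc f)
AB-fuel (suc f) (suc g) zero _ _ = cong (λ p → 2 * proj₂ p , proj₁ p) (trans (AB-zero f) (sym (AB-zero g)))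
AB-fuel (suc f) (suc g) (suc k) l l' = cong (λ p → (if odd (suc k) then suc (2 * proj₂ p) else 2 * proj₂ p) , proj₁ p)
  (AB-fuel f g ⌊ suc k /2⌋ (≤-pred (≤-trans (half< k) l)) (≤-pred (≤-trans (half< k) l')))

half-2 : ∀ k → ⌊ 2 * k /2⌋ ≡ k
half-2 zero = refl
half-2 (suc k) = trans (cong (λ z → ⌊ suc z /2⌋) (+-suc k (k + 0))) (cong suc (half-2 k))
half-2+1 : ∀ k → ⌊ suc (2 * k) /2⌋ ≡ k
half-2+1 zero = refl
half-2+1 (suc k) = trans (cong (λ z → ⌊ suc (suc z) /2⌋) (+-suc k (k + 0))) (cong suc (half-2+1 k))

AB-2 : ∀ k → AB (2 * k) (2 * k) ≡ (2 * B k , A k)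
AB-2 zero = refl
AB-2 (suc k) = trans (cong (λ b → (if b then suc (2 * proj₂ (AB (k + suc (k + 0)) ⌊ 2 * suc k /2⌋)) else 2 * proj₂ (AB (k + suc (k + 0)) ⌊ 2 * suc k /2⌋)) , proj₁ (AB (k + suc (k + 0)) ⌊ 2 * suc k /2⌋)) (odd-2 (suc k)))
  (cong (λ p → 2 * proj₂ p , proj₁ p) (trans (cong (AB (k + suc (k + 0))) (half-2 (suc k))) (AB-fuel _ _ (suc k) (subst (suc k ≤_) (sym (+-suc k (k + 0))) (s≤s (m≤m+n k (k + 0)))) ≤-refl)))

AB-2+1 : ∀ k → AB (suc (2 * k)) (suc (2 * k)) ≡ (suc (2 * B k) , A k)
AB-2+1 k = trans (cong (λ b → (if not b then suc (2 * proj₂ (AB (2 * k) ⌊ suc (2 * k) /2⌋)) else 2 * proj₂ (AB (2 * k) ⌊ suc (2 * k) /2⌋)) , proj₁ (AB (2 * k) ⌊ suc (2 * k) /2⌋)) (odd-2 k))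
  (cong (λ p → suc (2 * proj₂ p) , proj₁ p) (trans (cong (AB (2 * k)) (half-2+1 k)) (AB-fuel _ _ k (m≤m+n k (k + 0)) ≤-refl)))

A-2 : ∀ k → A (2 * k) ≡ 2 * B k
A-2 k = cong proj₁ (AB-2 k)
B-2 : ∀ k → B (2 * k) ≡ A k
B-2 k = cong proj₂ (AB-2 k)
A-2+1 : ∀ k → A (suc (2 * k)) ≡ suc (2 * B k)
A-2+1 k = cong proj₁ (AB-2+1 k)
B-2+1 : ∀ k → B (suc (2 * k)) ≡ A k
B-2+1 k = cong proj₂ (AB-2+1 k)

bin-ind : ∀ {P : ℕ → Set} → P 0 → (∀ k → P k → P (2 * k)) → (∀ k → P k → P (suc (2 * k))) → ∀ k → P k
bin-ind {P} p0 pe po k = go (suc k) k ≤-refl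
  where
  go : ∀ b k → k < b → P k
  go (suc b) zero _ = p0
  go (suc b) (suc k) l with even-or-odd (suc k)
  ... | inj₁ (suc m , e) = subst P (sym e) (pe (suc m) (go b (suc m) (<-≤-trans (m<m+n (suc m) (s≤s z≤n)) (subst (_≤ b) e (≤-pred l)))))
  ... | inj₂ (m , e) = subst P (sym e) (po m (go b m (<-≤-trans (s≤s (m≤m+n m (m + 0))) (subst (_≤ b) e (≤-pred l)))))

-- Digit 2j of k weighs u 2^j and digit 2j + 1 weighs v 2^j. Doubling k therefore turns the weights
-- (u, v) into (v, 2u).
W : ℕ → ℕ → ℕ → ℕ
W u v k = u * A k + v * B k

W-2 : ∀ u v k → W u v (2 * k) ≡ W v (2 * u) k
W-2 u v k = trans (cong₂ (λ x y → u * x + v * y) (A-2 k) (B-2 k)) (solve 4 (λ u v a b → u :* (con 2 :* b) :+ v :* a := v :* a :+ con 2 :* u :* b) refl u v (A k) (B k))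
  where open +-*-Solver
W-2+1 : ∀ u v k → W u v (suc (2 * k)) ≡ u + W v (2 * u) k
W-2+1 u v k = trans (cong₂ (λ x y → u * x + v * y) (A-2+1 k) (B-2+1 k)) (solve 4 (λ u v a b → u :* (con 1 :+ con 2 :* b) :+ v :* a := u :+ (v :* a :+ con 2 :* u :* b)) refl u v (A k) (B k))
  where open +-*-Solver

W-0 : ∀ u v → W u v 0 ≡ 0
W-0 u v = cong₂ _+_ (*-zeroʳ u) (*-zeroʳ v)
W-1 : ∀ u v → W u v 1 ≡ u
W-1 u v = trans (cong₂ _+_ (*-identityʳ u) (*-zeroʳ v)) (+-identityʳ u)

-- A carry replaces two digits in one place by a digit in the next place, which for u ≤ v ≤ 2u
-- weighs no more than both together. Without carries the weight is additive.
W-sub : ∀ m u v n → u ≤ v → v ≤ 2 * u → W u v (m + n) ≤ W u v m + W u v n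
W-sub = bin-ind (λ u v n _ _ → ≤-reflexive (cong (_+ W u v n) (sym (W-0 u v)))) ev' od'
  where
  open +-*-Solver
  ev' : ∀ m → (∀ u v n → u ≤ v → v ≤ 2 * u → W u v (m + n) ≤ W u v m + W u v n) → ∀ u v n → u ≤ v → v ≤ 2 * u → W u v (2 * m + n) ≤ W u v (2 * m) + W u v n
  ev' m ih u v n p q with even-or-odd n
  ... | inj₁ (k , refl) = subst₂ _≤_ (sym (trans (cong (W u v) (sym (2*+ m k))) (W-2 u v (m + k)))) (cong₂ _+_ (sym (W-2 u v m)) (sym (W-2 u v k))) (ih v (2 * u) k q (*-monoʳ-≤ 2 p))
  ... | inj₂ (k , refl) = subst₂ _≤_ (sym (trans (cong (W u v) (trans (+-suc (2 * m) (2 * k)) (cong suc (sym (2*+ m k))))) (W-2+1 u v (m + k))))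
        (trans (solve 3 (λ u a b → u :+ (a :+ b) := a :+ (u :+ b)) refl u (W v (2 * u) m) (W v (2 * u) k)) (cong₂ _+_ (sym (W-2 u v m)) (sym (W-2+1 u v k)))) (+-monoʳ-≤ u (ih v (2 * u) k q (*-monoʳ-≤ 2 p)))
  od' : ∀ m → (∀ u v n → u ≤ v → v ≤ 2 * u → W u v (m + n) ≤ W u v m + W u v n) → ∀ u v n → u ≤ v → v ≤ 2 * u → W u v (suc (2 * m) + n) ≤ W u v (suc (2 * m)) + W u v n
  od' m ih u v n p q with even-or-odd n
  ... | inj₁ (k , refl) = subst₂ _≤_ (sym (trans (cong (λ z → W u v (suc z)) (sym (2*+ m k))) (W-2+1 u v (m + k))))
        (trans (sym (+-assoc u _ _)) (cong₂ _+_ (sym (W-2+1 u v m)) (sym (W-2 u v k)))) (+-monoʳ-≤ u (ih v (2 * u) k q (*-monoʳ-≤ 2 p)))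
  ... | inj₂ (k , refl) = subst₂ _≤_ (sym (trans (cong (W u v) (solve 2 (λ m k → con 1 :+ con 2 :* m :+ (con 1 :+ con 2 :* k) := con 2 :* (m :+ (k :+ con 1))) refl m k)) (W-2 u v (m + (k + 1)))))
        (cong₂ _+_ (sym (W-2+1 u v m)) (sym (W-2+1 u v k)))
        (≤-trans (ih v (2 * u) (k + 1) q (*-monoʳ-≤ 2 p)) (≤-trans (+-monoʳ-≤ (W v (2 * u) m) (≤-trans (≤-reflexive (cong (W v (2 * u)) (+-comm k 1))) (one k)))
          (≤-trans (+-monoʳ-≤ (W v (2 * u) m) (+-monoˡ-≤ (W v (2 * u) k) q)) (≤-reflexive (solve 3 (λ a b u → a :+ (con 2 :* u :+ b) := (u :+ a) :+ (u :+ b)) refl (W v (2 * u) m) (W v (2 * u) k) u)))))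
    where
    one : ∀ k → W v (2 * u) (suc k) ≤ v + W v (2 * u) k
    one k = add1 k v (2 * u) q (*-monoʳ-≤ 2 p)
      where
      add1 : ∀ k u v → u ≤ v → v ≤ 2 * u → W u v (suc k) ≤ u + W u v k
      add1 = bin-ind (λ u v _ _ → ≤-reflexive (trans (W-1 u v) (sym (trans (cong (u +_) (W-0 u v)) (+-identityʳ u)))))
        (λ k _ u v _ _ → ≤-reflexive (trans (W-2+1 u v k) (cong (u +_) (sym (W-2 u v k)))))
        (λ k ih u v p q → subst₂ _≤_ (sym (trans (cong (λ z → W u v (suc z)) (sym (+-suc k (k + 0)))) (W-2 u v (suc k)))) (cong (u +_) (sym (W-2+1 u v k)))
            (≤-trans (ih v (2 * u) q (*-monoʳ-≤ 2 p)) (≤-trans (+-monoˡ-≤ _ q) (≤-reflexive (trans (cong (_+ W v (2 * u) k) (cong (u +_) (+-identityʳ u))) (+-assoc u u _))))))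

W-top : ∀ i u v l → l < 2 ^ i → W u v (2 ^ i + l) ≡ W u v (2 ^ i) + W u v l
W-top zero u v zero _ = sym (trans (cong (W u v 1 +_) (W-0 u v)) (+-identityʳ _))
W-top zero u v (suc l) (s≤s ())
W-top (suc i) u v l lt with even-or-odd l
... | inj₁ (k , refl) = trans (cong (W u v) (sym (2*+ (2 ^ i) k))) (trans (W-2 u v (2 ^ i + k)) (trans (W-top i v (2 * u) k (*-cancelˡ-< 2 k (2 ^ i) lt)) (sym (cong₂ _+_ (W-2 u v (2 ^ i)) (W-2 u v k)))))
... | inj₂ (k , refl) = trans (cong (W u v) (trans (+-suc (2 * 2 ^ i) (2 * k)) (cong suc (sym (2*+ (2 ^ i) k))))) (trans (W-2+1 u v (2 ^ i + k))
      (trans (cong (u +_) (W-top i v (2 * u) k (*-cancelˡ-< 2 k (2 ^ i) (<-trans (n<1+n _) lt)))) (trans (solve 3 (λ u a b → u :+ (a :+ b) := a :+ (u :+ b)) refl u (W v (2 * u) (2 ^ i)) (W v (2 * u) k))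
      (sym (cong₂ _+_ (W-2 u v (2 ^ i)) (W-2+1 u v k))))))
  where open +-*-Solver

W-4 : ∀ u v k → W u v (2 * (2 * k)) ≡ 2 * W u v k
W-4 u v k = trans (W-2 u v (2 * k)) (trans (W-2 v (2 * u) k) (solve 4 (λ u v a b → con 2 :* u :* a :+ con 2 :* v :* b := con 2 :* (u :* a :+ v :* b)) refl u v (A k) (B k)))
  where open +-*-Solver

W-mono : ∀ u v k → u ≤ v → v ≤ 2 * u → W u v k ≤ W u v (2 * k)
W-mono u v k p q = subst (W u v k ≤_) (sym (W-2 u v k)) (+-mono-≤ (*-monoˡ-≤ (A k) p) (*-monoˡ-≤ (B k) q))

top-bit : ∀ j k → 2 ^ j ≤ k → ∃ λ i → ∃ λ l → k ≡ 2 ^ (i + j) + l × l < 2 ^ (i + j)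
top-bit j k le = go (suc k) k j le (<-≤-trans (n<1+n k) (m≤n+m (suc k) j))
  where
  go : ∀ b k j → 2 ^ j ≤ k → k < j + b → ∃ λ i → ∃ λ l → k ≡ 2 ^ (i + j) + l × l < 2 ^ (i + j)
  go b k j le lt with 2 ^ suc j ≤? k
  go zero k j le lt | yes le' = ⊥-elim (<⇒≱ lt (≤-trans (≤-reflexive (+-identityʳ j)) (≤-trans (<⇒≤ (n<2^n j)) le)))
    where n<2^n : ∀ n → n < 2 ^ n
          n<2^n zero = s≤s z≤n
          n<2^n (suc n) = ≤-trans (s≤s (n<2^n n)) (≤-trans (+-monoˡ-≤ (2 ^ n) (≤-trans (s≤s z≤n) (n<2^n n))) (≤-reflexive (cong (2 ^ n +_) (sym (+-identityʳ (2 ^ n))))))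
  go (suc b) k j le lt | yes le' = let (i , l , e , x) = go b k (suc j) le' (subst (k <_) (+-suc j b) lt) in
     suc i , l , trans e (cong (λ z → 2 ^ z + l) (+-suc i j)) , subst (λ z → l < 2 ^ z) (+-suc i j) x
  go b k j le lt | no nle = 0 , k ∸ 2 ^ j , sym (m+[n∸m]≡n le) , +-cancelˡ-< (2 ^ j) _ _ (subst₂ _<_ (sym (m+[n∸m]≡n le)) (cong (2 ^ j +_) (+-identityʳ (2 ^ j))) (≰⇒> nle))

-- T₇(z wᵏ) = z xₖ(w), T₇(z⁵ wᵏ) = z⁵ x'ₖ(w), T₅(z wᵏ) = z⁵ y₁ₖ(w), T₅(z⁵ wᵏ) = z y₂ₖ(w): these sequences of
-- polynomials satisfy the recurrences above with the initial values below.  The other sequences come from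
-- splitting the binary expansion of the index; their initial values were found by computing enough terms.
x-init x'-init y₁-init y₂-init x₀-init x₂-init e-init h-init o-init us-init vs-init e₂-init y₁₀-init y₁₂-init xy-init y₄-init yb-init yc-init yd-init : ℕ → Poly1
x-init 1 = true ∷ []
x-init 3 = false ∷ false ∷ true ∷ []
x-init 4 = false ∷ true ∷ []
x-init 5 = false ∷ false ∷ false ∷ false ∷ true ∷ []
x-init 6 = false ∷ false ∷ false ∷ true ∷ []
x-init 7 = false ∷ false ∷ false ∷ false ∷ false ∷ false ∷ true ∷ []
x-init _ = []
x'-init 1 = true ∷ []
x'-init 3 = false ∷ false ∷ true ∷ []
x'-init 4 = false ∷ true ∷ []
x'-init 5 = true ∷ false ∷ false ∷ false ∷ true ∷ []
x'-init 6 = false ∷ false ∷ false ∷ true ∷ []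
x'-init 7 = false ∷ false ∷ true ∷ false ∷ false ∷ false ∷ true ∷ []
x'-init _ = []
y₁-init 4 = true ∷ []
y₁-init 5 = false ∷ true ∷ []
y₁-init _ = []
y₂-init 0 = true ∷ []
y₂-init 1 = false ∷ true ∷ []
y₂-init 2 = false ∷ false ∷ true ∷ []
y₂-init 3 = false ∷ false ∷ false ∷ true ∷ []
y₂-init 4 = false ∷ false ∷ false ∷ false ∷ true ∷ []
y₂-init 5 = false ∷ true ∷ false ∷ false ∷ false ∷ true ∷ []
y₂-init _ = []
x₀-init 1 = true ∷ []
x₀-init 2 = true ∷ []
x₀-init 3 = false ∷ false ∷ true ∷ []
x₀-init 4 = false ∷ true ∷ []
x₀-init 5 = false ∷ false ∷ false ∷ false ∷ true ∷ []
x₀-init 6 = false ∷ false ∷ false ∷ true ∷ true ∷ []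
x₀-init 7 = false ∷ true ∷ false ∷ true ∷ false ∷ false ∷ true ∷ []
x₀-init _ = []
x₂-init 1 = true ∷ []
x₂-init 3 = true ∷ true ∷ true ∷ []
x₂-init 4 = true ∷ true ∷ []
x₂-init 5 = true ∷ false ∷ false ∷ false ∷ true ∷ []
x₂-init 6 = false ∷ true ∷ false ∷ true ∷ []
x₂-init 7 = false ∷ false ∷ true ∷ false ∷ true ∷ true ∷ true ∷ []
x₂-init _ = []
e-init 2 = true ∷ []
e-init 6 = false ∷ false ∷ false ∷ false ∷ true ∷ []
e-init 7 = false ∷ true ∷ false ∷ true ∷ []
e-init _ = []
h-init 1 = true ∷ []
h-init 3 = false ∷ false ∷ true ∷ []
h-init 4 = false ∷ true ∷ []
h-init 5 = false ∷ false ∷ false ∷ false ∷ true ∷ []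
h-init 6 = false ∷ false ∷ false ∷ true ∷ []
h-init 7 = false ∷ true ∷ false ∷ false ∷ false ∷ false ∷ true ∷ []
h-init _ = []
o-init 7 = false ∷ true ∷ []
o-init _ = []
us-init 3 = false ∷ true ∷ []
us-init 4 = true ∷ []
us-init 7 = false ∷ false ∷ false ∷ false ∷ false ∷ true ∷ []
us-init _ = []
vs-init 1 = true ∷ []
vs-init 3 = true ∷ false ∷ true ∷ []
vs-init 4 = false ∷ true ∷ []
vs-init 5 = true ∷ false ∷ false ∷ false ∷ true ∷ []
vs-init 6 = false ∷ true ∷ false ∷ true ∷ []
vs-init 7 = false ∷ false ∷ true ∷ false ∷ true ∷ false ∷ true ∷ []
vs-init _ = []
e₂-init 3 = true ∷ true ∷ []
e₂-init 4 = true ∷ []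
e₂-init 5 = true ∷ []
e₂-init 6 = false ∷ true ∷ []
e₂-init 7 = false ∷ false ∷ true ∷ false ∷ true ∷ true ∷ []
e₂-init _ = []
y₁₀-init 1 = true ∷ []
y₁₀-init 3 = false ∷ false ∷ true ∷ []
y₁₀-init 4 = false ∷ true ∷ []
y₁₀-init 5 = false ∷ true ∷ true ∷ false ∷ true ∷ []
y₁₀-init _ = []
y₁₂-init 1 = true ∷ []
y₁₂-init 2 = true ∷ []
y₁₂-init 3 = true ∷ true ∷ true ∷ []
y₁₂-init 4 = false ∷ true ∷ []
y₁₂-init 5 = false ∷ false ∷ true ∷ false ∷ true ∷ []
y₁₂-init _ = []
xy-init 4 = false ∷ true ∷ []
xy-init 5 = false ∷ false ∷ true ∷ []
xy-init _ = []
y₄-init 1 = true ∷ []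
y₄-init 3 = false ∷ false ∷ true ∷ []
y₄-init 5 = false ∷ false ∷ false ∷ false ∷ true ∷ []
y₄-init _ = []
yb-init 5 = false ∷ true ∷ []
yb-init _ = []
yc-init 1 = true ∷ []
yc-init 3 = true ∷ false ∷ true ∷ []
yc-init 4 = false ∷ true ∷ []
yc-init 5 = false ∷ false ∷ true ∷ false ∷ true ∷ []
yc-init _ = []
yd-init 2 = true ∷ []
yd-init 3 = false ∷ true ∷ []
yd-init _ = []

-- Bounds and congruences for the monomials of the sequences

seq₇ seq₅ : (ℕ → Poly1) → Seq
seq₇ i k = ⟪ rec7 i k ⟫ Xv
seq₅ i k = ⟪ rec5 i k ⟫ Xv

look7 : ∀ i k t → seq₇ i k t ≡ true → look (rec7 i k) t ≡ true
look7 i k t e = trans (sym (look-ok (rec7 i k) t)) e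
look5 : ∀ i k t → seq₅ i k t ≡ true → look (rec5 i k) t ≡ true
look5 i k t e = trans (sym (look-ok (rec5 i k) t)) e

xor3-true : ∀ a b c → a xor (b xor c) ≡ true → a ≡ true ⊎ (b ≡ true ⊎ c ≡ true)
xor3-true true b c e = inj₁ refl
xor3-true false true c e = inj₂ (inj₁ refl)
xor3-true false false c e = inj₂ (inj₂ e)

rec7-true : ∀ {f} → Rec7 Xv f → ∀ i n t → f (2 ^ (3 + i) + n) t ≡ true →
  (∃ λ s → t ≡ 2 ^ (1 + i) + s × f (2 ^ (1 + i) + n) s ≡ true) ⊎ ((∃ λ s → t ≡ 2 ^ i + s × f (2 ^ i + n) s ≡ true) ⊎ (∃ λ s → t ≡ 2 ^ (3 + i) + s × f n s ≡ true))
rec7-true {f} rf i n t e = h (xor3-true (p₁ t) (p₂ t) (p₃ t) (trans (sym (trans (at (Rec7-q rf i n) t) (trans (+-at p₁ (p₂ ⊹ p₃) t) (cong (p₁ t xor_) (+-at p₂ p₃ t))))) e))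
  where
  p₁ p₂ p₃ : Series
  p₁ = Xq (1 + i) · f (2 ^ (1 + i) + n)
  p₂ = Xq i · f (2 ^ i + n)
  p₃ = Xq (3 + i) · f n
  h : p₁ t ≡ true ⊎ (p₂ t ≡ true ⊎ p₃ t ≡ true) → (∃ λ s → t ≡ 2 ^ (1 + i) + s × f (2 ^ (1 + i) + n) s ≡ true) ⊎ ((∃ λ s → t ≡ 2 ^ i + s × f (2 ^ i + n) s ≡ true) ⊎ (∃ λ s → t ≡ 2 ^ (3 + i) + s × f n s ≡ true))
  h (inj₁ e) = inj₁ (Xq-true (1 + i) _ t e)
  h (inj₂ (inj₁ e)) = inj₂ (inj₁ (Xq-true i _ t e))
  h (inj₂ (inj₂ e)) = inj₂ (inj₂ (Xq-true (3 + i) _ t e))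

rec5-true : ∀ {f} → Rec5 Xv f → ∀ i n t → f (2 ^ (4 + i) + n) t ≡ true →
  (∃ λ s → t ≡ 2 ^ (4 + i) + s × f n s ≡ true) ⊎ ((∃ λ s → t ≡ 2 ^ (2 + i) + s × f (2 ^ (2 + i) + n) s ≡ true) ⊎
  ((∃ λ s → t ≡ 2 ^ (3 + i) + s × f n s ≡ true) ⊎ (∃ λ s → t ≡ 2 ^ i + (2 ^ (1 + i) + s) × f (2 ^ i + n) s ≡ true)))
rec5-true {f} rf i n t e = h (xor3-true (p₁ t) (p₂ t) ((p₃ ⊹ p₄) t) (trans (sym (trans (at (Rec5-q rf i n) t) (trans (+-at p₁ (p₂ ⊹ (p₃ ⊹ p₄)) t) (cong (p₁ t xor_) (+-at p₂ (p₃ ⊹ p₄) t))))) e))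
  where
  p₁ p₂ p₃ p₄ : Series
  p₁ = Xq (4 + i) · f n
  p₂ = Xq (2 + i) · f (2 ^ (2 + i) + n)
  p₃ = Xq (3 + i) · f n
  p₄ = Xq i · (Xq (1 + i) · f (2 ^ i + n))
  Goal : Set
  Goal = (∃ λ s → t ≡ 2 ^ (4 + i) + s × f n s ≡ true) ⊎ ((∃ λ s → t ≡ 2 ^ (2 + i) + s × f (2 ^ (2 + i) + n) s ≡ true) ⊎
    ((∃ λ s → t ≡ 2 ^ (3 + i) + s × f n s ≡ true) ⊎ (∃ λ s → t ≡ 2 ^ i + (2 ^ (1 + i) + s) × f (2 ^ i + n) s ≡ true)))
  k : p₃ t ≡ true ⊎ (p₄ t ≡ true ⊎ false ≡ true) → Goal
  k (inj₁ e) = inj₂ (inj₂ (inj₁ (Xq-true (3 + i) _ t e)))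
  k (inj₂ (inj₁ e)) = let (s , e1 , e2) = Xq-true i _ t e ; (s' , e3 , e4) = Xq-true (1 + i) _ s e2 in inj₂ (inj₂ (inj₂ (s' , trans e1 (cong (2 ^ i +_) e3) , e4)))
  h : p₁ t ≡ true ⊎ (p₂ t ≡ true ⊎ (p₃ ⊹ p₄) t ≡ true) → Goal
  h (inj₁ e) = inj₁ (Xq-true (4 + i) _ t e)
  h (inj₂ (inj₁ e)) = inj₂ (inj₁ (Xq-true (2 + i) _ t e))
  h (inj₂ (inj₂ e)) = k (xor3-true (p₃ t) (p₄ t) false (trans (cong (p₃ t xor_) (xor-identityʳ (p₄ t))) (trans (sym (+-at p₃ p₄ t)) e)))

pow-W : ∀ u v i → W u v (2 ^ (2 + i)) ≡ 2 * W u v (2 ^ i)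
pow-W u v i = W-4 u v (2 ^ i)

-- Each monomial X^t of term k should weigh at least δ less than k. At k = 2^j + l the recurrence
-- contributes X^x times term y + l, and `contrib` only asks that W x + W y ≤ W (2^j); this holds
-- because multiplication by 4 doubles weights.
module Bound (u v δ : ℕ) (u≤v : u ≤ v) (v≤2u : v ≤ 2 * u) where
  open +-*-Solver
  w' : ℕ → ℕ
  w' = W u v
  sub : ∀ m n → w' (m + n) ≤ w' m + w' n
  sub m n = W-sub m u v n u≤v v≤2u
  mono2 : ∀ i → w' (2 ^ i) ≤ w' (2 ^ suc i)
  mono2 i = W-mono u v (2 ^ i) u≤v v≤2u
  -- bounds a term X^x f(y + l) of the recurrence for f(2^j + l)
  contrib : ∀ j l x y s t → l < 2 ^ j → w' x + w' y ≤ w' (2 ^ j) → t ≡ x + s → w' s + δ ≤ w' (y + l) → w' t + δ ≤ w' (2 ^ j + l)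
  contrib j l x y s t lt le refl h = begin
    w' (x + s) + δ ≤⟨ +-monoˡ-≤ δ (sub x s) ⟩
    w' x + w' s + δ ≡⟨ +-assoc (w' x) (w' s) δ ⟩
    w' x + (w' s + δ) ≤⟨ +-monoʳ-≤ (w' x) (≤-trans h (sub y l)) ⟩
    w' x + (w' y + w' l) ≡⟨ sym (+-assoc (w' x) _ _) ⟩
    w' x + w' y + w' l ≤⟨ +-monoˡ-≤ (w' l) le ⟩
    w' (2 ^ j) + w' l ≡⟨ sym (W-top j u v l lt) ⟩
    w' (2 ^ j + l) ∎
    where open ≤-Reasoning
  two : ∀ x → x + x ≡ 2 * x
  two x = cong (x +_) (sym (+-identityʳ x))
  chk : ℕ → (ℕ → Poly1) → Bool
  chk n p = allB n (λ k → allAt (λ t → w' t + δ ≤ᵇ w' k) (p k))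
  base : ∀ n p → chk n p ≡ true → ∀ k → k < n → ∀ t → look (p k) t ≡ true → w' t + δ ≤ w' k
  base n p c k l t e = ≤from _ _ (allAt-ok (λ t → w' t + δ ≤ᵇ w' k) (p k) (allB-ok n _ c k l) t e)
  strong : ∀ (P : ℕ → Set) j → (∀ k → k < 2 ^ j → P k) → (∀ i l → l < 2 ^ (i + j) → (∀ k → k < 2 ^ (i + j) + l → P k) → P (2 ^ (i + j) + l)) → ∀ k → P k
  strong P j b st k = go (suc k) k ≤-refl
    where
    go : ∀ B k → k < B → P k
    go (suc B) k l with k <? 2 ^ j
    ... | yes a = b k a
    ... | no na with top-bit j k (≮⇒≥ na)
    ...   | i , l' , e , lt = subst P (sym e) (st i l' lt (λ m lm → go B m (<-≤-trans (subst (m <_) (sym e) lm) (≤-pred l))))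
  pow< : ∀ i j → i < j → ∀ l → 2 ^ i + l < 2 ^ j + l
  pow< i j lt l = +-monoˡ-< l (^-monoʳ-< 2 (s≤s (s≤s z≤n)) lt)
  pos : ∀ j l → l < 2 ^ j + l
  pos j l = m<n+m l (m^n>0 2 j)
  bound7 : ∀ i → chk 8 (rec7 i) ≡ true → ∀ k t → seq₇ i k t ≡ true → w' t + δ ≤ w' k
  bound7 i c = strong (λ k → ∀ t → seq₇ i k t ≡ true → w' t + δ ≤ w' k) 3 (λ k l t e → base 8 (rec7 i) c k l t (look7 i k t e)) step
    where
    step : ∀ j l → l < 2 ^ (j + 3) → (∀ k → k < 2 ^ (j + 3) + l → ∀ t → seq₇ i k t ≡ true → w' t + δ ≤ w' k) → ∀ t → seq₇ i (2 ^ (j + 3) + l) t ≡ true → w' t + δ ≤ w' (2 ^ (j + 3) + l)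
    step j l lt ih t e rewrite +-comm j 3 = h (rec7-true (rec7-Rec i Xv) j l t e)
      where
      h : _ → w' t + δ ≤ w' (2 ^ (3 + j) + l)
      h (inj₁ (s , et , es)) = contrib (3 + j) l (2 ^ (1 + j)) (2 ^ (1 + j)) s t lt (≤-reflexive (trans (two (w' (2 ^ (1 + j)))) (sym (pow-W u v (1 + j))))) et (ih _ (pow< (1 + j) (3 + j) (s≤s (s≤s (n≤1+n j))) l) s es)
      h (inj₂ (inj₁ (s , et , es))) = contrib (3 + j) l (2 ^ j) (2 ^ j) s t lt (≤-trans (≤-reflexive (trans (two (w' (2 ^ j))) (sym (pow-W u v j)))) (mono2 (2 + j))) et (ih _ (pow< j (3 + j) (s≤s (m≤n+m j 2)) l) s es)
      h (inj₂ (inj₂ (s , et , es))) = contrib (3 + j) l (2 ^ (3 + j)) 0 s t lt (≤-reflexive (trans (cong (w' (2 ^ (3 + j)) +_) (W-0 u v)) (+-identityʳ _))) et (ih _ (pos (3 + j) l) s es)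
  -- Sixteen terms are checked by evaluation because the shift in `Rec5-q` starts at 16.
  bound5 : ∀ i → chk 16 (rec5 i) ≡ true → ∀ k t → seq₅ i k t ≡ true → w' t + δ ≤ w' k
  bound5 i c = strong (λ k → ∀ t → seq₅ i k t ≡ true → w' t + δ ≤ w' k) 4 (λ k l t e → base 16 (rec5 i) c k l t (look5 i k t e)) step
    where
    step : ∀ j l → l < 2 ^ (j + 4) → (∀ k → k < 2 ^ (j + 4) + l → ∀ t → seq₅ i k t ≡ true → w' t + δ ≤ w' k) → ∀ t → seq₅ i (2 ^ (j + 4) + l) t ≡ true → w' t + δ ≤ w' (2 ^ (j + 4) + l)
    step j l lt ih t e rewrite +-comm j 4 = h (rec5-true (rec5-Rec i Xv) j l t e)
      where
      w4 : w' (2 ^ (2 + j)) + w' (2 ^ (2 + j)) ≡ w' (2 ^ (4 + j))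
      w4 = trans (two (w' (2 ^ (2 + j)))) (sym (pow-W u v (2 + j)))
      h : _ → w' t + δ ≤ w' (2 ^ (4 + j) + l)
      h (inj₁ (s , et , es)) = contrib (4 + j) l (2 ^ (4 + j)) 0 s t lt (≤-reflexive (trans (cong (w' (2 ^ (4 + j)) +_) (W-0 u v)) (+-identityʳ _))) et (ih _ (pos (4 + j) l) s es)
      h (inj₂ (inj₁ (s , et , es))) = contrib (4 + j) l (2 ^ (2 + j)) (2 ^ (2 + j)) s t lt (≤-reflexive w4) et (ih _ (pow< (2 + j) (4 + j) (s≤s (s≤s (s≤s (n≤1+n j)))) l) s es)
      h (inj₂ (inj₂ (inj₁ (s , et , es)))) = contrib (4 + j) l (2 ^ (3 + j)) 0 s t lt (≤-trans (≤-reflexive (trans (cong (w' (2 ^ (3 + j)) +_) (W-0 u v)) (+-identityʳ _))) (mono2 (3 + j))) et (ih _ (pos (4 + j) l) s es)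
      h (inj₂ (inj₂ (inj₂ (s , et , es)))) = contrib (4 + j) l (2 ^ j + 2 ^ (1 + j)) (2 ^ j) s t lt
          (≤-trans (+-monoˡ-≤ (w' (2 ^ j)) (sub (2 ^ j) (2 ^ (1 + j)))) (≤-trans (≤-reflexive (solve 2 (λ a b → (a :+ b) :+ a := b :+ (con 2 :* a)) refl (w' (2 ^ j)) (w' (2 ^ (1 + j)))))
             (≤-trans (+-mono-≤ (mono2 (1 + j)) (≤-reflexive (sym (pow-W u v j)))) (≤-reflexive w4)))) (trans et (sym (+-assoc (2 ^ j) _ s))) (ih _ (pow< j (4 + j) (s≤s (m≤n+m j 3)) l) s es)

odd-A : ∀ k → odd (A k) ≡ odd k
odd-A k with even-or-odd k
... | inj₁ (m , refl) = trans (cong odd (A-2 m)) (trans (odd-2 (B m)) (sym (odd-2 m)))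
... | inj₂ (m , refl) = trans (cong odd (A-2+1 m)) (cong not (trans (odd-2 (B m)) (sym (odd-2 m))))

code-zero : ∀ k → A k ≡ 0 → B k ≡ 0 → k ≡ 0
code-zero = bin-ind (λ _ _ → refl)
  (λ k ih a b → cong (2 *_) (ih (trans (sym (B-2 k)) b) (*-cancelˡ-≡ (B k) 0 2 (trans (sym (A-2 k)) a))))
  (λ k ih a b → ⊥-elim (1+n≢0 (trans (sym (A-2+1 k)) a)))

code-inj : ∀ k k' → A k ≡ A k' → B k ≡ B k' → k ≡ k'
code-inj = bin-ind (λ k' a b → sym (code-zero k' (sym a) (sym b))) ev' od'
  where
  ev' : ∀ k → (∀ k' → A k ≡ A k' → B k ≡ B k' → k ≡ k') → ∀ k' → A (2 * k) ≡ A k' → B (2 * k) ≡ B k' → 2 * k ≡ k'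
  ev' k ih k' a b with even-or-odd k'
  ... | inj₁ (m , refl) = cong (2 *_) (ih m (trans (sym (B-2 k)) (trans b (B-2 m))) (*-cancelˡ-≡ (B k) (B m) 2 (trans (sym (A-2 k)) (trans a (A-2 m)))))
  ... | inj₂ (m , refl) = ⊥-elim (false≢true (trans (sym (odd-2 (B k))) (trans (cong odd (trans (sym (A-2 k)) (trans a (A-2+1 m)))) (cong not (odd-2 (B m))))))
  od' : ∀ k → (∀ k' → A k ≡ A k' → B k ≡ B k' → k ≡ k') → ∀ k' → A (suc (2 * k)) ≡ A k' → B (suc (2 * k)) ≡ B k' → suc (2 * k) ≡ k'
  od' k ih k' a b with even-or-odd k'
  ... | inj₂ (m , refl) = cong (λ z → suc (2 * z)) (ih m (trans (sym (B-2+1 k)) (trans b (B-2+1 m))) (*-cancelˡ-≡ (B k) (B m) 2 (suc-injective (trans (sym (A-2+1 k)) (trans a (A-2+1 m))))))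
  ... | inj₁ (m , refl) = ⊥-elim (false≢true (trans (sym (odd-2 (B m))) (trans (cong odd (trans (sym (A-2 m)) (trans (sym a) (A-2+1 k)))) (cong not (odd-2 (B k))))))

enc : ∀ a b → ∃ λ k → A k ≡ a × B k ≡ b
enc a b = go (suc (a + b)) a b ≤-refl
  where
  4k : ∀ m → A (2 * (2 * m)) ≡ 2 * A m × B (2 * (2 * m)) ≡ 2 * B m
  4k m = trans (A-2 (2 * m)) (cong (2 *_) (B-2 m)) , trans (B-2 (2 * m)) (A-2 m)
  4k+1 : ∀ m → A (suc (2 * (2 * m))) ≡ suc (2 * A m) × B (suc (2 * (2 * m))) ≡ 2 * B m
  4k+1 m = trans (A-2+1 (2 * m)) (cong (λ z → suc (2 * z)) (B-2 m)) , trans (B-2+1 (2 * m)) (A-2 m)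
  4k+2 : ∀ m → A (2 * suc (2 * m)) ≡ 2 * A m × B (2 * suc (2 * m)) ≡ suc (2 * B m)
  4k+2 m = trans (A-2 (suc (2 * m))) (cong (2 *_) (B-2+1 m)) , trans (B-2 (suc (2 * m))) (A-2+1 m)
  4k+3 : ∀ m → A (suc (2 * suc (2 * m))) ≡ suc (2 * A m) × B (suc (2 * suc (2 * m))) ≡ suc (2 * B m)
  4k+3 m = trans (A-2+1 (suc (2 * m))) (cong (λ z → suc (2 * z)) (B-2+1 m)) , trans (B-2+1 (suc (2 * m))) (A-2+1 m)
  h : ∀ a b a' b' m → A m ≡ a' × B m ≡ b' → (a ≡ 2 * a' ⊎ a ≡ suc (2 * a')) → (b ≡ 2 * b' ⊎ b ≡ suc (2 * b')) → ∃ λ k → A k ≡ a × B k ≡ b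
  h a b a' b' m (refl , refl) (inj₁ e) (inj₁ e') = 2 * (2 * m) , trans (proj₁ (4k m)) (sym e) , trans (proj₂ (4k m)) (sym e')
  h a b a' b' m (refl , refl) (inj₂ e) (inj₁ e') = suc (2 * (2 * m)) , trans (proj₁ (4k+1 m)) (sym e) , trans (proj₂ (4k+1 m)) (sym e')
  h a b a' b' m (refl , refl) (inj₁ e) (inj₂ e') = 2 * suc (2 * m) , trans (proj₁ (4k+2 m)) (sym e) , trans (proj₂ (4k+2 m)) (sym e')
  h a b a' b' m (refl , refl) (inj₂ e) (inj₂ e') = suc (2 * suc (2 * m)) , trans (proj₁ (4k+3 m)) (sym e) , trans (proj₂ (4k+3 m)) (sym e')
  half : ∀ a → ∃ λ a' → (a ≡ 2 * a' ⊎ a ≡ suc (2 * a')) × (a' ≤ a × (a' ≡ a → a ≡ 0))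
  half a with even-or-odd a
  ... | inj₁ (m , refl) = m , inj₁ refl , m≤m+n m (m + 0) , λ e → z' m e
    where z' : ∀ m → m ≡ 2 * m → 2 * m ≡ 0
          z' zero _ = refl
          z' (suc m) e = ⊥-elim (m≢1+m+n (suc m) (trans e (cong suc (+-suc m (m + 0)))))
  ... | inj₂ (m , refl) = m , inj₂ refl , m≤n⇒m≤1+n (m≤m+n m (m + 0)) , λ e → ⊥-elim (m≢1+m+n m e)
  go : ∀ n a b → a + b < n → ∃ λ k → A k ≡ a × B k ≡ b
  go (suc n) a b l = dec (half a) (half b)
    where
    dec : (∃ λ a' → (a ≡ 2 * a' ⊎ a ≡ suc (2 * a')) × (a' ≤ a × (a' ≡ a → a ≡ 0))) → (∃ λ b' → (b ≡ 2 * b' ⊎ b ≡ suc (2 * b')) × (b' ≤ b × (b' ≡ b → b ≡ 0))) → ∃ λ k → A k ≡ a × B k ≡ b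
    dec (a' , ea , la , za) (b' , eb , lb , zb) with a' ≟ a | b' ≟ b
    ... | yes p | yes q = 0 , sym (za p) , sym (zb q)
    ... | yes p | no q = let (m , em) = go n a' b' (<-≤-trans (+-mono-≤-< la (≤∧≢⇒< lb q)) (≤-pred l)) in h a b a' b' m em ea eb
    ... | no p | _ = let (m , em) = go n a' b' (<-≤-trans (+-mono-<-≤ (≤∧≢⇒< la p) lb) (≤-pred l)) in h a b a' b' m em ea eb

halfA : ∀ k m → A k ≡ 2 * m → ∃ λ l → k ≡ 2 * l × B l ≡ m × A l ≡ B k
halfA k m e with even-or-odd k
... | inj₁ (l , refl) = l , refl , *-cancelˡ-≡ (B l) m 2 (trans (sym (A-2 l)) e) , sym (B-2 l)
... | inj₂ (l , refl) = ⊥-elim (false≢true (trans (sym (odd-2 m)) (trans (cong odd (trans (sym e) (A-2+1 l))) (cong not (odd-2 (B l))))))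

halfA' : ∀ k m → A k ≡ suc (2 * m) → ∃ λ l → k ≡ suc (2 * l) × B l ≡ m × A l ≡ B k
halfA' k m e with even-or-odd k
... | inj₂ (l , refl) = l , refl , *-cancelˡ-≡ (B l) m 2 (suc-injective (trans (sym (A-2+1 l)) e)) , sym (B-2+1 l)
... | inj₁ (l , refl) = ⊥-elim (false≢true (trans (sym (odd-2 (B l))) (trans (cong odd (trans (sym (A-2 l)) e)) (cong not (odd-2 m)))))

-- Each summand of the recurrence changes exponent plus index by a multiple of 8, so this sum keeps
-- its residue modulo a divisor d of 8.
module Class7 (d c : ℕ) .{{_ : NonZero d}} (e8 : ∃ λ q → 8 ≡ q * d) where
  chk : (ℕ → Poly1) → Bool
  chk i = allB 8 (λ k → allAt (λ t → (t + k) % d ≡ᵇ c) (i k))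
  class : ∀ i → (∀ k → k < 8 → rec7 i k ≡ i k) → chk i ≡ true → ∀ k t → seq₇ i k t ≡ true → (t + k) % d ≡ c
  class i ii ck = base-step 8 (λ k l t e → ≡ᵇ-sound _ c (allAt-ok (λ t → (t + k) % d ≡ᵇ c) (i k) (allB-ok 8 (λ k → allAt (λ t → (t + k) % d ≡ᵇ c) (i k)) ck k l) t (subst (λ p → look p t ≡ true) (ii k l) (look7 i k t e)))) step
    where
    open +-*-Solver
    add8 : ∀ m n s → n ≡ m + 8 * s → m % d ≡ c → n % d ≡ c
    add8 m n s refl h = trans (cong (λ z → (m + z) % d) (trans (cong (_* s) (proj₂ e8)) (trans (*-assoc q d s) (trans (cong (q *_) (*-comm d s)) (sym (*-assoc q s d)))))) (trans ([m+kn]%n≡m%n m (q * s) d) h)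
      where q = proj₁ e8
    step : ∀ m → (∀ k → k < 8 + m → ∀ t → seq₇ i k t ≡ true → (t + k) % d ≡ c) → ∀ t → seq₇ i (8 + m) t ≡ true → (t + (8 + m)) % d ≡ c
    step m ih t e = h (rec7-true (rec7-Rec i Xv) 0 m t e)
      where
      h : _ → (t + (8 + m)) % d ≡ c
      h (inj₁ (s , refl , es)) = add8 (s + (2 + m)) _ 1 (solve 2 (λ s m → con 2 :+ s :+ (con 8 :+ m) := s :+ (con 2 :+ m) :+ con 8 :* con 1) refl s m) (ih (2 + m) (+-monoˡ-< m (≤from 3 8 refl)) s es)
      h (inj₂ (inj₁ (s , refl , es))) = add8 (s + (1 + m)) _ 1 (solve 2 (λ s m → con 1 :+ s :+ (con 8 :+ m) := s :+ (con 1 :+ m) :+ con 8 :* con 1) refl s m) (ih (1 + m) (+-monoˡ-< m (≤from 2 8 refl)) s es)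
      h (inj₂ (inj₂ (s , refl , es))) = add8 (s + m) _ 2 (solve 2 (λ s m → con 8 :+ s :+ (con 8 :+ m) := s :+ m :+ con 8 :* con 2) refl s m) (ih m (+-monoˡ-< m (≤from 1 8 refl)) s es)

xor4-true : ∀ {a b c d} → a xor (b xor (c xor d)) ≡ true → a ≡ true ⊎ (b ≡ true ⊎ (c ≡ true ⊎ d ≡ true))
xor4-true {true} e = inj₁ refl
xor4-true {false} {true} e = inj₂ (inj₁ refl)
xor4-true {false} {false} {true} e = inj₂ (inj₂ (inj₁ refl))
xor4-true {false} {false} {false} e = inj₂ (inj₂ (inj₂ e))

Xv^ : ∀ n g t → (Xv ^ₛ n · g) t ≡ true → ∃ λ s → t ≡ n + s × g s ≡ true
Xv^ zero g t e = t , refl , trans (sym (at (*-idˡ g) t)) e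
Xv^ (suc n) g t e = let (s , e1 , h1) = Xq-true 0 (Xv ^ₛ n · g) t (trans (sym (at (*-assoc' Xv (Xv ^ₛ n) g) t)) e) ; (s' , e2 , h2) = Xv^ n g s h1 in s' , trans e1 (cong suc e2) , h2

Xv^-at : ∀ n g t → (Xv ^ₛ n · g) (n + t) ≡ g t
Xv^-at zero g t = at (*-idˡ g) t
Xv^-at (suc n) g t = trans (at (*-assoc' Xv (Xv ^ₛ n) g) _) (trans (X-suc _ (n + t)) (Xv^-at n g t))

rec5-at : ∀ i n t → seq₅ i (6 + n) t ≡ (Xv ^ₛ 2 · seq₅ i (4 + n)) t xor ((Xv ^ₛ 4 · seq₅ i (2 + n)) t xor ((Xv ^ₛ 1 · seq₅ i (1 + n)) t xor (Xv ^ₛ 6 · seq₅ i n) t))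
rec5-at i n t = trans (at (rec5-Rec i Xv n) t) (trans (+-at _ _ t) (cong ((Xv ^ₛ 2 · seq₅ i (4 + n)) t xor_) (trans (+-at _ _ t) (cong ((Xv ^ₛ 4 · seq₅ i (2 + n)) t xor_) (trans (+-at _ _ t) (cong (_xor (Xv ^ₛ 6 · seq₅ i n) t) (at (*-cong (≋-sym (*-idʳ Xv)) ≋-refl) t)))))))

rec5-one : ∀ i n t → seq₅ i (6 + n) t ≡ true → (∃ λ s → t ≡ 2 + s × seq₅ i (4 + n) s ≡ true) ⊎ ((∃ λ s → t ≡ 4 + s × seq₅ i (2 + n) s ≡ true) ⊎ ((∃ λ s → t ≡ 1 + s × seq₅ i (1 + n) s ≡ true) ⊎ (∃ λ s → t ≡ 6 + s × seq₅ i n s ≡ true)))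
rec5-one i n t e = h (xor4-true {(Xv ^ₛ 2 · seq₅ i (4 + n)) t} (trans (sym (rec5-at i n t)) e))
  where
  h : _ → _
  h (inj₁ x) = inj₁ (Xv^ 2 _ t x)
  h (inj₂ (inj₁ x)) = inj₂ (inj₁ (Xv^ 4 _ t x))
  h (inj₂ (inj₂ (inj₁ x))) = inj₂ (inj₂ (inj₁ (Xv^ 1 _ t x)))
  h (inj₂ (inj₂ (inj₂ x))) = inj₂ (inj₂ (inj₂ (Xv^ 6 _ t x)))

-- For T₅ the quantity that changes by multiples of 8 is the exponent plus three times the index.
module Class5 (d c : ℕ) .{{_ : NonZero d}} (e8 : ∃ λ q → 8 ≡ q * d) where
  chk : (ℕ → Poly1) → Bool
  chk i = allB 6 (λ k → allAt (λ t → (t + 3 * k) % d ≡ᵇ c) (i k))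
  class : ∀ i → (∀ k → k < 6 → rec5 i k ≡ i k) → chk i ≡ true → ∀ k t → seq₅ i k t ≡ true → (t + 3 * k) % d ≡ c
  class i ii ck = base-step 6 (λ k l t e → ≡ᵇ-sound _ c (allAt-ok (λ t → (t + 3 * k) % d ≡ᵇ c) (i k) (allB-ok 6 (λ k → allAt (λ t → (t + 3 * k) % d ≡ᵇ c) (i k)) ck k l) t (subst (λ p → look p t ≡ true) (ii k l) (look5 i k t e)))) step
    where
    open +-*-Solver
    add8 : ∀ m n s → n ≡ m + 8 * s → m % d ≡ c → n % d ≡ c
    add8 m n s refl h = trans (cong (λ z → (m + z) % d) (trans (cong (_* s) (proj₂ e8)) (trans (*-assoc q d s) (trans (cong (q *_) (*-comm d s)) (sym (*-assoc q s d)))))) (trans ([m+kn]%n≡m%n m (q * s) d) h)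
      where q = proj₁ e8
    step : ∀ m → (∀ k → k < 6 + m → ∀ t → seq₅ i k t ≡ true → (t + 3 * k) % d ≡ c) → ∀ t → seq₅ i (6 + m) t ≡ true → (t + 3 * (6 + m)) % d ≡ c
    step m ih t e = h (rec5-one i m t e)
      where
      h : _ → (t + 3 * (6 + m)) % d ≡ c
      h (inj₁ (s , refl , es)) = add8 (s + 3 * (4 + m)) _ 1 (solve 2 (λ s m → con 2 :+ s :+ con 3 :* (con 6 :+ m) := s :+ con 3 :* (con 4 :+ m) :+ con 8 :* con 1) refl s m) (ih (4 + m) (+-monoˡ-< m (≤from 5 6 refl)) s es)
      h (inj₂ (inj₁ (s , refl , es))) = add8 (s + 3 * (2 + m)) _ 2 (solve 2 (λ s m → con 4 :+ s :+ con 3 :* (con 6 :+ m) := s :+ con 3 :* (con 2 :+ m) :+ con 8 :* con 2) refl s m) (ih (2 + m) (+-monoˡ-< m (≤from 3 6 refl)) s es)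
      h (inj₂ (inj₂ (inj₁ (s , refl , es)))) = add8 (s + 3 * (1 + m)) _ 2 (solve 2 (λ s m → con 1 :+ s :+ con 3 :* (con 6 :+ m) := s :+ con 3 :* (con 1 :+ m) :+ con 8 :* con 2) refl s m) (ih (1 + m) (+-monoˡ-< m (≤from 2 6 refl)) s es)
      h (inj₂ (inj₂ (inj₂ (s , refl , es)))) = add8 (s + 3 * m) _ 3 (solve 2 (λ s m → con 6 :+ s :+ con 3 :* (con 6 :+ m) := s :+ con 3 :* m :+ con 8 :* con 3) refl s m) (ih m (+-monoˡ-< m (≤from 1 6 refl)) s es)

rec7-ini : ∀ i k → k < 8 → rec7 i k ≡ i k
rec7-ini i 0 _ = refl
rec7-ini i 1 _ = refl
rec7-ini i 2 _ = refl
rec7-ini i 3 _ = refl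
rec7-ini i 4 _ = refl
rec7-ini i 5 _ = refl
rec7-ini i 6 _ = refl
rec7-ini i 7 _ = refl
rec7-ini i (suc (suc (suc (suc (suc (suc (suc (suc _)))))))) (s≤s (s≤s (s≤s (s≤s (s≤s (s≤s (s≤s (s≤s ()))))))))
rec5-ini : ∀ i k → k < 6 → rec5 i k ≡ i k
rec5-ini i 0 _ = refl
rec5-ini i 1 _ = refl
rec5-ini i 2 _ = refl
rec5-ini i 3 _ = refl
rec5-ini i 4 _ = refl
rec5-ini i 5 _ = refl
rec5-ini i (suc (suc (suc (suc (suc (suc _)))))) (s≤s (s≤s (s≤s (s≤s (s≤s (s≤s ()))))))

module M4-7 c = Class7 4 c (2 , refl)
module M2-7 c = Class7 2 c (4 , refl)
module M4-5 c = Class5 4 c (2 , refl)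
module M2-5 c = Class5 2 c (4 , refl)

x-odd : ∀ k t → seq₇ x-init k t ≡ true → (t + k) % 2 ≡ 1
x-odd = M2-7.class 1 x-init (rec7-ini x-init) refl
o-mod : ∀ k t → seq₇ o-init k t ≡ true → (t + k) % 4 ≡ 0
o-mod = M4-7.class 0 o-init (rec7-ini o-init) refl
us-mod : ∀ k t → seq₇ us-init k t ≡ true → (t + k) % 4 ≡ 0
us-mod = M4-7.class 0 us-init (rec7-ini us-init) refl
vs-odd : ∀ k t → seq₇ vs-init k t ≡ true → (t + k) % 2 ≡ 1
vs-odd = M2-7.class 1 vs-init (rec7-ini vs-init) refl
y1-mod : ∀ k t → seq₅ y₁-init k t ≡ true → (t + 3 * k) % 4 ≡ 0
y1-mod = M4-5.class 0 y₁-init (rec5-ini y₁-init) refl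
xy-mod : ∀ k t → seq₅ xy-init k t ≡ true → (t + 3 * k) % 4 ≡ 1
xy-mod = M4-5.class 1 xy-init (rec5-ini xy-init) refl
y4-mod : ∀ k t → seq₅ y₄-init k t ≡ true → (t + 3 * k) % 4 ≡ 3
y4-mod = M4-5.class 3 y₄-init (rec5-ini y₄-init) refl
yb-mod : ∀ k t → seq₅ yb-init k t ≡ true → (t + 3 * k) % 4 ≡ 0
yb-mod = M4-5.class 0 yb-init (rec5-ini yb-init) refl
yc-odd : ∀ k t → seq₅ yc-init k t ≡ true → (t + 3 * k) % 2 ≡ 1
yc-odd = M2-5.class 1 yc-init (rec5-ini yc-init) refl

-- Degrees stay below the index, so in top degree only the summand X⁸ f(n) survives: the top
-- coefficients have period 8 and equal the parity of the index.
module Top7 (i : ℕ → Poly1) (c0 : allB 8 (λ k → allAt (λ t → t <ᵇ k) (i k)) ≡ true) (c1 : allB 7 (λ j → not (look (i (suc j)) j xor odd (suc j))) ≡ true) where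
  deg : ∀ k t → seq₇ i k t ≡ true → t < k
  deg = base-step 8 (λ k l t e → <ᵇ⇒< t k (Equivalence.from T-≡ (allAt-ok (λ t → t <ᵇ k) (i k) (allB-ok 8 (λ k → allAt (λ t → t <ᵇ k) (i k)) c0 k l) t (subst (λ p → look p t ≡ true) (rec7-ini i k l) (look7 i k t e))))) step
    where
    step : ∀ m → (∀ k → k < 8 + m → ∀ t → seq₇ i k t ≡ true → t < k) → ∀ t → seq₇ i (8 + m) t ≡ true → t < 8 + m
    step m ih t e = h (rec7-true (rec7-Rec i Xv) 0 m t e)
      where
      h : _ → t < 8 + m
      h (inj₁ (s , refl , es)) = ≤-trans (+-monoʳ-< 2 (ih (2 + m) (+-monoˡ-< m (≤from 3 8 refl)) s es)) (+-monoˡ-≤ m (≤from 4 8 refl))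
      h (inj₂ (inj₁ (s , refl , es))) = ≤-trans (+-monoʳ-< 1 (ih (1 + m) (+-monoˡ-< m (≤from 2 8 refl)) s es)) (+-monoˡ-≤ m (≤from 2 8 refl))
      h (inj₂ (inj₂ (s , refl , es))) = +-monoʳ-< 8 (ih m (+-monoˡ-< m (≤from 1 8 refl)) s es)

  xor-not : ∀ a b → not (a xor b) ≡ true → a ≡ b
  xor-not false false _ = refl
  xor-not true true _ = refl

  top : ∀ j → seq₇ i (suc j) j ≡ odd (suc j)
  top = base-step 7 (λ j l → trans (look-ok (rec7 i (suc j)) j) (trans (cong (λ p → look p j) (rec7-ini i (suc j) (s≤s l))) (xor-not _ _ (allB-ok 7 (λ j → not (look (i (suc j)) j xor odd (suc j))) c1 j l)))) step
    where
    step : ∀ m → (∀ j → j < 7 + m → seq₇ i (suc j) j ≡ odd (suc j)) → seq₇ i (8 + m) (7 + m) ≡ odd (8 + m)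
    step m ih = trans (at (rec7-Rec i Xv m) (7 + m)) (trans (+-at _ _ (7 + m)) (cong₂ _xor_ z1 (trans (+-at _ _ (7 + m)) (cong₂ _xor_ z2 (z3 m ih)))))
      where
      z1 : (Xv ^ₛ 2 · seq₇ i (2 + m)) (7 + m) ≡ false
      z1 = ¬true (λ e → let (s , es , h) = Xv^ 2 _ (7 + m) e in <⇒≱ (deg (2 + m) s h) (subst (2 + m ≤_) (+-cancelˡ-≡ 2 _ _ es) (+-monoˡ-≤ m (≤from 2 5 refl))))
      z2 : (Xv · seq₇ i (1 + m)) (7 + m) ≡ false
      z2 = ¬true (λ e → let (s , es , h) = Xq-true 0 _ (7 + m) e in <⇒≱ (deg (1 + m) s h) (subst (1 + m ≤_) (+-cancelˡ-≡ 1 _ _ es) (+-monoˡ-≤ m (≤from 1 6 refl))))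
      nn : ∀ b → not (not (not (not (not (not (not (not b))))))) ≡ b
      nn false = refl
      nn true = refl
      z3 : ∀ m → (∀ j → j < 7 + m → seq₇ i (suc j) j ≡ odd (suc j)) → (Xv ^ₛ 8 · seq₇ i m) (7 + m) ≡ odd (8 + m)
      z3 zero _ = ¬true (λ e → let (s , es , h) = Xv^ 8 _ 7 e in <⇒≱ (deg 0 s h) z≤n)
      z3 (suc m) ih = trans (cong (Xv ^ₛ 8 · seq₇ i (suc m)) (cong (7 +_) refl)) (trans (cong (Xv ^ₛ 8 · seq₇ i (suc m)) (+-suc 7 m)) (trans (Xv^-at 8 (seq₇ i (suc m)) m) (trans (ih m (<-trans (n<1+n m) (m<n+m (suc m) {7} (s≤s z≤n)))) (sym (nn (odd (suc m)))))))

-- In top degree the summands from f(4 + n), f(2 + n) and f(n) contribute the same parity, and 1 + 1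
-- + 1 = 1.
module Top5 (i : ℕ → Poly1) (c0 : allB 6 (λ k → allAt (λ t → t <ᵇ k) (i k)) ≡ true) (c1 : allB 5 (λ j → not (look (i (suc j)) j xor odd (suc j))) ≡ true) where
  deg : ∀ k t → seq₅ i k t ≡ true → t < k
  deg = base-step 6 (λ k l t e → <ᵇ⇒< t k (Equivalence.from T-≡ (allAt-ok (λ t → t <ᵇ k) (i k) (allB-ok 6 (λ k → allAt (λ t → t <ᵇ k) (i k)) c0 k l) t (subst (λ p → look p t ≡ true) (rec5-ini i k l) (look5 i k t e))))) step
    where
    step : ∀ m → (∀ k → k < 6 + m → ∀ t → seq₅ i k t ≡ true → t < k) → ∀ t → seq₅ i (6 + m) t ≡ true → t < 6 + m
    step m ih t e = h (rec5-one i m t e)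
      where
      h : _ → t < 6 + m
      h (inj₁ (s , refl , es)) = +-monoʳ-< 2 (ih (4 + m) (+-monoˡ-< m (≤from 5 6 refl)) s es)
      h (inj₂ (inj₁ (s , refl , es))) = +-monoʳ-< 4 (ih (2 + m) (+-monoˡ-< m (≤from 3 6 refl)) s es)
      h (inj₂ (inj₂ (inj₁ (s , refl , es)))) = ≤-trans (+-monoʳ-< 1 (ih (1 + m) (+-monoˡ-< m (≤from 2 6 refl)) s es)) (+-monoˡ-≤ m (≤from 2 6 refl))
      h (inj₂ (inj₂ (inj₂ (s , refl , es)))) = +-monoʳ-< 6 (ih m (+-monoˡ-< m (≤from 1 6 refl)) s es)

  xor-not : ∀ a b → not (a xor b) ≡ true → a ≡ b
  xor-not false false _ = refl
  xor-not true true _ = refl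

  top : ∀ j → seq₅ i (suc j) j ≡ odd (suc j)
  top = base-step 5 (λ j l → trans (look-ok (rec5 i (suc j)) j) (trans (cong (λ p → look p j) (rec5-ini i (suc j) (s≤s l))) (xor-not _ _ (allB-ok 5 (λ j → not (look (i (suc j)) j xor odd (suc j))) c1 j l)))) step
    where
    step : ∀ m → (∀ j → j < 5 + m → seq₅ i (suc j) j ≡ odd (suc j)) → seq₅ i (6 + m) (5 + m) ≡ odd (6 + m)
    step m ih = trans (rec5-at i m (5 + m)) (trans (cong₂ _xor_ (trans (Xv^-at 2 (seq₅ i (4 + m)) (3 + m)) (ih (3 + m) (+-monoˡ-< m (≤from 4 5 refl))))
        (cong₂ _xor_ (trans (Xv^-at 4 (seq₅ i (2 + m)) (1 + m)) (ih (1 + m) (+-monoˡ-< m (≤from 2 5 refl)))) (cong₂ _xor_ z2 (z3 m ih)))) (nn (odd m)))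
      where
      z2 : (Xv ^ₛ 1 · seq₅ i (1 + m)) (5 + m) ≡ false
      z2 = ¬true (λ e → let (s , es , h) = Xv^ 1 _ (5 + m) e in <⇒≱ (deg (1 + m) s h) (subst (1 + m ≤_) (+-cancelˡ-≡ 1 _ _ es) (+-monoˡ-≤ m (≤from 1 4 refl))))
      nn : ∀ b → not (not (not (not b))) xor (not (not b) xor (false xor b)) ≡ not (not (not (not (not (not b)))))
      nn false = refl
      nn true = refl
      z3 : ∀ m → (∀ j → j < 5 + m → seq₅ i (suc j) j ≡ odd (suc j)) → (Xv ^ₛ 6 · seq₅ i m) (5 + m) ≡ odd m
      z3 zero _ = ¬true (λ e → let (s , es , h) = Xv^ 6 _ 5 e in <⇒≱ (deg 0 s h) z≤n)
      z3 (suc m) ih = trans (cong (Xv ^ₛ 6 · seq₅ i (suc m)) (+-suc 5 m)) (trans (Xv^-at 6 (seq₅ i (suc m)) m) (ih m (<-trans (n<1+n m) (m<n+m (suc m) {5} (s≤s z≤n)))))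

module TX = Top7 x-init refl refl
module TY0 = Top5 y₁₀-init refl refl
module TY22 = Top5 y₁₂-init refl refl

-- Weights (1, 1) measure A + B and weights (1, 2) measure A + 2B; together they give the order in
-- which T₇ and T₅ are triangular.
module WH n = Bound 1 1 n ≤-refl (s≤s z≤n)
module WL n = Bound 1 2 n (s≤s z≤n) ≤-refl

x-H : ∀ k t → seq₇ x-init k t ≡ true → W 1 1 t + 1 ≤ W 1 1 k
x-H = WH.bound7 1 x-init refl
x-L : ∀ k t → seq₇ x-init k t ≡ true → W 1 2 t + 1 ≤ W 1 2 k
x-L = WL.bound7 1 x-init refl
e-L : ∀ k t → seq₇ e-init k t ≡ true → W 1 2 t + 2 ≤ W 1 2 k
e-L = WL.bound7 2 e-init refl
e2-L : ∀ k t → seq₇ e₂-init k t ≡ true → W 1 2 t + 2 ≤ W 1 2 k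
e2-L = WL.bound7 2 e₂-init refl
y1-H : ∀ k t → seq₅ y₁-init k t ≡ true → W 1 1 t + 2 ≤ W 1 1 k
y1-H = WH.bound5 2 y₁-init refl
y1-L : ∀ k t → seq₅ y₁-init k t ≡ true → W 1 2 t + 2 ≤ W 1 2 k
y1-L = WL.bound5 2 y₁-init refl
y2-H : ∀ k t → seq₅ y₂-init k t ≡ true → W 1 1 t + 0 ≤ W 1 1 k
y2-H = WH.bound5 0 y₂-init refl
y2-L : ∀ k t → seq₅ y₂-init k t ≡ true → W 1 2 t + 0 ≤ W 1 2 k
y2-L = WL.bound5 0 y₂-init refl

-- Leading coefficients, found by splitting the index modulo 4

sq4 : Series → Series
sq4 f = (f · f) · (f · f)

sq4p : Poly1 → Poly1
sq4p p = mulp 1 (mulp 1 p p) (mulp 1 p p)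

sq4p-ok : ∀ p f → ⟪ sq4p p ⟫ f ≋ sq4 (⟪ p ⟫ f)
sq4p-ok p f = ⟪⟫-* (mulp 1 p p) (mulp 1 p p) f ⟫ *-cong (⟪⟫-* p p f) (⟪⟫-* p p f)

sq4-at : ∀ f t → sq4 f (2 * (2 * t)) ≡ f t
sq4-at f t = trans (sq-even (2 * t) (f · f)) (sq-even t f)

initial : ∀ n (P Q : ℕ → Poly1) → allB n (λ l → eqP (P l) (Q l)) ≡ true → ∀ l → l < n → ⟪ P l ⟫ Xv ≋ ⟪ Q l ⟫ Xv
initial n P Q h l lt = eqP-ok (P l) (Q l) Xv (allB-ok n (λ l → eqP (P l) (Q l)) h l lt)

R7s : ∀ i → Rec7 Xv (seq₇ i)
R7s i = rec7-Rec i Xv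
R5s : ∀ i → Rec5 Xv (seq₅ i)
R5s i = rec5-Rec i Xv

-- Both sides obey the recurrence with X⁴ in place of X, so eight values of l decide.
x-4l : ∀ l → seq₇ x-init (2 * (2 * l)) ≋ Xv · sq4 (seq₇ x₀-init l)
x-4l = uniq-rec7 (Rec7-even (Rec7-even (R7s x-init))) (Rec7-· Xv (Rec7-sq (Rec7-sq (R7s x₀-init))))
  (λ l lt → initial 8 (λ l → rec7 x-init (2 * (2 * l))) (λ l → sh 1 (sq4p (rec7 x₀-init l))) refl l lt ⟫ sh-ok 1 (sq4p (rec7 x₀-init l)) Xv ⟫ *-cong (*-idʳ Xv) (sq4p-ok (rec7 x₀-init l) Xv))

x-4l+2 : ∀ l → seq₇ x-init (2 * suc (2 * l)) ≋ Xv ^ₛ 3 · sq4 (seq₇ x₂-init l)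
x-4l+2 = uniq-rec7 (Rec7-even (Rec7-suc {f = λ n → seq₇ x-init (2 * n)} (Rec7-even (R7s x-init)))) (Rec7-· (Xv ^ₛ 3) (Rec7-sq (Rec7-sq (R7s x₂-init))))
  (λ l lt → initial 8 (λ l → rec7 x-init (2 * suc (2 * l))) (λ l → sh 3 (sq4p (rec7 x₂-init l))) refl l lt ⟫ sh-ok 3 (sq4p (rec7 x₂-init l)) Xv ⟫ *-cong ≋-refl (sq4p-ok (rec7 x₂-init l) Xv))

sum7 : ∀ i j k → allB 8 (λ l → eqP (rec7 i l) (rec7 j l ⊞ rec7 k l)) ≡ true → ∀ l → seq₇ i l ≋ seq₇ j l ⊹ seq₇ k l
sum7 i j k h = uniq-rec7 (R7s i) (Rec7-+ (R7s j) (R7s k)) (λ l lt → initial 8 (rec7 i) (λ l → rec7 j l ⊞ rec7 k l) h l lt ⟫ ⟪⟫-+ (rec7 j l) (rec7 k l) Xv)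
sum5 : ∀ i j k → allB 6 (λ l → eqP (rec5 i l) (rec5 j l ⊞ rec5 k l)) ≡ true → ∀ l → seq₅ i l ≋ seq₅ j l ⊹ seq₅ k l
sum5 i j k h = uniq-rec5 (R5s i) (Rec5-+ (R5s j) (R5s k)) (λ l lt → initial 6 (rec5 i) (λ l → rec5 j l ⊞ rec5 k l) h l lt ⟫ ⟪⟫-+ (rec5 j l) (rec5 k l) Xv)

-- The error `e-init` lowers A + 2B by at least two, too much to reach a leading term.
x0-e : ∀ l → seq₇ x₀-init l ≋ seq₇ x-init l ⊹ seq₇ e-init l
x0-e = sum7 x₀-init x-init e-init refl
x2-e : ∀ l → seq₇ x₂-init l ≋ seq₇ x-init l ⊹ seq₇ e₂-init l
x2-e = sum7 x₂-init x-init e₂-init refl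
x2-uv : ∀ l → seq₇ x₂-init l ≋ seq₇ us-init l ⊹ seq₇ vs-init l
x2-uv = sum7 x₂-init us-init vs-init refl
h-o : ∀ l → seq₇ h-init l ≋ seq₇ x-init l ⊹ seq₇ o-init l
h-o = sum7 h-init x-init o-init refl

-- For the corner points, where the error decides: at even indices it is the square of a sequence
-- equal to x up to `o-init`.
e-2i : ∀ l → seq₇ e-init (2 * l) ≋ seq₇ h-init l · seq₇ h-init l
e-2i = uniq-rec7 (Rec7-even (R7s e-init)) (Rec7-sq (R7s h-init))
  (λ l lt → initial 8 (λ l → rec7 e-init (2 * l)) (λ l → mulp 1 (rec7 h-init l) (rec7 h-init l)) refl l lt ⟫ ⟪⟫-* (rec7 h-init l) (rec7 h-init l) Xv)

y1-4l : ∀ l → seq₅ y₁-init (2 * (2 * l)) ≋ sq4 (seq₅ y₁₀-init l)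
y1-4l = uniq-rec5 (Rec5-even (Rec5-even (R5s y₁-init))) (Rec5-sq (Rec5-sq (R5s y₁₀-init)))
  (λ l lt → initial 6 (λ l → rec5 y₁-init (2 * (2 * l))) (λ l → sq4p (rec5 y₁₀-init l)) refl l lt ⟫ sq4p-ok (rec5 y₁₀-init l) Xv)

y1-4l+2 : ∀ l → seq₅ y₁-init (2 * suc (2 * l)) ≋ Xv ^ₛ 2 · sq4 (seq₅ y₁₂-init l)
y1-4l+2 = uniq-rec5 (Rec5-even (Rec5-suc {f = λ n → seq₅ y₁-init (2 * n)} (Rec5-even (R5s y₁-init)))) (Rec5-· (Xv ^ₛ 2) (Rec5-sq (Rec5-sq (R5s y₁₂-init))))
  (λ l lt → initial 6 (λ l → rec5 y₁-init (2 * suc (2 * l))) (λ l → sh 2 (sq4p (rec5 y₁₂-init l))) refl l lt ⟫ sh-ok 2 (sq4p (rec5 y₁₂-init l)) Xv ⟫ *-cong ≋-refl (sq4p-ok (rec5 y₁₂-init l) Xv))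

ya : Seq
ya l = seq₅ xy-init l ⊹ seq₅ y₄-init l

y0-ya : ∀ l → seq₅ y₁₀-init l ≋ ya l ⊹ seq₅ yb-init l
y0-ya = uniq-rec5 (R5s y₁₀-init) (Rec5-+ (Rec5-+ (R5s xy-init) (R5s y₄-init)) (R5s yb-init))
  (λ l lt → initial 6 (rec5 y₁₀-init) (λ l → rec5 xy-init l ⊞ rec5 y₄-init l ⊞ rec5 yb-init l) refl l lt ⟫ ⟪⟫-+ (rec5 xy-init l ⊞ rec5 y₄-init l) (rec5 yb-init l) Xv ⟫ +-cong (⟪⟫-+ (rec5 xy-init l) (rec5 y₄-init l) Xv) ≋-refl)

xy-y1 : ∀ l → seq₅ xy-init l ≋ Xv · seq₅ y₁-init l
xy-y1 = uniq-rec5 (R5s xy-init) (Rec5-· Xv (R5s y₁-init)) (λ l lt → initial 6 (rec5 xy-init) (λ l → sh 1 (rec5 y₁-init l)) refl l lt ⟫ sh-ok 1 (rec5 y₁-init l) Xv ⟫ *-cong (*-idʳ Xv) ≋-refl)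

y22-cd : ∀ l → seq₅ y₁₂-init l ≋ seq₅ yc-init l ⊹ seq₅ yd-init l
y22-cd = sum5 y₁₂-init yc-init yd-init refl

yd-2i : ∀ l → seq₅ yd-init (2 * l) ≋ ya l · ya l
yd-2i = uniq-rec5 (Rec5-even (R5s yd-init)) (Rec5-sq (Rec5-+ (R5s xy-init) (R5s y₄-init)))
  (λ l lt → initial 6 (λ l → rec5 yd-init (2 * l)) (λ l → mulp 1 (rec5 xy-init l ⊞ rec5 y₄-init l) (rec5 xy-init l ⊞ rec5 y₄-init l)) refl l lt ⟫ ⟪⟫-* (rec5 xy-init l ⊞ rec5 y₄-init l) (rec5 xy-init l ⊞ rec5 y₄-init l) Xv
    ⟫ *-cong (⟪⟫-+ (rec5 xy-init l) (rec5 y₄-init l) Xv) (⟪⟫-+ (rec5 xy-init l) (rec5 y₄-init l) Xv))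

at+ : ∀ {f g h : Series} {t x y} → f ≋ g ⊹ h → g t ≡ x → h t ≡ y → f t ≡ x xor y
at+ e p q = trans (at e _) (trans (+-at _ _ _) (cong₂ _xor_ p q))

x-4l-at : ∀ l t → seq₇ x-init (2 * (2 * l)) (suc (2 * (2 * t))) ≡ seq₇ x₀-init l t
x-4l-at l t = trans (at (x-4l l) _) (trans (X-suc _ _) (sq4-at _ t))

x-4l+2-at : ∀ l t → seq₇ x-init (2 * suc (2 * l)) (suc (2 * suc (2 * t))) ≡ seq₇ x₂-init l t
x-4l+2-at l t = trans (cong (seq₇ x-init (2 * suc (2 * l))) (solve 1 (λ t → con 1 :+ con 2 :* (con 1 :+ con 2 :* t) := con 3 :+ con 2 :* (con 2 :* t)) refl t))
  (trans (at (x-4l+2 l) _) (trans (Xv^-at 3 _ _) (sq4-at _ t)))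
  where open +-*-Solver

y1-4l-at : ∀ l t → seq₅ y₁-init (2 * (2 * l)) (2 * (2 * t)) ≡ seq₅ y₁₀-init l t
y1-4l-at l t = trans (at (y1-4l l) _) (sq4-at _ t)

y1-4l+2-at : ∀ l t → seq₅ y₁-init (2 * suc (2 * l)) (2 * suc (2 * t)) ≡ seq₅ y₁₂-init l t
y1-4l+2-at l t = trans (cong (seq₅ y₁-init (2 * suc (2 * l))) (2*+ 1 (2 * t))) (trans (at (y1-4l+2 l) _) (trans (Xv^-at 2 _ _) (sq4-at _ t)))

W11 : ∀ k → W 1 1 k ≡ A k + B k
W11 k = cong₂ _+_ (+-identityʳ (A k)) (+-identityʳ (B k))
W12 : ∀ k → W 1 2 k ≡ A k + 2 * B k
W12 k = cong (_+ 2 * B k) (+-identityʳ (A k))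

drop2-false : ∀ (f : Seq) → (∀ k t → f k t ≡ true → W 1 2 t + 2 ≤ W 1 2 k) → ∀ k t → suc (A t) ≡ A k → B t ≡ B k → f k t ≡ false
drop2-false f h k t a b = ¬true (λ e → <⇒≱ (≤-reflexive (lem (trans (W12 k) (trans (cong₂ (λ x y → x + 2 * y) (sym a) (sym b)) (cong suc (sym (W12 t))))))) (h k t e))
  where lem : W 1 2 k ≡ suc (W 1 2 t) → suc (W 1 2 k) ≡ W 1 2 t + 2
        lem e = trans (cong suc e) (+-comm 2 (W 1 2 t))

-- Recursion from k to its quotient by 4. Odd k is a top coefficient. For k = 4l or 4l + 2 the
-- coefficient is one of x₀ or x₂ at l, and their differences from x lie too low in A + 2B to
-- interfere.
x-lead : ∀ k t → suc (A t) ≡ A k → B t ≡ B k → seq₇ x-init k t ≡ true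
x-lead k t = go (suc k) k t ≤-refl
  where
  go : ∀ b k t → k < b → suc (A t) ≡ A k → B t ≡ B k → seq₇ x-init k t ≡ true
  odd-case : ∀ m t → suc (A t) ≡ A (suc (2 * m)) → B t ≡ B (suc (2 * m)) → seq₇ x-init (suc (2 * m)) t ≡ true
  odd-case m t a b with halfA t (B m) (suc-injective (trans a (A-2+1 m)))
  ... | l , refl , bl , al with code-inj l m (trans al (trans b (B-2+1 m))) bl
  ...   | refl = trans (TX.top (2 * m)) (cong not (odd-2 m))
  ev-case : ∀ b m t → 2 * m < suc b → suc (A t) ≡ A (2 * m) → B t ≡ B (2 * m) → (∃ λ l → m ≡ 2 * l) ⊎ (∃ λ l → m ≡ suc (2 * l)) → seq₇ x-init (2 * m) t ≡ true
  pos-pred : ∀ {t l} → suc (A t) ≡ 2 * A l → ∃ λ a → A l ≡ suc a × A t ≡ suc (2 * a)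
  pos-pred {t} {l} e with A l
  ... | suc a = a , refl , suc-injective (trans e (cong suc (+-suc a (a + 0))))
  lt : ∀ b l x → A l ≡ suc x → ∀ c → 2 * (c + 2 * l) < suc b → l < b
  lt b zero x e c q = ⊥-elim (0≢1+n e)
  lt b (suc l) x e c q = <-≤-trans (≤-trans (m<n+m (suc l) {suc l} (s≤s z≤n)) (≤-trans (≤-reflexive (cong (suc l +_) (sym (+-identityʳ (suc l))))) (≤-trans (m≤n+m (2 * suc l) c) (m≤m+n (c + 2 * suc l) _)))) (≤-pred q)
  ev-case b m t k<b a bb (inj₁ (l , refl)) = step (pos-pred {t} {l} (trans a (trans (A-2 (2 * l)) (cong (2 *_) (B-2 l)))))
    where
    step : (∃ λ a → A l ≡ suc a × A t ≡ suc (2 * a)) → seq₇ x-init (2 * (2 * l)) t ≡ true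
    step (a , el , et) with halfA' t a et
    ... | s , refl , bs , as with halfA s (B l) (trans as (trans bb (trans (B-2 (2 * l)) (A-2 l))))
    ...   | t' , refl , bt , at' = trans (x-4l-at l t') (at+ (x0-e l) (go b l t' (lt b l a el 0 k<b) (trans (cong suc (trans at' bs)) (sym el)) bt)
              (drop2-false (seq₇ e-init) e-L l t' (trans (cong suc (trans at' bs)) (sym el)) bt))
  ev-case b m t k<b a bb (inj₂ (l , refl)) = step (pos-pred {t} {l} (trans a (trans (A-2 (suc (2 * l))) (cong (2 *_) (B-2+1 l)))))
    where
    step : (∃ λ a → A l ≡ suc a × A t ≡ suc (2 * a)) → seq₇ x-init (2 * suc (2 * l)) t ≡ true
    step (a , el , et) with halfA' t a et
    ... | s , refl , bs , as with halfA' s (B l) (trans as (trans bb (trans (B-2 (suc (2 * l))) (A-2+1 l))))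
    ...   | t' , refl , bt , at' = trans (x-4l+2-at l t') (at+ (x2-e l) (go b l t' (lt b l a el 1 k<b) (trans (cong suc (trans at' bs)) (sym el)) bt)
              (drop2-false (seq₇ e₂-init) e2-L l t' (trans (cong suc (trans at' bs)) (sym el)) bt))
  go (suc b) k t l a bb with even-or-odd k
  ... | inj₁ (m , refl) = ev-case b m t l a bb (even-or-odd m)
  ... | inj₂ (m , refl) = odd-case m t a bb

double-mod2 : ∀ n x → n ≡ 2 * x → n % 2 ≢ 1
double-mod2 n x refl e = 0≢1+n (trans (sym (trans (cong (_% 2) (*-comm 2 x)) (m*n%n≡0 x 2))) e)

double-mod4 : ∀ n x → n ≡ 2 * x → odd x ≡ true → n % 4 ≡ 2
double-mod4 n x refl o with odd-half x o
... | y , refl = trans (cong (_% 4) (solve 1 (λ y → con 2 :* (con 1 :+ con 2 :* y) := con 2 :+ y :* con 4) refl y)) ([m+kn]%n≡m%n 2 y 4)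
  where open +-*-Solver

mod4-even : ∀ n → n % 4 ≡ 0 → odd n ≡ false
mod4-even n e = trans (cong odd (trans (m≡m%n+[m/n]*n n 4) (trans (cong (_+ n / 4 * 4) e) (solve 1 (λ q → q :* con 4 := con 2 :* (con 2 :* q)) refl (n / 4))))) (odd-2 (2 * (n / 4)))
  where open +-*-Solver

odd-AA : ∀ i j m → A i ≡ suc m → A j ≡ m → odd (j + i) ≡ true
odd-AA i j m ei ej = trans (odd-+ j i) (trans (cong₂ _xor_ (trans (sym (odd-A j)) (cong odd ej)) (trans (sym (odd-A i)) (cong odd ei))) (h (odd m)))
  where h : ∀ b → b xor not b ≡ true
        h false = refl
        h true = refl

odd-3 : ∀ i j → odd (j + 3 * i) ≡ odd (j + i)
odd-3 i j = trans (odd-+ j (3 * i)) (trans (cong (odd j xor_) (trans (odd-+ i (2 * i)) (trans (cong (odd i xor_) (odd-2 i)) (xor-identityʳ _)))) (sym (odd-+ j i)))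

dbl2 : ∀ i j → 2 * j + 2 * i ≡ 2 * (j + i)
dbl2 i j = sym (2*+ j i)
dbl3 : ∀ i j → 2 * j + 3 * (2 * i) ≡ 2 * (j + 3 * i)
dbl3 i j = solve 2 (λ i j → con 2 :* j :+ con 3 :* (con 2 :* i) := con 2 :* (j :+ con 3 :* i)) refl i j
  where open +-*-Solver

-- At A = 0 nothing is left to lower in A. For even n the coefficient comes from the square inside
-- `e-init`, whose root is read off with `x-lead`; for odd n residues modulo 2 and 4 exclude it.
x-corner : ∀ k t n → A k ≡ 0 → B k ≡ 2 + n → A t ≡ 1 → B t ≡ n → seq₇ x-init k t ≡ not (odd n)
x-corner k t n ak bk at' bt with even-or-odd n
x-corner k t n ak bk at' bt | inj₁ (m , refl) with halfA k 0 ak | halfA' t 0 at'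
... | k1 , refl , bk1 , ak1 | s , refl , bs , as with halfA k1 (suc m) (trans ak1 (trans bk (sym (2*+ 1 m)))) | halfA s m (trans as bt)
... | l , refl , bl , al | t' , refl , bt' , at2 with halfA l 0 (trans al bk1) | halfA t' 0 (trans at2 bs)
... | i , refl , bi , ai | j , refl , bj , aj = trans (x-4l-at (2 * i) (2 * j)) (trans (at+ (x0-e (2 * i))
       (¬true (λ e → double-mod2 _ (j + i) (dbl2 i j) (x-odd (2 * i) (2 * j) e)))
       (trans (at (e-2i i) (2 * j)) (trans (sq-even j _) (at+ (h-o i)
          (x-lead i j (trans (cong suc (trans aj bt')) (sym (trans ai bl))) (trans bj (sym bi)))
          (¬true (λ e → false≢true (trans (sym (mod4-even (j + i) (o-mod i j e))) (odd-AA i j m (trans ai bl) (trans aj bt')))))))))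
       (cong not (sym (odd-2 m))))
x-corner k t n ak bk at' bt | inj₂ (m , refl) with halfA k 0 ak | halfA' t 0 at'
... | k1 , refl , bk1 , ak1 | s , refl , bs , as with halfA' k1 (suc m) (trans ak1 (trans bk (cong suc (sym (2*+ 1 m))))) | halfA' s m (trans as bt)
... | l , refl , bl , al | t' , refl , bt' , at2 with halfA l 0 (trans al bk1) | halfA t' 0 (trans at2 bs)
... | i , refl , bi , ai | j , refl , bj , aj = trans (x-4l+2-at (2 * i) (2 * j)) (trans (at+ (x2-uv (2 * i))
       (¬true (λ e → 0≢1+n (trans (sym (us-mod (2 * i) (2 * j) e)) (double-mod4 _ (j + i) (dbl2 i j) (odd-AA i j m (trans ai bl) (trans aj bt'))))))
       (¬true (λ e → double-mod2 _ (j + i) (dbl2 i j) (vs-odd (2 * i) (2 * j) e))))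
       (cong not (cong not (sym (odd-2 m)))))

yb-false : ∀ i j → odd (j + i) ≡ true → seq₅ yb-init i j ≡ false
yb-false i j o = ¬true (λ e → false≢true (trans (sym (mod4-even (j + 3 * i) (yb-mod i j e))) (trans (odd-3 i j) o)))

xor-f : ∀ {a b c} → c ≡ a xor b → b ≡ false → c ≡ a
xor-f {a} refl refl = xor-identityʳ a

y0≡ya : ∀ i j → odd (j + i) ≡ true → seq₅ y₁₀-init i j ≡ ya i j
y0≡ya i j o = xor-f (at+ (y0-ya i) refl refl) (yb-false i j o)

-- Even m is a top coefficient of `y₁₀-init`. For odd m the summand X y₁ at index 4l leads back to
-- `y₁₀-init` at l, with m halved.
ya-lead : ∀ b m i j → m < b → A i ≡ suc m → B i ≡ 0 → A j ≡ m → B j ≡ 0 → ya i j ≡ true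
ya-lead (suc b) m i j lt ai bi aj bj with even-or-odd m
ya-lead (suc b) m i j lt ai bi aj bj | inj₁ (m' , refl) with halfA' i m' ai | halfA j m' aj
... | s , refl , bs , as | l , refl , bl , al with code-inj l s (trans al (trans bj (sym (trans as bi)))) (trans bl (sym bs))
...   | refl = trans (sym (y0≡ya (suc (2 * s)) (2 * s) (odd-AA (suc (2 * s)) (2 * s) (2 * m') ai aj))) (trans (TY0.top (2 * s)) (cong not (odd-2 s)))
ya-lead (suc b) m i j lt ai bi aj bj | inj₂ (m' , refl) with halfA i (suc m') (trans ai (sym (2*+ 1 m'))) | halfA' j m' aj
... | i1 , refl , bi1 , ai1 | j1 , refl , bj1 , aj1 with halfA i1 0 (trans ai1 bi) | halfA j1 0 (trans aj1 bj)
...   | i2 , refl , bi2 , ai2 | j2 , refl , bj2 , aj2 = trans (+-at _ _ (suc (2 * (2 * j2)))) (cong₂ _xor_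
        (trans (at (xy-y1 (2 * (2 * i2))) _) (trans (X-suc _ _) (trans (y1-4l-at i2 j2) (trans (y0≡ya i2 j2 (odd-AA i2 j2 m' (trans ai2 bi1) (trans aj2 bj1)))
           (ya-lead b m' i2 j2 (≤-trans (s≤s (m≤m+n m' (m' + 0))) (≤-pred lt)) (trans ai2 bi1) bi2 (trans aj2 bj1) bj2)))))
        (¬true (λ e → three (trans (sym (y4-mod (2 * (2 * i2)) (suc (2 * (2 * j2))) e)) (trans (cong (_% 4) (solve 2 (λ i j → con 1 :+ con 2 :* (con 2 :* j) :+ con 3 :* (con 2 :* (con 2 :* i)) := con 1 :+ (j :+ con 3 :* i) :* con 4) refl i2 j2)) ([m+kn]%n≡m%n 1 (j2 + 3 * i2) 4))))))
  where
  open +-*-Solver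
  three : 3 ≢ 1
  three ()

-- Residues modulo 4 exclude even n. For odd n the summand `yd-init` is a square at even indices,
-- and `ya-lead` gives its root.
y1-corner : ∀ k t n → A k ≡ 0 → B k ≡ 2 + n → A t ≡ 0 → B t ≡ n → seq₅ y₁-init k t ≡ odd n
y1-corner k t n ak bk at' bt with even-or-odd n
y1-corner k t n ak bk at' bt | inj₁ (m , refl) with halfA k 0 ak | halfA t 0 at'
... | k1 , refl , bk1 , ak1 | s , refl , bs , as with halfA k1 (suc m) (trans ak1 (trans bk (sym (2*+ 1 m)))) | halfA s m (trans as bt)
... | l , refl , bl , al | t' , refl , bt' , at2 with halfA l 0 (trans al bk1) | halfA t' 0 (trans at2 bs)
... | i , refl , bi , ai | j , refl , bj , aj = trans (y1-4l-at (2 * i) (2 * j)) (trans (at+ (y0-ya (2 * i)) (trans (+-at _ _ (2 * j)) (cong₂ _xor_ (f _ 1 (λ ()) (xy-mod (2 * i) (2 * j))) (f _ 3 (λ ()) (y4-mod (2 * i) (2 * j))))) (f _ 0 (λ ()) (yb-mod (2 * i) (2 * j)))) (sym (odd-2 m)))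
  where
  f : ∀ b c → c ≢ 2 → (b ≡ true → (2 * j + 3 * (2 * i)) % 4 ≡ c) → b ≡ false
  f b c ne h = ¬true (λ e → ne (trans (sym (h e)) (double-mod4 _ (j + 3 * i) (dbl3 i j) (trans (odd-3 i j) (odd-AA i j m (trans ai bl) (trans aj bt'))))))
y1-corner k t n ak bk at' bt | inj₂ (m , refl) with halfA k 0 ak | halfA t 0 at'
... | k1 , refl , bk1 , ak1 | s , refl , bs , as with halfA' k1 (suc m) (trans ak1 (trans bk (cong suc (sym (2*+ 1 m))))) | halfA' s m (trans as bt)
... | l , refl , bl , al | t' , refl , bt' , at2 with halfA l 0 (trans al bk1) | halfA t' 0 (trans at2 bs)
... | i , refl , bi , ai | j , refl , bj , aj = trans (y1-4l+2-at (2 * i) (2 * j)) (trans (at+ (y22-cd (2 * i))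
       (¬true (λ e → double-mod2 _ (j + 3 * i) (dbl3 i j) (yc-odd (2 * i) (2 * j) e)))
       (trans (at (yd-2i i) (2 * j)) (trans (sq-even j _) (ya-lead (suc m) m i j ≤-refl (trans ai bl) bi (trans aj bt') bj))))
       (cong not (sym (odd-2 m))))

-- For either parity of n the splitting ends at a top coefficient, in degree 2i at index 2i + 1.
y1-lead : ∀ k t n → A k ≡ 2 → B k ≡ n → A t ≡ 0 → B t ≡ n → seq₅ y₁-init k t ≡ true
y1-lead k t n ak bk at' bt with even-or-odd n
y1-lead k t n ak bk at' bt | inj₁ (m , refl) with halfA k 1 ak | halfA t 0 at'
... | k1 , refl , bk1 , ak1 | s , refl , bs , as with halfA k1 m (trans ak1 bk) | halfA s m (trans as bt)
... | l , refl , bl , al | t' , refl , bt' , at2 with halfA' l 0 (trans al bk1) | halfA t' 0 (trans at2 bs)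
... | i , refl , bi , ai | j , refl , bj , aj with code-inj j i (trans aj (trans bt' (sym (trans ai bl)))) (trans bj (sym bi))
...   | refl = trans (y1-4l-at (suc (2 * j)) (2 * j)) (trans (TY0.top (2 * j)) (cong not (odd-2 j)))
y1-lead k t n ak bk at' bt | inj₂ (m , refl) with halfA k 1 ak | halfA t 0 at'
... | k1 , refl , bk1 , ak1 | s , refl , bs , as with halfA' k1 m (trans ak1 bk) | halfA' s m (trans as bt)
... | l , refl , bl , al | t' , refl , bt' , at2 with halfA' l 0 (trans al bk1) | halfA t' 0 (trans at2 bs)
... | i , refl , bi , ai | j , refl , bj , aj with code-inj j i (trans aj (trans bt' (sym (trans ai bl)))) (trans bj (sym bi))
...   | refl = trans (y1-4l+2-at (suc (2 * j)) (2 * j)) (trans (TY22.top (2 * j)) (cong not (odd-2 j)))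

-- Linear algebra in F₂[X]

infix 4 _≃_
-- Lists that differ in trailing zeros denote the same polynomial.
_≃_ : Poly1 → Poly1 → Set
p ≃ q = ∀ t → look p t ≡ look q t

look-⊞ : ∀ p q t → look (p ⊞ q) t ≡ look p t xor look q t
look-⊞ p q t = trans (sym (look-ok (p ⊞ q) t)) (trans (at (⟪⟫-+ p q Xv) t) (trans (+-at _ _ t) (cong₂ _xor_ (look-ok p t) (look-ok q t))))

⊞-cong : ∀ {p p' q q'} → p ≃ p' → q ≃ q' → p ⊞ q ≃ p' ⊞ q'
⊞-cong {p} {p'} {q} {q'} e f t = trans (look-⊞ p q t) (trans (cong₂ _xor_ (e t) (f t)) (sym (look-⊞ p' q' t)))

≃-isz : ∀ p → p ≃ [] → isz 1 p ≡ true
≃-isz [] e = refl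
≃-isz (false ∷ p) e = ≃-isz p (λ t → e (suc t))
≃-isz (true ∷ p) e = ⊥-elim (false≢true (sym (e 0)))

isz-≃ : ∀ p → isz 1 p ≡ true → p ≃ []
isz-≃ p h t = trans (sym (look-ok p t)) (trans (at (isz-⟪⟫ p Xv h) t) (𝟘-at t))

look-end : ∀ p k → length p ≤ k → look p k ≡ false
look-end [] k l = refl
look-end (c ∷ p) (suc k) (s≤s l) = look-end p k l

Lin : (ℕ → Poly1) → Poly1 → Poly1
Lin s [] = []
Lin s (c ∷ p) = (if c then s 0 else []) ⊞ Lin (s ∘ suc) p

Lin-at : ∀ s p N t → length p ≤ N → look (Lin s p) t ≡ xorSum N (λ k → look p k ∧ look (s k) t)
Lin-at s [] N t l = sym (sum-0 N (λ _ _ → refl))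
Lin-at s (c ∷ p) (suc N) t (s≤s l) = trans (look-⊞ (if c then s 0 else []) (Lin (s ∘ suc) p) t)
  (trans (cong₂ _xor_ (h c) (Lin-at (s ∘ suc) p N t l)) (sym (sum-first N (λ k → look (c ∷ p) k ∧ look (s k) t))))
  where h : ∀ c → look (if c then s 0 else []) t ≡ c ∧ look (s 0) t
        h true = refl
        h false = refl

Lin-cong : ∀ s {p q} → p ≃ q → Lin s p ≃ Lin s q
Lin-cong s {p} {q} e t = trans (Lin-at s p (length p + length q) t (m≤m+n (length p) (length q)))
  (trans (sum-cong (length p + length q) (λ k _ → cong (_∧ look (s k) t) (e k))) (sym (Lin-at s q (length p + length q) t (m≤n+m (length q) (length p)))))

Lin-⊞ : ∀ s p q → Lin s (p ⊞ q) ≃ Lin s p ⊞ Lin s q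
Lin-⊞ s p q t = trans (Lin-at s (p ⊞ q) N t (m≤n+m _ _))
  (trans (sum-cong N {g = λ k → (look p k ∧ look (s k) t) xor (look q k ∧ look (s k) t)} (λ k _ → trans (cong (_∧ look (s k) t) (look-⊞ p q k)) (∧-distribʳ-xor (look (s k) t) (look p k) (look q k))))
  (trans (sum-xor N (λ k → look p k ∧ look (s k) t) (λ k → look q k ∧ look (s k) t))
  (trans (cong₂ _xor_ (sym (Lin-at s p N t (≤-trans (m≤m+n _ _) (m≤m+n _ _)))) (sym (Lin-at s q N t (≤-trans (m≤n+m _ (length p)) (m≤m+n _ _)))))
   (sym (look-⊞ (Lin s p) (Lin s q) t)))))
  where N = length p + length q + length (p ⊞ q)

sum-one : ∀ N k₀ (h : ℕ → Bool) → (∀ k → N ≤ k → h k ≡ false) → (∀ k → h k ≡ true → k ≡ k₀) → xorSum N h ≡ h k₀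
sum-one N k₀ h e u with k₀ <? N
... | yes l = sum-single N k₀ h l (λ i _ ne → ¬true (λ x → ne (u i x)))
... | no nl = trans (sum-0 N (λ i l → ¬true (λ x → nl (subst (_< N) (u i x) l)))) (sym (e k₀ (≮⇒≥ nl)))

Lin-one : ∀ s p t k₀ → (∀ k → look p k ≡ true → look (s k) t ≡ true → k ≡ k₀) → look (Lin s p) t ≡ look p k₀ ∧ look (s k₀) t
Lin-one s p t k₀ u = trans (Lin-at s p (length p) t ≤-refl) (sum-one (length p) k₀ (λ k → look p k ∧ look (s k) t)
  (λ k l → cong (_∧ look (s k) t) (look-end p k l)) (λ k e → u k (proj₁ (∧-true e)) (proj₂ (∧-true {look p k} e))))

Lin-two : ∀ s p t k₀ k₁ → k₀ ≢ k₁ → (∀ k → look p k ≡ true → look (s k) t ≡ true → k ≡ k₀ ⊎ k ≡ k₁) →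
  look (Lin s p) t ≡ (look p k₀ ∧ look (s k₀) t) xor (look p k₁ ∧ look (s k₁) t)
Lin-two s p t k₀ k₁ ne u = trans (Lin-at s p N t ≤-refl) (trans (sum-cong N (λ k _ → spl k)) (trans (sum-xor N (g k₀) (g k₁)) (cong₂ _xor_ (pt k₀) (pt k₁))))
  where
  N = length p
  h : ℕ → Bool
  h k = look p k ∧ look (s k) t
  g : ℕ → ℕ → Bool
  g c k = h k ∧ (k ≡ᵇ c)
  pt : ∀ c → xorSum N (g c) ≡ h c
  pt c = trans (sum-one N c (g c) (λ k l → cong (λ b → (b ∧ look (s k) t) ∧ (k ≡ᵇ c)) (look-end p k l)) (λ k e → ≡ᵇ-sound k c (proj₂ (∧-true {h k} e)))) (trans (cong (h c ∧_) (≡ᵇ-refl c)) (∧-identityʳ (h c)))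
  spl : ∀ k → h k ≡ g k₀ k xor g k₁ k
  spl k = go (k ≟ k₀) (k ≟ k₁)
    where
    go : Dec (k ≡ k₀) → Dec (k ≡ k₁) → h k ≡ g k₀ k xor g k₁ k
    go (yes refl) _ = sym (trans (cong₂ _xor_ (trans (cong (h k ∧_) (≡ᵇ-refl k)) (∧-identityʳ _)) (trans (cong (h k ∧_) (≡ᵇ-no ne)) (∧-zeroʳ _))) (xor-identityʳ _))
    go (no n0) (yes refl) = sym (cong₂ _xor_ (trans (cong (h k ∧_) (≡ᵇ-no n0)) (∧-zeroʳ (h k))) (trans (cong (h k ∧_) (≡ᵇ-refl k)) (∧-identityʳ _)))
    go (no n0) (no n1) = trans (¬true (λ e → bad (u k (proj₁ (∧-true e)) (proj₂ (∧-true {look p k} e))))) (sym (cong₂ _xor_ (trans (cong (h k ∧_) (≡ᵇ-no n0)) (∧-zeroʳ (h k))) (trans (cong (h k ∧_) (≡ᵇ-no n1)) (∧-zeroʳ (h k)))))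
      where bad : k ≡ k₀ ⊎ k ≡ k₁ → ⊥
            bad (inj₁ e) = n0 e
            bad (inj₂ e) = n1 e

Lin-supp : ∀ s p t → look (Lin s p) t ≡ true → ∃ λ k → look p k ≡ true × look (s k) t ≡ true
Lin-supp s p t e = let (k , _ , h) = sum-true (length p) _ (trans (sym (Lin-at s p (length p) t ≤-refl)) e) in k , proj₁ (∧-true h) , proj₂ (∧-true {look p k} h)

ep : ℕ → Poly1
ep t = sh t (true ∷ [])

ep-at : ∀ d → look (ep d) d ≡ true
ep-at zero = refl
ep-at (suc d) = ep-at d

ep-true : ∀ d t → look (ep d) t ≡ true → t ≡ d
ep-true zero zero e = refl
ep-true (suc d) (suc t) e = cong suc (ep-true d t e)

basis-ind : (P : Poly1 → Set) → (∀ p q → p ≃ q → P p → P q) → P [] → (∀ p q → P p → P q → P (p ⊞ q)) →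
  ∀ p → (∀ t → look p t ≡ true → P (ep t)) → P p
basis-ind P cg p0 pa p h = go 0 p h
  where
  s1 : ∀ k p → sh k (false ∷ p) ≡ sh (suc k) p
  s1 zero p = refl
  s1 (suc k) p = cong (false ∷_) (s1 k p)
  s2 : ∀ k p → ep k ⊞ sh (suc k) p ≡ sh k (true ∷ p)
  s2 zero p = refl
  s2 (suc k) p = cong (false ∷_) (s2 k p)
  nil : ∀ k → [] ≃ sh k []
  nil zero t = refl
  nil (suc k) zero = refl
  nil (suc k) (suc t) = nil k t
  go : ∀ k p → (∀ t → look p t ≡ true → P (ep (k + t))) → P (sh k p)
  go k [] h = cg [] (sh k []) (nil k) p0
  go k (false ∷ p) h = subst P (sym (s1 k p)) (go (suc k) p (λ t e → subst (λ z → P (ep z)) (+-suc k t) (h (suc t) e)))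
  go k (true ∷ p) h = subst P (s2 k p) (pa (ep k) (sh (suc k) p) (subst (λ z → P (ep z)) (+-identityʳ k) (h 0 refl)) (go (suc k) p (λ t e → subst (λ z → P (ep z)) (+-suc k t) (h (suc t) e))))

Lin-ep : ∀ s k → Lin s (ep k) ≃ s k
Lin-ep s k t = trans (Lin-one s (ep k) t k (λ j e _ → ep-true k j e)) (cong (_∧ look (s k) t) (ep-at k))

-- T₇ and T₅ as triangular matrices on binary codes

H : ℕ → ℕ
H k = A k + B k

-- T₇ on z F₂[w] and on z⁵ F₂[w]; then T₅ from the first summand to the second and back, since T₅
-- exchanges them.
X₇ X₇' Y1 Y2 : Poly1 → Poly1
X₇ = Lin (rec7 x-init)
X₇' = Lin (rec7 x'-init)
Y1 = Lin (rec5 y₁-init)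
Y2 = Lin (rec5 y₂-init)

W→H : ∀ {t k} c → W 1 1 t + c ≤ W 1 1 k → c + H t ≤ H k
W→H {t} {k} c l = subst₂ _≤_ (trans (cong (_+ c) (W11 t)) (+-comm (H t) c)) (W11 k) l
W→L : ∀ {t k} c → W 1 2 t + c ≤ W 1 2 k → c + (A t + 2 * B t) ≤ A k + 2 * B k
W→L {t} {k} c l = subst₂ _≤_ (trans (cong (_+ c) (W12 t)) (+-comm (A t + 2 * B t) c)) (W12 k) l

fromlook : ∀ {p t b} → look p t ≡ b → ⟪ p ⟫ Xv t ≡ b
fromlook {p} {t} e = trans (look-ok p t) e
tolook : ∀ {p t b} → ⟪ p ⟫ Xv t ≡ b → look p t ≡ b
tolook {p} {t} e = trans (sym (look-ok p t)) e

xH : ∀ k t → look (rec7 x-init k) t ≡ true → 1 + H t ≤ H k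
xH k t e = W→H {t} {k} 1 (x-H k t (fromlook {rec7 x-init k} e))
xL : ∀ k t → look (rec7 x-init k) t ≡ true → 1 + (A t + 2 * B t) ≤ A k + 2 * B k
xL k t e = W→L {t} {k} 1 (x-L k t (fromlook {rec7 x-init k} e))
x5H : ∀ k t → look (rec7 x'-init k) t ≡ true → 1 + H t ≤ H k
x5H k t e = W→H {t} {k} 1 (WH.bound7 1 x'-init refl k t (fromlook {rec7 x'-init k} e))
y1H : ∀ k t → look (rec5 y₁-init k) t ≡ true → 2 + H t ≤ H k
y1H k t e = W→H {t} {k} 2 (y1-H k t (fromlook {rec5 y₁-init k} e))
y1L : ∀ k t → look (rec5 y₁-init k) t ≡ true → 2 + (A t + 2 * B t) ≤ A k + 2 * B k
y1L k t e = W→L {t} {k} 2 (y1-L k t (fromlook {rec5 y₁-init k} e))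
y2H : ∀ k t → look (rec5 y₂-init k) t ≡ true → H t ≤ H k
y2H k t e = W→H {t} {k} 0 (y2-H k t (fromlook {rec5 y₂-init k} e))
y2L : ∀ k t → look (rec5 y₂-init k) t ≡ true → A t + 2 * B t ≤ A k + 2 * B k
y2L k t e = W→L {t} {k} 0 (y2-L k t (fromlook {rec5 y₂-init k} e))

Supp : Poly1 → ℕ → Set
Supp p m = ∀ k → look p k ≡ true → H k < m

Supp-bound : ∀ p → ∃ λ m → Supp p m
Supp-bound p = let (m , h) = go (length p) in m , λ k e → h k (≰⇒> (λ l → false≢true (trans (sym (look-end p k l)) e)))
  where
  go : ∀ n → ∃ λ m → ∀ k → k < n → H k < m
  go zero = 0 , λ k ()
  go (suc n) = let (m , h) = go n in suc (H n) + m , λ k l → st m h k (k ≟ n) l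
    where st : ∀ m → (∀ k → k < n → H k < m) → ∀ k → Dec (k ≡ n) → k < suc n → H k < suc (H n) + m
          st m h k (yes refl) l = m≤m+n (suc (H n)) m
          st m h k (no ne) l = ≤-trans (h k (≤∧≢⇒< (≤-pred l) ne)) (m≤n+m m (suc (H n)))

Supp-0 : ∀ {p} → Supp p 0 → p ≃ []
Supp-0 s t = ¬true (λ e → n≮0 (s t e))

Supp-⊞ : ∀ {p q m} → Supp p m → Supp q m → Supp (p ⊞ q) m
Supp-⊞ {p} {q} {m} s s' k e = go (look p k) refl
  where go : ∀ b → look p k ≡ b → H k < m
        go true x = s k x
        go false x = s' k (trans (sym (trans (look-⊞ p q k) (cong (_xor look q k) x))) e)

X₇-Supp : ∀ {p m} → Supp p (suc m) → Supp (X₇ p) m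
X₇-Supp {p} s t e = let (k , a , b) = Lin-supp (rec7 x-init) p t e in ≤-trans (xH k t b) (≤-pred (s k a))
X₇'-Supp : ∀ {p m} → Supp p (suc m) → Supp (X₇' p) m
X₇'-Supp {p} s t e = let (k , a , b) = Lin-supp (rec7 x'-init) p t e in ≤-trans (x5H k t b) (≤-pred (s k a))
Y1-Supp : ∀ {p m} → Supp p (2 + m) → Supp (Y1 p) m
Y1-Supp {p} s t e = let (k , a , b) = Lin-supp (rec5 y₁-init) p t e in ≤-pred (≤-trans (y1H k t b) (≤-pred (s k a)))
Y2-Supp : ∀ {p m} → Supp p m → Supp (Y2 p) m
Y2-Supp {p} s t e = let (k , a , b) = Lin-supp (rec5 y₂-init) p t e in ≤-<-trans (y2H k t b) (s k a)

L-HB : ∀ t → A t + 2 * B t ≡ H t + B t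
L-HB t = trans (cong (A t +_) (cong (B t +_) (+-identityʳ (B t)))) (sym (+-assoc (A t) (B t) (B t)))

-- X₇ hits each basis vector (a , b) by (suc a , b), up to terms of smaller H or of equal H and smaller B.
module Onto (m : ℕ) where
  Img : Poly1 → Set
  -- The preimage avoids all points with A = 0. This later allows kernel elements with a prescribed
  -- coefficient at such a point.
  Img p = ∃ λ g → X₇ g ≃ p × (∀ k → look g k ≡ true → H k ≤ m × ∃ λ a → A k ≡ suc a)

  Img-≃ : ∀ p q → p ≃ q → Img p → Img q
  Img-≃ p q e (g , h , s) = g , (λ t → trans (h t) (e t)) , s

  Img-⊞ : ∀ p q → Img p → Img q → Img (p ⊞ q)
  Img-⊞ p q (g , h , s) (g' , h' , s') = g ⊞ g' , (λ t → trans (Lin-⊞ (rec7 x-init) g g' t) (⊞-cong {X₇ g} {p} {X₇ g'} {q} h h' t)) , λ k e → go k e (look g k) refl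
    where go : ∀ k → look (g ⊞ g') k ≡ true → ∀ b → look g k ≡ b → H k ≤ m × ∃ λ a → A k ≡ suc a
          go k e true x = s k x
          go k e false x = s' k (trans (sym (trans (look-⊞ g g' k) (cong (_xor look g' k) x))) e)

  basis : ∀ h → h ≤ m → ∀ d → H d < h → Img (ep d)
  basis (suc h) hm = λ d l → inner (suc (B d)) d (≤-pred l) ≤-refl
    where
    inner : ∀ b d → H d ≤ h → B d < b → Img (ep d)
    inner (suc b) d l lb with m≤n⇒m<n∨m≡n l
    ... | inj₁ l' = basis h (≤-trans (n≤1+n h) hm) d l'
    ... | inj₂ eh with enc (suc (A d)) (B d)
    ...   | k , ak , bk = Img-≃ (rec7 x-init k ⊞ (rec7 x-init k ⊞ ep d)) (ep d) cancel (Img-⊞ (rec7 x-init k) (rec7 x-init k ⊞ ep d) imk (basis-ind Img Img-≃ ([] , (λ _ → refl) , λ _ ()) Img-⊞ (rec7 x-init k ⊞ ep d) low))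
      where
      hk : H k ≡ suc h
      hk = trans (cong₂ _+_ ak bk) (cong suc eh)
      imk : Img (rec7 x-init k)
      imk = ep k , Lin-ep (rec7 x-init) k , λ j e → subst (λ z → H z ≤ m × ∃ λ a → A z ≡ suc a) (sym (ep-true k j e)) (subst (_≤ m) (sym hk) hm , A d , ak)
      cancel : rec7 x-init k ⊞ (rec7 x-init k ⊞ ep d) ≃ ep d
      cancel t = trans (look-⊞ (rec7 x-init k) (rec7 x-init k ⊞ ep d) t) (trans (cong (look (rec7 x-init k) t xor_) (look-⊞ (rec7 x-init k) (ep d) t)) (trans (sym (xor-assoc (look (rec7 x-init k) t) (look (rec7 x-init k) t) (look (ep d) t))) (cong (_xor look (ep d) t) (xor-same (look (rec7 x-init k) t)))))
      low : ∀ t → look (rec7 x-init k ⊞ ep d) t ≡ true → Img (ep t)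
      low t e = go (t ≟ d)
        where
        go : Dec (t ≡ d) → Img (ep t)
        go (yes refl) = ⊥-elim (false≢true (trans (sym (trans (look-⊞ (rec7 x-init k) (ep t) t) (cong₂ _xor_ (tolook {rec7 x-init k} (x-lead k t (sym ak) (sym bk))) (ep-at t)))) e))
        go (no ne) = step (m≤n⇒m<n∨m≡n hle)
          where
          xt : look (rec7 x-init k) t ≡ true
          xt = trans (sym (trans (look-⊞ (rec7 x-init k) (ep d) t) (trans (cong (look (rec7 x-init k) t xor_) (¬true (λ x → ne (ep-true d t x)))) (xor-identityʳ _)))) e
          hle : H t ≤ h
          hle = ≤-pred (subst (suc (H t) ≤_) hk (xH k t xt))
          step : H t < h ⊎ H t ≡ h → Img (ep t)
          step (inj₁ l) = basis h (≤-trans (n≤1+n h) hm) t l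
          step (inj₂ ht) = inner b t (≤-reflexive ht) (<-≤-trans (≤∧≢⇒< ble (λ be → ne (code-inj t d (+-cancelʳ-≡ (B d) (A t) (A d) (trans (cong (A t +_) (sym be)) (trans ht (sym eh)))) be))) (≤-pred lb))
            where
            ble : B t ≤ B d
            ble = +-cancelˡ-≤ (H t) (B t) (B d) (≤-pred (subst₂ _≤_ (cong suc (L-HB t)) (trans (L-HB k) (cong₂ _+_ (trans hk (cong suc (sym ht))) bk)) (xL k t xt)))

  onto : ∀ p → Supp p m → Img p
  onto p s = basis-ind Img Img-≃ ([] , (λ _ → refl) , λ _ ()) Img-⊞ p (λ t e → basis m ≤-refl t (s t e))

-- Hence an element of ker X₇ is determined by its coefficients at the points (0 , n).
ker-drop : ∀ m p → X₇ p ≃ [] → Supp p (suc m) → (∀ k → A k ≡ 0 → B k ≡ m → look p k ≡ false) → Supp p m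
ker-drop m p xp s h k e = ≤∧≢⇒< (≤-pred (s k e)) (λ hk → false≢true (trans (sym (van m k hk (m≤n+m m (B k)))) e))
  where
  -- Descending induction on B, with `j` bounding m - B k. Once the points of larger B are known to
  -- vanish, the coefficient of X₇ p at (A k - 1, B k) is that of p at k.
  van : ∀ j k → H k ≡ m → m ≤ B k + j → look p k ≡ false
  zer : ∀ j k a → A k ≡ a → H k ≡ m → m ≤ B k + j → look p k ≡ false
  van j k = zer j k (A k) refl
  zer j k zero ak hk l = h k ak (trans (cong (_+ B k) (sym ak)) hk)
  zer zero k (suc a) ak hk l = ⊥-elim (<⇒≱ (m<n+m (B k) {suc a} (s≤s z≤n)) (subst (_≤ B k) (trans (sym hk) (cong (_+ B k) ak)) (subst (m ≤_) (+-identityʳ (B k)) l)))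
  zer (suc j) k (suc a) ak hk l with enc a (B k)
  ... | t , at' , bt = trans (sym (∧-identityʳ _)) (trans (cong (look p k ∧_) (sym (tolook {rec7 x-init k} (x-lead k t (trans (cong suc at') (sym ak)) bt)))) (trans (sym (Lin-one (rec7 x-init) p t k uniq)) (xp t)))
    where
    ht : suc (H t) ≡ m
    ht = trans (cong suc (cong₂ _+_ at' bt)) (trans (cong (_+ B k) (sym ak)) hk)
    uniq : ∀ k' → look p k' ≡ true → look (rec7 x-init k') t ≡ true → k' ≡ k
    uniq k' e x = go (m≤n⇒m<n∨m≡n ble)
      where
      hk' : H k' ≡ m
      hk' = ≤-antisym (≤-pred (s k' e)) (subst (_≤ H k') ht (xH k' t x))
      ble : B k ≤ B k'
      ble = +-cancelˡ-≤ m (B k) (B k') (subst₂ _≤_ (trans (cong suc (L-HB t)) (cong₂ _+_ ht bt)) (trans (L-HB k') (cong (_+ B k') hk')) (xL k' t x))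
      go : B k < B k' ⊎ B k ≡ B k' → k' ≡ k
      go (inj₁ l') = ⊥-elim (false≢true (trans (sym (van j k' hk' (≤-trans l (≤-trans (≤-reflexive (+-suc (B k) j)) (+-monoˡ-≤ j l'))))) e))
      go (inj₂ be) = code-inj k' k (+-cancelʳ-≡ (B k) (A k') (A k) (trans (cong (A k' +_) be) (trans hk' (sym hk)))) (sym be)

corner-cases : ∀ k n → H k ≡ 2 + n → n ≤ B k → (A k ≡ 0 × B k ≡ 2 + n) ⊎ ((A k ≡ 1 × B k ≡ 1 + n) ⊎ (A k ≡ 2 × B k ≡ n))
corner-cases k n h l = go (A k) (B k) (m≤n⇒∃[o]m+o≡n l) h
  where
  fin : ∀ a j → a + j ≡ 2 → (a ≡ 0 × n + j ≡ 2 + n) ⊎ ((a ≡ 1 × n + j ≡ 1 + n) ⊎ (a ≡ 2 × n + j ≡ n))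
  fin 0 .2 refl = inj₁ (refl , +-comm n 2)
  fin 1 .1 refl = inj₂ (inj₁ (refl , +-comm n 1))
  fin 2 .0 refl = inj₂ (inj₂ (refl , +-identityʳ n))
  fin (suc (suc (suc a))) j ()
  go : ∀ a b → (∃ λ j → n + j ≡ b) → a + b ≡ 2 + n → (a ≡ 0 × b ≡ 2 + n) ⊎ ((a ≡ 1 × b ≡ 1 + n) ⊎ (a ≡ 2 × b ≡ n))
  go a b (j , refl) h = fin a j (+-cancelʳ-≡ n (a + j) 2 (trans (trans (+-assoc a j n) (cong (a +_) (+-comm j n))) h))

-- Let p₀ and p₂ be the coefficients of p at (0, n + 2) and (2, n). The coefficient of X₇ p at (1,
-- n) is p₂, plus p₀ if n is even, and it vanishes; that of Y1 p at (0, n) is p₂, plus p₀ if n is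
-- odd. Their sum is p₀. The point (1, n + 1) is excluded by congruences.
top-Y1 : ∀ n p → X₇ p ≃ [] → Supp p (3 + n) → ∀ k₀ t → A k₀ ≡ 0 → B k₀ ≡ 2 + n → A t ≡ 0 → B t ≡ n → look (Y1 p) t ≡ look p k₀
top-Y1 n p xp s k₀ t ak bk at' bt with enc 2 n | enc 1 n
... | k₂ , ak₂ , bk₂ | t₁ , at₁ , bt₁ = fin (look p k₀) (look p k₂) (odd n)
     (trans (sym (trans (Lin-two (rec7 x-init) p t₁ k₀ k₂ ne ux) (cong₂ (λ u v → (look p k₀ ∧ u) xor (look p k₂ ∧ v)) (tolook {rec7 x-init k₀} (x-corner k₀ t₁ n ak bk at₁ bt₁)) (tolook {rec7 x-init k₂} (x-lead k₂ t₁ (trans (cong suc at₁) (sym ak₂)) (trans bt₁ (sym bk₂))))))) (xp t₁))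
     (trans (Lin-two (rec5 y₁-init) p t k₀ k₂ ne uy) (cong₂ (λ u v → (look p k₀ ∧ u) xor (look p k₂ ∧ v)) (tolook {rec5 y₁-init k₀} (y1-corner k₀ t n ak bk at' bt)) (tolook {rec5 y₁-init k₂} (y1-lead k₂ t n ak₂ bk₂ at' bt))))
  where
  ne : k₀ ≢ k₂
  ne e = 0≢1+n (trans (sym ak) (trans (cong A e) ak₂))
  fin : ∀ p₀ p₂ o {y} → (p₀ ∧ not o) xor (p₂ ∧ true) ≡ false → y ≡ (p₀ ∧ o) xor (p₂ ∧ true) → y ≡ p₀
  fin true true true () e
  fin true true false h e = e
  fin true false true h e = e
  fin true false false () e
  fin false true true () e
  fin false true false () e
  fin false false true h e = e
  fin false false false h e = e
  oA : ∀ k c → A k ≡ c → odd k ≡ odd c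
  oA k c e = trans (sym (odd-A k)) (cong odd e)
  code : ∀ k → (A k ≡ 0 × B k ≡ 2 + n) ⊎ ((A k ≡ 1 × B k ≡ 1 + n) ⊎ (A k ≡ 2 × B k ≡ n)) → (A k ≡ 1 → ⊥) → k ≡ k₀ ⊎ k ≡ k₂
  code k (inj₁ (a , b)) _ = inj₁ (code-inj k k₀ (trans a (sym ak)) (trans b (sym bk)))
  code k (inj₂ (inj₁ (a , b))) h = ⊥-elim (h a)
  code k (inj₂ (inj₂ (a , b))) _ = inj₂ (code-inj k k₂ (trans a (sym ak₂)) (trans b (sym bk₂)))
  hyp : ∀ k c → look p k ≡ true → 2 + n ≤ H k → c ≡ 2 + n + n → c ≤ A k + 2 * B k → H k ≡ 2 + n × n ≤ B k
  hyp k c e h ec l = hk , +-cancelˡ-≤ (2 + n) n (B k) (subst₂ _≤_ ec (trans (L-HB k) (cong (_+ B k) hk)) l)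
    where hk : H k ≡ 2 + n
          hk = ≤-antisym (≤-pred (s k e)) h
  ux : ∀ k → look p k ≡ true → look (rec7 x-init k) t₁ ≡ true → k ≡ k₀ ⊎ k ≡ k₂
  ux k e x = code k (corner-cases k n (proj₁ hz) (proj₂ hz)) (λ a1 → false≢true (trans (sym (mod2-even (t₁ + k) (trans (odd-+ t₁ k) (cong₂ _xor_ (oA t₁ 1 at₁) (oA k 1 a1))))) (cong (_≡ᵇ 1) (x-odd k t₁ (fromlook {rec7 x-init k} x)))))
    where
    hz : H k ≡ 2 + n × n ≤ B k
    hz = hyp k (1 + (A t₁ + 2 * B t₁)) e (subst (_≤ H k) (cong suc (cong₂ _+_ at₁ bt₁)) (xH k t₁ x)) (trans (cong₂ (λ a b → 1 + (a + 2 * b)) at₁ bt₁) (cong (λ z → 2 + (n + z)) (+-identityʳ n))) (xL k t₁ x)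
    mod2-even : ∀ m → odd m ≡ false → (m % 2 ≡ᵇ 1) ≡ false
    mod2-even m e = ¬true (λ h → bad (even-or-odd m) (≡ᵇ-sound _ 1 h))
      where bad : (∃ λ l → m ≡ 2 * l) ⊎ (∃ λ l → m ≡ suc (2 * l)) → m % 2 ≢ 1
            bad (inj₁ (l , q)) = double-mod2 m l q
            bad (inj₂ (l , refl)) _ = false≢true (trans (sym e) (cong not (odd-2 l)))
  uy : ∀ k → look p k ≡ true → look (rec5 y₁-init k) t ≡ true → k ≡ k₀ ⊎ k ≡ k₂
  uy k e x = code k (corner-cases k n (proj₁ hz) (proj₂ hz)) (λ a1 → false≢true (trans (sym (mod4-even (t + 3 * k) (y1-mod k t (fromlook {rec5 y₁-init k} x)))) (trans (odd-3 k t) (trans (odd-+ t k) (cong₂ _xor_ (oA t 0 at') (oA k 1 a1))))))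
    where
    hz : H k ≡ 2 + n × n ≤ B k
    hz = hyp k (2 + (A t + 2 * B t)) e (subst (_≤ H k) (cong (2 +_) (cong₂ _+_ at' bt)) (y1H k t x)) (trans (cong₂ (λ a b → 2 + (a + 2 * b)) at' bt) (cong (λ z → 2 + (n + z)) (+-identityʳ n))) (y1L k t x)

y2-deg : ∀ k t → seq₅ y₂-init k t ≡ true → t ≤ k
y2-deg = base-step 6 (λ k l t e → ≤ᵇ⇒≤ t k (Equivalence.from T-≡ (allAt-ok (λ t → t ≤ᵇ k) (y₂-init k) (allB-ok 6 (λ k → allAt (λ t → t ≤ᵇ k) (y₂-init k)) refl k l) t (subst (λ p → look p t ≡ true) (rec5-ini y₂-init k l) (look5 y₂-init k t e))))) step
  where
  step : ∀ m → (∀ k → k < 6 + m → ∀ t → seq₅ y₂-init k t ≡ true → t ≤ k) → ∀ t → seq₅ y₂-init (6 + m) t ≡ true → t ≤ 6 + m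
  step m ih t e = h (rec5-one y₂-init m t e)
    where
    h : _ → t ≤ 6 + m
    h (inj₁ (s , refl , es)) = +-monoʳ-≤ 2 (ih (4 + m) (+-monoˡ-< m (≤from 5 6 refl)) s es)
    h (inj₂ (inj₁ (s , refl , es))) = +-monoʳ-≤ 4 (ih (2 + m) (+-monoˡ-< m (≤from 3 6 refl)) s es)
    h (inj₂ (inj₂ (inj₁ (s , refl , es)))) = ≤-trans (+-monoʳ-≤ 1 (ih (1 + m) (+-monoˡ-< m (≤from 2 6 refl)) s es)) (+-monoˡ-≤ m (≤from 2 6 refl))
    h (inj₂ (inj₂ (inj₂ (s , refl , es)))) = +-monoʳ-≤ 6 (ih m (+-monoˡ-< m (≤from 1 6 refl)) s es)

y2-diag : ∀ k → seq₅ y₂-init k k ≡ true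
y2-diag = base-step 6 (λ k l → trans (look-ok (rec5 y₂-init k) k) (trans (cong (λ p → look p k) (rec5-ini y₂-init k l)) (allB-ok 6 (λ k → look (y₂-init k) k) refl k l))) step
  where
  step : ∀ m → (∀ k → k < 6 + m → seq₅ y₂-init k k ≡ true) → seq₅ y₂-init (6 + m) (6 + m) ≡ true
  step m ih = trans (rec5-at y₂-init m (6 + m)) (cong₂ _xor_ (trans (Xv^-at 2 (seq₅ y₂-init (4 + m)) (4 + m)) (ih (4 + m) (+-monoˡ-< m (≤from 5 6 refl)))) (cong₂ _xor_ (trans (Xv^-at 4 (seq₅ y₂-init (2 + m)) (2 + m)) (ih (2 + m) (+-monoˡ-< m (≤from 3 6 refl))))
     (cong₂ _xor_ {y = false} (¬true (λ e → let (s , es , h) = Xv^ 1 (seq₅ y₂-init (1 + m)) (6 + m) e in <⇒≱ (s≤s (y2-deg (1 + m) s h)) (subst (2 + m ≤_) (+-cancelˡ-≡ 1 _ _ es) (+-monoˡ-≤ m (≤from 2 5 refl)))))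
       (trans (Xv^-at 6 (seq₅ y₂-init m) m) (ih m (+-monoˡ-< m (≤from 1 6 refl)))))))

-- In the ordinary degree in X this matrix is triangular with ones on the diagonal.
Y2-inj : ∀ p → Y2 p ≃ [] → p ≃ []
Y2-inj p e t = go (length p) (λ k l → look-end p k l) t
  where
  go : ∀ n → (∀ k → n ≤ k → look p k ≡ false) → p ≃ []
  go zero h t = h t z≤n
  go (suc n) h = go n (λ k l → st (m≤n⇒m<n∨m≡n l))
    where
    st : ∀ {k} → n < k ⊎ n ≡ k → look p k ≡ false
    st {k} (inj₁ l) = h k l
    st (inj₂ refl) = trans (sym (∧-identityʳ _)) (trans (cong (look p n ∧_) (sym (tolook {rec5 y₂-init n} (y2-diag n))))
       (trans (sym (Lin-one (rec5 y₂-init) p n n (λ k a b → ≤-antisym (≮⇒≥ (λ l → false≢true (trans (sym (h k l)) a))) (y2-deg k n (fromlook {rec5 y₂-init k} b))))) (e n)))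

-- The image of the basis vector at (0, n) is cancelled by a preimage supported on positive A, which
-- leaves the coefficient at (0, n) untouched.
ker-elt : ∀ n → ∃ λ g → X₇ g ≃ [] × Supp g (suc n) × (∀ k → A k ≡ 0 → B k ≡ n → look g k ≡ true)
ker-elt n with enc 0 n
... | k₀ , ak , bk with Onto.onto n (rec7 x-init k₀) (λ t e → subst (suc (H t) ≤_) (cong₂ _+_ ak bk) (xH k₀ t e))
...   | g , eg , sg = ep k₀ ⊞ g , ker , Supp-⊞ {ep k₀} {g} (λ k e → subst (λ z → H z < suc n) (sym (ep-true k₀ k e)) (s≤s (≤-reflexive (cong₂ _+_ ak bk)))) (λ k e → s≤s (proj₁ (sg k e))) , top
  where
  ker : X₇ (ep k₀ ⊞ g) ≃ []
  ker t = trans (Lin-⊞ (rec7 x-init) (ep k₀) g t) (trans (look-⊞ (X₇ (ep k₀)) (X₇ g) t) (trans (cong₂ _xor_ (Lin-ep (rec7 x-init) k₀ t) (eg t)) (xor-same (look (rec7 x-init k₀) t))))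
  top : ∀ k → A k ≡ 0 → B k ≡ n → look (ep k₀ ⊞ g) k ≡ true
  top k a b = trans (look-⊞ (ep k₀) g k) (cong₂ _xor_ (trans (cong (look (ep k₀)) (code-inj k k₀ (trans a (sym ak)) (trans b (sym bk)))) (ep-at k₀)) (¬true (λ e → 0≢1+n (trans (sym a) (proj₂ (proj₂ (sg k e)))))))

-- T₅ exchanges the summands, so T₅² is used: it acts on z F₂[w] as `Y2` after `Y1`. On ker X₇ it
-- moves the leading point (0, n + 2) to (0, n), so leading points can be removed one by one.
module KerOnto (comm : ∀ p → X₇ p ≃ [] → X₇ (Y2 (Y1 p)) ≃ []) where
  E : Poly1 → Poly1
  E p = Y2 (Y1 p)

  E-⊞ : ∀ p q → E (p ⊞ q) ≃ E p ⊞ E q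
  E-⊞ p q t = trans (Lin-cong (rec5 y₂-init) {Y1 (p ⊞ q)} {Y1 p ⊞ Y1 q} (Lin-⊞ (rec5 y₁-init) p q) t) (Lin-⊞ (rec5 y₂-init) (Y1 p) (Y1 q) t)

  E-top : ∀ n p → X₇ p ≃ [] → Supp p (3 + n) → (∀ k → A k ≡ 0 → B k ≡ 2 + n → look p k ≡ true) → ∀ t → A t ≡ 0 → B t ≡ n → look (E p) t ≡ true
  E-top n p xp s top t at' bt = go (enc 0 (2 + n))
    where
    uniq : ∀ k → look (Y1 p) k ≡ true → look (rec5 y₂-init k) t ≡ true → k ≡ t
    go : (∃ λ k → A k ≡ 0 × B k ≡ 2 + n) → look (E p) t ≡ true
    go (k₀ , ak , bk) = trans (Lin-one (rec5 y₂-init) (Y1 p) t t uniq) (cong₂ _∧_ (trans (top-Y1 n p xp s k₀ t ak bk at' bt) (top k₀ ak bk)) (tolook {rec5 y₂-init t} (y2-diag t)))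
    uniq k a b = code-inj k t (trans ka (sym at')) (trans kb (sym bt))
      where
      hk : H k ≤ n
      hk = ≤-pred (Y1-Supp {p} s k a)
      kb : B k ≡ n
      kb = ≤-antisym (≤-trans (m≤n+m (B k) (A k)) hk) (+-cancelˡ-≤ n n (B k) (≤-trans (subst₂ _≤_ (trans (cong₂ (λ a b → a + 2 * b) at' bt) (cong (n +_) (+-identityʳ n))) (L-HB k) (y2L k t b)) (+-monoˡ-≤ (B k) hk)))
      ka : A k ≡ 0
      ka = n≤0⇒n≡0 (+-cancelʳ-≤ n (A k) 0 (subst (_≤ n) (cong (A k +_) kb) hk))

  Lift : Poly1 → Set
  Lift p = ∃ λ g → X₇ g ≃ [] × E g ≃ p

  add-back : ∀ p κ → X₇ κ ≃ [] → Lift (p ⊞ E κ) → Lift p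
  add-back p κ xκ (g , xg , eg) = g ⊞ κ , (λ u → trans (Lin-⊞ (rec7 x-init) g κ u) (trans (look-⊞ (X₇ g) (X₇ κ) u) (cong₂ _xor_ (xg u) (xκ u)))) ,
            λ u → trans (E-⊞ g κ u) (trans (look-⊞ (E g) (E κ) u) (trans (cong (_xor look (E κ) u) (trans (eg u) (look-⊞ p (E κ) u))) (trans (xor-assoc (look p u) (look (E κ) u) (look (E κ) u)) (trans (cong (look p u xor_) (xor-same (look (E κ) u))) (xor-identityʳ (look p u))))))

  ker-onto : ∀ m p → X₇ p ≃ [] → Supp p m → Lift p
  ker-onto zero p xp s = [] , (λ _ → refl) , λ t → sym (Supp-0 {p} s t)
  ker-onto (suc m) p xp s = step (enc 0 m)
    where
    step : (∃ λ k → A k ≡ 0 × B k ≡ m) → Lift p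
    step (t , at' , bt) = go (look p t) refl
      where
      at-t : ∀ q → look q t ≡ false → ∀ k → A k ≡ 0 → B k ≡ m → look q k ≡ false
      at-t q e k a b = trans (cong (look q) (code-inj k t (trans a (sym at')) (trans b (sym bt)))) e
      add : look p t ≡ true → (∃ λ g → X₇ g ≃ [] × Supp g (suc (2 + m)) × (∀ k → A k ≡ 0 → B k ≡ 2 + m → look g k ≡ true)) → Lift p
      add e (κ , xκ , sκ , tκ) = add-back p κ xκ (ker-onto m (p ⊞ E κ) xq (ker-drop m (p ⊞ E κ) xq (Supp-⊞ {p} {E κ} s (Y2-Supp {Y1 κ} (Y1-Supp {κ} sκ))) (at-t (p ⊞ E κ) (trans (look-⊞ p (E κ) t) (cong₂ _xor_ e (E-top m κ xκ sκ tκ t at' bt))))))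
        where
        xq : X₇ (p ⊞ E κ) ≃ []
        xq u = trans (Lin-⊞ (rec7 x-init) p (E κ) u) (trans (look-⊞ (X₇ p) (X₇ (E κ)) u) (cong₂ _xor_ (xp u) (comm κ xκ u)))
      go : ∀ c → look p t ≡ c → Lift p
      go false e = ker-onto m p xp (ker-drop m p xp s (at-t p e))
      go true e = add e (ker-elt (2 + m))

-- `top-Y1` forbids a leading point (0, n + 2), so H is at most 1, and X₇ excludes (1, 0). The codes
-- 0 and 2 are the points (0, 0) and (0, 1).
socle : ∀ p → X₇ p ≃ [] → Y1 p ≃ [] → ∀ t → look p t ≡ true → t ≡ 0 ⊎ t ≡ 2
socle p xp yp = fin (drop (proj₁ (Supp-bound p)) (λ k e → ≤-trans (proj₂ (Supp-bound p) k e) (m≤n+m _ 2)))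
  where
  drop : ∀ m → Supp p (2 + m) → Supp p 2
  drop zero s = s
  drop (suc n) s = drop n (ker-drop (2 + n) p xp s (λ k a b → trans (sym (top-Y1 n p xp s k (proj₁ (enc 0 n)) a b (proj₁ (proj₂ (enc 0 n))) (proj₂ (proj₂ (enc 0 n))))) (yp _)))
  fin : Supp p 2 → ∀ t → look p t ≡ true → t ≡ 0 ⊎ t ≡ 2
  fin s t e = go (A t) (B t) refl refl (≤-pred (s t e))
    where
    p1 : look p 1 ≡ false
    p1 = trans (sym (∧-identityʳ _)) (trans (sym (Lin-one (rec7 x-init) p 0 1 uniq)) (xp 0))
      where
      uniq : ∀ k → look p k ≡ true → look (rec7 x-init k) 0 ≡ true → k ≡ 1
      uniq k a b = c (A k) (B k) refl refl (≤-pred (s k a)) (xH k 0 b)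
        where
        c : ∀ x y → A k ≡ x → B k ≡ y → A k + B k ≤ 1 → 1 ≤ A k + B k → k ≡ 1
        c x y ea eb l l' = d x y ea eb (≤-antisym (subst₂ (λ x y → x + y ≤ 1) ea eb l) (subst₂ (λ x y → 1 ≤ x + y) ea eb l'))
          where
          d : ∀ x y → A k ≡ x → B k ≡ y → x + y ≡ 1 → k ≡ 1
          d 0 .1 ea eb refl = ⊥-elim (false≢true (trans (cong (λ k → look (rec7 x-init k) 0) (sym (code-inj k 2 ea eb))) b))
          d 1 .0 ea eb refl = code-inj k 1 ea eb
          d (suc (suc x)) y ea eb ()
    go : ∀ a b → A t ≡ a → B t ≡ b → A t + B t ≤ 1 → t ≡ 0 ⊎ t ≡ 2
    go a b ea eb l = d a b ea eb (subst₂ (λ x y → x + y ≤ 1) ea eb l)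
      where
      d : ∀ x y → A t ≡ x → B t ≡ y → x + y ≤ 1 → t ≡ 0 ⊎ t ≡ 2
      d 0 0 ea eb _ = inj₁ (code-inj t 0 ea eb)
      d 0 1 ea eb _ = inj₂ (code-inj t 2 ea eb)
      d 1 0 ea eb _ = ⊥-elim (false≢true (trans (sym p1) (trans (cong (look p) (sym (code-inj t 1 ea eb))) e)))
      d 0 (suc (suc _)) ea eb (s≤s ())
      d 1 (suc _) ea eb (s≤s ())
      d (suc (suc _)) _ ea eb (s≤s ())

-- T₅ and T₇ on powers of z and w

tz7 tz5 : ℕ → Poly1
tz7 (suc (suc (suc (suc (suc (suc (suc (suc n)))))))) = sh 1 (tz7 (suc n)) ⊞ (sh 4 (tz7 (suc (suc (suc (suc n))))) ⊞ sh 8 (tz7 n))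
-- T₇(z⁷) = z is the only nonzero initial value; for T₅ it is T₅(z⁵) = z.
tz7 7 = sh 1 (true ∷ [])
tz7 _ = []
tz5 (suc (suc (suc (suc (suc (suc n)))))) = sh 1 (tz5 (suc n)) ⊞ sh 6 (tz5 n)
tz5 5 = sh 1 (true ∷ [])
tz5 _ = []

⟪X⟫ : ⟪ sh 1 (true ∷ []) ⟫ z ≋ z
⟪X⟫ = sh-ok 1 (true ∷ []) z ⟫ *-cong (*-idʳ z) (⟪⟫-∷ true [] z ⟫ +-cong ≋-refl (*-zeroʳ' z) ⟫ +-idʳ 𝟙) ⟫ *-idʳ z

tz7-ok : ∀ n → Tₛ 7 (z ^ₛ n) ≋ ⟪ tz7 n ⟫ z
tz7-ok = base-step 8 base step
  where
  base : ∀ n → n < 8 → Tₛ 7 (z ^ₛ n) ≋ ⟪ tz7 n ⟫ z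
  base 0 _ = V7.T𝟙
  base 1 _ = V7.T^1 V7.Tz
  base 2 _ = V7.T^2 1 (V7.T^1 V7.Tz)
  base 3 _ = V7.Tz3
  base 4 _ = V7.T^2 2 (V7.T^2 1 (V7.T^1 V7.Tz))
  base 5 _ = T7z5
  base 6 _ = V7.T^2 3 V7.Tz3
  base 7 _ = T7z7 ⟫ ≋-sym ⟪X⟫
  base (suc (suc (suc (suc (suc (suc (suc (suc _)))))))) (s≤s (s≤s (s≤s (s≤s (s≤s (s≤s (s≤s (s≤s ()))))))))
  step : ∀ n → (∀ k → k < 8 + n → Tₛ 7 (z ^ₛ k) ≋ ⟪ tz7 k ⟫ z) → Tₛ 7 (z ^ₛ (8 + n)) ≋ ⟪ tz7 (8 + n) ⟫ z
  step n ih = ≋-sym (*-idˡ _ ⟫ T7^ z 8 n) ⟫ +-cong0 (Z7.rec (z ^ₛ n))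
    ⟫ +-cong (*-cong ≋-refl (T7^ z 1 n ⟫ ih (1 + n) (+-monoˡ-< n (≤from 2 8 refl))) ⟫ ≋-sym (sh-ok 1 (tz7 (1 + n)) z))
      (+-cong (*-cong ≋-refl (T7^ z 4 n ⟫ ih (4 + n) (+-monoˡ-< n (≤from 5 8 refl))) ⟫ ≋-sym (sh-ok 4 (tz7 (4 + n)) z))
        (+-idʳ _ ⟫ *-cong ≋-refl (T7^ z 0 n ⟫ ih n (+-monoˡ-< n (≤from 1 8 refl))) ⟫ ≋-sym (sh-ok 8 (tz7 n) z)) ⟫ ≋-sym (⟪⟫-+ (sh 4 (tz7 (4 + n))) (sh 8 (tz7 n)) z))
    ⟫ ≋-sym (⟪⟫-+ (sh 1 (tz7 (1 + n))) (sh 4 (tz7 (4 + n)) ⊞ sh 8 (tz7 n)) z)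

tz5-ok : ∀ n → Tₛ 5 (z ^ₛ n) ≋ ⟪ tz5 n ⟫ z
tz5-ok = base-step 6 base step
  where
  base : ∀ n → n < 6 → Tₛ 5 (z ^ₛ n) ≋ ⟪ tz5 n ⟫ z
  base 0 _ = V5.T𝟙
  base 1 _ = V5.T^1 V5.Tz
  base 2 _ = V5.T^2 1 (V5.T^1 V5.Tz)
  base 3 _ = V5.Tz3
  base 4 _ = V5.T^2 2 (V5.T^2 1 (V5.T^1 V5.Tz))
  base 5 _ = T5z5 ⟫ ≋-sym ⟪X⟫
  base (suc (suc (suc (suc (suc (suc _)))))) (s≤s (s≤s (s≤s (s≤s (s≤s (s≤s ()))))))
  step : ∀ n → (∀ k → k < 6 + n → Tₛ 5 (z ^ₛ k) ≋ ⟪ tz5 k ⟫ z) → Tₛ 5 (z ^ₛ (6 + n)) ≋ ⟪ tz5 (6 + n) ⟫ z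
  step n ih = ≋-sym (*-idˡ _ ⟫ T5^ z 6 n) ⟫ +-cong0 (Z5.rec (z ^ₛ n))
    ⟫ +-cong (*-cong ≋-refl (T5^ z 1 n ⟫ ih (1 + n) (+-monoˡ-< n (≤from 2 6 refl))) ⟫ ≋-sym (sh-ok 1 (tz5 (1 + n)) z))
        (+-idʳ _ ⟫ *-cong ≋-refl (T5^ z 0 n ⟫ ih n (+-monoˡ-< n (≤from 1 6 refl))) ⟫ ≋-sym (sh-ok 6 (tz5 n) z))
    ⟫ ≋-sym (⟪⟫-+ (sh 1 (tz5 (1 + n))) (sh 6 (tz5 n)) z)

w-shift : ∀ p .{{_ : NonZero p}} h i n → Tₛ p (w ^ₛ i · (h · w ^ₛ n)) ≋ Tₛ p (h · w ^ₛ (i + n))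
w-shift p h i n = T-cong p (*-swap' _ _ _ ⟫ *-cong ≋-refl (≋-sym (^-+ w i n)))

T7-Rec : ∀ h → Rec7 w (λ n → Tₛ 7 (h · w ^ₛ n))
T7-Rec h n = ≋-sym (*-idˡ _ ⟫ w-shift 7 h 8 n) ⟫ +-cong0 (Wr7.rec (h · w ^ₛ n))
  ⟫ +-cong (*-cong ≋-refl (w-shift 7 h 2 n)) (+-cong (*-cong (*-idʳ w) (w-shift 7 h 1 n)) (+-idʳ _ ⟫ *-cong ≋-refl (w-shift 7 h 0 n)))

T5-Rec : ∀ h → Rec5 w (λ n → Tₛ 5 (h · w ^ₛ n))
T5-Rec h n = ≋-sym (*-idˡ _ ⟫ w-shift 5 h 6 n) ⟫ +-cong0 (Wr5.rec (h · w ^ₛ n))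
  ⟫ +-cong (*-cong ≋-refl (w-shift 5 h 4 n)) (+-cong (*-cong ≋-refl (w-shift 5 h 2 n)) (+-cong (*-cong (*-idʳ w) (w-shift 5 h 1 n)) (+-idʳ _ ⟫ *-cong ≋-refl (w-shift 5 h 0 n))))

w-z6 : w ≋ z ^ₛ 6
w-z6 = *-cong (≋-sym z³) (≋-sym z³) ⟫ ≋-sym (^-+ z 3 3)

w^-z : ∀ k → w ^ₛ k ≋ z ^ₛ (k * 6)
w^-z zero = ≋-refl
w^-z (suc k) = *-cong w-z6 (w^-z k) ⟫ ≋-sym (^-+ z 6 (k * 6))

exp6 : Poly1 → Poly1
exp6 [] = []
exp6 (c ∷ p) = (c ∷ []) ⊞ sh 6 (exp6 p)

exp6-ok : ∀ p → ⟪ exp6 p ⟫ z ≋ ⟪ p ⟫ w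
exp6-ok [] = ≋-refl
exp6-ok (c ∷ p) = ⟪⟫-+ (c ∷ []) (sh 6 (exp6 p)) z ⟫ +-cong (⟪⟫-∷ c [] z ⟫ +-cong ≋-refl (*-zeroʳ' z) ⟫ +-idʳ _) (sh-ok 6 (exp6 p) z ⟫ *-cong (≋-sym w-z6) (exp6-ok p)) ⟫ ≋-sym (⟪⟫-∷ c p w)

-- Both sides obey the recurrence in w; by w = z⁶ the initial values are T₇ of powers of z, compared
-- by evaluation.
T7-seq : ∀ e g i → (∀ k → k < 8 → rec7 i k ≡ i k) → allB 8 (λ k → eqP (tz7 (e + k * 6)) (sh g (exp6 (i k)))) ≡ true →
  ∀ n → Tₛ 7 (z ^ₛ e · w ^ₛ n) ≋ z ^ₛ g · ⟪ rec7 i n ⟫ w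
T7-seq e g i ii h = uniq-rec7 (T7-Rec (z ^ₛ e)) (Rec7-· (z ^ₛ g) (rec7-Rec i w)) λ k l →
  T-cong 7 (*-cong ≋-refl (w^-z k) ⟫ ≋-sym (^-+ z e (k * 6))) ⟫ tz7-ok (e + k * 6)
  ⟫ eqP-ok (tz7 (e + k * 6)) (sh g (exp6 (i k))) z (allB-ok 8 (λ k → eqP (tz7 (e + k * 6)) (sh g (exp6 (i k)))) h k l)
  ⟫ sh-ok g (exp6 (i k)) z ⟫ *-cong ≋-refl (exp6-ok (i k) ⟫ subst (λ p → ⟪ i k ⟫ w ≋ ⟪ p ⟫ w) (sym (ii k l)) ≋-refl)

T5-seq : ∀ e g i → (∀ k → k < 6 → rec5 i k ≡ i k) → allB 6 (λ k → eqP (tz5 (e + k * 6)) (sh g (exp6 (i k)))) ≡ true →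
  ∀ n → Tₛ 5 (z ^ₛ e · w ^ₛ n) ≋ z ^ₛ g · ⟪ rec5 i n ⟫ w
T5-seq e g i ii h = uniq-rec5 (T5-Rec (z ^ₛ e)) (Rec5-· (z ^ₛ g) (rec5-Rec i w)) λ k l →
  T-cong 5 (*-cong ≋-refl (w^-z k) ⟫ ≋-sym (^-+ z e (k * 6))) ⟫ tz5-ok (e + k * 6)
  ⟫ eqP-ok (tz5 (e + k * 6)) (sh g (exp6 (i k))) z (allB-ok 6 (λ k → eqP (tz5 (e + k * 6)) (sh g (exp6 (i k)))) h k l)
  ⟫ sh-ok g (exp6 (i k)) z ⟫ *-cong ≋-refl (exp6-ok (i k) ⟫ subst (λ p → ⟪ i k ⟫ w ≋ ⟪ p ⟫ w) (sym (ii k l)) ≋-refl)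

T-Lin : ∀ p .{{_ : NonZero p}} g s h → (∀ n → Tₛ p (h · w ^ₛ n) ≋ g · ⟪ s n ⟫ w) → ∀ q → Tₛ p (h · ⟪ q ⟫ w) ≋ g · ⟪ Lin s q ⟫ w
T-Lin p g s h e [] = T-cong p (*-zeroʳ' h) ⟫ T-𝟘 p ⟫ ≋-sym (*-zeroʳ' g)
T-Lin p g s h e (c ∷ q) = T-cong p (*-cong ≋-refl (⟪⟫-∷ c q w) ⟫ *-distˡ _ _ _ ⟫ +-cong ≋-refl (≋-sym (*-assoc' _ _ _))) ⟫ T-+ p _ _
  ⟫ +-cong (hd c) (T-Lin p g (s ∘ suc) (h · w) (λ n → T-cong p (*-assoc' _ _ _) ⟫ e (suc n)) q) ⟫ ≋-sym (*-distˡ _ _ _) ⟫ *-cong ≋-refl (≋-sym (⟪⟫-+ (if c then s 0 else []) (Lin (s ∘ suc) q) w))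
  where
  hd : ∀ c → Tₛ p (h · b𝟙 c) ≋ g · ⟪ if c then s 0 else [] ⟫ w
  hd true = e 0
  hd false = T-cong p (*-zeroʳ' h) ⟫ T-𝟘 p ⟫ ≋-sym (*-zeroʳ' g)

s1 s2 : Poly1 → Series
s1 b = z · ⟪ b ⟫ w
s2 c = z ^ₛ 5 · ⟪ c ⟫ w

z^1 : ∀ b → z ^ₛ 1 · ⟪ b ⟫ w ≋ s1 b
z^1 b = *-cong (*-idʳ z) ≋-refl

T7-s1 : ∀ b → Tₛ 7 (s1 b) ≋ s1 (X₇ b)
T7-s1 b = T-cong 7 (≋-sym (z^1 b)) ⟫ T-Lin 7 (z ^ₛ 1) (rec7 x-init) (z ^ₛ 1) (T7-seq 1 1 x-init (rec7-ini x-init) refl) b ⟫ z^1 (X₇ b)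
T7-s2 : ∀ c → Tₛ 7 (s2 c) ≋ s2 (X₇' c)
T7-s2 = T-Lin 7 (z ^ₛ 5) (rec7 x'-init) (z ^ₛ 5) (T7-seq 5 5 x'-init (rec7-ini x'-init) refl)
T5-s1 : ∀ b → Tₛ 5 (s1 b) ≋ s2 (Y1 b)
T5-s1 b = T-cong 5 (≋-sym (z^1 b)) ⟫ T-Lin 5 (z ^ₛ 5) (rec5 y₁-init) (z ^ₛ 1) (T5-seq 1 5 y₁-init (rec5-ini y₁-init) refl) b
T5-s2 : ∀ c → Tₛ 5 (s2 c) ≋ s1 (Y2 c)
T5-s2 c = T-Lin 5 (z ^ₛ 1) (rec5 y₂-init) (z ^ₛ 5) (T5-seq 5 1 y₂-init (rec5-ini y₂-init) refl) c ⟫ z^1 (Y2 c)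

-- Injective hulls and their power series operators

record F₂-Space : Set₁ where
  infix 4 _≈ᵥ_
  infixl 6 _∙_
  field
    Carrier : Set
    _≈ᵥ_ : Carrier → Carrier → Set
    reflᵥ : ∀ {x} → x ≈ᵥ x
    symᵥ : ∀ {x y} → x ≈ᵥ y → y ≈ᵥ x
    transᵥ : ∀ {x y z} → x ≈ᵥ y → y ≈ᵥ z → x ≈ᵥ z
    _∙_ : Carrier → Carrier → Carrier
    ε : Carrier
    ∙-cong : ∀ {x x' y y'} → x ≈ᵥ x' → y ≈ᵥ y' → x ∙ y ≈ᵥ x' ∙ y'
    ∙-assoc : ∀ x y z → (x ∙ y) ∙ z ≈ᵥ x ∙ (y ∙ z)
    ∙-comm : ∀ x y → x ∙ y ≈ᵥ y ∙ x
    ∙-idʳ : ∀ x → x ∙ ε ≈ᵥ x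
    ∙-self : ∀ x → x ∙ x ≈ᵥ ε

module Hull (S : F₂-Space) where
  open F₂-Space S

  -- A space on which commuting, locally nilpotent t and s act so that t is onto, s is onto on ker t and
  -- ker t ∩ ker s is spanned by e₀: the injective hull of the residue field of F₂[[t , s]].
  module Cofree
    (t s : Carrier → Carrier)
    (t-cong : ∀ {x y} → x ≈ᵥ y → t x ≈ᵥ t y) (s-cong : ∀ {x y} → x ≈ᵥ y → s x ≈ᵥ s y)
    (t-∙ : ∀ x y → t (x ∙ y) ≈ᵥ t x ∙ t y) (s-∙ : ∀ x y → s (x ∙ y) ≈ᵥ s x ∙ s y)
    (ts : ∀ x → t (s x) ≈ᵥ s (t x))
    (σ : Carrier → Carrier) (tσ : ∀ x → t (σ x) ≈ᵥ x)
    (s-onto : ∀ x → t x ≈ᵥ ε → ∃ λ y → t y ≈ᵥ ε × s y ≈ᵥ x)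
    where

    _^_⟨_⟩ : (Carrier → Carrier) → ℕ → Carrier → Carrier
    f ^ zero ⟨ x ⟩ = x
    f ^ suc n ⟨ x ⟩ = f (f ^ n ⟨ x ⟩)

    module Nil (t-nil : ∀ x → ∃ λ n → t ^ n ⟨ x ⟩ ≈ᵥ ε) (s-nil : ∀ x → ∃ λ n → s ^ n ⟨ x ⟩ ≈ᵥ ε)
      (coeff : Carrier → Bool) (coeff-cong : ∀ x y → x ≈ᵥ y → coeff x ≡ coeff y) (coeff-∙ : ∀ x y → coeff (x ∙ y) ≡ coeff x xor coeff y)
      (e₀ : Carrier) (te₀ : t e₀ ≈ᵥ ε) (se₀ : s e₀ ≈ᵥ ε) (coeff-e₀ : coeff e₀ ≡ true)
      (socle₀ : ∀ x → t x ≈ᵥ ε → s x ≈ᵥ ε → coeff x ≡ false → x ≈ᵥ ε) where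

      infixr 3 _◂_
      _◂_ : ∀ {x y z} → x ≈ᵥ y → y ≈ᵥ z → x ≈ᵥ z
      _◂_ = transᵥ

      ∙-idˡ : ∀ x → ε ∙ x ≈ᵥ x
      ∙-idˡ x = ∙-comm ε x ◂ ∙-idʳ x

      ∙-cancel : ∀ {x y} → x ∙ y ≈ᵥ ε → x ≈ᵥ y
      ∙-cancel {x} {y} e = symᵥ (∙-idʳ x) ◂ ∙-cong reflᵥ (symᵥ (∙-self y)) ◂ symᵥ (∙-assoc x y y) ◂ ∙-cong e reflᵥ ◂ ∙-idˡ y

      ∙-swap : ∀ a b c d → (a ∙ b) ∙ (c ∙ d) ≈ᵥ (a ∙ c) ∙ (b ∙ d)
      ∙-swap a b c d = ∙-assoc a b (c ∙ d) ◂ ∙-cong reflᵥ (symᵥ (∙-assoc b c d) ◂ ∙-cong (∙-comm b c) reflᵥ ◂ ∙-assoc c b d) ◂ symᵥ (∙-assoc a c (b ∙ d))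

      ε∙ε : ∀ {x y} → x ≈ᵥ ε → y ≈ᵥ ε → x ∙ y ≈ᵥ ε
      ε∙ε p q = ∙-cong p q ◂ ∙-idʳ ε

      record Comm : Set where
        field
          fn : Carrier → Carrier
          cong-fn : ∀ {x y} → x ≈ᵥ y → fn x ≈ᵥ fn y
          fn-∙ : ∀ x y → fn (x ∙ y) ≈ᵥ fn x ∙ fn y
          fn-t : ∀ x → fn (t x) ≈ᵥ t (fn x)
          fn-s : ∀ x → fn (s x) ≈ᵥ s (fn x)

      open Comm

      fn-ε : (ψ : Comm) → ∀ {x} → x ≈ᵥ ε → fn ψ x ≈ᵥ ε
      fn-ε ψ e = cong-fn ψ (e ◂ symᵥ (∙-self ε)) ◂ fn-∙ ψ ε ε ◂ ∙-self _

      Tᶜ Sᶜ : Comm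
      Tᶜ = record { fn = t ; cong-fn = t-cong ; fn-∙ = t-∙ ; fn-t = λ _ → reflᵥ ; fn-s = ts }
      Sᶜ = record { fn = s ; cong-fn = s-cong ; fn-∙ = s-∙ ; fn-t = λ x → symᵥ (ts x) ; fn-s = λ _ → reflᵥ }

      _⊚_ : Comm → Comm → Comm
      ψ ⊚ χ = record { fn = λ x → fn ψ (fn χ x) ; cong-fn = λ e → cong-fn ψ (cong-fn χ e) ; fn-∙ = λ x y → cong-fn ψ (fn-∙ χ x y) ◂ fn-∙ ψ _ _
        ; fn-t = λ x → cong-fn ψ (fn-t χ x) ◂ fn-t ψ _ ; fn-s = λ x → cong-fn ψ (fn-s χ x) ◂ fn-s ψ _ }

      pow : Comm → ℕ → Comm
      pow ψ zero = record { fn = λ x → x ; cong-fn = λ e → e ; fn-∙ = λ _ _ → reflᵥ ; fn-t = λ _ → reflᵥ ; fn-s = λ _ → reflᵥ }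
      pow ψ (suc n) = ψ ⊚ pow ψ n

      _⊕'_ : Comm → Comm → Comm
      ψ ⊕' χ = record { fn = λ x → fn ψ x ∙ fn χ x ; cong-fn = λ e → ∙-cong (cong-fn ψ e) (cong-fn χ e)
        ; fn-∙ = λ x y → ∙-cong (fn-∙ ψ x y) (fn-∙ χ x y) ◂ ∙-swap _ _ _ _
        ; fn-t = λ x → ∙-cong (fn-t ψ x) (fn-t χ x) ◂ symᵥ (t-∙ _ _) ; fn-s = λ x → ∙-cong (fn-s ψ x) (fn-s χ x) ◂ symᵥ (s-∙ _ _) }

      s^ : ℕ → Carrier → Carrier
      s^ n = fn (pow Sᶜ n)
      t^ : ℕ → Carrier → Carrier
      t^ n = fn (pow Tᶜ n)

      pow-⟨⟩ : ∀ ψ n x → fn ψ ^ n ⟨ x ⟩ ≡ fn (pow ψ n) x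
      pow-⟨⟩ ψ zero x = refl
      pow-⟨⟩ ψ (suc n) x = cong (fn ψ) (pow-⟨⟩ ψ n x)

      pow-+ : ∀ ψ m n x → fn (pow ψ (m + n)) x ≡ fn (pow ψ m) (fn (pow ψ n) x)
      pow-+ ψ zero n x = refl
      pow-+ ψ (suc m) n x = cong (fn ψ) (pow-+ ψ m n x)

      pow-suc : ∀ ψ n x → fn (pow ψ n) (fn ψ x) ≡ fn (pow ψ (suc n)) x
      pow-suc ψ n x = trans (sym (pow-+ ψ n 1 x)) (cong (λ k → fn (pow ψ k) x) (+-comm n 1))

      s^-comm : ∀ ψ n x → fn ψ (s^ n x) ≈ᵥ s^ n (fn ψ x)
      s^-comm ψ zero x = reflᵥ
      s^-comm ψ (suc n) x = fn-s ψ _ ◂ s-cong (s^-comm ψ n x)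

      ≡→≈ : ∀ {x y} → x ≡ y → x ≈ᵥ y
      ≡→≈ refl = reflᵥ

      pow-ε : ∀ ψ m n x → m ≤ n → fn (pow ψ m) x ≈ᵥ ε → fn (pow ψ n) x ≈ᵥ ε
      pow-ε ψ m n x l e = ≡→≈ (trans (cong (λ k → fn (pow ψ k) x) (sym (m∸n+n≡m l))) (pow-+ ψ (n ∸ m) m x)) ◂ fn-ε (pow ψ (n ∸ m)) e

      -- Adding e₀ changes neither t y nor s y, so the preimage can be normalised.
      next : ∀ {x} → (∃ λ y → t y ≈ᵥ ε × s y ≈ᵥ x) → ∃ λ y → t y ≈ᵥ ε × s y ≈ᵥ x × coeff y ≡ false
      next {x} (y , ty , sy) = go (coeff y) refl
        where
        go : ∀ b → coeff y ≡ b → ∃ λ y → t y ≈ᵥ ε × s y ≈ᵥ x × coeff y ≡ false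
        go false e = y , ty , sy , e
        go true e = y ∙ e₀ , (t-∙ y e₀ ◂ ε∙ε ty te₀) , (s-∙ y e₀ ◂ ∙-cong sy se₀ ◂ ∙-idʳ _) , trans (coeff-∙ y e₀) (cong₂ _xor_ e coeff-e₀)

      mlist : ℕ → ∃ λ y → t y ≈ᵥ ε
      mlist zero = e₀ , te₀
      mlist (suc n) = let (y , ty , _) = next (s-onto (proj₁ (mlist n)) (proj₂ (mlist n))) in y , ty

      -- Dual to the powers of s on ker t: `coeff` of s^i (m j) is 1 exactly for i = j.
      m : ℕ → Carrier
      m n = proj₁ (mlist n)
      tm : ∀ n → t (m n) ≈ᵥ ε
      tm n = proj₂ (mlist n)
      sm : ∀ n → s (m (suc n)) ≈ᵥ m n
      sm n = proj₁ (proj₂ (proj₂ (next (s-onto (proj₁ (mlist n)) (proj₂ (mlist n))))))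
      coeff-m : ∀ n → coeff (m (suc n)) ≡ false
      coeff-m n = proj₂ (proj₂ (proj₂ (next (s-onto (proj₁ (mlist n)) (proj₂ (mlist n))))))

      s^m : ∀ i j → s^ i (m (i + j)) ≈ᵥ m j
      s^m zero j = reflᵥ
      s^m (suc i) j = symᵥ (≡→≈ (pow-suc Sᶜ i (m (suc i + j)))) ◂ cong-fn (pow Sᶜ i) (sm (i + j)) ◂ s^m i j

      s^m0 : ∀ j → s^ j (m j) ≈ᵥ e₀
      s^m0 j = ≡→≈ (cong (λ k → s^ j (m k)) (sym (+-identityʳ j))) ◂ s^m j 0

      s^mε : ∀ j → s^ (suc j) (m j) ≈ᵥ ε
      s^mε j = s-cong (s^m0 j) ◂ se₀

      coeff-ε : ∀ {x} → x ≈ᵥ ε → coeff x ≡ false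
      coeff-ε e = trans (coeff-cong _ _ (e ◂ symᵥ (∙-self ε))) (trans (coeff-∙ ε ε) (xor-same (coeff ε)))

      in-socle : ∀ x → t x ≈ᵥ ε → s x ≈ᵥ ε → x ≈ᵥ ε ⊎ x ≈ᵥ e₀
      in-socle x tx sx = go (coeff x) refl
        where go : ∀ b → coeff x ≡ b → x ≈ᵥ ε ⊎ x ≈ᵥ e₀
              go false e = inj₁ (socle₀ x tx sx e)
              go true e = inj₂ (∙-cancel (socle₀ (x ∙ e₀) (t-∙ x e₀ ◂ ε∙ε tx te₀) (s-∙ x e₀ ◂ ε∙ε sx se₀) (trans (coeff-∙ x e₀) (cong₂ _xor_ e coeff-e₀))))

      -- For x in ker t with s^(n + 1) x = 0, the vector s^n x is zero or e₀ = s^n (m n); in the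
      -- second case m n is subtracted from x.
      kills-ker : ∀ (δ : Comm) n → (∀ j → j < n → fn δ (m j) ≈ᵥ ε) → ∀ x → t x ≈ᵥ ε → s^ n x ≈ᵥ ε → fn δ x ≈ᵥ ε
      kills-ker δ zero h x tx e = fn-ε δ e
      kills-ker δ (suc n) h x tx e = go (in-socle (s^ n x) (s^-comm Tᶜ n x ◂ fn-ε (pow Sᶜ n) tx) e)
        where
        smaller : ∀ x → t x ≈ᵥ ε → s^ n x ≈ᵥ ε → fn δ x ≈ᵥ ε
        smaller = kills-ker δ n (λ j l → h j (m<n⇒m<1+n l))
        go : s^ n x ≈ᵥ ε ⊎ s^ n x ≈ᵥ e₀ → fn δ x ≈ᵥ ε
        go (inj₁ z) = smaller x tx z
        go (inj₂ z) = ∙-cancel (symᵥ (fn-∙ δ x (m n)) ◂ smaller (x ∙ m n) (t-∙ x (m n) ◂ ε∙ε tx (tm n)) (fn-∙ (pow Sᶜ n) x (m n) ◂ ∙-cong z (s^m0 n) ◂ ∙-self e₀)) ◂ h n ≤-refl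

      kills-ker' : ∀ (δ : Comm) → (∀ j → fn δ (m j) ≈ᵥ ε) → ∀ x → t x ≈ᵥ ε → fn δ x ≈ᵥ ε
      kills-ker' δ h x tx = kills-ker δ (proj₁ (s-nil x)) (λ j _ → h j) x tx (symᵥ (≡→≈ (pow-⟨⟩ Sᶜ (proj₁ (s-nil x)) x)) ◂ proj₂ (s-nil x))

      -- An operator that kills ker t factors through the surjection t. The quotient is computed
      -- with the section σ, and `same` makes it independent of the values chosen by σ.
      module Divide (δ : Comm) (k : ∀ x → t x ≈ᵥ ε → fn δ x ≈ᵥ ε) where
        same : ∀ {x y} → t x ≈ᵥ t y → fn δ x ≈ᵥ fn δ y
        same {x} {y} e = ∙-cancel (symᵥ (fn-∙ δ x y) ◂ k (x ∙ y) (t-∙ x y ◂ ∙-cong e reflᵥ ◂ ∙-self _))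

        δ/t : Comm
        δ/t = record { fn = λ x → fn δ (σ x) ; cong-fn = λ {x} {y} e → same (tσ x ◂ e ◂ symᵥ (tσ y))
          ; fn-∙ = λ x y → same (tσ (x ∙ y) ◂ symᵥ (∙-cong (tσ x) (tσ y)) ◂ symᵥ (t-∙ (σ x) (σ y))) ◂ fn-∙ δ (σ x) (σ y)
          ; fn-t = λ x → same (tσ (t x) ◂ t-cong (symᵥ (tσ x))) ◂ fn-t δ (σ x)
          ; fn-s = λ x → same (tσ (s x) ◂ s-cong (symᵥ (tσ x)) ◂ symᵥ (ts (σ x))) ◂ fn-s δ (σ x) }

        δ/t-t : ∀ x → fn δ/t (t x) ≈ᵥ fn δ x
        δ/t-t x = same (tσ (t x))

      -- If ψ (m j) were the first nonzero value on the m's, it would be e₀. Then ψ (m (j + j))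
      -- differs from m j by vectors that ψ kills, so applying ψ again yields e₀, not zero. Hence ψ
      -- kills ker t and is divisible by t; the quotient again has square zero, and local nilpotency
      -- of t ends the descent.
      square-zero : ∀ (ψ : Comm) → (∀ x → fn ψ (fn ψ x) ≈ᵥ ε) → ∀ x → fn ψ x ≈ᵥ ε
      square-zero ψ h x = byt (proj₁ (t-nil x)) ψ h x (symᵥ (≡→≈ (pow-⟨⟩ Tᶜ (proj₁ (t-nil x)) x)) ◂ proj₂ (t-nil x))
        where
        onm : ∀ (ψ : Comm) → (∀ x → fn ψ (fn ψ x) ≈ᵥ ε) → ∀ n j → j < n → fn ψ (m j) ≈ᵥ ε
        onm ψ h (suc n) j l = go (in-socle (fn ψ (m j)) (symᵥ (fn-t ψ (m j)) ◂ fn-ε ψ (tm j)) (symᵥ (fn-s ψ (m j)) ◂ lower j (≤-pred l)))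
          where
          lower : ∀ j → j ≤ n → fn ψ (s (m j)) ≈ᵥ ε
          lower zero _ = fn-ε ψ se₀
          lower (suc j) l = cong-fn ψ (sm j) ◂ onm ψ h n j l
          go : fn ψ (m j) ≈ᵥ ε ⊎ fn ψ (m j) ≈ᵥ e₀ → fn ψ (m j) ≈ᵥ ε
          go (inj₁ e) = e
          go (inj₂ e) = ⊥-elim (false≢true (trans (sym (coeff-ε (symᵥ (∙-cancel (symᵥ (fn-∙ ψ y (m j)) ◂ kills-ker ψ j (λ i li → onm ψ h n i (<-≤-trans li (≤-pred l))) (y ∙ m j)
               (t-∙ y (m j) ◂ ε∙ε (symᵥ (fn-t ψ (m (j + j))) ◂ fn-ε ψ (tm (j + j))) (tm j))
               (fn-∙ (pow Sᶜ j) y (m j) ◂ ∙-cong (symᵥ (s^-comm ψ j (m (j + j))) ◂ cong-fn ψ (s^m j j) ◂ e) (s^m0 j) ◂ ∙-self e₀)) ◂ e) ◂ h (m (j + j))))) coeff-e₀))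
            where y : Carrier
                  y = fn ψ (m (j + j))
        byt : ∀ n (ψ : Comm) → (∀ x → fn ψ (fn ψ x) ≈ᵥ ε) → ∀ x → t^ n x ≈ᵥ ε → fn ψ x ≈ᵥ ε
        byt zero ψ h x e = fn-ε ψ e
        byt (suc n) ψ h x e = symᵥ (D.δ/t-t x) ◂ byt n D.δ/t sq (t x) (≡→≈ (pow-suc Tᶜ n x) ◂ e)
          where
          module D = Divide ψ (kills-ker' ψ (λ j → onm ψ h (suc j) j ≤-refl))
          sq : ∀ x → fn D.δ/t (fn D.δ/t x) ≈ᵥ ε
          sq x = cong-fn (D.δ/t ⊚ D.δ/t) (symᵥ (t-cong (tσ (σ x)) ◂ tσ x)) ◂ cong-fn D.δ/t (D.δ/t-t (t (σ (σ x))) ◂ fn-t ψ _) ◂ D.δ/t-t _ ◂ h _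

      -- The square of ψ^(n + 1) is a multiple of ψ^(n + 2), so the exponent can be lowered step by
      -- step.
      reduced : ∀ (ψ : Comm) n → (∀ x → fn (pow ψ (suc n)) x ≈ᵥ ε) → ∀ x → fn ψ x ≈ᵥ ε
      reduced ψ zero h = h
      reduced ψ (suc n) h = reduced ψ n (square-zero (pow ψ (suc n)) (λ x → ≡→≈ (trans (sym (pow-+ ψ (suc n) (suc n) x)) (trans (cong (λ k → fn (pow ψ k) x) (sym (+-suc n (suc n)))) (pow-+ ψ n (suc (suc n)) x))) ◂ fn-ε (pow ψ n) (h x)))

      bit : Bool → Carrier → Carrier
      bit b x = if b then x else ε

      bit-fn : ∀ ψ b x → fn ψ (bit b x) ≈ᵥ bit b (fn ψ x)
      bit-fn ψ true x = reflᵥ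
      bit-fn ψ false x = fn-ε ψ reflᵥ

      bit-cong : ∀ b {x y} → x ≈ᵥ y → bit b x ≈ᵥ bit b y
      bit-cong true e = e
      bit-cong false e = reflᵥ

      bit-∙ : ∀ b x y → bit b (x ∙ y) ≈ᵥ bit b x ∙ bit b y
      bit-∙ true x y = reflᵥ
      bit-∙ false x y = symᵥ (∙-idʳ ε)

      bit-ε : ∀ b {x} → x ≈ᵥ ε → bit b x ≈ᵥ ε
      bit-ε b e = bit-cong b e ◂ go b
        where go : ∀ b → bit b ε ≈ᵥ ε
              go true = reflᵥ
              go false = reflᵥ

      series : (ℕ → Bool) → ℕ → Carrier → Carrier
      series d zero x = ε
      series d (suc n) x = bit (d n) (s^ n x) ∙ series d n x

      series-cong : ∀ d n {x y} → x ≈ᵥ y → series d n x ≈ᵥ series d n y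
      series-cong d zero e = reflᵥ
      series-cong d (suc n) e = ∙-cong (bit-cong (d n) (cong-fn (pow Sᶜ n) e)) (series-cong d n e)

      series-∙ : ∀ d n x y → series d n (x ∙ y) ≈ᵥ series d n x ∙ series d n y
      series-∙ d zero x y = symᵥ (∙-idʳ ε)
      series-∙ d (suc n) x y = ∙-cong (bit-cong (d n) (fn-∙ (pow Sᶜ n) x y) ◂ bit-∙ (d n) _ _) (series-∙ d n x y) ◂ ∙-swap _ _ _ _

      series-fn : ∀ ψ d n x → series d n (fn ψ x) ≈ᵥ fn ψ (series d n x)
      series-fn ψ d zero x = symᵥ (fn-ε ψ reflᵥ)
      series-fn ψ d (suc n) x = ∙-cong (bit-cong (d n) (symᵥ (s^-comm ψ n x)) ◂ symᵥ (bit-fn ψ (d n) _)) (series-fn ψ d n x) ◂ symᵥ (fn-∙ ψ _ _)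

      series-stable : ∀ d N e x → s^ N x ≈ᵥ ε → series d (e + N) x ≈ᵥ series d N x
      series-stable d N zero x h = reflᵥ
      series-stable d N (suc e) x h = ∙-cong (bit-ε (d (e + N)) (pow-ε Sᶜ N (e + N) x (m≤n+m N e) h)) (series-stable d N e x h) ◂ ∙-idˡ _

      series-coeff : ∀ d n x → coeff (series d n x) ≡ xorSum n (λ i → d i ∧ coeff (s^ i x))
      series-coeff d zero x = coeff-ε reflᵥ
      series-coeff d (suc n) x = trans (coeff-∙ _ _) (cong₂ _xor_ (go (d n)) (series-coeff d n x))
        where go : ∀ b → coeff (bit b (s^ n x)) ≡ b ∧ coeff (s^ n x)
              go true = refl
              go false = coeff-ε reflᵥ

      len' : Carrier → ℕ
      len' x = proj₁ (s-nil x)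

      s^len : ∀ x → s^ (len' x) x ≈ᵥ ε
      s^len x = symᵥ (≡→≈ (pow-⟨⟩ Sᶜ (len' x) x)) ◂ proj₂ (s-nil x)

      series-any : ∀ d N M x → s^ N x ≈ᵥ ε → s^ M x ≈ᵥ ε → series d N x ≈ᵥ series d M x
      series-any d N M x h h' = symᵥ (series-stable d N M x h) ◂ ≡→≈ (cong (λ k → series d k x) (+-comm M N)) ◂ series-stable d M N x h'

      -- Every vector is killed by a power of s, so the infinite series acts as a finite sum whose
      -- length depends on the vector.
      Ser : (ℕ → Bool) → Comm
      Ser d = record
        { fn = λ x → series d (len' x) x
        ; cong-fn = λ {x} {y} e → series-any d (len' x) (len' y) x (s^len x) (cong-fn (pow Sᶜ (len' y)) e ◂ s^len y) ◂ series-cong d (len' y) e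
        ; fn-∙ = λ x y → let N = len' x + len' y ; hx = pow-ε Sᶜ (len' x) N x (m≤m+n _ _) (s^len x) ; hy = pow-ε Sᶜ (len' y) N y (m≤n+m _ _) (s^len y) in
            series-any d (len' (x ∙ y)) N (x ∙ y) (s^len _) (fn-∙ (pow Sᶜ N) x y ◂ ε∙ε hx hy) ◂ series-∙ d N x y ◂ ∙-cong (series-any d N (len' x) x hx (s^len x)) (series-any d N (len' y) y hy (s^len y))
        ; fn-t = λ x → comm' Tᶜ x
        ; fn-s = λ x → comm' Sᶜ x }
        where
        comm' : ∀ ψ x → series d (len' (fn ψ x)) (fn ψ x) ≈ᵥ fn ψ (series d (len' x) x)
        comm' ψ x = series-any d (len' (fn ψ x)) (len' x) (fn ψ x) (s^len _) (symᵥ (s^-comm ψ (len' x) x) ◂ fn-ε ψ (s^len x)) ◂ series-fn ψ d (len' x) x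

      -- By duality of the m's with the powers of s, this reads off the j-th coefficient of the
      -- action on ker t.
      coeffs : Comm → ℕ → Bool
      coeffs ψ j = coeff (fn ψ (m j))

      coeff-s^m : ∀ i j → coeff (s^ i (m j)) ≡ true → i ≡ j
      coeff-s^m i j e = go (<-cmp i j)
        where
        go : _ → i ≡ j
        go (tri≈ _ p _) = p
        go (tri< l _ _) = low (m≤n⇒∃[o]m+o≡n l)
          where low : (∃ λ o → suc i + o ≡ j) → i ≡ j
                low (o , refl) = ⊥-elim (false≢true (trans (sym (trans (coeff-cong _ _ (≡→≈ (cong (λ k → s^ i (m k)) (sym (+-suc i o))) ◂ s^m i (suc o))) (coeff-m o))) e))
        go (tri> _ _ l) = ⊥-elim (false≢true (trans (sym (coeff-ε (pow-ε Sᶜ (suc j) i (m j) l (s^mε j)))) e))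

      remainder : Comm → Comm
      remainder ψ = ψ ⊕' Ser (coeffs ψ)

      remainder-ker : ∀ ψ x → t x ≈ᵥ ε → fn (remainder ψ) x ≈ᵥ ε
      remainder-ker ψ = kills-ker' (remainder ψ) onm
        where
        onm : ∀ j → fn (remainder ψ) (m j) ≈ᵥ ε
        onm j = socle₀ (fn (remainder ψ) (m j)) (symᵥ (fn-t (remainder ψ) (m j)) ◂ fn-ε (remainder ψ) (tm j)) (symᵥ (fn-s (remainder ψ) (m j)) ◂ low j) co
          where
          low : ∀ j → fn (remainder ψ) (s (m j)) ≈ᵥ ε
          low zero = fn-ε (remainder ψ) se₀
          low (suc j) = cong-fn (remainder ψ) (sm j) ◂ onm j
          co : coeff (fn (remainder ψ) (m j)) ≡ false
          co = trans (coeff-∙ _ _) (trans (cong (coeffs ψ j xor_) (trans (series-coeff (coeffs ψ) (len' (m j)) (m j))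
               (trans (sum-one (len' (m j)) j _ (λ i l → trans (cong (coeffs ψ i ∧_) (coeff-ε (pow-ε Sᶜ (len' (m j)) i (m j) l (s^len (m j))))) (∧-zeroʳ (coeffs ψ i))) (λ i e → coeff-s^m i j (proj₂ (∧-true {coeffs ψ i} e))))
                 (trans (cong (coeffs ψ j ∧_) (trans (coeff-cong _ _ (s^m0 j)) coeff-e₀)) (∧-identityʳ (coeffs ψ j)))))) (xor-same (coeffs ψ j)))

      -- What remains after removing the series in s kills ker t and can be divided by t. Iteration
      -- yields the rows of a double power series.
      quotient : Comm → Comm
      quotient ψ = Divide.δ/t (remainder ψ) (remainder-ker ψ)

      coeffs² : Comm → ℕ → ℕ → Bool
      coeffs² ψ zero = coeffs ψ
      coeffs² ψ (suc i) = coeffs² (quotient ψ) i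

      series² : (ℕ → ℕ → Bool) → ℕ → ℕ → Carrier → Carrier
      series² c zero N x = ε
      series² c (suc n) N x = series (c 0) N x ∙ series² (c ∘ suc) n N (t x)

      expansion : ∀ ψ n N x → t^ n x ≈ᵥ ε → s^ N x ≈ᵥ ε → fn ψ x ≈ᵥ series² (coeffs² ψ) n N x
      expansion ψ zero N x e h = fn-ε ψ e
      expansion ψ (suc n) N x e h = ∙-cancel' ◂ ∙-cong (series-any (coeffs ψ) (len' x) N x (s^len x) h)
          (symᵥ (Divide.δ/t-t (remainder ψ) (remainder-ker ψ) x) ◂ expansion (quotient ψ) n N (t x) (≡→≈ (pow-suc Tᶜ n x) ◂ e) (symᵥ (s^-comm Tᶜ N x) ◂ fn-ε Tᶜ h))
        where
        ∙-cancel' : fn ψ x ≈ᵥ fn (Ser (coeffs ψ)) x ∙ (fn ψ x ∙ fn (Ser (coeffs ψ)) x)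
        ∙-cancel' = symᵥ (∙-cong reflᵥ (∙-comm _ _) ◂ symᵥ (∙-assoc _ _ _) ◂ ∙-cong (∙-self _) reflᵥ ◂ ∙-idˡ _)

-- T₅ and T₇ on K and on N2/N1

≃-⊞ : ∀ {p q} → p ≃ q → p ⊞ q ≃ []
≃-⊞ {p} {q} e t = trans (look-⊞ p q t) (trans (cong (_xor look q t) (e t)) (xor-same (look q t)))

⊞-≃ : ∀ {p q} → p ⊞ q ≃ [] → p ≃ q
⊞-≃ {p} {q} e t = xor-cancel (trans (sym (look-⊞ p q t)) (e t))

≃-⟪⟫ : ∀ {p q} f → p ≃ q → ⟪ p ⟫ f ≋ ⟪ q ⟫ f
≃-⟪⟫ {p} {q} f e = +-cong0 (≋-sym (⟪⟫-+ p q f) ⟫ isz-⟪⟫ (p ⊞ q) f (≃-isz (p ⊞ q) (≃-⊞ {p} {q} e)))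

sform-+ : ∀ b c b' c' → sform (b ⊞ b') (c ⊞ c') ≋ sform b c ⊹ sform b' c'
sform-+ b c b' c' = +-cong (*-cong ≋-refl (⟪⟫-+ b b' w) ⟫ *-distˡ _ _ _) (*-cong ≋-refl (⟪⟫-+ c c' w) ⟫ *-distˡ _ _ _) ⟫ +-swap' _ _ _ _

sform-inj : ∀ b c b' c' → sform b c ≋ sform b' c' → b ≃ b' × c ≃ c'
sform-inj b c b' c' e = let (h , k) = sform-zero (b ⊞ b') (c ⊞ c') (sform-+ b c b' c' ⟫ +-cong0' e) in ⊞-≃ {b} {b'} (isz-≃ (b ⊞ b') h) , ⊞-≃ {c} {c'} (isz-≃ (c ⊞ c') k)

sform-cong : ∀ {b c b' c'} → b ≃ b' → c ≃ c' → sform b c ≋ sform b' c'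
sform-cong {b} {c} {b'} {c'} e f = +-cong (*-cong ≋-refl (≃-⟪⟫ {b} {b'} w e)) (*-cong ≋-refl (≃-⟪⟫ {c} {c'} w f))

sform-[] : sform [] [] ≋ 𝟘
sform-[] = +-cong (*-zeroʳ' z) (*-zeroʳ' _) ⟫ +-idˡ 𝟘

π-T : ∀ {p} → Prime p → p ≢ 3 → ∀ f → π (Tₛ p f) ≋ Tₛ p (π f)
π-T {p} pp ne f = ≋-sym (T-+ p f _ ⟫ +-cong ≋-refl (≋-sym (T-V pp prime3 ne _) ⟫ V-cong 3 (≋-sym (T-U pp prime3 ne f))))
  where instance
    nz : NonZero p
    nz = prime⇒nonZero pp

T7-sform : ∀ b c → Tₛ 7 (sform b c) ≋ sform (X₇ b) (X₇' c)
T7-sform b c = T-+ 7 _ _ ⟫ +-cong (T7-s1 b) (T7-s2 c)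
T5-sform : ∀ b c → Tₛ 5 (sform b c) ≋ sform (Y2 c) (Y1 b)
T5-sform b c = T-+ 5 _ _ ⟫ +-cong (T5-s1 b) (T5-s2 c) ⟫ +-comm' _ _

πT7 : ∀ {f b c} → π f ≋ sform b c → π (Tₛ 7 f) ≋ sform (X₇ b) (X₇' c)
πT7 {f} {b} {c} e = π-T prime7 (λ ()) f ⟫ T-cong 7 e ⟫ T7-sform b c
πT5 : ∀ {f b c} → π f ≋ sform b c → π (Tₛ 5 f) ≋ sform (Y2 c) (Y1 b)
πT5 {f} {b} {c} e = π-T prime5 (λ ()) f ⟫ T-cong 5 e ⟫ T5-sform b c

Tⁿ : ℕ → ℕ → Series → Series
Tⁿ p zero f = f
Tⁿ p (suc n) f = Tₛ p (Tⁿ p n f)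

Supp-mono : ∀ {p m n} → m ≤ n → Supp p m → Supp p n
Supp-mono l s k e = ≤-trans (s k e) l

T7-nil : ∀ n m f b c → π f ≋ sform b c → Supp b (n + m) → Supp c (n + m) → ∃ λ b' → ∃ λ c' → π (Tⁿ 7 n f) ≋ sform b' c' × Supp b' m × Supp c' m
T7-nil zero m f b c e sb sc = b , c , e , sb , sc
T7-nil (suc n) m f b c e sb sc = step (T7-nil n (suc m) f b c e (subst (Supp b) (sym (+-suc n m)) sb) (subst (Supp c) (sym (+-suc n m)) sc))
  where
  step : (∃ λ b' → ∃ λ c' → π (Tⁿ 7 n f) ≋ sform b' c' × Supp b' (suc m) × Supp c' (suc m)) → ∃ λ b' → ∃ λ c' → π (Tⁿ 7 (suc n) f) ≋ sform b' c' × Supp b' m × Supp c' m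
  step (b' , c' , e' , sb' , sc') = X₇ b' , X₇' c' , πT7 {Tⁿ 7 n f} {b'} {c'} e' , X₇-Supp {b'} sb' , X₇'-Supp {c'} sc'

-- T₅ exchanges the components; `Y1` lowers A + B by two, `Y2` need not lower it. Granting the first
-- component one unit more makes both bounds drop by one at every step.
T5-nil : ∀ n m f b c → π f ≋ sform b c → Supp b (suc (n + m)) → Supp c (n + m) → ∃ λ b' → ∃ λ c' → π (Tⁿ 5 n f) ≋ sform b' c' × Supp b' (suc m) × Supp c' m
T5-nil zero m f b c e sb sc = b , c , e , sb , sc
T5-nil (suc n) m f b c e sb sc = step (T5-nil n (suc m) f b c e (subst (λ k → Supp b (suc k)) (sym (+-suc n m)) sb) (subst (Supp c) (sym (+-suc n m)) sc))
  where
  step : (∃ λ b' → ∃ λ c' → π (Tⁿ 5 n f) ≋ sform b' c' × Supp b' (2 + m) × Supp c' (suc m)) → ∃ λ b' → ∃ λ c' → π (Tⁿ 5 (suc n) f) ≋ sform b' c' × Supp b' (suc m) × Supp c' m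
  step (b' , c' , e' , sb' , sc') = Y2 c' , Y1 b' , πT5 {Tⁿ 5 n f} {b'} {c'} e' , Y2-Supp {c'} sc' , Y1-Supp {b'} sb'

Supp-[] : ∀ b c f → π f ≋ sform b c → Supp b 0 → Supp c 0 → π f ≋ 𝟘
Supp-[] b c f e sb sc = e ⟫ sform-cong {b} {c} {[]} {[]} (Supp-0 {b} sb) (Supp-0 {c} sc) ⟫ sform-[]

T7-nilpotent : ∀ n f b c → π f ≋ sform b c → Supp b n → Supp c n → π (Tⁿ 7 n f) ≋ 𝟘
T7-nilpotent n f b c e sb sc = fin (T7-nil n 0 f b c e (subst (Supp b) (sym (+-identityʳ n)) sb) (subst (Supp c) (sym (+-identityʳ n)) sc))
  where fin : (∃ λ b' → ∃ λ c' → π (Tⁿ 7 n f) ≋ sform b' c' × Supp b' 0 × Supp c' 0) → π (Tⁿ 7 n f) ≋ 𝟘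
        fin (b' , c' , e' , sb' , sc') = Supp-[] b' c' _ e' sb' sc'

T5-nilpotent : ∀ n f b c → π f ≋ sform b c → Supp b n → Supp c n → π (Tⁿ 5 (suc n) f) ≋ 𝟘
T5-nilpotent n f b c e sb sc = fin (T5-nil n 0 f b c e (subst (Supp b) (cong suc (sym (+-identityʳ n))) (Supp-mono {b} (n≤1+n n) sb)) (subst (Supp c) (sym (+-identityʳ n)) sc))
  where fin : (∃ λ b' → ∃ λ c' → π (Tⁿ 5 n f) ≋ sform b' c' × Supp b' 1 × Supp c' 0) → π (Tⁿ 5 (suc n) f) ≋ 𝟘
        fin (b' , c' , e' , sb' , sc') = Supp-[] (Y2 c') (Y1 b') _ (πT5 {Tⁿ 5 n f} {b'} {c'} e') (Y2-Supp {c'} sc') (Y1-Supp {b'} (Supp-mono {b'} (n≤1+n 1) sb'))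

record KEl : Set where
  constructor kel
  field
    ser : Series
    inZ2 : Z2 ser
    U2-0 : U 2 ser ≋ 𝟘
    U3-id : U 3 ser ≋ ser
open KEl public

K-form : ∀ k → ∃ λ a → ∃ λ b → ∃ λ c → ser k ≋ nform a b c
K-form (kel f zf e2 e3) = K-N2 zf e2 e3

opaque
  K-π : ∀ k → ∃ λ b → ∃ λ c → π (ser k) ≋ sform b c
  K-π k = go (K-form k)
    where go : (∃ λ a → ∃ λ b → ∃ λ c → ser k ≋ nform a b c) → ∃ λ b → ∃ λ c → π (ser k) ≋ sform b c
          go (a , b , c , e) = b , c , (π-cong e ⟫ π-nform a b c)

-- By `K-inj`, invariance under U₃ determines all of k from its component on z F₂[w].
K-zero : ∀ k b c → π (ser k) ≋ sform b c → b ≃ [] → ser k ≋ 𝟘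
K-zero k b c e b0 = go (K-form k)
  where
  go : (∃ λ a → ∃ λ b → ∃ λ c → ser k ≋ nform a b c) → ser k ≋ 𝟘
  go (a , b' , c' , q) = q ⟫ K-inj a b' c' (U-cong 3 (≋-sym q) ⟫ U3-id k ⟫ q) (≃-isz b' (λ t → trans (proj₁ (sform-inj b' c' b c (≋-sym (π-nform a b' c') ⟫ π-cong (≋-sym q) ⟫ e)) t) (b0 t)))

K-lift : ∀ b → ∃ λ k → ∃ λ c → π (ser k) ≋ sform b c
K-lift b = go (K-exists b)
  where go : (∃ λ a → ∃ λ c → U 3 (nform a b c) ≋ nform a b c) → ∃ λ k → ∃ λ c → π (ser k) ≋ sform b c
        go (a , c , e) = kel (nform a b c) (Z2-nform a b c) (U2-nform a b c) e , c , π-nform a b c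

_⊹ₖ_ : KEl → KEl → KEl
k ⊹ₖ l = kel (ser k ⊹ ser l) (Z2-+ (inZ2 k) (inZ2 l)) (U-+ 2 _ _ ⟫ +-cong (U2-0 k) (U2-0 l) ⟫ +-idˡ 𝟘) (U-+ 3 _ _ ⟫ +-cong (U3-id k) (U3-id l))

K-ext : ∀ k l b c b' c' → π (ser k) ≋ sform b c → π (ser l) ≋ sform b' c' → b ≃ b' → ser k ≋ ser l
K-ext k l b c b' c' e e' h = +-cong0 (K-zero (k ⊹ₖ l) (b ⊞ b') (c ⊞ c') (π-+ _ _ ⟫ +-cong e e' ⟫ ≋-sym (sform-+ b c b' c')) (≃-⊞ {b} {b'} h))

T7ₖ T5ₖ : KEl → KEl
T7ₖ k = kel (Tₛ 7 (ser k)) (C7.T-Z2 (inZ2 k)) (T-U prime7 prime2 (λ ()) _ ⟫ T-cong 7 (U2-0 k) ⟫ T-𝟘 7) (T-U prime7 prime3 (λ ()) _ ⟫ T-cong 7 (U3-id k))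
T5ₖ k = kel (Tₛ 5 (ser k)) (C5.T-Z2 (inZ2 k)) (T-U prime5 prime2 (λ ()) _ ⟫ T-cong 5 (U2-0 k) ⟫ T-𝟘 5) (T-U prime5 prime3 (λ ()) _ ⟫ T-cong 5 (U3-id k))

KS : F₂-Space
KS = record
  { Carrier = KEl ; _≈ᵥ_ = λ k l → ser k ≋ ser l ; reflᵥ = ≋-refl ; symᵥ = ≋-sym ; transᵥ = _⟫_ ; _∙_ = _⊹ₖ_
  ; ε = kel 𝟘 Z2-𝟘 (U-𝟘 2) (U-𝟘 3) ; ∙-cong = +-cong ; ∙-assoc = λ x y z → +-assoc' _ _ _ ; ∙-comm = λ x y → +-comm' _ _ ; ∙-idʳ = λ x → +-idʳ _ ; ∙-self = λ x → +-self _ }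

opaque
  T7-onto : ∀ k → ∃ λ l → Tₛ 7 (ser l) ≋ ser k
  T7-onto k = go (K-π k)
    where
    go : (∃ λ b → ∃ λ c → π (ser k) ≋ sform b c) → ∃ λ l → Tₛ 7 (ser l) ≋ ser k
    go (b , c , e) = go2 (Onto.onto (proj₁ (Supp-bound b)) b (proj₂ (Supp-bound b)))
      where
      go2 : Onto.Img (proj₁ (Supp-bound b)) b → ∃ λ l → Tₛ 7 (ser l) ≋ ser k
      go2 (g , h , _) = go3 (K-lift g)
        where go3 : (∃ λ k → ∃ λ c → π (ser k) ≋ sform g c) → ∃ λ l → Tₛ 7 (ser l) ≋ ser k
              go3 (l , c' , e') = l , K-ext (T7ₖ l) k (X₇ g) (X₇' c') b c (πT7 {ser l} {g} {c'} e') e h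

T57 : ∀ f → Tₛ 7 (Tₛ 5 f) ≋ Tₛ 5 (Tₛ 7 f)
T57 = T-comm prime7 prime5

-- Compare components on z F₂[w] in T₇ T₅² = T₅² T₇, applied to z p(w).
XY-comm : ∀ p → X₇ p ≃ [] → X₇ (Y2 (Y1 p)) ≃ []
XY-comm p h = proj₁ (sform-inj (X₇ (Y2 (Y1 p))) (X₇' (Y1 (Y2 []))) [] [] (≋-sym (T-cong 7 (T-cong 5 (T5-sform p []) ⟫ T5-sform (Y2 []) (Y1 p)) ⟫ T7-sform (Y2 (Y1 p)) (Y1 (Y2 [])))
   ⟫ T57 _ ⟫ T-cong 5 (T57 _) ⟫ T-cong 5 (T-cong 5 (T7-sform p [] ⟫ sform-cong {X₇ p} {X₇' []} {[]} {[]} h (λ t → refl) ⟫ sform-[]) ⟫ T-𝟘 5) ⟫ T-𝟘 5 ⟫ ≋-sym sform-[]))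

module KO = KerOnto XY-comm

Xp-of-0 : ∀ k b c → π (ser k) ≋ sform b c → Tₛ 7 (ser k) ≋ 𝟘 → X₇ b ≃ []
Xp-of-0 k b c e h = proj₁ (sform-inj (X₇ b) (X₇' c) [] [] (≋-sym (πT7 {ser k} {b} {c} e) ⟫ π-cong h ⟫ π-𝟘 ⟫ ≋-sym sform-[]))
  where π-𝟘 : π 𝟘 ≋ 𝟘
        π-𝟘 = +-idˡ _ ⟫ V-cong 3 (U-𝟘 3) ⟫ V-𝟘 3

opaque
  T5-onto : ∀ k → Tₛ 7 (ser k) ≋ 𝟘 → ∃ λ l → Tₛ 7 (ser l) ≋ 𝟘 × Tₛ 5 (ser l) ≋ ser k
  T5-onto k h = go (K-π k)
    where
    go : (∃ λ b → ∃ λ c → π (ser k) ≋ sform b c) → ∃ λ l → Tₛ 7 (ser l) ≋ 𝟘 × Tₛ 5 (ser l) ≋ ser k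
    go (b , c , e) = go2 (KO.ker-onto (proj₁ (Supp-bound b)) b (Xp-of-0 k b c e h) (proj₂ (Supp-bound b)))
      where
      go2 : KO.Lift b → ∃ λ l → Tₛ 7 (ser l) ≋ 𝟘 × Tₛ 5 (ser l) ≋ ser k
      go2 (g , xg , eg) = go3 (K-lift g)
        where
        go3 : (∃ λ k → ∃ λ c → π (ser k) ≋ sform g c) → ∃ λ l → Tₛ 7 (ser l) ≋ 𝟘 × Tₛ 5 (ser l) ≋ ser k
        -- `ker-onto` solves T₅² l = k, so T₅ l is the preimage.
        go3 (l , c' , e') = T5ₖ l , (T57 _ ⟫ T-cong 5 (K-zero (T7ₖ l) (X₇ g) (X₇' c') (πT7 {ser l} {g} {c'} e') xg) ⟫ T-𝟘 5)
          , K-ext (T5ₖ (T5ₖ l)) k (Y2 (Y1 g)) (Y1 (Y2 c')) b c (πT5 {Tₛ 5 (ser l)} {Y2 c'} {Y1 g} (πT5 {ser l} {g} {c'} e')) e eg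

e₁ : KEl
e₁ = kel (F ⊹ G) (Z2-+ Z2-F Z2-G) (U-cong 2 F+G ⟫ U2u) (U-+ 3 F G ⟫ +-cong U3F U3G ⟫ +-comm' G F)
T7e₁ : Tₛ 7 (F ⊹ G) ≋ 𝟘
T7e₁ = V7.T-+0 V7.TF V7.TG
T5e₁ : Tₛ 5 (F ⊹ G) ≋ 𝟘
T5e₁ = V5.T-+0 V5.TF V5.TG
e₁-1 : (F ⊹ G) 1 ≡ true
e₁-1 = trans (at F+G 1) (proj₂ Lead-u)

-- G⁵ + G⁴F + F²G, the element of K whose part prime to 3 starts with z w².
κ-fix : U 3 (nform (ep 2) (ep 2) (ep 0)) ≋ nform (ep 2) (ep 2) (ep 0)
κ-fix = U3-nform (ep 2) (ep 2) (ep 0) ⟫ +-cong (+-cong (*-cong (c2 φ) ≋-refl) (*-cong (c2 φ) ≋-refl)) (*-cong (c0 φ) ≋-refl)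
  ⟫ +-cong0 (ring (F ∷ G ∷ []) ((P X0 ⊗ X0 ⊕ P X0 ⊗ X1 ⊕ on ⊗ (X0 ⊗ (X1 ⊗ X1))) ⊕ (P X1 ⊗ X1 ⊕ P X1 ⊗ X0 ⊕ on ⊗ ((X0 ⊗ X0) ⊗ X1))) ((X0 ⊕ X1) ↑ 4 ⊗ (X0 ⊕ X1) ⊕ (X0 ⊗ X1) ⊗ (X0 ⊕ X1)) refl
      ⟫ +-cong0' (*-cong (≋-sym FG) ≋-refl))
  ⟫ ≋-sym (+-cong (+-cong (*-cong (c2 w) ≋-refl) (*-cong (c2 w) ≋-refl)) (*-cong (c0 w) ≋-refl))
  where
  P : Ex → Ex
  P x = (x ⊗ x) ↑ 2 ⊗ on
  c0 : ∀ f → ⟪ ep 0 ⟫ f ≋ 𝟙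
  c0 f = ⟪⟫-∷ true [] f ⟫ +-cong ≋-refl (*-zeroʳ' f) ⟫ +-idʳ 𝟙
  c2 : ∀ f → ⟪ ep 2 ⟫ f ≋ f ^ₛ 2 · 𝟙
  c2 f = sh-ok 2 (true ∷ []) f ⟫ *-cong ≋-refl (c0 f)

π-at-1 : ∀ f → π f 1 ≡ f 1
π-at-1 f = trans (+-at f _ 1) (trans (cong (f 1 xor_) (V-non 3 (U 3 f) 1 (λ m e → no3 m e))) (xor-identityʳ (f 1)))
  where no3 : ∀ m → 1 ≢ 3 * m
        no3 zero ()
        no3 (suc m) e = 0≢1+n (suc-injective (trans e (trans (cong (λ x → suc (m + x)) refl) (cong suc (+-suc m _)))))

sform-at-1 : ∀ b c → sform b c 1 ≡ look b 0
sform-at-1 b c = trans (+-at _ _ 1) (trans (cong₂ _xor_ (trans (trans (at (*-comm' z _) 1) (lead b)) refl) (low5 c)) (xor-identityʳ _))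
  where
  lw : ∀ b → ⟪ b ⟫ w 0 ≡ look b 0
  lw [] = 𝟘-at 0
  lw (d ∷ b) = trans (at (⟪⟫-∷ d b w) 0) (trans (+-at _ _ 0) (trans (cong₂ _xor_ (b0 d) (trans (mul-zero w _) (cong (_∧ ⟪ b ⟫ w 0) (proj₁ Lead-w 0 (s≤s z≤n))))) (xor-identityʳ d)))
    where b0 : ∀ d → b𝟙 d 0 ≡ d
          b0 true = 𝟙-zero
          b0 false = 𝟘-at 0
  lead : ∀ b → (⟪ b ⟫ w · z) 1 ≡ look b 0
  lead b = trans (*-low-at 0 1 (λ _ ()) (proj₁ Lead-z)) (trans (cong (⟪ b ⟫ w 0 ∧_) (proj₂ Lead-z)) (trans (∧-identityʳ _) (lw b)))
  low5 : ∀ c → (z ^ₛ 5 · ⟪ c ⟫ w) 1 ≡ false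
  low5 c = Low-*ˡ (⟪ c ⟫ w) (proj₁ (Lead-^ 5 Lead-z)) 1 (s≤s (s≤s z≤n))

-- `socle` leaves 1 and X² for the component b, and the coefficient of x removes 1. If b were X²,
-- then k would be κ, with a nonzero component on z⁵ F₂[w]; but T₅ k = 0 and injectivity of `Y2`
-- make that component zero.
K-socle : ∀ k → Tₛ 7 (ser k) ≋ 𝟘 → Tₛ 5 (ser k) ≋ 𝟘 → ser k 1 ≡ false → ser k ≋ 𝟘
K-socle k h7 h5 h1 = go (K-π k)
  where
  go : (∃ λ b → ∃ λ c → π (ser k) ≋ sform b c) → ser k ≋ 𝟘
  go (b , c , e) = fin (look b 2) refl
    where
    y : Y2 c ≃ [] × Y1 b ≃ []
    y = sform-inj (Y2 c) (Y1 b) [] [] (≋-sym (πT5 {ser k} {b} {c} e) ⟫ π-cong h5 ⟫ +-idˡ _ ⟫ V-cong 3 (U-𝟘 3) ⟫ V-𝟘 3 ⟫ ≋-sym sform-[])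
    soc : ∀ t → look b t ≡ true → t ≡ 0 ⊎ t ≡ 2
    soc = socle b (Xp-of-0 k b c e h7) (proj₂ y)
    b0 : look b 0 ≡ false
    b0 = trans (sym (sform-at-1 b c)) (trans (sym (at e 1)) (trans (π-at-1 (ser k)) h1))
    bt : ∀ t → look b t ≡ true → t ≡ 2
    bt t q = sel (soc t q)
      where sel : t ≡ 0 ⊎ t ≡ 2 → t ≡ 2
            sel (inj₁ refl) = ⊥-elim (false≢true (trans (sym b0) q))
            sel (inj₂ r) = r
    fin : ∀ v → look b 2 ≡ v → ser k ≋ 𝟘
    fin false q = K-zero k b c e (λ t → ¬true (λ x → false≢true (trans (sym (trans (cong (look b) (bt t x)) q)) x)))
    fin true q = ⊥-elim (false≢true (sym (trans (sym c0) (Y2-inj c (proj₁ y) 0))))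
      where
      κ : KEl
      κ = kel (nform (ep 2) (ep 2) (ep 0)) (Z2-nform (ep 2) (ep 2) (ep 0)) (U2-nform (ep 2) (ep 2) (ep 0)) κ-fix
      πκ : π (ser κ) ≋ sform (ep 2) (ep 0)
      πκ = π-nform (ep 2) (ep 2) (ep 0)
      b2 : b ≃ ep 2
      b2 t = bool-ext (λ x → trans (cong (look (ep 2)) (bt t x)) (ep-at 2)) (λ x → trans (cong (look b) (ep-true 2 t x)) q)
      c0 : look c 0 ≡ true
      c0 = proj₂ (sform-inj b c (ep 2) (ep 0) (≋-sym e ⟫ π-cong (K-ext k κ b c (ep 2) (ep 0) e πκ b2) ⟫ πκ)) 0

σ₇ : KEl → KEl
σ₇ k = proj₁ (T7-onto k)
T7σ₇ : ∀ k → Tₛ 7 (ser (σ₇ k)) ≋ ser k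
T7σ₇ k = proj₂ (T7-onto k)
T7ₖ-+ : ∀ k l → ser (T7ₖ (k ⊹ₖ l)) ≋ ser (T7ₖ k ⊹ₖ T7ₖ l)
T7ₖ-+ k l = T-+ 7 (ser k) (ser l)
T5ₖ-+ : ∀ k l → ser (T5ₖ (k ⊹ₖ l)) ≋ ser (T5ₖ k ⊹ₖ T5ₖ l)
T5ₖ-+ k l = T-+ 5 (ser k) (ser l)
T57ₖ : ∀ k → ser (T7ₖ (T5ₖ k)) ≋ ser (T5ₖ (T7ₖ k))
T57ₖ k = T57 (ser k)

module CK = Hull.Cofree KS T7ₖ T5ₖ (T-cong 7) (T-cong 5) T7ₖ-+ T5ₖ-+ T57ₖ σ₇ T7σ₇ T5-onto

Tⁿ7 : ∀ k n → ser (T7ₖ CK.^ n ⟨ k ⟩) ≡ Tⁿ 7 n (ser k)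
Tⁿ7 k zero = refl
Tⁿ7 k (suc n) = cong (Tₛ 7) (Tⁿ7 k n)
Tⁿ5 : ∀ k n → ser (T5ₖ CK.^ n ⟨ k ⟩) ≡ Tⁿ 5 n (ser k)
Tⁿ5 k zero = refl
Tⁿ5 k (suc n) = cong (Tₛ 5) (Tⁿ5 k n)

≡→≋ : ∀ {f g : Series} → f ≡ g → f ≋ g
≡→≋ refl = ≋-refl

π-inj : ∀ k l → π (ser k) ≋ π (ser l) → ser k ≋ ser l
π-inj k l e = go (K-π k)
  where go : (∃ λ b → ∃ λ c → π (ser k) ≋ sform b c) → ser k ≋ ser l
        go (b , c , q) = K-ext k l b c b c q (≋-sym e ⟫ q) (λ _ → refl)

K0 : KEl
K0 = F₂-Space.ε KS

π-𝟘 : π 𝟘 ≋ 𝟘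
π-𝟘 = +-idˡ _ ⟫ V-cong 3 (U-𝟘 3) ⟫ V-𝟘 3

π-0 : ∀ k → π (ser k) ≋ 𝟘 → ser k ≋ 𝟘
π-0 k e = π-inj k K0 (e ⟫ ≋-sym π-𝟘)

max-Supp : ∀ b c → ∃ λ n → Supp b n × Supp c n
max-Supp b c = let (m , sm) = Supp-bound b ; (n , sn) = Supp-bound c in m + n , Supp-mono {b} (m≤m+n m n) sm , Supp-mono {c} (m≤n+m n m) sn

Nilp : ℕ → Series → Set
Nilp n f = Tⁿ 7 n (π f) ≋ 𝟘 × Tⁿ 5 n (π f) ≋ 𝟘

π-Tⁿ : ∀ {p} → Prime p → p ≢ 3 → ∀ n f → π (Tⁿ p n f) ≋ Tⁿ p n (π f)
π-Tⁿ pp ne zero f = ≋-refl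
π-Tⁿ {p} pp ne (suc n) f = π-T pp ne _ ⟫ T-cong p (π-Tⁿ pp ne n f)
  where instance
    nz : NonZero p
    nz = prime⇒nonZero pp

opaque
  nilp : ∀ {f} → (∃ λ b → ∃ λ c → π f ≋ sform b c) → ∃ λ n → Nilp n f
  nilp {f} (b , c , e) = go (max-Supp b c)
    where go : (∃ λ n → Supp b n × Supp c n) → ∃ λ n → Nilp n f
          go (n , sb , sc) = suc n , (T-cong 7 (≋-sym (π-Tⁿ prime7 (λ ()) n f) ⟫ T7-nilpotent n f b c e sb sc) ⟫ T-𝟘 7) , (≋-sym (π-Tⁿ prime5 (λ ()) (suc n) f) ⟫ T5-nilpotent n f b c e sb sc)

K-t-nil : ∀ k n → Nilp n (ser k) → ser (T7ₖ CK.^ n ⟨ k ⟩) ≋ 𝟘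
K-t-nil k n h = π-0 (T7ₖ CK.^ n ⟨ k ⟩) (π-cong (≡→≋ (Tⁿ7 k n)) ⟫ π-Tⁿ prime7 (λ ()) n _ ⟫ proj₁ h)
K-s-nil : ∀ k n → Nilp n (ser k) → ser (T5ₖ CK.^ n ⟨ k ⟩) ≋ 𝟘
K-s-nil k n h = π-0 (T5ₖ CK.^ n ⟨ k ⟩) (π-cong (≡→≋ (Tⁿ5 k n)) ⟫ π-Tⁿ prime5 (λ ()) n _ ⟫ proj₂ h)

t-nilₖ : ∀ k → ∃ λ n → ser (T7ₖ CK.^ n ⟨ k ⟩) ≋ 𝟘
t-nilₖ k = let (n , h) = nilp {ser k} (K-π k) in n , K-t-nil k n h
s-nilₖ : ∀ k → ∃ λ n → ser (T5ₖ CK.^ n ⟨ k ⟩) ≋ 𝟘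
s-nilₖ k = let (n , h) = nilp {ser k} (K-π k) in n , K-s-nil k n h
coeffₖ : KEl → Bool
coeffₖ k = ser k 1
coeffₖ-cong : ∀ k l → ser k ≋ ser l → coeffₖ k ≡ coeffₖ l
coeffₖ-cong k l e = at e 1
coeffₖ-+ : ∀ k l → coeffₖ (k ⊹ₖ l) ≡ coeffₖ k xor coeffₖ l
coeffₖ-+ k l = +-at (ser k) (ser l) 1

module CN = CK.Nil t-nilₖ s-nilₖ coeffₖ coeffₖ-cong coeffₖ-+ e₁ T7e₁ T5e₁ e₁-1 K-socle

-- The Hecke algebras of K and of N2/N1

opaque
  unfolding 𝟘
  0-def : 0ₛ ≋ 𝟘
  0-def = ≋-refl

+ₛ-cong : ∀ {f f' g g'} → f ≋ f' → g ≋ g' → f +ₛ g ≋ f' ⊹ g'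
+ₛ-cong e e' = +-def _ _ ⟫ +-cong e e'

*ₛ-cong : ∀ {f f' g g'} → f ≋ f' → g ≋ g' → f *ₛ g ≋ f' · g'
*ₛ-cong e e' = *-def _ _ ⟫ *-cong e e'

nform-def : ∀ a b c → evalAt a G² *ₛ G +ₛ evalAt b G² *ₛ F +ₛ evalAt c G² *ₛ ((F *ₛ F) *ₛ G) ≋ nform a b c
nform-def a b c = +ₛ-cong (+ₛ-cong (*ₛ-cong (eval-def a G²-def) ≋-refl) (*ₛ-cong (eval-def b G²-def) ≋-refl)) (*ₛ-cong (eval-def c G²-def) (*ₛ-cong (*ₛ-cong ≋-refl ≋-refl) ≋-refl))

N2 : Series → Set
N2 f = ∃ λ a → ∃ λ b → ∃ λ c → f ≋ nform a b c

InN2→N2 : ∀ {f} → InN2 f → N2 f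
InN2→N2 (a , b , c , e) = a , b , c , (mk e ⟫ nform-def a b c)

N2→InN2 : ∀ {f} → N2 f → InN2 f
N2→InN2 (a , b , c , e) = a , b , c , at (e ⟫ ≋-sym (nform-def a b c))

N2-≋ : ∀ {f g} → f ≋ g → N2 f → N2 g
N2-≋ e (a , b , c , q) = a , b , c , (≋-sym e ⟫ q)

nform-+ : ∀ a b c a' b' c' → nform (a ⊞ a') (b ⊞ b') (c ⊞ c') ≋ nform a b c ⊹ nform a' b' c'
nform-+ a b c a' b' c' = +-cong (+-cong (d a a' G) (d b b' F) ⟫ +-swap' _ _ _ _) (d c c' _) ⟫ +-swap' _ _ _ _
  where d : ∀ p q g → ⟪ p ⊞ q ⟫ w · g ≋ ⟪ p ⟫ w · g ⊹ ⟪ q ⟫ w · g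
        d p q g = *-cong (⟪⟫-+ p q w) ≋-refl ⟫ *-distʳ _ _ _

N2-+ : ∀ {f g} → N2 f → N2 g → N2 (f ⊹ g)
N2-+ (a , b , c , e) (a' , b' , c' , e') = a ⊞ a' , b ⊞ b' , c ⊞ c' , (+-cong e e' ⟫ ≋-sym (nform-+ a b c a' b' c'))

N2-𝟘 : N2 𝟘
N2-𝟘 = [] , [] , [] , ≋-sym (+-cong (+-cong (*-zeroˡ' _) (*-zeroˡ' _) ⟫ +-idˡ 𝟘) (*-zeroˡ' _) ⟫ +-idˡ 𝟘)

N2-π : ∀ {f} → N2 f → ∃ λ b → ∃ λ c → π f ≋ sform b c
N2-π (a , b , c , e) = b , c , (π-cong e ⟫ π-nform a b c)

nform-a : ∀ a → nform a [] [] ≋ ⟪ a ⟫ w · G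
nform-a a = +-cong (+-cong ≋-refl (*-zeroˡ' _) ⟫ +-idʳ _) (*-zeroˡ' _) ⟫ +-idʳ _

N1→N2 : ∀ {f} → InN1 f → N2 f
N1→N2 (a , e) = a , [] , [] , (mk e ⟫ *ₛ-cong (eval-def a G²-def) ≋-refl ⟫ ≋-sym (nform-a a))

N1→π : ∀ {f} → InN1 f → π f ≋ 𝟘
N1→π (a , e) = π-cong (mk e ⟫ *ₛ-cong (eval-def a G²-def) ≋-refl) ⟫ π-w a G ⟫ *-cong ≋-refl π-G ⟫ *-zeroʳ' _

-- On N2 the kernel of π is N1, because `sform-zero` recovers both other coefficients. From here on
-- classes modulo N1 are compared through π.
π→N1 : ∀ {f} → N2 f → π f ≋ 𝟘 → InN1 f
π→N1 {f} (a , b , c , e) h = a , at (e ⟫ +-cong (+-cong ≋-refl (zz b F (proj₁ bc)) ⟫ +-idʳ _) (zz c _ (proj₂ bc)) ⟫ +-idʳ _ ⟫ ≋-sym (*ₛ-cong (eval-def a G²-def) ≋-refl))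
  where
  bc : isz 1 b ≡ true × isz 1 c ≡ true
  bc = sform-zero b c (≋-sym (π-nform a b c) ⟫ π-cong (≋-sym e) ⟫ h)
  zz : ∀ p g → isz 1 p ≡ true → ⟪ p ⟫ w · g ≋ 𝟘
  zz p g q = *-cong (isz-⟪⟫ p w q) ≋-refl ⟫ *-zeroˡ' g

infix 4 _~₁_
_~₁_ : Series → Series → Set
f ~₁ g = InN1 (f +ₛ g)

~→π : ∀ {f g} → f ~₁ g → π f ≋ π g
~→π {f} {g} h = +-cong0 (≋-sym (π-+ f g) ⟫ π-cong (≋-sym (+-def f g)) ⟫ N1→π h)

π→~ : ∀ {f g} → N2 f → N2 g → π f ≋ π g → f ~₁ g
π→~ {f} {g} nf ng e = π→N1 (N2-≋ (≋-sym (+-def f g)) (N2-+ nf ng)) (π-cong (+-def f g) ⟫ π-+ f g ⟫ +-cong0' e)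

~-N2 : ∀ {f g} → f ~₁ g → N2 f → N2 g
~-N2 {f} {g} h nf = N2-≋ (+-cong (+-def f g) ≋-refl ⟫ +-cong (+-comm' f g) ≋-refl ⟫ +-assoc' g f f ⟫ +-cong ≋-refl (+-self f) ⟫ +-idʳ g) (N2-+ (N1→N2 h) nf)

Z2-def : ∀ {f} → InZ2r f → Z2 f
Z2-def (P , e) = P , (mk e ⟫ eval-def P ≋-refl)

Z2-undef : ∀ {f} → Z2 f → InZ2r f
Z2-undef (P , e) = P , at (e ⟫ ≋-sym (eval-def P ≋-refl))

toK : Σ Series InK → KEl
toK (f , zf , e2 , e3) = kel f (Z2-def zf) (mk e2 ⟫ 0-def) (mk e3)

fromK : KEl → Σ Series InK
fromK (kel f zf e2 e3) = f , Z2-undef zf , at (e2 ⟫ ≋-sym 0-def) , at e3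

K→N : KEl → Σ Series InN2
K→N k = ser k , N2→InN2 (K-form k)

-- The Hecke algebra acting on series, and squares of its elements

T-≋ : ∀ p .{{_ : NonZero p}} {f g} → f ≋ g → T p f ≋ Tₛ p g
T-≋ p {f} e = T-def p f ⟫ T-cong p e

act-cong : ∀ a {f g} → f ≋ g → act a f ≋ act a g
actMono-cong : ∀ m {f g} → f ≋ g → actMono m f ≋ actMono m g
actMono-cong [] e = e
actMono-cong ((p , pp , _) ∷ m) e = T-≋ p (actMono-cong m e) ⟫ ≋-sym (T-def p _)
  where instance
    nz : NonZero p
    nz = prime⇒nonZero pp
act-cong [] e = ≋-refl
act-cong (m ∷ a) e = +ₛ-cong (actMono-cong m e) (act-cong a e) ⟫ ≋-sym (+-def _ _)

act-++ : ∀ a b f → act (a ++ b) f ≋ act a f ⊹ act b f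
act-++ [] b f = ≋-sym (+-cong 0-def ≋-refl ⟫ +-idˡ _)
act-++ (m ∷ a) b f = +ₛ-cong (≋-refl {actMono m f}) (act-++ a b f) ⟫ ≋-sym (+-assoc' _ _ _) ⟫ +-cong (≋-sym (+-def (actMono m f) (act a f))) ≋-refl

-- Commutation with each T_p extends to the whole algebra. Instances are π, U₂, U₃ and the elements
-- of the algebra themselves.
record Linear (L : Series → Series) : Set where
  field
    cong-L : ∀ {f g} → f ≋ g → L f ≋ L g
    L-+ : ∀ f g → L (f ⊹ g) ≋ L f ⊹ L g
    L-T : ∀ {p} → Prime p → 3 < p → ∀ f → L (Tₛ p f) ≋ Tₛ p (L f)

  L-𝟘 : L 𝟘 ≋ 𝟘
  L-𝟘 = cong-L (≋-sym (+-self 𝟘)) ⟫ L-+ 𝟘 𝟘 ⟫ +-self _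

  L-actMono : ∀ m f → L (actMono m f) ≋ actMono m (L f)
  L-actMono [] f = ≋-refl
  L-actMono ((p , pp , l) ∷ m) f = cong-L (T-def p _) ⟫ L-T pp l _ ⟫ T-cong p (L-actMono m f) ⟫ ≋-sym (T-def p _)
    where instance
      nz : NonZero p
      nz = prime⇒nonZero pp

  L-act : ∀ a f → L (act a f) ≋ act a (L f)
  L-act [] f = cong-L 0-def ⟫ L-𝟘 ⟫ ≋-sym 0-def
  L-act (m ∷ a) f = cong-L (+-def (actMono m f) (act a f)) ⟫ L-+ _ _ ⟫ +-cong (L-actMono m f) (L-act a f) ⟫ ≋-sym (+-def _ _)
open Linear public

3<→≢ : ∀ {p} q → q ≤ 3 → 3 < p → p ≢ q
3<→≢ q l l' refl = <⇒≱ l' l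

lin-π : Linear π
lin-π = record { cong-L = π-cong ; L-+ = π-+ ; L-T = λ pp l → π-T pp (3<→≢ 3 ≤-refl l) }
lin-U2 : Linear (U 2)
lin-U2 = record { cong-L = U-cong 2 ; L-+ = U-+ 2 ; L-T = λ pp l → T-U pp prime2 (3<→≢ 2 (n≤1+n 2) l) }
lin-U3 : Linear (U 3)
lin-U3 = record { cong-L = U-cong 3 ; L-+ = U-+ 3 ; L-T = λ pp l → T-U pp prime3 (3<→≢ 3 ≤-refl l) }
lin-T : ∀ {p} → Prime p → 3 < p → Linear (Tₛ p)
lin-T {p} pp l = record { cong-L = T-cong p ; L-+ = T-+ p ; L-T = λ pq _ f → T-comm pp pq f }
  where instance
    nz : NonZero p
    nz = prime⇒nonZero pp
lin-actMono : ∀ m → Linear (actMono m)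
lin-actMono m = record { cong-L = actMono-cong m ; L-+ = add m ; L-T = λ pp l f → ≋-sym (L-actMono (lin-T pp l) m f) }
  where
  add : ∀ m f g → actMono m (f ⊹ g) ≋ actMono m f ⊹ actMono m g
  add [] f g = ≋-refl
  add ((p , pp , _) ∷ m) f g = T-≋ p (add m f g) ⟫ T-+ p _ _ ⟫ +-cong (≋-sym (T-def p _)) (≋-sym (T-def p _))
    where instance
      nz : NonZero p
      nz = prime⇒nonZero pp
lin-act : ∀ a → Linear (act a)
lin-act a = record { cong-L = act-cong a ; L-+ = add a ; L-T = λ pp l f → ≋-sym (L-act (lin-T pp l) a f) }
  where
  add : ∀ a f g → act a (f ⊹ g) ≋ act a f ⊹ act a g
  add [] f g = 0-def ⟫ ≋-sym (+-cong 0-def 0-def ⟫ +-self 𝟘)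
  add (m ∷ a) f g = +ₛ-cong (L-+ (lin-actMono m) f g) (add a f g) ⟫ +-swap' _ _ _ _ ⟫ +-cong (≋-sym (+-def _ _)) (≋-sym (+-def _ _))

doubled : List P5 → List P5
doubled [] = []
doubled (p ∷ m) = p ∷ p ∷ doubled m

actMono-doubled : ∀ m f → actMono (doubled m) f ≋ actMono m (actMono m f)
actMono-doubled [] f = ≋-refl
actMono-doubled ((p , pp , l) ∷ m) f = T-≋ p (T-≋ p (actMono-doubled m f) ⟫ L-actMono (lin-T pp l) m _) ⟫ T-cong p (actMono-cong m (≋-sym (T-def p _))) ⟫ ≋-sym (T-def p _)
  where instance
    nz : NonZero p
    nz = prime⇒nonZero pp

-- cross terms cancel in characteristic 2
act-square : ∀ a f → act (map doubled a) f ≋ act a (act a f)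
act-square [] f = ≋-refl
act-square (m ∷ a) f = +ₛ-cong (actMono-doubled m f) (act-square a f)
  ⟫ ≋-sym (+ₛ-cong (actMono-cong m (+-def _ _) ⟫ L-+ (lin-actMono m) _ _) (act-cong a (+-def _ _) ⟫ L-+ (lin-act a) _ _ ⟫ +-cong (≋-sym (L-act (lin-actMono m) a f)) ≋-refl)
    ⟫ ring (actMono m (actMono m f) ∷ actMono m (act a f) ∷ act a (act a f) ∷ []) ((X0 ⊕ X1) ⊕ (X1 ⊕ X2)) (X0 ⊕ X2) refl)

swap₃ : ℕ → ℕ
swap₃ 1 = 2
swap₃ 2 = 1
swap₃ n = n

Unit₃ : ℕ → Set
Unit₃ i = i ≡ 1 ⊎ i ≡ 2

Cl-T1 : ∀ p .{{_ : NonZero p}} i {f} → p % 3 ≡ 1 → Cl i f → Cl i (Tₛ p f)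
Cl-T1 p i {f} e c = Cl-≋ (≋-sym (T-UV p f)) (Cl-+ (λ n h → trans (sym (m1 n)) (c (p * n) h)) (λ n h → let (m , q , hm) = V-true p f n h in trans (cong (_% 3) q) (trans (m1 m) (c m hm))))
  where m1 : ∀ n → (p * n) % 3 ≡ n % 3
        m1 n = trans (%-distribˡ-* p n 3) (trans (cong (λ x → (x * (n % 3)) % 3) e) (trans (cong (_% 3) (+-identityʳ (n % 3))) (m%n%n≡m%n n 3)))

Cl-T2 : ∀ p .{{_ : NonZero p}} i {f} → p % 3 ≡ 2 → Unit₃ i → Cl i f → Cl (swap₃ i) (Tₛ p f)
Cl-T2 p i {f} e u c = Cl-≋ (≋-sym (T-UV p f)) (Cl-+ (λ n h → back (n % 3) (m%n<n n 3) i u (trans (sym (m2 n)) (c (p * n) h))) (λ n h → let (m , q , hm) = V-true p f n h in trans (cong (_% 3) q) (trans (m2 m) (forth i u (c m hm)))))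
  where
  m2 : ∀ n → (p * n) % 3 ≡ (2 * (n % 3)) % 3
  m2 n = trans (%-distribˡ-* p n 3) (cong (λ x → (x * (n % 3)) % 3) e)
  back : ∀ x → x < 3 → ∀ i → Unit₃ i → (2 * x) % 3 ≡ i → x ≡ swap₃ i
  back 0 _ .1 (inj₁ refl) ()
  back 0 _ .2 (inj₂ refl) ()
  back 1 _ .2 (inj₂ refl) h = refl
  back 1 _ .1 (inj₁ refl) ()
  back 2 _ .1 (inj₁ refl) h = refl
  back 2 _ .2 (inj₂ refl) ()
  back (suc (suc (suc _))) (s≤s (s≤s (s≤s ()))) i u h
  forth : ∀ i → Unit₃ i → ∀ {x} → x ≡ i → (2 * x) % 3 ≡ swap₃ i
  forth .1 (inj₁ refl) refl = refl
  forth .2 (inj₂ refl) refl = refl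

prime-%3 : ∀ {p} → Prime p → 3 < p → Unit₃ (p % 3)
prime-%3 {p} pp l = go (p % 3) refl (m%n<n p 3)
  where
  go : ∀ x → p % 3 ≡ x → x < 3 → Unit₃ x
  go 0 e _ = ⊥-elim (bad (prime⇒irreducible pp (divides (p / 3) (trans (m≡m%n+[m/n]*n p 3) (cong (_+ p / 3 * 3) e)))))
    where bad : 3 ≡ 1 ⊎ 3 ≡ p → ⊥
          bad (inj₂ refl) = <-irrefl refl l
  go 1 e _ = inj₁ refl
  go 2 e _ = inj₂ refl
  go (suc (suc (suc _))) e (s≤s (s≤s (s≤s ())))

-- A prime above 3 is 1 or 2 modulo 3; in the second case T_p exchanges the residues 1 and 2, so
-- applying it twice restores them.
Cl-TT : ∀ {p} → Prime p → 3 < p → ∀ i {f} → Unit₃ i → Cl i f → Cl i (Tₛ p (Tₛ p f))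
Cl-TT {p} pp l i {f} u c = go (prime-%3 pp l)
  where
  instance
    nz : NonZero p
    nz = prime⇒nonZero pp
  su : ∀ i → Unit₃ i → Unit₃ (swap₃ i) × swap₃ (swap₃ i) ≡ i
  su .1 (inj₁ refl) = inj₂ refl , refl
  su .2 (inj₂ refl) = inj₁ refl , refl
  go : Unit₃ (p % 3) → Cl i (Tₛ p (Tₛ p f))
  go (inj₁ e) = Cl-T1 p i e (Cl-T1 p i e c)
  go (inj₂ e) = subst (λ j → Cl j (Tₛ p (Tₛ p f))) (proj₂ (su i u)) (Cl-T2 p (swap₃ i) e (proj₁ (su i u)) (Cl-T2 p i e u c))

Cl-doubled : ∀ m i {f} → Unit₃ i → Cl i f → Cl i (actMono (doubled m) f)
Cl-doubled [] i u c = c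
Cl-doubled ((p , pp , l) ∷ m) i u c = Cl-≋ (≋-sym (T-≋ p (T-def p _))) (Cl-TT pp l i u (Cl-doubled m i u c))
  where instance
    nz : NonZero p
    nz = prime⇒nonZero pp

Cl-act : ∀ a i {f} → Unit₃ i → Cl i f → Cl i (act (map doubled a) f)
Cl-act [] i u c = Cl-≋ (≋-sym 0-def) Cl-𝟘
Cl-act (m ∷ a) i u c = Cl-≋ (≋-sym (+-def _ _)) (Cl-+ (Cl-doubled m i u c) (Cl-act a i u c))

-- The homomorphism from HE(N2/N1) to HE(K)

open HE renaming (resp to HE-resp)

NVec : Set
NVec = Σ Series InN2

nv : (v : NVec) → N2 (proj₁ v)
nv v = InN2→N2 (proj₂ v)

fnₖ : HE SpK → KEl → KEl
fnₖ θ k = toK (fn θ (fromK k))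

-- Every law involves finitely many vectors, on which the operator agrees with a single element of
-- the algebra; that element is additive and commutes with T₅ and T₇.
comm-HE : HE SpK → CN.Comm
comm-HE θ = record
  { fn = fnₖ θ
  ; cong-fn = λ {k} {l} e → mk (HE-resp θ (fromK k) (fromK l) (at e))
  ; fn-∙ = λ k l → add k l (approx θ (fromK k ∷ fromK l ∷ fromK (k ⊹ₖ l) ∷ []))
  ; fn-t = λ k → com T7ₖ (lin-T prime7 (≤from 4 7 refl)) (λ _ → refl) k (approx θ (fromK k ∷ fromK (T7ₖ k) ∷ []))
  ; fn-s = λ k → com T5ₖ (lin-T prime5 (≤from 4 5 refl)) (λ _ → refl) k (approx θ (fromK k ∷ fromK (T5ₖ k) ∷ [])) }
  where
  add : ∀ k l → (∃ λ a → All (λ v → proj₁ (fn θ v) ≈ act a (proj₁ v)) (fromK k ∷ fromK l ∷ fromK (k ⊹ₖ l) ∷ [])) → ser (fnₖ θ (k ⊹ₖ l)) ≋ ser (fnₖ θ k) ⊹ ser (fnₖ θ l)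
  add k l (a , e1 ∷ e2 ∷ e3 ∷ []) = mk e3 ⟫ L-+ (lin-act a) (ser k) (ser l) ⟫ ≋-sym (+-cong (mk e1) (mk e2))
  com : ∀ {p} (t : KEl → KEl) → Linear (Tₛ p) → (∀ k → ser (t k) ≡ Tₛ p (ser k)) → ∀ k → (∃ λ a → All (λ v → proj₁ (fn θ v) ≈ act a (proj₁ v)) (fromK k ∷ fromK (t k) ∷ [])) → ser (fnₖ θ (t k)) ≋ ser (t (fnₖ θ k))
  com {p} t L q k (a , e1 ∷ e2 ∷ []) = mk e2 ⟫ ≡→≋ (cong (act a) (q k)) ⟫ ≋-sym (L-act L a (ser k)) ⟫ cong-L L (≋-sym (mk e1)) ⟫ ≡→≋ (sym (q (fnₖ θ k)))

act-Kel : ∀ a k → N2 (act a (ser k)) → KEl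
act-Kel a k n = kel (act a (ser k)) (z2 n) (L-act lin-U2 a _ ⟫ act-cong a (U2-0 k) ⟫ L-𝟘 (lin-act a)) (L-act lin-U3 a _ ⟫ act-cong a (U3-id k))
  where z2 : ∀ {f} → N2 f → Z2 f
        z2 (a , b , c , e) = Z2-≋ (≋-sym e) (Z2-nform a b c)

resp-π : ∀ (φ : HE SpN) v w → π (proj₁ v) ≋ π (proj₁ w) → π (proj₁ (fn φ v)) ≋ π (proj₁ (fn φ w))
resp-π φ v w e = ~→π (HE-resp φ v w (π→~ (nv v) (nv w) e))

approx-N2 : ∀ (φ : HE SpN) v a → proj₁ (fn φ v) ~₁ act a (proj₁ v) → N2 (act a (proj₁ v))
approx-N2 φ v a h = ~-N2 h (nv (fn φ v))

-- φ yields only a class modulo N1. An approximating element of the algebra, applied to k itself,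
-- gives a representative in K, unique because π is injective on K.
module _ (φ : HE SpN) (k : KEl) where
  Φ-approx : ∃ λ a → All (λ v → proj₁ (fn φ v) ~₁ act a (proj₁ v)) (K→N k ∷ [])
  Φ-approx = approx φ (K→N k ∷ [])

  fnΦ : KEl
  fnΦ = act-Kel (proj₁ Φ-approx) k (approx-N2 φ (K→N k) (proj₁ Φ-approx) (All.head (proj₂ Φ-approx)))

  fnΦ-π : π (ser fnΦ) ≋ π (proj₁ (fn φ (K→N k)))
  fnΦ-π = ≋-sym (~→π (All.head (proj₂ Φ-approx)))

Φ : HE SpN → HE SpK
Φ φ = record
  { fn = λ v → fromK (fnΦ φ (toK v))
  ; resp = λ v w e → at (π-inj (fnΦ φ (toK v)) (fnΦ φ (toK w)) (fnΦ-π φ (toK v) ⟫ resp-π φ (K→N (toK v)) (K→N (toK w)) (π-cong (mk e)) ⟫ ≋-sym (fnΦ-π φ (toK w))))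
  ; approx = λ vs → let (a , h) = approx φ (map (λ v → K→N (toK v)) vs) in a , All.map (λ {v} → step a v) (map⁻ h) }
  where
  step : ∀ a v → proj₁ (fn φ (K→N (toK v))) ~₁ act a (proj₁ v) → ser (fnΦ φ (toK v)) ≈ act a (proj₁ v)
  step a v h = at (π-inj (fnΦ φ (toK v)) (act-Kel a (toK v) (approx-N2 φ (K→N (toK v)) a h)) (fnΦ-π φ (toK v) ⟫ ~→π h))

Φ-π : ∀ φ v → π (proj₁ (fn (Φ φ) v)) ≋ π (proj₁ (fn φ (K→N (toK v))))
Φ-π φ v = fnΦ-π φ (toK v)

π-inj-vec : ∀ (v w : Σ Series InK) → π (proj₁ v) ≋ π (proj₁ w) → proj₁ v ≈ proj₁ w
π-inj-vec v w e = at (π-inj (toK v) (toK w) e)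

Φ-additive : ∀ χ φ ψ → IsSum χ φ ψ → IsSum (Φ χ) (Φ φ) (Φ ψ)
Φ-additive χ φ ψ s v = at (π-inj (toK (fn (Φ χ) v)) (toK (fn (Φ φ) v) ⊹ₖ toK (fn (Φ ψ) v))
   (Φ-π χ v ⟫ ~→π (s (K→N (toK v))) ⟫ π-cong (+-def _ _) ⟫ π-+ _ _ ⟫ +-cong (≋-sym (Φ-π φ v)) (≋-sym (Φ-π ψ v)) ⟫ ≋-sym (π-+ _ _)) ⟫ ≋-sym (+-def _ _))

Φ-multiplicative : ∀ χ φ ψ → IsProd χ φ ψ → IsProd (Φ χ) (Φ φ) (Φ ψ)
Φ-multiplicative χ φ ψ s v = π-inj-vec (fn (Φ χ) v) (fn (Φ φ) (fn (Φ ψ) v))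
  (Φ-π χ v ⟫ ~→π (s (K→N (toK v))) ⟫ resp-π φ (fn ψ (K→N (toK v))) (K→N (toK (fn (Φ ψ) v))) (≋-sym (Φ-π ψ v)) ⟫ ≋-sym (Φ-π φ (fn (Φ ψ) v)))

Φ-unital : ∀ χ → IsOne χ → IsOne (Φ χ)
Φ-unital χ s v = π-inj-vec (fn (Φ χ) v) v (Φ-π χ v ⟫ ~→π (s (K→N (toK v))))

Φ-sendsT : ∀ p → Prime p → 3 < p → ∀ χ → IsT p χ → IsT p (Φ χ)
Φ-sendsT p pp l χ s v = at (π-inj (toK (fn (Φ χ) v)) (act-Kel a (toK v) n2) (Φ-π χ v ⟫ ~→π (s (K→N (toK v))) ⟫ π-cong (≋-sym one)) ⟫ one)
  where
  a : Alg
  a = ((p , pp , l) ∷ []) ∷ []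
  one : act a (proj₁ v) ≋ T p (proj₁ v)
  one = +-def _ _ ⟫ +-cong ≋-refl 0-def ⟫ +-idʳ _
  n2 : N2 (act a (proj₁ v))
  n2 = N2-≋ (≋-sym one) (~-N2 (s (K→N (toK v))) (nv (fn χ (K→N (toK v)))))

powΦ : HE SpN → ℕ → KEl → KEl
powΦ χ n = CN.Comm.fn (CN.pow (comm-HE (Φ χ)) n)

iter-π : ∀ (χ : HE SpN) n k → π (ser (powΦ χ n k)) ≋ π (proj₁ (iter {SpN} n (fn χ) (K→N k)))
iter-π χ zero k = ≋-refl
iter-π χ (suc n) k = fnΦ-π χ (toK (fromK (powΦ χ n k))) ⟫ resp-π χ (K→N (toK (fromK (powΦ χ n k)))) (iter {SpN} n (fn χ) (K→N k)) (iter-π χ n k)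

powΦ-zero : ∀ χ n → (∀ v → proj₁ (iter {SpN} n (fn χ) v) ~₁ 0ₛ) → ∀ k → ser (powΦ χ n k) ≋ 𝟘
powΦ-zero χ n h k = π-0 (powΦ χ n k) (iter-π χ n k ⟫ ~→π {proj₁ (iter {SpN} n (fn χ) (K→N k))} {0ₛ} (h (K→N k)) ⟫ π-cong 0-def ⟫ π-𝟘)

-- Guarantees a positive exponent, the form that `reduced` expects.
powΦ-suc : ∀ χ n → (∀ k → ser (powΦ χ n k) ≋ 𝟘) → ∀ k → ser (powΦ χ (suc n) k) ≋ 𝟘
powΦ-suc χ n h k = CN.fn-ε (comm-HE (Φ χ)) {powΦ χ n k} (h k)

-- Through π the iterates of Φ χ are those of χ, so Φ χ is nilpotent, and commuting with T₅ and T₇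
-- it must vanish.
Φ-nilpotent : ∀ χ → Nilpotent {SpN} χ → ∀ k → ser (fnₖ (Φ χ) k) ≋ 𝟘
Φ-nilpotent χ (n , h) = CN.reduced (comm-HE (Φ χ)) n (powΦ-suc χ n (powΦ-zero χ n h))

Φ-wellDef : ∀ φ ψ → _≈red_ {SpN} φ ψ → _≐_ {SpK} (Φ φ) (Φ ψ)
Φ-wellDef φ ψ (χ , s , nil) v = at (+-cong0 (≋-sym (+-def (proj₁ (fn (Φ φ) v)) (proj₁ (fn (Φ ψ) v))) ⟫ ≋-sym sum ⟫ mk (HE-resp (Φ χ) v (fromK (toK v)) (λ _ → refl)) ⟫ Φ-nilpotent χ nil (toK v)))
  where sum : proj₁ (fn (Φ χ) v) ≋ proj₁ (fn (Φ φ) v) +ₛ proj₁ (fn (Φ ψ) v)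
        sum = mk (Φ-additive χ φ ψ s v)

-- Surjectivity: lifting a power series to N2/N1

p5 p7 : P5
p5 = 5 , prime5 , ≤from 4 5 refl
p7 = 7 , prime7 , ≤from 4 7 refl

monoA : ℕ → ℕ → List P5
monoA zero zero = []
monoA zero (suc i) = p7 ∷ monoA zero i
monoA (suc j) i = p5 ∷ monoA j i

rowA : (ℕ → Bool) → ℕ → ℕ → Alg
rowA d zero i = []
rowA d (suc n) i = if d n then monoA n i ∷ rowA d n i else rowA d n i

-- A truncated double power series in T₇ and T₅ as an element of the algebra; `i` counts the factors
-- T₇ already taken out.
polyA : (ℕ → ℕ → Bool) → ℕ → ℕ → ℕ → Alg
polyA c zero N i = []
polyA c (suc n) N i = rowA (c 0) N i ++ polyA (c ∘ suc) n N (suc i)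

rowS : (ℕ → Bool) → ℕ → Series → Series
rowS d zero f = 𝟘
rowS d (suc n) f = (if d n then Tⁿ 5 n f else 𝟘) ⊹ rowS d n f

polyS : (ℕ → ℕ → Bool) → ℕ → ℕ → Series → Series
polyS c zero N f = 𝟘
polyS c (suc n) N f = rowS (c 0) N f ⊹ polyS (c ∘ suc) n N (Tₛ 7 f)

act-monoA : ∀ j i f → actMono (monoA j i) f ≋ Tⁿ 5 j (Tⁿ 7 i f)
act-monoA zero zero f = ≋-refl
act-monoA zero (suc i) f = T-≋ 7 (act-monoA zero i f)
act-monoA (suc j) i f = T-≋ 5 (act-monoA j i f)

act-rowA : ∀ d n i f → act (rowA d n i) f ≋ rowS d n (Tⁿ 7 i f)
act-rowA d zero i f = 0-def
act-rowA d (suc n) i f = go (d n)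
  where
  go : ∀ b → act (if b then monoA n i ∷ rowA d n i else rowA d n i) f ≋ (if b then Tⁿ 5 n (Tⁿ 7 i f) else 𝟘) ⊹ rowS d n (Tⁿ 7 i f)
  go true = +ₛ-cong (act-monoA n i f) (act-rowA d n i f)
  go false = act-rowA d n i f ⟫ ≋-sym (+-idˡ _)

act-polyA : ∀ c n N i f → act (polyA c n N i) f ≋ polyS c n N (Tⁿ 7 i f)
act-polyA c zero N i f = 0-def
act-polyA c (suc n) N i f = act-++ (rowA (c 0) N i) (polyA (c ∘ suc) n N (suc i)) f ⟫ +-cong (act-rowA (c 0) N i f) (act-polyA (c ∘ suc) n N (suc i) f)

polyS-cong : ∀ c n N {f g} → f ≋ g → polyS c n N f ≋ polyS c n N g
polyS-cong c n N {f} {g} e = ≋-sym (act-polyA c n N 0 f) ⟫ act-cong (polyA c n N 0) e ⟫ act-polyA c n N 0 g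

polyS-𝟘 : ∀ c n N {f} → f ≋ 𝟘 → polyS c n N f ≋ 𝟘
polyS-𝟘 c n N e = polyS-cong c n N e ⟫ ≋-sym (act-polyA c n N 0 𝟘) ⟫ L-𝟘 (lin-act (polyA c n N 0))

π-polyA : ∀ c n N f → π (act (polyA c n N 0) f) ≋ polyS c n N (π f)
π-polyA c n N f = L-act lin-π (polyA c n N 0) f ⟫ act-polyA c n N 0 (π f)

Tⁿ-T : ∀ n f → Tⁿ 5 n (Tₛ 7 f) ≋ Tₛ 7 (Tⁿ 5 n f)
Tⁿ-T zero f = ≋-refl
Tⁿ-T (suc n) f = T-cong 5 (Tⁿ-T n f) ⟫ ≋-sym (T57 _)

Tⁿ-suc : ∀ n f → Tⁿ 7 n (Tₛ 7 f) ≡ Tⁿ 7 (suc n) f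
Tⁿ-suc zero f = refl
Tⁿ-suc (suc n) f = cong (Tₛ 7) (Tⁿ-suc n f)

row-stable : ∀ d N e g → Tⁿ 5 N g ≋ 𝟘 → rowS d (e + N) g ≋ rowS d N g
row-stable d N zero g h = ≋-refl
row-stable d N (suc e) g h = +-cong (go (d (e + N))) (row-stable d N e g h) ⟫ +-idˡ _
  where
  van : ∀ e → Tⁿ 5 (e + N) g ≋ 𝟘
  van zero = h
  van (suc e) = T-cong 5 (van e) ⟫ T-𝟘 5
  go : ∀ b → (if b then Tⁿ 5 (e + N) g else 𝟘) ≋ 𝟘
  go true = van e
  go false = ≋-refl

poly-stable5 : ∀ c n N e g → Tⁿ 5 N g ≋ 𝟘 → polyS c n (e + N) g ≋ polyS c n N g
poly-stable5 c zero N e g h = ≋-refl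
poly-stable5 c (suc n) N e g h = +-cong (row-stable (c 0) N e g h) (poly-stable5 (c ∘ suc) n N e (Tₛ 7 g) (Tⁿ-T N g ⟫ T-cong 7 h ⟫ T-𝟘 7))

poly-stable7 : ∀ c n N e g → Tⁿ 7 n g ≋ 𝟘 → polyS c (n + e) N g ≋ polyS c n N g
poly-stable7 c zero N e g h = polyS-𝟘 c e N h
poly-stable7 c (suc n) N e g h = +-cong ≋-refl (poly-stable7 (c ∘ suc) n N e (Tₛ 7 g) (≡→≋ (Tⁿ-suc n g) ⟫ h))

poly-stable : ∀ c n e {f} → Nilp n f → polyS c (n + e) (n + e) (π f) ≋ polyS c n n (π f)
poly-stable c n e {f} (h7 , h5) = poly-stable7 c n (n + e) e (π f) h7 ⟫ subst (λ M → polyS c n M (π f) ≋ polyS c n n (π f)) (+-comm e n) (poly-stable5 c n n e (π f) h5)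

N2-T7 : ∀ {f} → N2 f → N2 (Tₛ 7 f)
N2-T7 {f} (a , b , c , e) = N2-exact (X₇ b) (X₇' c) (C7.T-Z2 (Z2-≋ (≋-sym e) (Z2-nform a b c))) (T-U prime7 prime2 (λ ()) _ ⟫ T-cong 7 (U-cong 2 e ⟫ U2-nform a b c) ⟫ T-𝟘 7) (πT7 {f} {b} {c} (π-cong e ⟫ π-nform a b c))
N2-T5 : ∀ {f} → N2 f → N2 (Tₛ 5 f)
N2-T5 {f} (a , b , c , e) = N2-exact (Y2 c) (Y1 b) (C5.T-Z2 (Z2-≋ (≋-sym e) (Z2-nform a b c))) (T-U prime5 prime2 (λ ()) _ ⟫ T-cong 5 (U-cong 2 e ⟫ U2-nform a b c) ⟫ T-𝟘 5) (πT5 {f} {b} {c} (π-cong e ⟫ π-nform a b c))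

N2-rowS : ∀ d n {f} → N2 f → N2 (rowS d n f)
N2-rowS d zero h = N2-𝟘
N2-rowS d (suc n) {f} h = N2-+ (go (d n)) (N2-rowS d n h)
  where
  it : ∀ n → N2 (Tⁿ 5 n f)
  it zero = h
  it (suc n) = N2-T5 (it n)
  go : ∀ b → N2 (if b then Tⁿ 5 n f else 𝟘)
  go true = it n
  go false = N2-𝟘

N2-polyS : ∀ c n N {f} → N2 f → N2 (polyS c n N f)
N2-polyS c zero N h = N2-𝟘
N2-polyS c (suc n) N h = N2-+ (N2-rowS (c 0) N h) (N2-polyS (c ∘ suc) n N (N2-T7 h))

N2-polyA : ∀ c n N {f} → N2 f → N2 (act (polyA c n N 0) f)
N2-polyA c n N {f} h = N2-≋ (≋-sym (act-polyA c n N 0 f)) (N2-polyS c n N h)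

bnd : (v : NVec) → ∃ λ n → Nilp n (proj₁ v)
bnd v = nilp (N2-π (nv v))

-- The truncation depends on the vector. Several vectors are compared at a common larger truncation,
-- which changes nothing on the part prime to 3.
module Lifted (c : ℕ → ℕ → Bool) where
  fnL : NVec → NVec
  fnL v = act (polyA c (proj₁ (bnd v)) (proj₁ (bnd v)) 0) (proj₁ v) , N2→InN2 (N2-polyA c (proj₁ (bnd v)) (proj₁ (bnd v)) (nv v))

  fnL-π : ∀ v M → proj₁ (bnd v) ≤ M → π (proj₁ (fnL v)) ≋ polyS c M M (π (proj₁ v))
  fnL-π v M l = π-polyA c (proj₁ (bnd v)) (proj₁ (bnd v)) (proj₁ v) ⟫ ≋-sym (subst (λ M → polyS c M M (π (proj₁ v)) ≋ polyS c (proj₁ (bnd v)) (proj₁ (bnd v)) (π (proj₁ v))) (m+[n∸m]≡n l) (poly-stable c (proj₁ (bnd v)) (M ∸ proj₁ (bnd v)) {proj₁ v} (proj₂ (bnd v))))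

  total : List NVec → ℕ
  total [] = 0
  total (v ∷ vs) = proj₁ (bnd v) + total vs

  lift : HE SpN
  lift = record
    { fn = fnL
    ; resp = λ v w e → let M = proj₁ (bnd v) + proj₁ (bnd w) in π→~ (nv (fnL v)) (nv (fnL w)) (fnL-π v M (m≤m+n _ _) ⟫ polyS-cong c M M (~→π e) ⟫ ≋-sym (fnL-π w M (m≤n+m _ _)))
    ; approx = λ vs → polyA c (total vs) (total vs) 0 , all vs (total vs) ≤-refl }
    where
    all : ∀ vs M → total vs ≤ M → All (λ v → proj₁ (fnL v) ~₁ act (polyA c M M 0) (proj₁ v)) vs
    all [] M l = []
    all (v ∷ vs) M l = π→~ (nv (fnL v)) (N2-polyA c M M (nv v)) (fnL-π v M (≤-trans (m≤m+n _ _) l) ⟫ ≋-sym (π-polyA c M M (proj₁ v))) ∷ all vs M (≤-trans (m≤n+m _ _) l)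

s^-Tⁿ : ∀ n k → ser (CN.s^ n k) ≡ Tⁿ 5 n (ser k)
s^-Tⁿ zero k = refl
s^-Tⁿ (suc n) k = cong (Tₛ 5) (s^-Tⁿ n k)
t^-Tⁿ : ∀ n k → ser (CN.t^ n k) ≡ Tⁿ 7 n (ser k)
t^-Tⁿ zero k = refl
t^-Tⁿ (suc n) k = cong (Tₛ 7) (t^-Tⁿ n k)

series-rowS : ∀ d n k → ser (CN.series d n k) ≋ rowS d n (ser k)
series-rowS d zero k = ≋-refl
series-rowS d (suc n) k = +-cong (go (d n)) (series-rowS d n k)
  where go : ∀ b → ser (CN.bit b (CN.s^ n k)) ≋ (if b then Tⁿ 5 n (ser k) else 𝟘)
        go true = ≡→≋ (s^-Tⁿ n k)
        go false = ≋-refl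

series-polyS : ∀ c n N k → ser (CN.series² c n N k) ≋ polyS c n N (ser k)
series-polyS c zero N k = ≋-refl
series-polyS c (suc n) N k = +-cong (series-rowS (c 0) N k) (series-polyS (c ∘ suc) n N (T7ₖ k))

Φ-surjective : ∀ ψ → ∃ λ φ → _≐_ {SpK} (Φ φ) ψ
Φ-surjective ψ = L.lift , λ v → π-inj-vec (fn (Φ L.lift) v) (fn ψ v) (Φ-π L.lift v ⟫ go v (bnd (K→N (toK v))) refl)
  where
  c : ℕ → ℕ → Bool
  c = CN.coeffs² (comm-HE ψ)
  module L = Lifted c
  go : ∀ v (n : ∃ λ n → Nilp n (proj₁ v)) → bnd (K→N (toK v)) ≡ n → π (proj₁ (L.fnL (K→N (toK v)))) ≋ π (proj₁ (fn ψ v))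
  go v (n , h) e = L.fnL-π (K→N (toK v)) n (≤-reflexive (cong proj₁ e)) ⟫ ≋-sym (π-polyA c n n (proj₁ v)) ⟫ π-cong (act-polyA c n n 0 (proj₁ v) ⟫ ≋-sym (series-polyS c n n (toK v))
     ⟫ ≋-sym (CN.expansion (comm-HE ψ) n n (toK v) (≋-sym (≡→≋ (trans (Tⁿ7 (toK v) n) (sym (t^-Tⁿ n (toK v))))) ⟫ K-t-nil (toK v) n h) (≋-sym (≡→≋ (trans (Tⁿ5 (toK v) n) (sym (s^-Tⁿ n (toK v))))) ⟫ K-s-nil (toK v) n h))
     ⟫ mk (HE-resp ψ (fromK (toK v)) v (λ _ → refl)))

-- Injectivity modulo nilpotents

_⊞ₕ_ : HE SpN → HE SpN → HE SpN
φ ⊞ₕ ψ = record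
  { fn = fn+
  ; resp = λ v w e → π→~ (nv (fn+ v)) (nv (fn+ w)) (π+ v ⟫ +-cong (~→π (HE-resp φ v w e)) (~→π (HE-resp ψ v w e)) ⟫ ≋-sym (π+ w))
  ; approx = λ vs → let (a , ha) = approx φ vs ; (b , hb) = approx ψ vs in a ++ b , All.zipWith (λ {v} (x , y) → step a b v x y) (ha , hb) }
  where
  fn+ : NVec → NVec
  fn+ v = (proj₁ (fn φ v) +ₛ proj₁ (fn ψ v)) , N2→InN2 (N2-≋ (≋-sym (+-def _ _)) (N2-+ (nv (fn φ v)) (nv (fn ψ v))))
  π+ : ∀ v → π (proj₁ (fn+ v)) ≋ π (proj₁ (fn φ v)) ⊹ π (proj₁ (fn ψ v))
  π+ v = π-cong (+-def _ _) ⟫ π-+ _ _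
  step : ∀ a b v → proj₁ (fn φ v) ~₁ act a (proj₁ v) → proj₁ (fn ψ v) ~₁ act b (proj₁ v) → proj₁ (fn+ v) ~₁ act (a ++ b) (proj₁ v)
  step a b v x y = π→~ (nv (fn+ v)) (N2-≋ (≋-sym (act-++ a b (proj₁ v))) (N2-+ (approx-N2 φ v a x) (approx-N2 ψ v b y)))
    (π+ v ⟫ +-cong (~→π x) (~→π y) ⟫ ≋-sym (π-cong (act-++ a b (proj₁ v)) ⟫ π-+ _ _))

⊞ₕ-π : ∀ φ ψ v → π (proj₁ (fn (φ ⊞ₕ ψ) v)) ≋ π (proj₁ (fn φ v)) ⊹ π (proj₁ (fn ψ v))
⊞ₕ-π φ ψ v = π-cong (+-def _ _) ⟫ π-+ _ _

-- The square of an element of the algebra is a sum of squares of monomials, so it preserves exponents mod 3.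
square-kills-s1 : ∀ a b c {f} → π f ≋ sform b c → act a (π f) ≋ 𝟘 → act (map doubled a) (s1 b) ≋ 𝟘
square-kills-s1 a b c {f} e h = Cl-split (λ ()) (Cl-act a 1 (inj₁ refl) (Cl-s1 b)) (Cl-act a 2 (inj₂ refl) (Cl-s2 c))
  (≋-sym (L-+ (lin-act (map doubled a)) (s1 b) (s2 c)) ⟫ act-cong (map doubled a) (≋-sym e) ⟫ act-square a (π f) ⟫ act-cong a h ⟫ L-𝟘 (lin-act a))

-- The image of z⁵ c(w) keeps its exponents at 2 modulo 3. T₅ carries it to the image of z (Y2
-- c)(w), which is zero, and T₅ is injective on z⁵ F₂[w]; only exponents 1 modulo 3 could remain.
square-kills : ∀ a b c b' c' → act (map doubled a) (s1 b) ≋ 𝟘 → act (map doubled a) (s1 (Y2 c)) ≋ 𝟘 →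
  act (map doubled a) (sform b c) ≋ sform b' c' → act (map doubled a) (sform b c) ≋ 𝟘
square-kills a b c b' c' h1 h2 e = sum ⟫ Cl-split (λ ()) (Cl-act a 2 (inj₂ refl) (Cl-s2 c)) (Cl-s1 b') (+-cong0' only)
  where
  aa : Alg
  aa = map doubled a
  sum : act aa (sform b c) ≋ act aa (s2 c)
  sum = L-+ (lin-act aa) (s1 b) (s2 c) ⟫ +-cong h1 ≋-refl ⟫ +-idˡ _
  y : Y2 c' ≃ []
  y = proj₁ (sform-inj (Y2 c') (Y1 b') [] [] (≋-sym (T5-sform b' c') ⟫ T-cong 5 (≋-sym e ⟫ sum) ⟫ L-act (lin-T prime5 (≤from 4 5 refl)) aa (s2 c) ⟫ act-cong aa (T5-s2 c) ⟫ h2 ⟫ ≋-sym sform-[]))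
  only : act aa (s2 c) ≋ s1 b'
  only = ≋-sym sum ⟫ e ⟫ +-cong ≋-refl (*-cong ≋-refl (isz-⟪⟫ c' w (≃-isz c' (Y2-inj c' y))) ⟫ *-zeroʳ' _) ⟫ +-idʳ _

-- The round trip through `fromK` matches the vectors that appear in `Φ-π`.
K→N' : KEl → NVec
K→N' k = K→N (toK (fromK k))

vanish-square : ∀ (χ : HE SpN) → (∀ k → π (proj₁ (fn χ (K→N' k))) ≋ 𝟘) → ∀ v → π (proj₁ (fn χ (fn χ v))) ≋ 𝟘
vanish-square χ h v = go1 (N2-π (nv v))
  where
  go1 : (∃ λ b → ∃ λ c → π (proj₁ v) ≋ sform b c) → π (proj₁ (fn χ (fn χ v))) ≋ 𝟘
  go1 (b , c , e) = go2 (K-lift b) (K-lift (Y2 c)) (N2-π (nv (fn χ (fn χ v))))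
    where
    go2 : (∃ λ k → ∃ λ c → π (ser k) ≋ sform b c) → (∃ λ k → ∃ λ c' → π (ser k) ≋ sform (Y2 c) c') → (∃ λ b → ∃ λ c → π (proj₁ (fn χ (fn χ v))) ≋ sform b c) → π (proj₁ (fn χ (fn χ v))) ≋ 𝟘
    -- A single element of the algebra has to serve v, χ v and two elements of K, those with
    -- components b and Y2 c on z F₂[w].
    go2 (k₁ , c₁ , q₁) (k₂ , c₂ , q₂) (b' , c' , q) = go3 (approx χ (v ∷ fn χ v ∷ K→N' k₁ ∷ K→N' k₂ ∷ []))
      where
      go3 : (∃ λ a → All (λ v → proj₁ (fn χ v) ~₁ act a (proj₁ v)) (v ∷ fn χ v ∷ K→N' k₁ ∷ K→N' k₂ ∷ [])) → π (proj₁ (fn χ (fn χ v))) ≋ 𝟘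
      go3 (a , x₁ ∷ x₂ ∷ x₃ ∷ x₄ ∷ []) = χχ ⟫ square-kills a b c b' c' (square-kills-s1 a b c₁ {ser k₁} q₁ (kill k₁ x₃)) (square-kills-s1 a (Y2 c) c₂ {ser k₂} q₂ (kill k₂ x₄)) (≋-sym χχ ⟫ q)
        where
        π-act : ∀ v → proj₁ (fn χ v) ~₁ act a (proj₁ v) → π (proj₁ (fn χ v)) ≋ act a (π (proj₁ v))
        π-act v x = ~→π x ⟫ L-act lin-π a (proj₁ v)
        kill : ∀ k → proj₁ (fn χ (K→N' k)) ~₁ act a (ser k) → act a (π (ser k)) ≋ 𝟘
        kill k x = ≋-sym (π-act (K→N' k) x) ⟫ h k
        χχ : π (proj₁ (fn χ (fn χ v))) ≋ act (map doubled a) (sform b c)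
        χχ = π-act (fn χ v) x₂ ⟫ act-cong a (π-act v x₁) ⟫ ≋-sym (act-square a (π (proj₁ v))) ⟫ act-cong (map doubled a) e

Φ-injective : ∀ φ ψ → _≐_ {SpK} (Φ φ) (Φ ψ) → _≈red_ {SpN} φ ψ
Φ-injective φ ψ h = χ , (λ v → π→~ (nv (fn χ v)) (nv (fn χ v)) ≋-refl) , 2 , λ v → π→~ (nv (fn χ (fn χ v))) (N2-≋ (≋-sym 0-def) N2-𝟘) (vanish-square χ zero-K v ⟫ ≋-sym π-𝟘 ⟫ π-cong (≋-sym 0-def))
  where
  χ : HE SpN
  χ = φ ⊞ₕ ψ
  zero-K : ∀ k → π (proj₁ (fn χ (K→N' k))) ≋ 𝟘
  zero-K k = ⊞ₕ-π φ ψ (K→N' k) ⟫ +-cong0' (≋-sym (Φ-π φ (fromK k)) ⟫ π-cong (mk (h (fromK k))) ⟫ Φ-π ψ (fromK k))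

theorem4p14 : ∃ λ (Φ : HE SpN → HE SpK) → RedIso Φ
theorem4p14 = Φ , record
  { wellDef = Φ-wellDef
  ; injective = Φ-injective
  ; surjective = Φ-surjective
  ; additive = Φ-additive
  ; multiplicative = Φ-multiplicative
  ; unital = Φ-unital
  ; sendsT = Φ-sendsT
  }
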